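{- Let $p$ be an arbitrary but fixed prime. Then the series $\sum_{n\ge 2,\ p(n)=p}\frac{\mu(n)\omega(n)}{n}$ converges and $$\sum_{\substack{n\ge 1\\ p(n)=p}}\frac{\mu(n)\omega(n)}{n}=\sum_{\substack{n\ge 2\\ p(n)=p}}\frac{\mu(n)\omega(n)}{n}=0.$$
   Context: $\mu$ is the Möbius function, $\omega(n)$ is the number of distinct prime factors of $n$, and for $n\ge 2$, $p(n)$ is the smallest prime factor of $n$ (the integer $n=1$ is not counted, as it has no prime factor). -}

module Defs where

open import Data.Nat using (ℕ; zero; suc; _*_; _≟_)
open import Data.Nat.Divisibility using (_∣_; _∣?_)
open import Data.Nat.Primality using (Prime; prime?)
open import Data.List using (List; []; _∷_; filter; length; upTo)
open import Data.Bool.ListAction using (any)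
open import Data.Maybe using (Maybe; just; nothing)
open import Data.Bool using (Bool; true; false; if_then_else_)
open import Data.Product using (_×_)
open import Relation.Nullary.Decidable using (_×-dec_; does)
open import Data.Integer as ℤ using (ℤ; +_; -[1+_])
open import Data.Rational as ℚ using (ℚ; _/_; _+_; 0ℚ)

primeDivisors : ℕ → List ℕ
primeDivisors n = filter (λ q → prime? q ×-dec (q ∣? n)) (upTo (suc n))

ω : ℕ → ℕ
ω n = length (primeDivisors n)

spf : ℕ → Maybe ℕ
spf n with primeDivisors n
... | []    = nothing
... | q ∷ _ = just q

hasSquarePrimeFactor : ℕ → Bool
hasSquarePrimeFactor n = any (λ q → does (q * q ∣? n)) (primeDivisors n)

negOnePow : ℕ → ℤ
negOnePow zero          = + 1
negOnePow (suc zero)    = -[1+ 0 ]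
negOnePow (suc (suc k)) = negOnePow k

μ : ℕ → ℤ
μ n = if hasSquarePrimeFactor n then + 0 else negOnePow (ω n)

spfIs : ℕ → ℕ → Bool
spfIs p n with spf n
... | nothing = false
... | just q  = does (q ≟ p)

-- the n-th term μ(n)ω(n)/n restricted to p(n) = p (zero otherwise), n = suc m
term : ℕ → ℕ → ℚ
term p m = if spfIs p (suc m) then (μ (suc m) ℤ.* (+ ω (suc m))) / suc m else 0ℚ

partialSum : ℕ → ℕ → ℚ
partialSum p zero    = 0ℚ
partialSum p (suc N) = partialSum p N + term p N

-- Write n = p n', so that p(n) = p leaves for n' only prime factors exceeding p (a further factor p
-- makes μ(n) vanish). With f the Möbius function restricted to such integers and y = ⌊M / p⌋, the
-- partial sum is - (1/p) (∑ f(n) / n + ∑ f(n) ω(n) / n), both over n ≤ y. Writing ω(n) as a sum over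
-- primes q ∣ n turns the second sum into ∑_q (1/q) ∑ f(n) / n with n ≤ y / q prime to q; these inner
-- sums obey m_q(y) = m(y) + (1/q) m_q(y/q) with m(y) = ∑_{n ≤ y} f(n) / n. As ∑ 1/q is of size
-- log log y, it suffices that m decays faster than 1 / log log y, with some uniformity; no prime
-- number theorem is needed.
--
-- To bound F(x) = ∑_{n ≤ x} f(n), start from F(x) log x + ∑_{q ≤ x} log q F(x/q) = O(x log log x).
-- In mean square with weight x⁻³ it shows F(x) ≈ - q F(x/q) for most primes q, and combined with
-- upper bounds for primes in short intervals, that x ↦ b F(x/b) hardly depends on b. But
-- ∑_{b ≤ B} F(x/b) = O(x), so averaging b F(x/b) against 1/b shows that F is small unless the
-- defect in the mean square inequality is large. Iterating, ∑_{x < 2^K} F(x)² / x³ ≤ 2^-n K + B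
-- where log B is polynomial in n. This is turned into a pointwise bound for F, and by Axer's
-- argument into one for m.
module Submission where

-- Near y b primes are known only through an upper bound which, for windows of relative width 1/N
-- with N = 2^k, exceeds the expected order by a factor k + 3. So good primes need not occur near
-- every y b. Counting shows only that among more than 48 (k + 3) values of b two have good primes
-- for a common y, and the functions x ↦ b F(x/b) of these two are then close. Neighbouring b are
-- close anyway, hence a walk between any two b takes O(k) moves and costs a factor of order k² in
-- mean square, whereas the errors to be beaten are 1/N² and 1/c² with c = N: polynomial losses
-- against exponential gains. This keeps log B of order n⁴, and a saving 2^-n valid from log log y
-- of order n⁴ on is enough against ∑ 1/q. The log log in the starting relation comes from `lg`, the
-- integer part of the binary logarithm, which is additive only up to 1. It is the price of staying
-- inside ℚ. The weight x⁻³ makes the mean square of q F(x/q) no larger than that of F, and linear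
-- growth of the energy is exactly the case in which the mean square inequality is tight; a smaller
-- slope has to be won from the defect.

module Base where

  open import Data.Nat as ℕ using (ℕ; zero; suc; z≤n; s≤s)
  import Data.Nat.Properties as ℕ
  import Data.Nat.Solver as ℕ
  import Data.Nat.DivMod as ℕ
  import Data.Nat.Coprimality as Coprime
  open import Data.Nat.Divisibility using (_∣_; divides; _∣?_; ∣m+n∣m⇒∣n; ∣⇒≤)
  open import Data.Integer as ℤ using (+_)
  import Data.Integer.Properties as ℤ
  open import Data.Rational as ℚ using (ℚ; mkℚ; 0ℚ; 1ℚ; _+_; _*_; _-_; -_; _≤_; _<_; ∣_∣; *≤*; *<*)
  open import Data.Rational.Properties hiding (_≟_)
  open import Data.Rational.Solver
  open import Data.Rational.Unnormalised as ℚᵘ using (*≡*)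
  import Data.Rational.Unnormalised.Properties as ℚᵘ
  open import Data.Sum using (inj₁; inj₂)
  open import Function using (_∘_)
  open import Relation.Nullary using (¬_; Dec; yes; no; contradiction)
  open import Relation.Binary.PropositionalEquality hiding ([_])

  open +-*-Solver using (solve; con; _:=_; _:+_; _:*_; _:-_; :-_; Polynomial) public
  open ℕ.+-*-Solver using () renaming (solve to ℕ-solve; con to conₙ; _:=_ to _:=ₙ_; _:+_ to _:+ₙ_; _:*_ to _:*ₙ_) public

  -- Rational arithmetic and inequalities certified by ring identities.

  infix 9 #_
  infixl 6 _⊕_ _⊕ₙ_
  infixr 7 _⊛_ _⊛ₙ_

  -- Given by numerator and denominator, so that numerals compute: `ι 0` and `ι 1` are
  -- definitionally `0ℚ` and `1ℚ`, and numerical coefficients in the solver are settled by `refl`.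
  ι : ℕ → ℚ
  ι n = mkℚ (+ n) 0 (Coprime.sym (Coprime.1-coprimeTo n))

  -- The value 0 at 0 lets sums start at index 0 and gives `inv-*` without side conditions.
  inv : ℕ → ℚ
  inv zero = 0ℚ
  inv (suc n) = mkℚ (+ 1) n (Coprime.1-coprimeTo (suc n))

  #_ : ∀ {n} → ℕ → Polynomial n
  # k = con (ι k)

  ι-+ : ∀ m n → ι (m ℕ.+ n) ≡ ι m + ι n
  ι-+ m n = toℚᵘ-injective (ℚᵘ.≃-sym (ℚᵘ.≃-trans (toℚᵘ-homo-+ (ι m) (ι n)) (*≡* (cong (ℤ._* + 1)
    (cong₂ ℤ._+_ (ℤ.*-identityʳ (+ m)) (ℤ.*-identityʳ (+ n)))))))

  ι-* : ∀ m n → ι (m ℕ.* n) ≡ ι m * ι n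
  ι-* m n = toℚᵘ-injective (ℚᵘ.≃-sym (ℚᵘ.≃-trans (toℚᵘ-homo-* (ι m) (ι n)) (*≡* (cong (ℤ._* + 1)
    (sym (ℤ.pos-* m n))))))

  ι-suc : ∀ n → ι (suc n) ≡ ι 1 + ι n
  ι-suc = ι-+ 1

  ι-mono : ∀ {m n} → m ℕ.≤ n → ι m ≤ ι n
  ι-mono {m} {n} m≤n = *≤* (subst₂ ℤ._≤_ (sym (ℤ.*-identityʳ (+ m))) (sym (ℤ.*-identityʳ (+ n))) (ℤ.+≤+ m≤n))

  ι-cancel : ∀ {m n} → ι m ≤ ι n → m ℕ.≤ n
  ι-cancel {m} {n} (*≤* p) = ℤ.drop‿+≤+ (subst₂ ℤ._≤_ (ℤ.*-identityʳ (+ m)) (ℤ.*-identityʳ (+ n)) p)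

  ι-inv : ∀ n → ι (suc n) * inv (suc n) ≡ 1ℚ
  ι-inv n = toℚᵘ-injective (ℚᵘ.≃-trans (toℚᵘ-homo-* (ι (suc n)) (inv (suc n))) (*≡* (cong +_
    (trans (ℕ.*-identityʳ _) (trans (ℕ.*-identityʳ (suc n)) (sym (trans (ℕ.+-identityʳ _) (ℕ.+-identityʳ (suc n)))))))))

  0≤ι : ∀ n → ι 0 ≤ ι n
  0≤ι n = ι-mono z≤n

  0<ι : ∀ n → ι 0 < ι (suc n)
  0<ι n = *<* (subst (ℤ._<_ (+ 0)) (sym (ℤ.*-identityʳ (+ suc n))) (ℤ.+<+ (s≤s z≤n)))

  _⊕_ : ∀ {a b c d} → a ≤ b → c ≤ d → a + c ≤ b + d
  _⊕_ = +-mono-≤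

  *-monoˡ : ∀ {a b} c → 0ℚ ≤ c → a ≤ b → c * a ≤ c * b
  *-monoˡ c 0≤c a≤b = *-monoˡ-≤-nonNeg c {{ℚ.nonNegative 0≤c}} a≤b

  *-monoʳ : ∀ {a b} c → 0ℚ ≤ c → a ≤ b → a * c ≤ b * c
  *-monoʳ c 0≤c a≤b = *-monoʳ-≤-nonNeg c {{ℚ.nonNegative 0≤c}} a≤b

  _⊛_ : ∀ {a b} k → a ≤ b → ι k * a ≤ ι k * b
  k ⊛ a≤b = *-monoˡ (ι k) (0≤ι k) a≤b

  cancel-* : ∀ {a b} c → 0ℚ < c → c * a ≤ c * b → a ≤ b
  cancel-* c 0<c p = *-cancelˡ-≤-pos c {{ℚ.positive 0<c}} p

  -- The shape of nearly every estimate below: `x ≤ y` is a sum of known inequalities with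
  -- nonnegative weights, and the ring solver checks that `b - a` and `y - x` are the same
  -- polynomial.
  linear : ∀ {a b x y} → x ≤ y → b - a ≡ y - x → a ≤ b
  linear {a} {b} {x} {y} x≤y eq = subst₂ _≤_ (+-identityˡ a)
    (trans (cong (_+ a) (sym eq)) (solve 2 (λ a b → b :- a :+ a := b) refl a b))
    (+-monoˡ-≤ a (subst (_≤ y - x) (+-inverseʳ x) (+-monoˡ-≤ (- x) x≤y)))

  linear-≡ : ∀ {a b x y} → x ≡ y → b - a ≡ y - x → a ≡ b
  linear-≡ {a} {b} {x} refl eq = ≤-antisym (linear {x = x} ≤-refl eq) (linear {x = x} {x} ≤-refl (trans (solve 2 (λ a b → a :- b := (:- (b :- a))) refl a b) (trans (cong -_ eq) (solve 1 (λ x → (:- (x :- x)) := x :- x) refl x))))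

  -- The factor `suc k` clears the denominators of the weights in such a certificate.
  linear-by : ∀ {a b x y} k → x ≤ y → ι (suc k) * (b - a) ≡ y - x → a ≤ b
  linear-by {a} {b} k x≤y eq = cancel-* (ι (suc k)) (0<ι k)
    (linear x≤y (trans (solve 3 (λ k a b → k :* b :- k :* a := k :* (b :- a)) refl (ι (suc k)) a b) eq))

  _⊕ₙ_ : ∀ {a b c d} → a ℕ.≤ b → c ℕ.≤ d → a ℕ.+ c ℕ.≤ b ℕ.+ d
  _⊕ₙ_ = ℕ.+-mono-≤

  _⊛ₙ_ : ∀ {a b} k → a ℕ.≤ b → k ℕ.* a ℕ.≤ k ℕ.* b
  k ⊛ₙ p = ℕ.*-monoʳ-≤ k p

  -- The same certificates over ℕ: all terms stay on the side where they are positive, which avoids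
  -- truncated subtraction, and `s` is the slack left over.
  ℕ-linear : ∀ {a b x y s} → x ℕ.≤ y → a ℕ.+ (y ℕ.+ s) ≡ b ℕ.+ x → a ℕ.≤ b
  ℕ-linear {a} {b} {x} {y} {s} x≤y eq = ℕ.≤-trans (ℕ.m≤m+n a s) (ℕ.+-cancelʳ-≤ y (a ℕ.+ s) b
    (ℕ.≤-trans (ℕ.≤-reflexive (trans (ℕ-solve 3 (λ a s y → a :+ₙ s :+ₙ y :=ₙ a :+ₙ (y :+ₙ s)) refl a s y) eq)) (ℕ.+-monoʳ-≤ b x≤y)))

  ℕ-linear-by : ∀ {a b x y s} k → x ℕ.≤ y → suc k ℕ.* a ℕ.+ (y ℕ.+ s) ≡ suc k ℕ.* b ℕ.+ x → a ℕ.≤ b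
  ℕ-linear-by {a} {b} k x≤y eq = ℕ.*-cancelˡ-≤ (suc k) (ℕ-linear x≤y eq)

  *-nonneg : ∀ {a b} → 0ℚ ≤ a → 0ℚ ≤ b → 0ℚ ≤ a * b
  *-nonneg {a} {b} 0≤a 0≤b = subst (_≤ a * b) (*-zeroʳ a) (*-monoˡ a 0≤a 0≤b)

  *-mono : ∀ {a b c d} → 0ℚ ≤ a → 0ℚ ≤ d → a ≤ b → c ≤ d → a * c ≤ b * d
  *-mono {a} {b} {c} {d} 0≤a 0≤d a≤b c≤d = ≤-trans (*-monoˡ a 0≤a c≤d) (*-monoʳ d 0≤d a≤b)

  sq≥0 : ∀ a → 0ℚ ≤ a * a
  sq≥0 a with ≤-total 0ℚ a
  ... | inj₁ 0≤a = *-nonneg 0≤a 0≤a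
  ... | inj₂ a≤0 = subst (0ℚ ≤_) (solve 1 (λ a → (:- a) :* (:- a) := a :* a) refl a) (*-nonneg 0≤-a 0≤-a)
    where
    0≤-a : 0ℚ ≤ - a
    0≤-a = linear a≤0 (solve 1 (λ a → (:- a) :- # 0 := # 0 :- a) refl a)

  sq-cancel : ∀ {a b} → 0ℚ ≤ b → a * a ≤ b * b → a ≤ b
  sq-cancel {a} {b} 0≤b p with ≤-total a b
  ... | inj₁ a≤b = a≤b
  ... | inj₂ b≤a with b ≟ 0ℚ
    where open import Data.Rational.Properties using (_≟_)
  ... | yes refl = sqz p
    where
    sqz : a * a ≤ 0ℚ → a ≤ 0ℚ
    sqz p with a ≤? 0ℚ
    ... | yes q = q
    ... | no q = cancel-* a (≰⇒> q) (≤-trans p (≤-reflexive (sym (*-zeroʳ a))))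
  ... | no b≢0 = cancel-* b (≤∧≢⇒< 0≤b (b≢0 ∘ sym)) (≤-trans (*-monoˡ b 0≤b ≤-refl ) (linear (p ⊕ *-monoˡ a (≤-trans 0≤b b≤a) b≤a) (solve 2 (λ a b → b :* b :- b :* a := b :* b :+ a :* a :- (a :* a :+ a :* b)) refl a b)))
    where
    ≤∧≢⇒< : ∀ {x y} → x ≤ y → ¬ x ≡ y → x < y
    ≤∧≢⇒< {x} {y} x≤y x≢y with y ≤? x
    ... | yes y≤x = contradiction (≤-antisym x≤y y≤x) x≢y
    ... | no ¬p = ≰⇒> ¬p

  0≤inv : ∀ n → 0ℚ ≤ inv n
  0≤inv zero = ≤-refl
  0≤inv (suc n) = *≤* (ℤ.+≤+ z≤n)

  inv-unique : ∀ n {a} → ι (suc n) * a ≡ 1ℚ → a ≡ inv (suc n)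
  inv-unique n {a} eq = trans (sym (*-identityˡ a)) (trans (cong (_* a) (sym (ι-inv n)))
    (trans (solve 3 (λ i v a → i :* v :* a := i :* a :* v) refl (ι (suc n)) (inv (suc n)) a) (trans (cong (_* inv (suc n)) eq) (*-identityˡ _))))

  inv-* : ∀ m n → inv (m ℕ.* n) ≡ inv m * inv n
  inv-* zero n = sym (*-zeroˡ (inv n))
  inv-* (suc m) zero = trans (cong inv (ℕ.*-zeroʳ m)) (sym (*-zeroʳ (inv (suc m))))
  inv-* (suc m) (suc n) = sym (inv-unique (n ℕ.+ m ℕ.* suc n) (trans (cong (_* (inv (suc m) * inv (suc n))) (ι-* (suc m) (suc n)))
    (trans (solve 4 (λ a b c d → a :* b :* (c :* d) := a :* c :* (b :* d)) refl (ι (suc m)) (ι (suc n)) (inv (suc m)) (inv (suc n)))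
    (cong₂ _*_ (ι-inv m) (ι-inv n)))))

  ι*inv : ∀ {n} → 1 ℕ.≤ n → ι n * inv n ≡ 1ℚ
  ι*inv {suc n} _ = ι-inv n

  ι*inv≤1 : ∀ n → ι n * inv n ≤ 1ℚ
  ι*inv≤1 zero = 0≤ι 1
  ι*inv≤1 (suc n) = ≤-reflexive (ι-inv n)

  0<ι′ : ∀ {n} → 1 ℕ.≤ n → 0ℚ < ι n
  0<ι′ {suc n} _ = 0<ι n

  inv-anti : ∀ {m n} → 1 ℕ.≤ m → m ℕ.≤ n → inv n ≤ inv m
  inv-anti {suc m} {suc n} _ p = *≤* (subst₂ ℤ._≤_ (sym (ℤ.*-identityˡ (+ suc m))) (sym (ℤ.*-identityˡ (+ suc n))) (ℤ.+≤+ p))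

  inv≤1 : ∀ n → inv n ≤ 1ℚ
  inv≤1 zero = 0≤ι 1
  inv≤1 (suc n) = inv-anti {1} (s≤s z≤n) (s≤s z≤n)

  -- Finite sums, Cauchy-Schwarz and indicators.

  ∑ : ℕ → (ℕ → ℚ) → ℚ
  ∑ zero f = 0ℚ
  ∑ (suc n) f = ∑ n f + f n

  ∑-cong : ∀ n {f g} → (∀ i → i ℕ.< n → f i ≡ g i) → ∑ n f ≡ ∑ n g
  ∑-cong zero h = refl
  ∑-cong (suc n) h = cong₂ _+_ (∑-cong n (λ i p → h i (ℕ.m<n⇒m<1+n p))) (h n ℕ.≤-refl)

  ∑-ext : ∀ n {f g} → (∀ i → f i ≡ g i) → ∑ n f ≡ ∑ n g
  ∑-ext n h = ∑-cong n (λ i _ → h i)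

  ∑-mono : ∀ n {f g} → (∀ i → i ℕ.< n → f i ≤ g i) → ∑ n f ≤ ∑ n g
  ∑-mono zero h = ≤-refl
  ∑-mono (suc n) h = ∑-mono n (λ i p → h i (ℕ.m<n⇒m<1+n p)) ⊕ h n ℕ.≤-refl

  ∑-0 : ∀ n → ∑ n (λ _ → 0ℚ) ≡ 0ℚ
  ∑-0 zero = refl
  ∑-0 (suc n) = trans (+-identityʳ _) (∑-0 n)

  ∑-zero : ∀ n {f} → (∀ i → i ℕ.< n → f i ≡ 0ℚ) → ∑ n f ≡ 0ℚ
  ∑-zero n h = trans (∑-cong n h) (∑-0 n)

  ∑-nonneg : ∀ n {f} → (∀ i → i ℕ.< n → 0ℚ ≤ f i) → 0ℚ ≤ ∑ n f
  ∑-nonneg n {f} h = subst (_≤ ∑ n f) (∑-0 n) (∑-mono n h)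

  ∑-+ : ∀ n f g → ∑ n (λ i → f i + g i) ≡ ∑ n f + ∑ n g
  ∑-+ zero f g = refl
  ∑-+ (suc n) f g = trans (cong (_+ (f n + g n)) (∑-+ n f g))
    (solve 4 (λ a b c d → a :+ b :+ (c :+ d) := a :+ c :+ (b :+ d)) refl (∑ n f) (∑ n g) (f n) (g n))

  ∑-*ˡ : ∀ n c f → ∑ n (λ i → c * f i) ≡ c * ∑ n f
  ∑-*ˡ zero c f = sym (*-zeroʳ c)
  ∑-*ˡ (suc n) c f = trans (cong (_+ c * f n) (∑-*ˡ n c f)) (sym (*-distribˡ-+ c _ _))

  ∑-*ʳ : ∀ n c f → ∑ n (λ i → f i * c) ≡ ∑ n f * c
  ∑-*ʳ n c f = trans (∑-ext n (λ i → *-comm (f i) c)) (trans (∑-*ˡ n c f) (*-comm c _))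

  ∑-neg : ∀ n f → ∑ n (λ i → - f i) ≡ - ∑ n f
  ∑-neg zero f = refl
  ∑-neg (suc n) f = trans (cong (_+ - f n) (∑-neg n f)) (solve 2 (λ a b → (:- a) :+ (:- b) := (:- (a :+ b))) refl (∑ n f) (f n))

  ∑-- : ∀ n f g → ∑ n (λ i → f i - g i) ≡ ∑ n f - ∑ n g
  ∑-- n f g = trans (∑-+ n f (λ i → - g i)) (cong (_+_ (∑ n f)) (∑-neg n g))

  ∑-const : ∀ n c → ∑ n (λ _ → c) ≡ ι n * c
  ∑-const zero c = sym (*-zeroˡ c)
  ∑-const (suc n) c = trans (cong (_+ c) (∑-const n c)) (trans (solve 2 (λ n c → n :* c :+ c := (# 1 :+ n) :* c) refl (ι n) c) (cong (_* c) (sym (ι-suc n))))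

  ∑-swap : ∀ m n (f : ℕ → ℕ → ℚ) → ∑ m (λ i → ∑ n (f i)) ≡ ∑ n (λ j → ∑ m (λ i → f i j))
  ∑-swap zero n f = sym (∑-0 n)
  ∑-swap (suc m) n f = trans (cong (_+ ∑ n (f m)) (∑-swap m n f)) (sym (∑-+ n _ _))

  ∑-split : ∀ m n f → ∑ (m ℕ.+ n) f ≡ ∑ m f + ∑ n (λ i → f (m ℕ.+ i))
  ∑-split m zero f = trans (cong (λ k → ∑ k f) (ℕ.+-identityʳ m)) (sym (+-identityʳ _))
  ∑-split m (suc n) f = trans (cong (λ k → ∑ k f) (ℕ.+-suc m n))
    (trans (cong (_+ f (m ℕ.+ n)) (∑-split m n f)) (+-assoc (∑ m f) (∑ n (λ i → f (m ℕ.+ i))) (f (m ℕ.+ n))))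

  ∑-extend : ∀ {m n f} → m ℕ.≤ n → (∀ i → m ℕ.≤ i → i ℕ.< n → 0ℚ ≤ f i) → ∑ m f ≤ ∑ n f
  ∑-extend {m} {n} {f} m≤n h = subst (λ k → ∑ m f ≤ ∑ k f) (ℕ.m+[n∸m]≡n m≤n)
    (≤-trans (≤-reflexive (sym (+-identityʳ _))) (≤-trans (+-monoʳ-≤ (∑ m f) (∑-nonneg (n ℕ.∸ m) (λ i p →
      h (m ℕ.+ i) (ℕ.m≤m+n m i) (subst (m ℕ.+ i ℕ.<_) (ℕ.m+[n∸m]≡n m≤n) (ℕ.+-monoʳ-< m p)))))
      (≤-reflexive (sym (∑-split m (n ℕ.∸ m) f)))))

  ∑-extend-≡ : ∀ {m n f} → m ℕ.≤ n → (∀ i → m ℕ.≤ i → i ℕ.< n → f i ≡ 0ℚ) → ∑ m f ≡ ∑ n f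
  ∑-extend-≡ {m} {n} {f} m≤n h = sym (trans (cong (λ k → ∑ k f) (sym (ℕ.m+[n∸m]≡n m≤n)))
    (trans (∑-split m (n ℕ.∸ m) f) (trans (cong (_+_ (∑ m f)) (∑-zero (n ℕ.∸ m) (λ i p →
      h (m ℕ.+ i) (ℕ.m≤m+n m i) (subst (m ℕ.+ i ℕ.<_) (ℕ.m+[n∸m]≡n m≤n) (ℕ.+-monoʳ-< m p))))) (+-identityʳ _))))

  ∑-upper : ∀ n {f} c → (∀ i → i ℕ.< n → f i ≤ c) → ∑ n f ≤ ι n * c
  ∑-upper n c h = ≤-trans (∑-mono n h) (≤-reflexive (∑-const n c))

  ∑-lower : ∀ n {f} c → (∀ i → i ℕ.< n → c ≤ f i) → ι n * c ≤ ∑ n f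
  ∑-lower n c h = ≤-trans (≤-reflexive (sym (∑-const n c))) (∑-mono n h)

  ∑-single : ∀ n k {f} → k ℕ.< n → (∀ i → i ℕ.< n → ¬ i ≡ k → f i ≡ 0ℚ) → ∑ n f ≡ f k
  ∑-single (suc n) k {f} k<n h with k ℕ.≟ n
  ... | yes refl = trans (cong (_+ f n) (∑-zero n (λ i p → h i (ℕ.m<n⇒m<1+n p) (ℕ.<⇒≢ p)))) (+-identityˡ _)
  ... | no k≢n = trans (cong₂ _+_ (∑-single n k (ℕ.≤∧≢⇒< (ℕ.≤-pred k<n) k≢n) (λ i p → h i (ℕ.m<n⇒m<1+n p))) (h n ℕ.≤-refl (k≢n ∘ sym))) (+-identityʳ _)

  ∣∑∣≤ : ∀ n f → ∣ ∑ n f ∣ ≤ ∑ n (λ i → ∣ f i ∣)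
  ∣∑∣≤ zero f = ≤-refl
  ∣∑∣≤ (suc n) f = ≤-trans (∣p+q∣≤∣p∣+∣q∣ (∑ n f) (f n)) (+-monoˡ-≤ _ (∣∑∣≤ n f))

  ∑-head : ∀ n f → ∑ (suc n) f ≡ f 0 + ∑ n (λ i → f (suc i))
  ∑-head n f = trans (∑-split 1 n f) (cong (_+ ∑ n (λ i → f (suc i))) (+-identityˡ (f 0)))

  -- With S and T the two sums and V ≤ W the total weight, ∑ w (c W - S)² ≥ 0 expands to W² T - 2 W
  -- S² + S² V ≥ 0. Hence W S² ≤ W² T, and an upper bound W for the weight is enough.
  cauchy-schwarz : ∀ n (w c : ℕ → ℚ) W → (∀ i → i ℕ.< n → 0ℚ ≤ w i) → 0ℚ < W → ∑ n w ≤ W →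
    ∑ n (λ i → w i * c i) * ∑ n (λ i → w i * c i) ≤ W * ∑ n (λ i → w i * (c i * c i))
  cauchy-schwarz n w c W 0≤w 0<W w≤W = cancel-* W 0<W (linear (q ⊕ *-monoˡ (S * S) (sq≥0 S) w≤W) (solve 4 (λ W S T V → W :* (W :* T) :- W :* (S :* S) := W :* W :* T :- # 2 :* W :* S :* S :+ S :* S :* V :+ S :* S :* W :- (# 0 :+ S :* S :* V)) refl W S T (∑ n w)))
    where
    S T : ℚ
    S = ∑ n (λ i → w i * c i)
    T = ∑ n (λ i → w i * (c i * c i))
    t : ∀ i → w i * ((c i * W - S) * (c i * W - S)) ≡ W * W * (w i * (c i * c i)) - ι 2 * W * S * (w i * c i) + S * S * w i
    t i = solve 4 (λ w c W S → w :* ((c :* W :- S) :* (c :* W :- S)) := W :* W :* (w :* (c :* c)) :- # 2 :* W :* S :* (w :* c) :+ S :* S :* w) refl (w i) (c i) W S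
    q : 0ℚ ≤ W * W * T - ι 2 * W * S * S + S * S * ∑ n w
    q = ≤-trans (∑-nonneg n (λ i p → *-nonneg (0≤w i p) (sq≥0 (c i * W - S)))) (≤-reflexive
      (trans (∑-ext n t) (trans (∑-+ n (λ i → W * W * (w i * (c i * c i)) - ι 2 * W * S * (w i * c i)) (λ i → S * S * w i))
      (cong₂ _+_ (trans (∑-- n (λ i → W * W * (w i * (c i * c i))) (λ i → ι 2 * W * S * (w i * c i)))
        (cong₂ _-_ (∑-*ˡ n (W * W) (λ i → w i * (c i * c i))) (∑-*ˡ n (ι 2 * W * S) (λ i → w i * c i)))) (∑-*ˡ n (S * S) w)))))

  𝟙 : {P : Set} → Dec P → ℚ
  𝟙 (yes _) = 1ℚ
  𝟙 (no _) = 0ℚ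

  𝟙-yes : {P : Set} (d : Dec P) → P → 𝟙 d ≡ 1ℚ
  𝟙-yes (yes _) p = refl
  𝟙-yes (no ¬p) p = contradiction p ¬p

  𝟙-no : {P : Set} (d : Dec P) → ¬ P → 𝟙 d ≡ 0ℚ
  𝟙-no (yes p) ¬p = contradiction p ¬p
  𝟙-no (no _) ¬p = refl

  𝟙-cong : {P Q : Set} (d : Dec P) (e : Dec Q) → (P → Q) → (Q → P) → 𝟙 d ≡ 𝟙 e
  𝟙-cong (yes p) e f g = sym (𝟙-yes e (f p))
  𝟙-cong (no ¬p) e f g = sym (𝟙-no e (¬p ∘ g))

  𝟙-mono : {P Q : Set} (d : Dec P) (e : Dec Q) → (P → Q) → 𝟙 d ≤ 𝟙 e
  𝟙-mono (yes p) e f = ≤-reflexive (sym (𝟙-yes e (f p)))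
  𝟙-mono (no ¬p) (yes _) f = 0≤ι 1
  𝟙-mono (no ¬p) (no _) f = ≤-refl

  0≤𝟙 : {P : Set} (d : Dec P) → 0ℚ ≤ 𝟙 d
  0≤𝟙 (yes _) = 0≤ι 1
  0≤𝟙 (no _) = ≤-refl

  𝟙≤1 : {P : Set} (d : Dec P) → 𝟙 d ≤ 1ℚ
  𝟙≤1 (yes _) = ≤-refl
  𝟙≤1 (no _) = 0≤ι 1

  -- Integer division and sums over multiples.

  infixl 7 _div_
  -- Total, with value 0 for divisor 0 in accordance with `inv 0 = 0`.
  _div_ : ℕ → ℕ → ℕ
  x div zero = 0
  x div suc q = x ℕ./ suc q

  div-lower : ∀ x q → q ℕ.* (x div q) ℕ.≤ x
  div-lower x zero = z≤n
  div-lower x (suc q) = ℕ.≤-trans (ℕ.≤-reflexive (ℕ.*-comm (suc q) (x ℕ./ suc q))) (ℕ.m/n*n≤m x (suc q))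

  div-upper : ∀ x {q} → 1 ℕ.≤ q → x ℕ.< q ℕ.* (x div q) ℕ.+ q
  div-upper x {suc q} _ = subst (ℕ._< suc q ℕ.* (x ℕ./ suc q) ℕ.+ suc q) (sym (trans (ℕ.m≡m%n+[m/n]*n x (suc q)) (trans (ℕ.+-comm (x ℕ.% suc q) _) (cong (ℕ._+ x ℕ.% suc q) (ℕ.*-comm (x ℕ./ suc q) (suc q))))))
    (ℕ.+-monoʳ-< (suc q ℕ.* (x ℕ./ suc q)) (ℕ.m%n<n x (suc q)))

  div-≥ : ∀ {x q v} → 1 ℕ.≤ q → q ℕ.* v ℕ.≤ x → v ℕ.≤ x div q
  div-≥ {x} {suc q} {v} 1≤q p = ℕ.≤-pred (ℕ.*-cancelˡ-< (suc q) v (suc (x div suc q)) (ℕ.≤-<-trans p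
    (subst (x ℕ.<_) (trans (ℕ.+-comm _ (suc q)) (sym (ℕ.*-suc (suc q) (x div suc q)))) (div-upper x 1≤q))))

  div-< : ∀ {x q v} → x ℕ.< q ℕ.* v → x div q ℕ.< v
  div-< {x} {q} {v} p = ℕ.*-cancelˡ-< q (x div q) v (ℕ.≤-<-trans (div-lower x q) p)

  div-unique : ∀ {x q v} → q ℕ.* v ℕ.≤ x → x ℕ.< q ℕ.* v ℕ.+ q → x div q ≡ v
  div-unique {x} {zero} {v} p ()
  div-unique {x} {suc q} {v} p r = ℕ.≤-antisym (ℕ.≤-pred (div-< (subst (x ℕ.<_) (trans (ℕ.+-comm _ (suc q)) (sym (ℕ.*-suc (suc q) v))) r))) (div-≥ (s≤s z≤n) p)

  div-zero : ∀ {x q} → x ℕ.< q → x div q ≡ 0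
  div-zero {x} {q} p = ℕ.n<1⇒n≡0 (div-< {x} {q} {1} (subst (x ℕ.<_) (sym (ℕ.*-identityʳ q)) p))

  div-≤ : ∀ x q → x div q ℕ.≤ x
  div-≤ x zero = z≤n
  div-≤ x (suc q) = ℕ.m/n≤m x (suc q)

  div-div : ∀ x a b → x div a div b ≡ x div (a ℕ.* b)
  div-div x zero zero = refl
  div-div x zero (suc b) = refl
  div-div x (suc a) zero = cong (x div_) (sym (ℕ.*-zeroʳ a))
  div-div x (suc a) (suc b) = ℕ.m/n/o≡m/[n*o] x (suc a) (suc b)

  ι-div-≤ : ∀ x q → ι (x div q) ≤ ι x * inv q
  ι-div-≤ x zero = ≤-reflexive (sym (*-zeroʳ (ι x)))
  ι-div-≤ x (suc q) = cancel-* (ι (suc q)) (0<ι q) (linear (subst (_≤ ι x) (ι-* (suc q) (x div suc q)) (ι-mono (div-lower x (suc q))) ⊕ ≤-reflexive (sym (cong (ι x *_) (ι-inv q)))) (solve 4 (λ q v x y → q :* (x :* v) :- q :* y := x :+ x :* (q :* v) :- (q :* y :+ x :* # 1)) refl (ι (suc q)) (inv (suc q)) (ι x) (ι (x div suc q))))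

  ι-div-≥ : ∀ x {q} → 1 ℕ.≤ q → ι x * inv q ≤ 1ℚ + ι (x div q)
  ι-div-≥ x {suc q} 1≤q = cancel-* (ι (suc q)) (0<ι q) (linear (ι-mono (ℕ.<⇒≤ (div-upper x 1≤q)) ⊕ ≤-reflexive (ι-+ (suc q ℕ.* (x div suc q)) (suc q)) ⊕ ≤-reflexive (ι-* (suc q) (x div suc q)) ⊕ ≤-reflexive (cong (ι x *_) (ι-inv q))) (solve 6 (λ q v x y s t → q :* (# 1 :+ y) :- q :* (x :* v) := s :+ (t :+ q) :+ q :* y :+ x :* # 1 :- (x :+ s :+ t :+ x :* (q :* v))) refl (ι (suc q)) (inv (suc q)) (ι x) (ι (x div suc q)) (ι (suc q ℕ.* (x div suc q) ℕ.+ suc q)) (ι (suc q ℕ.* (x div suc q)))))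

  ∑-blocks : ∀ q v f → ∑ (q ℕ.* v) f ≡ ∑ v (λ y → ∑ q (λ r → f (q ℕ.* y ℕ.+ r)))
  ∑-blocks q zero f = cong (λ k → ∑ k f) (ℕ.*-zeroʳ q)
  ∑-blocks q (suc v) f = trans (cong (λ k → ∑ k f) (trans (ℕ.*-suc q v) (ℕ.+-comm q _)))
    (trans (∑-split (q ℕ.* v) q f) (cong (_+ ∑ q (λ r → f (q ℕ.* v ℕ.+ r))) (∑-blocks q v f)))

  -- Cut the range into blocks of length q; only the first index of a block is a multiple. The index
  -- 0 takes part on both sides.
  ∑-multiples : ∀ x {q} (g : ℕ → ℚ) → 1 ℕ.≤ q → ∑ (suc x) (λ n → 𝟙 (q ∣? n) * g n) ≡ ∑ (suc (x div q)) (λ m → g (q ℕ.* m))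
  ∑-multiples x {q} g 1≤q = trans (cong (λ k → ∑ k h) split) (trans (∑-split (q ℕ.* v) (suc r) h)
    (cong₂ _+_ (trans (∑-blocks q v h) (∑-ext v (λ y → trans (cong (λ k → ∑ k (λ r → h (q ℕ.* y ℕ.+ r))) (sym q≡)) (block y (ℕ.pred q) (ℕ.≤-reflexive q≡))))) (block v r r<q)))
    where
    v r : ℕ
    v = x div q
    r = x ℕ.∸ q ℕ.* v
    h : ℕ → ℚ
    h n = 𝟙 (q ∣? n) * g n
    q≡ : suc (ℕ.pred q) ≡ q
    q≡ = ℕ.suc-pred q {{ℕ.>-nonZero 1≤q}}
    x≡ : q ℕ.* v ℕ.+ r ≡ x
    x≡ = ℕ.m+[n∸m]≡n (div-lower x q)
    split : suc x ≡ q ℕ.* v ℕ.+ suc r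
    split = trans (cong suc (sym x≡)) (sym (ℕ.+-suc _ r))
    r<q : r ℕ.< q
    r<q = ℕ.+-cancelˡ-< (q ℕ.* v) r q (subst (ℕ._< q ℕ.* v ℕ.+ q) (sym x≡) (div-upper x 1≤q))
    block : ∀ y j → j ℕ.< q → ∑ (suc j) (λ r → h (q ℕ.* y ℕ.+ r)) ≡ g (q ℕ.* y)
    block y j j<q = trans (∑-single (suc j) 0 (s≤s z≤n) off) (trans (cong h (ℕ.+-identityʳ _))
      (trans (cong (_* g (q ℕ.* y)) (𝟙-yes (q ∣? (q ℕ.* y)) (divides y (ℕ.*-comm q y)))) (*-identityˡ _)))
      where
      off : ∀ i → i ℕ.< suc j → ¬ i ≡ 0 → h (q ℕ.* y ℕ.+ i) ≡ 0ℚ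
      off zero p i≢0 = contradiction refl i≢0
      off (suc i) p i≢0 = trans (cong (_* g (q ℕ.* y ℕ.+ suc i)) (𝟙-no (q ∣? (q ℕ.* y ℕ.+ suc i)) (λ d →
        contradiction (∣⇒≤ (∣m+n∣m⇒∣n d (divides y (ℕ.*-comm q y)))) (ℕ.<⇒≱ (ℕ.≤-<-trans (ℕ.≤-pred p) j<q))))) (*-zeroˡ (g (q ℕ.* y ℕ.+ suc i)))

  abs-≤ : ∀ {a b} → a ≤ b → - a ≤ b → ∣ a ∣ ≤ b
  abs-≤ {a} {b} a≤b -a≤b with ≤-total 0ℚ a
  ... | inj₁ 0≤a = subst (_≤ b) (sym (0≤p⇒∣p∣≡p 0≤a)) a≤b
  ... | inj₂ a≤0 = subst (_≤ b) (trans (sym (0≤p⇒∣p∣≡p (linear a≤0 (solve 1 (λ a → (:- a) :- # 0 := # 0 :- a) refl a)))) (∣-p∣≡∣p∣ a)) -a≤b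

  ≤∣∣ : ∀ a → a ≤ ∣ a ∣
  ≤∣∣ a with ≤-total 0ℚ a
  ... | inj₁ 0≤a = ≤-reflexive (sym (0≤p⇒∣p∣≡p 0≤a))
  ... | inj₂ a≤0 = ≤-trans a≤0 (0≤∣p∣ a)

  -≤∣∣ : ∀ a → - a ≤ ∣ a ∣
  -≤∣∣ a = subst (- a ≤_) (∣-p∣≡∣p∣ a) (≤∣∣ (- a))

  ∣∣² : ∀ a → ∣ a ∣ * ∣ a ∣ ≡ a * a
  ∣∣² a with ≤-total 0ℚ a
  ... | inj₁ 0≤a = cong₂ _*_ (0≤p⇒∣p∣≡p 0≤a) (0≤p⇒∣p∣≡p 0≤a)
  ... | inj₂ a≤0 = trans (cong₂ _*_ eq eq) (solve 1 (λ a → (:- a) :* (:- a) := a :* a) refl a)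
    where
    eq : ∣ a ∣ ≡ - a
    eq = trans (sym (∣-p∣≡∣p∣ a)) (0≤p⇒∣p∣≡p (linear a≤0 (solve 1 (λ a → (:- a) :- # 0 := # 0 :- a) refl a)))

  ι-*≤ : ∀ a b {c} → a ℕ.* b ℕ.≤ c → ι a * ι b ≤ ι c
  ι-*≤ a b {c} p = subst (_≤ ι c) (ι-* a b) (ι-mono p)

  dec-elim : {P A : Set} → Dec P → (P → A) → (¬ P → A) → A
  dec-elim (yes p) f g = f p
  dec-elim (no ¬p) f g = g ¬p

  -- The motive is explicit, so that a single occurrence of an indicator can be replaced inside a
  -- large goal.
  𝟙-elim : {P : Set} (d : Dec P) (φ : ℚ → Set) → (P → φ 1ℚ) → (¬ P → φ 0ℚ) → φ (𝟙 d)
  𝟙-elim (yes p) φ f g = f p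
  𝟙-elim (no ¬p) φ f g = g ¬p

-- Binary logarithm and upper bounds for primes in short intervals.

module Chebyshev where

  open import Data.Nat
  open import Data.Nat.Properties
  open import Data.Nat.Divisibility
  open import Data.Nat.Primality
  open import Data.Nat.Combinatorics
  import Data.Rational as ℚ
  import Data.Rational.Properties as ℚ
  open import Data.Product using (_×_; _,_; proj₁; proj₂; ∃)
  open import Data.Sum using (_⊎_; inj₁; inj₂)
  open import Relation.Nullary using (¬_; Dec; yes; no; contradiction)
  open import Relation.Nullary.Decidable using (_×-dec_)
  open import Relation.Binary.PropositionalEquality hiding ([_])
  open Base

  0<2^ : ∀ k → 1 ≤ 2 ^ k
  0<2^ k = m^n>0 2 k

  2^-mono : ∀ {m n} → m ≤ n → 2 ^ m ≤ 2 ^ n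
  2^-mono = ^-monoʳ-≤ 2

  2^-cancel : ∀ {m n} → 2 ^ m < 2 ^ n → m < n
  2^-cancel {m} {n} p with n ≤? m
  ... | yes n≤m = contradiction (2^-mono n≤m) (<⇒≱ p)
  ... | no n≰m = ≰⇒> n≰m

  -- The integer part of the binary logarithm, extended by `lg 0 = 0`. It replaces log everywhere,
  -- so that all quantities stay rational.
  lg : ℕ → ℕ
  lg zero = 0
  lg (suc n) with 2 ^ suc (lg n) ≤? suc n
  ... | yes _ = suc (lg n)
  ... | no _ = lg n

  lg-upper : ∀ n → n < 2 ^ suc (lg n)
  lg-upper zero = s≤s z≤n
  lg-upper (suc n) with 2 ^ suc (lg n) ≤? suc n
  ... | yes _ = ℕ-linear (lg-upper n ⊕ₙ 0<2^ (suc (lg n))) (ℕ-solve 2 (λ n x → conₙ 1 :+ₙ (conₙ 1 :+ₙ n) :+ₙ (x :+ₙ x :+ₙ conₙ 0) :=ₙ x :+ₙ (x :+ₙ conₙ 0) :+ₙ (conₙ 1 :+ₙ n :+ₙ conₙ 1)) refl n (2 ^ suc (lg n)))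
  ... | no p = ≰⇒> p

  lg-positive : ∀ {n} → 1 ≤ lg n → 1 ≤ n
  lg-positive {suc n} _ = s≤s z≤n

  lg-lower : ∀ {n} → 1 ≤ n → 2 ^ lg n ≤ n
  lg-lower {suc n} _ = go n
    where
    go : ∀ n → 2 ^ lg (suc n) ≤ suc n
    go n with 2 ^ suc (lg n) ≤? suc n
    go n | yes p = p
    go zero | no p = s≤s z≤n
    go (suc n) | no p = m≤n⇒m≤1+n (go n)

  lg-≥ : ∀ {n k} → 2 ^ k ≤ n → k ≤ lg n
  lg-≥ {n} {k} p = ≤-pred (2^-cancel (≤-<-trans p (lg-upper n)))

  lg-< : ∀ {n k} → 1 ≤ n → n < 2 ^ k → lg n < k
  lg-< {n} {k} 1≤n p = 2^-cancel (≤-<-trans (lg-lower 1≤n) p)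

  lg-≤ : ∀ {n k} → n < 2 ^ suc k → lg n ≤ k
  lg-≤ {zero} p = z≤n
  lg-≤ {suc n} p = ≤-pred (lg-< (s≤s z≤n) p)

  lg-unique : ∀ {n k} → 2 ^ k ≤ n → n < 2 ^ suc k → lg n ≡ k
  lg-unique p q = ≤-antisym (lg-≤ q) (lg-≥ p)

  lg-mono : ∀ {m n} → m ≤ n → lg m ≤ lg n
  lg-mono {m} {n} p = lg-≤ (≤-<-trans p (lg-upper n))

  n<2^n : ∀ n → n < 2 ^ n
  n<2^n zero = s≤s z≤n
  n<2^n (suc n) = ℕ-linear (n<2^n n ⊕ₙ 0<2^ n) (ℕ-solve 2 (λ n x → conₙ 1 :+ₙ (conₙ 1 :+ₙ n) :+ₙ (x :+ₙ x :+ₙ conₙ 0) :=ₙ x :+ₙ (x :+ₙ conₙ 0) :+ₙ (conₙ 1 :+ₙ n :+ₙ conₙ 1)) refl n (2 ^ n))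

  lg<n : ∀ {n} → 1 ≤ n → lg n < n
  lg<n {n} 1≤n = lg-< 1≤n (n<2^n n)

  prime≥2 : ∀ {q} → Prime q → 2 ≤ q
  prime≥2 {q} pr = nonTrivial⇒n>1 q {{prime⇒nonTrivial pr}}

  prime∣prime : ∀ {p q} → Prime p → Prime q → p ∣ q → p ≡ q
  prime∣prime pp pq p∣q with prime⇒irreducible pq p∣q
  ... | inj₁ refl = contradiction (prime≥2 pp) λ { (s≤s ()) }
  ... | inj₂ p≡q = p≡q

  prime∤1 : ∀ {q} → Prime q → ¬ q ∣ 1
  prime∤1 pr q∣1 = contradiction (prime≥2 pr) (<⇒≱ (s≤s (∣⇒≤ q∣1)))

  -- An integer d whose prime factors are below X and which absorbs the primes
  -- below X that satisfy P.
  prime-product : {P : ℕ → Set} (P? : ∀ i → Dec (P i)) (n X : ℕ) → (∀ i → i < X → P i → Prime i × i ∣ n) →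
    ∃ λ d → ∃ λ e → d ∣ n × 2 ^ e ≤ d × (∀ q → Prime q → q ∣ d → q < X) × ι e ≡ ∑ X (λ i → 𝟙 (P? i) ℚ.* ι (lg i))
  prime-product P? n zero h = 1 , 0 , 1∣ n , ≤-refl , (λ q pq q∣1 → contradiction q∣1 (prime∤1 pq)) , refl
  prime-product {P} P? n (suc X) h with prime-product P? n X (λ i p → h i (m<n⇒m<1+n p)) | P? X
  ... | d , e , d∣n , 2^e≤d , small , eq | no _ = d , e , d∣n , 2^e≤d , (λ q pq q∣d → m<n⇒m<1+n (small q pq q∣d)) ,
    trans eq (sym (trans (cong (ℚ._+_ (∑ X _)) (ℚ.*-zeroˡ (ι (lg X)))) (ℚ.+-identityʳ _)))
  ... | d , e , d∣n , 2^e≤d , small , eq | yes pX = X * d , lg X + e , Xd∣n′ d∣n ,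
    ≤-trans (≤-reflexive (^-distribˡ-+-* 2 (lg X) e)) (*-mono-≤ (lg-lower (≤-trans (s≤s z≤n) (prime≥2 prX))) 2^e≤d) , small′ ,
    trans (ι-+ (lg X) e) (trans (ℚ.+-comm (ι (lg X)) (ι e)) (cong₂ ℚ._+_ eq (sym (ℚ.*-identityˡ (ι (lg X))))))
    where
    prX : Prime X
    prX = proj₁ (h X ≤-refl pX)
    Xd∣n′ : d ∣ n → X * d ∣ n
    Xd∣n′ (divides k n≡kd) with euclidsLemma k d prX (subst (X ∣_) n≡kd (proj₂ (h X ≤-refl pX)))
    ... | inj₁ (divides j k≡jX) = divides j (trans n≡kd (trans (cong (_* d) k≡jX) (*-assoc j X d)))
    ... | inj₂ X∣d = contradiction (small X prX X∣d) (<-irrefl refl)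
    small′ : ∀ q → Prime q → q ∣ X * d → q < suc X
    small′ q pq q∣Xd with euclidsLemma X d pq q∣Xd
    ... | inj₁ q∣X = s≤s (≤-reflexive (prime∣prime pq prX q∣X))
    ... | inj₂ q∣d = m<n⇒m<1+n (small q pq q∣d)

  -- The product of the selected primes divides n, hence is below 2^(m+1), and it is at least 2 to
  -- the power of the sum of their `lg`. Applied both to binomial coefficients and to plain
  -- integers.
  prime-log-sum : {P : ℕ → Set} (P? : ∀ i → Dec (P i)) (n X m : ℕ) → 1 ≤ n → n < 2 ^ suc m →
    (∀ i → i < X → P i → Prime i × i ∣ n) → ∑ X (λ i → 𝟙 (P? i) ℚ.* ι (lg i)) ℚ.≤ ι m
  prime-log-sum P? n X m 1≤n n< h with prime-product P? n X h
  ... | d , e , d∣n , 2^e≤d , _ , eq = subst (ℚ._≤ ι m) eq (ι-mono (≤-pred (2^-cancel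
    (≤-<-trans 2^e≤d (≤-<-trans (∣⇒≤ {{>-nonZero 1≤n}} d∣n) n<)))))

  -- Bernoulli's inequality 1 - M/(x+1) ≤ (x/(x+1))^M with denominators cleared, where a = x + 1 -
  -- M.
  bernoulli : ∀ x M a → a + M ≡ suc x → suc x ^ M * a ≤ x ^ M * suc x
  bernoulli x zero a eq = ≤-reflexive (cong (_+ 0) (trans (sym (+-identityʳ a)) eq))
  bernoulli x (suc M) a eq = ℕ-linear (*-monoʳ-≤ (suc x ^ M) (ℕ-linear a≤x (ℕ-solve 2 (λ x a → (conₙ 1 :+ₙ x) :*ₙ a :+ₙ (x :+ₙ conₙ 0) :=ₙ x :*ₙ (conₙ 1 :+ₙ a) :+ₙ a) refl x a)) ⊕ₙ *-monoʳ-≤ x (bernoulli x M (suc a) (trans (sym (+-suc a M)) eq))) (ℕ-solve 4 (λ s r a x → (conₙ 1 :+ₙ x) :*ₙ s :*ₙ a :+ₙ (s :*ₙ (x :*ₙ (conₙ 1 :+ₙ a)) :+ₙ x :*ₙ (r :*ₙ (conₙ 1 :+ₙ x)) :+ₙ conₙ 0) :=ₙ x :*ₙ r :*ₙ (conₙ 1 :+ₙ x) :+ₙ (s :*ₙ ((conₙ 1 :+ₙ x) :*ₙ a) :+ₙ x :*ₙ (s :*ₙ (conₙ 1 :+ₙ a)))) refl (suc x ^ M) (x ^ M) a x)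
    where
    a≤x : a ≤ x
    a≤x = subst (a ≤_) (suc-injective (trans (sym (+-suc a M)) eq)) (m≤m+n a M)

  [1+2M]^M : ∀ M → (1 + 2 * M) ^ M ≤ 2 * (2 * M) ^ M
  [1+2M]^M M = *-cancelʳ-≤ _ _ (suc M) (ℕ-linear (bernoulli (2 * M) M (suc M) (ℕ-solve 1 (λ M → conₙ 1 :+ₙ M :+ₙ M :=ₙ conₙ 1 :+ₙ conₙ 2 :*ₙ M) refl M)) (ℕ-solve 3 (λ M a b → a :*ₙ (conₙ 1 :+ₙ M) :+ₙ (b :*ₙ (conₙ 1 :+ₙ conₙ 2 :*ₙ M) :+ₙ b) :=ₙ conₙ 2 :*ₙ b :*ₙ (conₙ 1 :+ₙ M) :+ₙ a :*ₙ (conₙ 1 :+ₙ M)) refl M ((1 + 2 * M) ^ M) ((2 * M) ^ M)))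

  -- With N = 2^k this is (1 + 1/N)^N ≤ 4, the square of (1 + 1/(2M))^M ≤ 2.
  [1+2^k]^2^k : ∀ k → (1 + 2 ^ k) ^ (2 ^ k) ≤ 4 * (2 ^ k) ^ (2 ^ k)
  [1+2^k]^2^k zero = s≤s (s≤s z≤n)
  [1+2^k]^2^k (suc k) = begin
    (1 + 2 * M) ^ (2 * M) ≡⟨ double (1 + 2 * M) ⟩
    (1 + 2 * M) ^ M * (1 + 2 * M) ^ M ≤⟨ *-mono-≤ ([1+2M]^M M) ([1+2M]^M M) ⟩
    2 * (2 * M) ^ M * (2 * (2 * M) ^ M) ≡⟨ (ℕ-solve 1 (λ a → conₙ 2 :*ₙ a :*ₙ (conₙ 2 :*ₙ a) :=ₙ conₙ 4 :*ₙ (a :*ₙ a)) refl ((2 * M) ^ M)) ⟩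
    4 * ((2 * M) ^ M * (2 * M) ^ M) ≡⟨ cong (4 *_) (double (2 * M)) ⟨
    4 * (2 * M) ^ (2 * M) ∎
    where
    open ≤-Reasoning
    M = 2 ^ k
    double : ∀ x → x ^ (2 * M) ≡ x ^ M * x ^ M
    double x = trans (cong (x ^_) (cong (M +_) (+-identityʳ M))) (^-distribˡ-+-* x M M)

  -- A single term of the expansion of (1 + N)^(t+z), kept by induction along Pascal's rule.
  binomial-≤ : ∀ N t z → ((t + z) C z) * N ^ t ≤ (1 + N) ^ (t + z)
  binomial-≤ N t zero = subst₂ _≤_ (sym (trans (cong (_* N ^ t) (nC0 (t + 0))) (+-identityʳ _))) (cong ((1 + N) ^_) (sym (+-identityʳ t))) (^-monoˡ-≤ t (n≤1+n N))
    where
    nC0 : ∀ n → n C 0 ≡ 1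
    nC0 zero = refl
    nC0 (suc n) = trans (nCk≡nC[n∸k] {0} {suc n} z≤n) (nCn≡1 (suc n))
  binomial-≤ N zero (suc z) = subst (_≤ (1 + N) ^ suc z) (sym (trans (*-identityʳ _) (nCn≡1 (suc z)))) (m^n>0 (1 + N) (suc z))
  binomial-≤ N (suc t) (suc z) = subst (λ c → c * N ^ suc t ≤ (1 + N) ^ suc (t + suc z)) (nCk+nC[k+1]≡[n+1]C[k+1] (t + suc z) z)
    (ℕ-linear (subst (λ n → (n C z) * N ^ suc t ≤ (1 + N) ^ n) (sym (+-suc t z)) (binomial-≤ N (suc t) z) ⊕ₙ *-monoʳ-≤ N (binomial-≤ N t (suc z))) (ℕ-solve 5 (λ N a b r s → (a :+ₙ b) :*ₙ (N :*ₙ r) :+ₙ (s :+ₙ N :*ₙ s :+ₙ conₙ 0) :=ₙ (conₙ 1 :+ₙ N) :*ₙ s :+ₙ (a :*ₙ (N :*ₙ r) :+ₙ N :*ₙ (b :*ₙ r))) refl N ((t + suc z) C z) ((t + suc z) C suc z) (N ^ t) ((1 + N) ^ (t + suc z))))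

  -- With N = 2^k the single term gives (1 + N)^z (1 + 1/N)^t. As t ≤ N z, the second factor is at
  -- most 4^z, and (2 N · 4)^z = 2^((k+3) z). Multiplying through by N^(N z) = N^t N^w avoids
  -- fractions.
  binomial-bound : ∀ k t z → t ≤ 2 ^ k * z → (t + z) C z ≤ 2 ^ ((k + 3) * z)
  binomial-bound k t z t≤ = *-cancelʳ-≤ _ _ (N ^ (N * z)) {{m^n≢0 N (N * z) {{>-nonZero (0<2^ k)}}}} (begin
    ((t + z) C z) * N ^ (N * z) ≡⟨ cong (((t + z) C z) *_) (split N) ⟩
    ((t + z) C z) * (N ^ t * N ^ w) ≡⟨ *-assoc ((t + z) C z) (N ^ t) (N ^ w) ⟨
    ((t + z) C z) * N ^ t * N ^ w ≤⟨ *-mono-≤ (binomial-≤ N t z) (^-monoˡ-≤ w (n≤1+n N)) ⟩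
    (1 + N) ^ (t + z) * (1 + N) ^ w ≡⟨ cong (_* (1 + N) ^ w) (^-distribˡ-+-* (1 + N) t z) ⟩
    (1 + N) ^ t * (1 + N) ^ z * (1 + N) ^ w ≡⟨ (ℕ-solve 3 (λ a b c → a :*ₙ b :*ₙ c :=ₙ b :*ₙ (a :*ₙ c)) refl ((1 + N) ^ t) ((1 + N) ^ z) ((1 + N) ^ w)) ⟩
    (1 + N) ^ z * ((1 + N) ^ t * (1 + N) ^ w) ≡⟨ cong ((1 + N) ^ z *_) (split (1 + N)) ⟨
    (1 + N) ^ z * (1 + N) ^ (N * z) ≡⟨ cong ((1 + N) ^ z *_) (^-*-assoc (1 + N) N z) ⟨
    (1 + N) ^ z * ((1 + N) ^ N) ^ z ≤⟨ *-mono-≤ (^-monoˡ-≤ z (ℕ-linear (0<2^ k) (ℕ-solve 1 (λ N → conₙ 1 :+ₙ N :+ₙ (N :+ₙ conₙ 0) :=ₙ conₙ 2 :*ₙ N :+ₙ conₙ 1) refl N))) (^-monoˡ-≤ z ([1+2^k]^2^k k)) ⟩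
    (2 * N) ^ z * (4 * N ^ N) ^ z ≡⟨ ^-distribʳ-* z (2 * N) (4 * N ^ N) ⟨
    (2 * N * (4 * N ^ N)) ^ z ≡⟨ cong (_^ z) (ℕ-solve 2 (λ N a → conₙ 2 :*ₙ N :*ₙ (conₙ 4 :*ₙ a) :=ₙ N :*ₙ conₙ 8 :*ₙ a) refl N (N ^ N)) ⟩
    (N * 8 * N ^ N) ^ z ≡⟨ ^-distribʳ-* z (N * 8) (N ^ N) ⟩
    (N * 8) ^ z * (N ^ N) ^ z ≡⟨ cong₂ _*_ (cong (_^ z) (^-distribˡ-+-* 2 k 3)) refl ⟨
    (2 ^ (k + 3)) ^ z * (N ^ N) ^ z ≡⟨ cong₂ _*_ (^-*-assoc 2 (k + 3) z) (^-*-assoc N N z) ⟩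
    2 ^ ((k + 3) * z) * N ^ (N * z) ∎)
    where
    open ≤-Reasoning
    N w : ℕ
    N = 2 ^ k
    w = N * z ∸ t
    split : ∀ x → x ^ (N * z) ≡ x ^ t * x ^ w
    split x = trans (cong (x ^_) (sym (m+[n∸m]≡n t≤))) (^-distribˡ-+-* x t w)
    ^-distribʳ-* : ∀ n a b → (a * b) ^ n ≡ a ^ n * b ^ n
    ^-distribʳ-* zero a b = refl
    ^-distribʳ-* (suc n) a b = trans (cong (a * b *_) (^-distribʳ-* n a b)) (ℕ-solve 4 (λ a b c d → a :*ₙ b :*ₙ (c :*ₙ d) :=ₙ a :*ₙ c :*ₙ (b :*ₙ d)) refl a b (a ^ n) (b ^ n))

  prime∤! : ∀ {q} n → Prime q → n < q → ¬ q ∣ n !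
  prime∤! zero pq n<q d = prime∤1 pq d
  prime∤! (suc n) pq n<q d with euclidsLemma (suc n) (n !) pq d
  ... | inj₁ e = contradiction (∣⇒≤ e) (<⇒≱ n<q)
  ... | inj₂ e = prime∤! n pq (<-trans (n<1+n n) n<q) e

  -- Such a prime divides (t + z)! but neither z! nor t!, since z ≤ t < q.
  prime∣binomial : ∀ {q} t z → z ≤ t → Prime q → t < q → q ≤ t + z → q ∣ (t + z) C z
  prime∣binomial {q} t z z≤t pq t<q q≤ = go (euclidsLemma ((t + z) C z) (z ! * t !) pq (subst (q ∣_) (sym C*) (q∣! (t + z) q≤)))
    where
    q∣! : ∀ n → q ≤ n → q ∣ n !
    q∣! n q≤n = ∣-trans (self q (≤-trans (s≤s z≤n) (prime≥2 pq))) (m≤n⇒m!∣n! q≤n)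
      where
      self : ∀ m → 1 ≤ m → m ∣ m !
      self (suc m) _ = m∣m*n (m !)
    C* : ((t + z) C z) * (z ! * t !) ≡ (t + z) !
    C* = trans (cong (_* (z ! * t !)) (trans (nCk≡n!/k![n-k]! (m≤n+m z t)) refl))
      (subst (λ w → (((t + z) ! / (z ! * w !)) {{z !* w !≢0}}) * (z ! * t !) ≡ (t + z) !) (sym (m+n∸n≡m t z))
        (DM.m/n*n≡m {{z !* t !≢0}} (subst (λ w → z ! * w ! ∣ (t + z) !) (m+n∸n≡m t z) (k![n∸k]!∣n! (m≤n+m z t)))))
      where import Data.Nat.DivMod as DM
    go : q ∣ (t + z) C z ⊎ q ∣ z ! * t ! → q ∣ (t + z) C z
    go (inj₁ d) = d
    go (inj₂ d) with euclidsLemma (z !) (t !) pq d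
    ... | inj₁ e = contradiction e (prime∤! z pq (≤-<-trans z≤t t<q))
    ... | inj₂ e = contradiction e (prime∤! t pq t<q)

  -- A weak Brun-Titchmarsh bound: the interval has relative length at least 2^-k, and the estimate
  -- exceeds the expected order z by the factor k + 3 only. It is the sole information used on
  -- primes in short intervals.
  window-bound : ∀ k t z → z ≤ t → t ≤ 2 ^ k * z →
    ∑ (suc (t + z)) (λ q → 𝟙 (prime? q ×-dec t <? q) ℚ.* ι (lg q)) ℚ.≤ ι ((k + 3) * z)
  window-bound k t z z≤t t≤ = prime-log-sum (λ q → prime? q ×-dec t <? q) ((t + z) C z) (suc (t + z)) ((k + 3) * z)
    1≤C (≤-<-trans (binomial-bound k t z t≤) (^-monoʳ-< 2 (s≤s (s≤s z≤n)) (n<1+n ((k + 3) * z))))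
    (λ q q≤ (pq , t<q) → pq , prime∣binomial t z z≤t pq t<q (≤-pred q≤))
    where
    1≤C : 1 ≤ (t + z) C z
    1≤C with (t + z) C z in eq
    ... | suc _ = s≤s z≤n
    ... | zero = contradiction (trans (sym (nCk≡n!/k![n-k]! (m≤n+m z t))) eq) (m/n≢0⇒ )
      where
      import Data.Nat.DivMod as DM
      m/n≢0⇒ : ¬ (((t + z) ! / (z ! * (t + z ∸ z) !)) {{z !* (t + z ∸ z) !≢0}}) ≡ 0
      m/n≢0⇒ e = contradiction (DM.m/n≡0⇒m<n {{z !* (t + z ∸ z) !≢0}} e) (≤⇒≯ (∣⇒≤ {{(t + z) !≢0}} (k![n∸k]!∣n! (m≤n+m z t))))

open import Data.Nat as ℕ using (ℕ; zero; suc; z≤n; s≤s)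
import Data.Nat.Properties as ℕ
open import Data.Nat.Divisibility
open import Data.Nat.Primality using (Prime; prime?; euclidsLemma; prime⇒irreducible)
open import Data.Rational as ℚ using (ℚ; 0ℚ; 1ℚ; _+_; _*_; _-_; -_; _≤_; _<_; ∣_∣)
open import Data.Rational.Properties hiding (_≟_)
open import Data.Product using (_×_; _,_; proj₁; proj₂; ∃)
open import Data.Sum using (_⊎_; inj₁; inj₂)
open import Function using (_∘_)
open import Relation.Nullary using (¬_; Dec; yes; no; contradiction)
open import Relation.Nullary.Decidable using (_×-dec_)
open import Relation.Binary.PropositionalEquality hiding ([_]; J)
open Base
open Chebyshev

module _ (p : ℕ) (pp : Prime p) where

  -- Chebyshev and Mertens bounds from above, by dyadic blocks.

  module Mertens where

    dyadic : ∀ j g → ∑ (2 ℕ.^ j) g ≡ g 0 + ∑ j (λ i → ∑ (2 ℕ.^ i) (λ r → g (2 ℕ.^ i ℕ.+ r)))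
    dyadic zero g = +-comm 0ℚ (g 0)
    dyadic (suc j) g = trans (cong (λ k → ∑ k g) (cong (2 ℕ.^ j ℕ.+_) (ℕ.+-identityʳ (2 ℕ.^ j))))
      (trans (∑-split (2 ℕ.^ j) (2 ℕ.^ j) g) (trans (cong (_+ ∑ (2 ℕ.^ j) (λ r → g (2 ℕ.^ j ℕ.+ r))) (dyadic j g))
        (+-assoc (g 0) (∑ j (λ i → ∑ (2 ℕ.^ i) (λ r → g (2 ℕ.^ i ℕ.+ r)))) (∑ (2 ℕ.^ j) (λ r → g (2 ℕ.^ j ℕ.+ r))))))

    dyadic₀ : ∀ j g → g 0 ≡ 0ℚ → ∑ (2 ℕ.^ j) g ≡ ∑ j (λ i → ∑ (2 ℕ.^ i) (λ r → g (2 ℕ.^ i ℕ.+ r)))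
    dyadic₀ j g g0 = trans (dyadic j g) (trans (cong (_+ ∑ j (λ i → ∑ (2 ℕ.^ i) (λ r → g (2 ℕ.^ i ℕ.+ r)))) g0)
      (+-identityˡ (∑ j (λ i → ∑ (2 ℕ.^ i) (λ r → g (2 ℕ.^ i ℕ.+ r))))))

    lg-block : ∀ i {r} → r ℕ.< 2 ℕ.^ i → lg (2 ℕ.^ i ℕ.+ r) ≡ i
    lg-block i {r} r< = lg-unique (ℕ.m≤m+n _ r) (subst (2 ℕ.^ i ℕ.+ r ℕ.<_) (cong (2 ℕ.^ i ℕ.+_) (sym (ℕ.+-identityʳ (2 ℕ.^ i)))) (ℕ.+-monoʳ-< (2 ℕ.^ i) r<))

    ι2^ : ∀ i → ι (2 ℕ.^ suc i) ≡ ι 2 * ι (2 ℕ.^ i)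
    ι2^ i = ι-* 2 (2 ℕ.^ i)

    π χ : ℕ → ℚ
    π q = 𝟙 (prime? q)

    𝒫? : ∀ q → Dec (Prime q × p ℕ.< q)
    𝒫? q = prime? q ×-dec (p ℕ.<? q)

    χ q = 𝟙 (𝒫? q)

    χ≤π : ∀ q → χ q ≤ π q
    χ≤π q = 𝟙-mono (𝒫? q) (prime? q) proj₁

    0≤χ : ∀ q → 0ℚ ≤ χ q
    0≤χ q = 0≤𝟙 (𝒫? q)

    0≤π : ∀ q → 0ℚ ≤ π q
    0≤π q = 0≤𝟙 (prime? q)

    -- Von Mangoldt weights on primes, with `lg` for log; `Λ` keeps the primes above p, the only
    -- ones that divide integers in the support of `f`. Higher prime powers are treated as error
    -- terms.
    Λ Λ′ : ℕ → ℚ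
    Λ q = χ q * ι (lg q)
    Λ′ q = π q * ι (lg q)

    0≤Λ : ∀ q → 0ℚ ≤ Λ q
    0≤Λ q = *-nonneg (0≤χ q) (0≤ι (lg q))

    0≤Λ′ : ∀ q → 0ℚ ≤ Λ′ q
    0≤Λ′ q = *-nonneg (0≤π q) (0≤ι (lg q))

    Λ≤Λ′ : ∀ q → Λ q ≤ Λ′ q
    Λ≤Λ′ q = *-monoʳ (ι (lg q)) (0≤ι (lg q)) (χ≤π q)

    Λ0 : Λ 0 ≡ 0ℚ
    Λ0 = *-zeroʳ (χ 0)

    Λ′≤lg : ∀ q → Λ′ q ≤ ι (lg q)
    Λ′≤lg q = subst (Λ′ q ≤_) (*-identityˡ (ι (lg q))) (*-monoʳ (ι (lg q)) (0≤ι (lg q)) (𝟙≤1 (prime? q)))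

    -- `Λ 0` vanishes, so identities that rest on q · (1/q) = 1 may be used under `Λ q` for every
    -- index q.
    Λ-support : ∀ q {a b} → (1 ℕ.≤ q → a ≡ b) → Λ q * a ≡ Λ q * b
    Λ-support zero {a} {b} h = trans (cong (_* a) Λ0) (trans (*-zeroˡ a) (sym (trans (cong (_* b) Λ0) (*-zeroˡ b))))
    Λ-support (suc q) h = cong (Λ (suc q) *_) (h (s≤s z≤n))

    -- The window bound with t = z = 2^i yields 3 · 2^i for the primes above 2^i. The first index
    -- 2^i is not covered by it and is paid with its own logarithm i ≤ 2^i.
    θ-block : ∀ i → ∑ (2 ℕ.^ i) (λ r → Λ′ (2 ℕ.^ i ℕ.+ r)) ≤ ι 4 * ι (2 ℕ.^ i)
    θ-block i = ≤-trans (∑-mono T step) (≤-trans (≤-reflexive (trans (∑-+ T (λ r → w (T ℕ.+ r)) (λ r → 𝟙 (r ℕ.≟ 0) * ι i)) (cong (_+_ (∑ T (λ r → w (T ℕ.+ r))))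
        (trans (∑-single T 0 (0<2^ i) (λ r _ r≢0 → trans (cong (_* ι i) (𝟙-no (r ℕ.≟ 0) r≢0)) (*-zeroˡ (ι i)))) (*-identityˡ (ι i))))))
        (linear (window ⊕ ∑-nonneg T (λ q _ → 0≤w q) ⊕ ι-mono (ℕ.<⇒≤ (n<2^n i))) (solve 4 (λ s a i t → # 4 :* t :- (s :+ i) := # 3 :* t :+ a :+ t :- (a :+ s :+ # 0 :+ i)) refl (∑ T (λ r → w (T ℕ.+ r))) (∑ T w) (ι i) (ι T))))
      where
      T = 2 ℕ.^ i
      w : ℕ → ℚ
      w q = 𝟙 (prime? q ×-dec T ℕ.<? q) * ι (lg q)
      0≤w : ∀ q → 0ℚ ≤ w q
      0≤w q = *-nonneg (0≤𝟙 (prime? q ×-dec T ℕ.<? q)) (0≤ι (lg q))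
      window : ∑ T w + ∑ T (λ r → w (T ℕ.+ r)) ≤ ι 3 * ι T
      window = ≤-trans (≤-reflexive (sym (∑-split T T w))) (≤-trans (∑-extend (ℕ.n≤1+n (T ℕ.+ T)) (λ q _ _ → 0≤w q))
        (≤-trans (window-bound 0 T T ℕ.≤-refl (ℕ.≤-reflexive (sym (ℕ.+-identityʳ T)))) (≤-reflexive (ι-* 3 T))))
      step : ∀ r → r ℕ.< T → Λ′ (T ℕ.+ r) ≤ w (T ℕ.+ r) + 𝟙 (r ℕ.≟ 0) * ι i
      step zero r<T = linear (subst (λ k → Λ′ (T ℕ.+ 0) ≤ ι k) (lg-block i r<T) (Λ′≤lg (T ℕ.+ 0)) ⊕ 0≤w (T ℕ.+ 0)) (solve 3 (λ a w i → w :+ # 1 :* i :- a := i :+ w :- (a :+ # 0)) refl (Λ′ (T ℕ.+ 0)) (w (T ℕ.+ 0)) (ι i))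
      step (suc r) r<T = linear (*-monoʳ (ι (lg (T ℕ.+ suc r))) (0≤ι _) (𝟙-mono (prime? (T ℕ.+ suc r)) (prime? (T ℕ.+ suc r) ×-dec T ℕ.<? (T ℕ.+ suc r)) (λ pr → pr , ℕ.m<m+n T (s≤s z≤n)))) (solve 3 (λ a w i → w :+ # 0 :* i :- a := w :- a) refl (Λ′ (T ℕ.+ suc r)) (w (T ℕ.+ suc r)) (ι i))

    θ-bound : ∀ j → ∑ (2 ℕ.^ j) Λ′ ≤ ι 4 * ι (2 ℕ.^ j)
    θ-bound j = ≤-trans (≤-reflexive (dyadic j Λ′)) (go j)
      where
      go : ∀ j → Λ′ 0 + ∑ j (λ i → ∑ (2 ℕ.^ i) (λ r → Λ′ (2 ℕ.^ i ℕ.+ r))) ≤ ι 4 * ι (2 ℕ.^ j)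
      go zero = ≤-trans (≤-reflexive (trans (+-identityʳ (Λ′ 0)) (*-zeroʳ (π 0)))) (0≤ι 4)
      go (suc j) = linear (go j ⊕ θ-block j ⊕ 4 ⊛ ≤-reflexive (sym (ι2^ j))) (solve 5 (λ a s b t t' → # 4 :* t' :- (a :+ (s :+ b)) := # 4 :* t :+ # 4 :* t :+ # 4 :* t' :- (a :+ s :+ b :+ # 4 :* (# 2 :* t))) refl (Λ′ 0) (∑ j (λ i → ∑ (2 ℕ.^ i) (λ r → Λ′ (2 ℕ.^ i ℕ.+ r)))) (∑ (2 ℕ.^ j) (λ r → Λ′ (2 ℕ.^ j ℕ.+ r))) (ι (2 ℕ.^ j)) (ι (2 ℕ.^ suc j)))

    h : ℕ → ℚ
    h j = ∑ j inv

    h-mono : ∀ {i j} → i ℕ.≤ j → h i ≤ h j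
    h-mono p = ∑-extend p (λ i _ _ → 0≤inv i)

    h-2^ : ∀ j → h (2 ℕ.^ j) ≤ ι j
    h-2^ j = ≤-trans (≤-reflexive (dyadic₀ j inv refl)) (≤-trans (∑-upper j 1ℚ (λ i _ →
      ≤-trans (∑-upper (2 ℕ.^ i) (inv (2 ℕ.^ i)) (λ r _ → inv-anti (0<2^ i) (ℕ.m≤m+n _ r))) (ι*inv≤1 (2 ℕ.^ i)))) (≤-reflexive (*-identityʳ (ι j))))

    R : ℕ → ℚ
    R j = ∑ (2 ℕ.^ j) (λ q → π q * inv q)

    -- Since lg q = i on the block, i ∑ 1/q is at most ∑ lg q / 2^i. The block i = 0 contains only
    -- the index 1, which is not prime, in agreement with `inv 0 = 0`.
    R-block : ∀ i → ∑ (2 ℕ.^ i) (λ r → π (2 ℕ.^ i ℕ.+ r) * inv (2 ℕ.^ i ℕ.+ r)) ≤ ι 4 * inv i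
    R-block zero = ≤-reflexive (trans (+-identityˡ _) (trans (cong (_* inv 1) (𝟙-no (prime? 1) (λ pr → contradiction (prime≥2 pr) λ { (s≤s ()) }))) (*-zeroˡ (inv 1))))
    R-block i@(suc _) = cancel-* (ι i) (0<ι _) (linear (sum ⊕ 4 ⊛ ≤-reflexive (sym (ι-inv (ℕ.pred i)))) (solve 3 (λ i s v → i :* (# 4 :* v) :- i :* s := # 4 :+ # 4 :* (i :* v) :- (i :* s :+ # 4 :* # 1)) refl (ι i) (∑ T (λ r → π (T ℕ.+ r) * inv (T ℕ.+ r))) (inv i)))
      where
      T = 2 ℕ.^ i
      sum : ι i * ∑ T (λ r → π (T ℕ.+ r) * inv (T ℕ.+ r)) ≤ ι 4
      sum = ≤-trans (≤-reflexive (sym (∑-*ˡ T (ι i) _))) (≤-trans (∑-mono T (λ r r<T → 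
        (linear (≤-reflexive (sym (cong (λ k → π (T ℕ.+ r) * ι k * inv T) (lg-block i r<T))) ⊕ *-monoˡ (π (T ℕ.+ r) * ι i) (*-nonneg (0≤π (T ℕ.+ r)) (0≤ι i)) (inv-anti (0<2^ i) (ℕ.m≤m+n T r))) (solve 5 (λ p i v t l → p :* l :* t :- i :* (p :* v) := p :* l :* t :+ p :* i :* t :- (p :* i :* t :+ p :* i :* v)) refl (π (T ℕ.+ r)) (ι i) (inv (T ℕ.+ r)) (inv T) (ι (lg (T ℕ.+ r)))))))
        (≤-trans (≤-reflexive (∑-*ʳ T (inv T) (λ r → Λ′ (T ℕ.+ r)))) (linear (*-monoʳ (inv T) (0≤inv T) (θ-block i) ⊕ 4 ⊛ ≤-reflexive (ι*inv (0<2^ i))) (solve 3 (λ s t v → # 4 :- s :* v := # 4 :* t :* v :+ # 4 :* # 1 :- (s :* v :+ # 4 :* (t :* v))) refl (∑ T (λ r → Λ′ (T ℕ.+ r))) (ι T) (inv T)))))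

    R-bound : ∀ j → R j ≤ ι 4 * h j
    R-bound j = ≤-trans (≤-reflexive (dyadic₀ j (λ q → π q * inv q) (*-zeroʳ (π 0))))
      (≤-trans (∑-mono j (λ i _ → R-block i)) (≤-reflexive (∑-*ˡ j (ι 4) inv)))

    -- Removes the index 0, which `∑-multiples` counts as a multiple of everything.
    pos : ℕ → ℚ
    pos n = 𝟙 (1 ℕ.≤? n)

    0≤pos : ∀ n → 0ℚ ≤ pos n
    0≤pos n = 0≤𝟙 (1 ℕ.≤? n)

    pos-≤ : ∀ n {a b} → (1 ℕ.≤ n → a ≤ b) → pos n * a ≤ pos n * b
    pos-≤ zero {a} {b} h = ≤-reflexive (trans (*-zeroˡ a) (sym (*-zeroˡ b)))
    pos-≤ (suc n) h = *-monoˡ 1ℚ (0≤ι 1) (h (s≤s z≤n))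

    ∑-pos : ∀ x → ∑ (suc x) pos ≡ ι x
    ∑-pos zero = refl
    ∑-pos (suc x) = trans (cong (_+ 1ℚ) (∑-pos x)) (trans (+-comm (ι x) 1ℚ) (sym (ι-suc x)))

    count-multiples : ∀ x {q} → 1 ℕ.≤ q → ∑ (suc x) (λ n → 𝟙 (q ∣? n) * pos n) ≡ ι (x div q)
    count-multiples x {q} 1≤q = trans (∑-multiples x pos 1≤q) (trans (∑-ext (suc (x div q)) (λ m → 𝟙-cong (1 ℕ.≤? (q ℕ.* m)) (1 ℕ.≤? m) (f m) (g m))) (∑-pos (x div q)))
      where
      f : ∀ m → 1 ℕ.≤ q ℕ.* m → 1 ℕ.≤ m
      f zero r = contradiction (subst (1 ℕ.≤_) (ℕ.*-zeroʳ q) r) λ ()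
      f (suc m) r = s≤s z≤n
      g : ∀ m → 1 ℕ.≤ m → 1 ℕ.≤ q ℕ.* m
      g m r = ℕ.*-mono-≤ 1≤q r

    -- The part of log n carried by the primes above p, each taken without multiplicity; it never
    -- exceeds lg n.
    ℓ : ℕ → ℕ → ℚ
    ℓ X n = ∑ X (λ q → Λ q * 𝟙 (q ∣? n))

    ∑-ℓ : ∀ x X (g : ℕ → ℚ) → ∑ (suc x) (λ n → g n * ℓ X n) ≡ ∑ X (λ q → Λ q * ∑ (suc (x div q)) (λ m → g (q ℕ.* m)))
    ∑-ℓ x X g = trans (∑-ext (suc x) (λ n → sym (∑-*ˡ X (g n) _))) (trans (∑-swap (suc x) X _) (∑-ext X (λ q →
      trans (∑-ext (suc x) (λ n → (solve 3 (λ g l i → g :* (l :* i) := l :* (i :* g)) refl (g n) (Λ q) (𝟙 (q ∣? n)))))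
        (trans (∑-*ˡ (suc x) (Λ q) _) (Λ-support q (∑-multiples x g))))))

    ∑-pos-ℓ : ∀ x X → ∑ (suc x) (λ n → pos n * ℓ X n) ≡ ∑ X (λ q → Λ q * ι (x div q))
    ∑-pos-ℓ x X = trans (∑-ℓ x X pos) (∑-ext X (λ q → Λ-support q (λ 1≤q → trans (sym (∑-multiples x pos 1≤q)) (count-multiples x 1≤q))))

    𝟙-× : {P Q : Set} (d : Dec P) (e : Dec Q) → 𝟙 (d ×-dec e) ≡ 𝟙 d * 𝟙 e
    𝟙-× (yes _) (yes _) = refl
    𝟙-× (yes _) (no _) = refl
    𝟙-× (no _) (yes _) = refl
    𝟙-× (no _) (no _) = refl

    ℓ≤lg : ∀ X {n} → 1 ℕ.≤ n → ℓ X n ≤ ι (lg n)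
    ℓ≤lg X {n} 1≤n = ≤-trans (≤-reflexive (∑-ext X (λ q → trans (solve 3 (λ c l d → c :* l :* d := c :* d :* l) refl (χ q) (ι (lg q)) (𝟙 (q ∣? n)))
        (cong (_* ι (lg q)) (sym (𝟙-× (𝒫? q) (q ∣? n))))))) (prime-log-sum (λ q → 𝒫? q ×-dec (q ∣? n)) n X (lg n) 1≤n (lg-upper n) (λ q _ ((pr , _) , d) → pr , d))

    S : ℕ → ℚ
    S j = ∑ (2 ℕ.^ j) (λ q → Λ q * inv q)

    -- Mertens' argument at x = 2^j: ∑ Λ q ⌊x/q⌋ equals ∑ ℓ n over n ≤ x, hence is at most x j, and
    -- replacing ⌊x/q⌋ by x/q costs ∑ Λ q ≤ 5 x.
    S-upper : ∀ j → S j ≤ ι j + ι 5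
    S-upper j = cancel-* (ι x) (0<ι′ (0<2^ j)) (linear (*-monoˡ (ι x) (0≤ι x) (∑-extend (ℕ.n≤1+n x) (λ q _ _ → *-nonneg (0≤Λ q) (0≤inv q))) ⊕ low ⊕ up ⊕ thet) (solve 6 (λ x s s' t j y → x :* (j :+ # 5) :- x :* s := x :* s' :+ (t :+ y) :+ x :* j :+ # 5 :* x :- (x :* s :+ x :* s' :+ y :+ t)) refl (ι x) (S j) (∑ (suc x) (λ q → Λ q * inv q)) (∑ (suc x) Λ) (ι j) (∑ (suc x) (λ q → Λ q * ι (x div q)))))
      where
      x = 2 ℕ.^ j
      up : ∑ (suc x) (λ q → Λ q * ι (x div q)) ≤ ι x * ι j
      up = ≤-trans (≤-reflexive (sym (∑-pos-ℓ x (suc x)))) (≤-trans (∑-mono (suc x) (λ n n≤x → pos-≤ n (λ 1≤n →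
        ≤-trans (ℓ≤lg (suc x) 1≤n) (ι-mono (lg-≤ (ℕ.≤-<-trans (ℕ.≤-pred n≤x) (ℕ.^-monoʳ-< 2 (s≤s (s≤s z≤n)) (ℕ.n<1+n j))))))))
        (≤-reflexive (trans (∑-*ʳ (suc x) (ι j) pos) (cong (_* ι j) (∑-pos x)))))
      low : ι x * ∑ (suc x) (λ q → Λ q * inv q) ≤ ∑ (suc x) Λ + ∑ (suc x) (λ q → Λ q * ι (x div q))
      low = ≤-trans (≤-reflexive (sym (∑-*ˡ (suc x) (ι x) _))) (≤-trans (∑-mono (suc x) (λ q _ → term q)) (≤-reflexive (∑-+ (suc x) Λ _)))
        where
        term : ∀ q → ι x * (Λ q * inv q) ≤ Λ q + Λ q * ι (x div q)
        term zero = ≤-trans (≤-reflexive (trans (cong (ι x *_) (*-zeroʳ (Λ 0))) (*-zeroʳ (ι x)))) (0≤Λ 0 ⊕ *-nonneg (0≤Λ 0) (0≤ι (x div 0)))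
        term q@(suc _) = linear (*-monoˡ (Λ q) (0≤Λ q) (ι-div-≥ x {q} (s≤s z≤n))) (solve 4 (λ x l v y → l :+ l :* y :- x :* (l :* v) := l :* (# 1 :+ y) :- l :* (x :* v)) refl (ι x) (Λ q) (inv q) (ι (x div q)))
      thet : ∑ (suc x) Λ ≤ ι 5 * ι x
      thet = linear (∑-mono x (λ q _ → Λ≤Λ′ q) ⊕ θ-bound j ⊕ Λ≤Λ′ x ⊕ Λ′≤lg x ⊕ ι-mono (ℕ.<⇒≤ (lg<n (0<2^ j)))) (solve 6 (λ s s' l l' x k → # 5 :* x :- (s :+ l) := s' :+ # 4 :* x :+ l' :+ k :+ x :- (s :+ s' :+ l :+ l' :+ k)) refl (∑ x Λ) (∑ x Λ′) (Λ x) (Λ′ x) (ι x) (ι (lg x)))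

  -- Mertens' estimate from below and the mean deficit of `ℓ`.

  module LogSum where

    open Mertens
    open import Data.Nat.Primality.Factorisation using (factorise)
    open import Data.List using ([]; _∷_)
    open import Data.Nat.ListAction using (product)
    open import Data.List.Relation.Unary.All using (All; []; _∷_)

    -- Integer parts add up only to within 1. This unit is paid once for every prime factor and is
    -- why sums of 1/q, hence log log, enter the error terms.
    lg-* : ∀ {a b} → 1 ℕ.≤ a → 1 ℕ.≤ b → lg (a ℕ.* b) ℕ.≤ suc (lg a) ℕ.+ lg b
    lg-* {a} {b} 1≤a 1≤b = lg-≤ (subst (a ℕ.* b ℕ.<_) (trans (sym (ℕ.^-distribˡ-+-* 2 (suc (lg a)) (suc (lg b)))) (cong (2 ℕ.^_) (ℕ.+-suc (suc (lg a)) (lg b))))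
      (ℕ.<-≤-trans (ℕ.*-monoˡ-< b {{ℕ.>-nonZero 1≤b}} (lg-upper a)) (ℕ.*-monoʳ-≤ (2 ℕ.^ suc (lg a)) (ℕ.<⇒≤ (lg-upper b)))))

    private
      c : ℕ → ℚ
      c q = π q * (ι (lg q) + 1ℚ)

      0≤c : ∀ q → 0ℚ ≤ c q
      0≤c q = *-nonneg (0≤π q) (0≤ι (lg q) ⊕ 0≤ι 1)

      -- For n < X and prime q this is the exponent of q in n. Written as a count of prime powers,
      -- it allows the summation over n to be done first.
      V : ℕ → ℕ → ℕ → ℚ
      V X q n = ∑ X (λ i → 𝟙 (q ℕ.^ suc i ∣? n))

      G : ℕ → ℕ → ℚ
      G X n = ∑ X (λ q → c q * V X q n)

    valuation-step : ∀ X q m → 2 ℕ.≤ q → 1 ℕ.≤ m → m ℕ.< X → V X q m + 1ℚ ≤ V X q (q ℕ.* m)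
    valuation-step X@(suc X′) q m 2≤q 1≤m m<X = linear (≤-reflexive (refl {x = V X q m}) ⊕ ≤-reflexive (𝟙-no (q ℕ.^ suc X′ ∣? m) big) ⊕ ∑-mono X′ (λ i _ → 𝟙-mono (q ℕ.^ suc i ∣? m) (q ℕ.^ suc (suc i) ∣? (q ℕ.* m)) (*-monoʳ-∣ q)) ⊕ ≤-reflexive (sym (∑-head X′ (λ i → 𝟙 (q ℕ.^ suc i ∣? (q ℕ.* m))))) ⊕ ≤-reflexive (sym (𝟙-yes (q ℕ.^ 1 ∣? (q ℕ.* m)) (*-monoʳ-∣ q (1∣ m))))) (solve 6 (λ a b c d e f → f :- (a :+ # 1) := b :+ c :+ # 0 :+ d :+ f :+ e :- (a :+ c :+ b :+ (e :+ d) :+ # 1)) refl (V X q m) (∑ X′ (λ i → 𝟙 (q ℕ.^ suc i ∣? m))) (𝟙 (q ℕ.^ suc X′ ∣? m)) (∑ X′ (λ i → 𝟙 (q ℕ.^ suc (suc i) ∣? (q ℕ.* m)))) (𝟙 (q ℕ.^ 1 ∣? (q ℕ.* m))) (V X q (q ℕ.* m)))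
      where
      big : ¬ q ℕ.^ suc X′ ∣ m
      big d = contradiction (∣⇒≤ {{ℕ.>-nonZero 1≤m}} d) (ℕ.<⇒≱ (ℕ.<-trans m<X (ℕ.<-≤-trans (n<2^n X) (ℕ.^-monoˡ-≤ X 2≤q))))

    -- Induction along the factorisation: splitting off a prime q lowers `lg` by at most lg q + 1,
    -- while the exponent of q drops by at least one.
    lg≤G : ∀ X n → 1 ℕ.≤ n → n ℕ.< X → ι (lg n) ≤ G X n
    lg≤G X n 1≤n n<X with factorise n {{ℕ.>-nonZero 1≤n}}
    ... | record { factors = fs ; isFactorisation = eq ; factorsPrime = pfs } = subst (λ k → ι (lg k) ≤ G X k) (sym eq) (go fs pfs (subst (ℕ._< X) eq n<X))
      where
      1≤product : ∀ {fs} → All Prime fs → 1 ℕ.≤ product fs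
      1≤product [] = s≤s z≤n
      1≤product (pr ∷ pfs) = ℕ.*-mono-≤ (ℕ.≤-trans (s≤s z≤n) (prime≥2 pr)) (1≤product pfs)
      go : ∀ fs → All Prime fs → product fs ℕ.< X → ι (lg (product fs)) ≤ G X (product fs)
      go [] [] _ = ∑-nonneg X (λ q _ → *-nonneg (0≤c q) (∑-nonneg X (λ i _ → 0≤𝟙 (q ℕ.^ suc i ∣? 1))))
      go (q ∷ fs) (pr ∷ pfs) n<X = linear (ι-mono (lg-* (ℕ.≤-trans (s≤s z≤n) 2≤q) 1≤m) ⊕ ≤-reflexive (ι-+ (suc (lg q)) (lg m)) ⊕ ≤-reflexive (ι-suc (lg q)) ⊕ go fs pfs m<X ⊕ gain) (solve 7 (λ a b d e e' g g' → g' :- a := e :+ (e' :+ d) :+ (# 1 :+ b) :+ g :+ g' :- (a :+ e :+ e' :+ d :+ (g :+ (b :+ # 1)))) refl (ι (lg (q ℕ.* m))) (ι (lg q)) (ι (lg m)) (ι (suc (lg q) ℕ.+ lg m)) (ι (suc (lg q))) (G X m) (G X (q ℕ.* m)))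
        where
        m = product fs
        1≤m = 1≤product pfs
        2≤q = prime≥2 pr
        q<X : q ℕ.< X
        q<X = ℕ.≤-<-trans (∣⇒≤ {{ℕ.>-nonZero (ℕ.*-mono-≤ (ℕ.≤-trans (s≤s z≤n) 2≤q) 1≤m)}} (m∣m*n m)) n<X
        m<X : m ℕ.< X
        m<X = ℕ.≤-<-trans (∣⇒≤ {{ℕ.>-nonZero (ℕ.*-mono-≤ (ℕ.≤-trans (s≤s z≤n) 2≤q) 1≤m)}} (n∣m*n q)) n<X
        term : ∀ r → c r * V X r m + 𝟙 (r ℕ.≟ q) * (ι (lg q) + 1ℚ) ≤ c r * V X r (q ℕ.* m)
        term r with r ℕ.≟ q
        ... | yes refl = linear (*-monoˡ (c q) (0≤c q) (valuation-step X q m 2≤q 1≤m m<X) ⊕ ≤-reflexive (sym (cong (_* (ι (lg q) + 1ℚ)) (𝟙-yes (prime? q) pr)))) (solve 4 (λ p l v w → p :* (l :+ # 1) :* w :- (p :* (l :+ # 1) :* v :+ # 1 :* (l :+ # 1)) := p :* (l :+ # 1) :* w :+ p :* (l :+ # 1) :- (p :* (l :+ # 1) :* (v :+ # 1) :+ # 1 :* (l :+ # 1))) refl (π q) (ι (lg q)) (V X q m) (V X q (q ℕ.* m)))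
        ... | no _ = linear (*-monoˡ (c r) (0≤c r) (∑-mono X (λ i _ → 𝟙-mono (r ℕ.^ suc i ∣? m) (r ℕ.^ suc i ∣? (q ℕ.* m)) (∣n⇒∣m*n q)))) (solve 5 (λ p l k v w → p :* (l :+ # 1) :* w :- (p :* (l :+ # 1) :* v :+ # 0 :* (k :+ # 1)) := p :* (l :+ # 1) :* w :- p :* (l :+ # 1) :* v) refl (π r) (ι (lg r)) (ι (lg q)) (V X r m) (V X r (q ℕ.* m)))
        gain : G X m + (ι (lg q) + 1ℚ) ≤ G X (q ℕ.* m)
        gain = ≤-trans (≤-reflexive (sym (trans (∑-+ X (λ r → c r * V X r m) (λ r → 𝟙 (r ℕ.≟ q) * (ι (lg q) + 1ℚ))) (cong (_+_ (G X m))
          (trans (∑-single X q q<X (λ r _ r≢q → trans (cong (_* (ι (lg q) + 1ℚ)) (𝟙-no (r ℕ.≟ q) r≢q)) (*-zeroˡ (ι (lg q) + 1ℚ))))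
            (trans (cong (_* (ι (lg q) + 1ℚ)) (𝟙-yes (q ℕ.≟ q) refl)) (*-identityˡ (ι (lg q) + 1ℚ)))))))) (∑-mono X (λ r _ → term r))

    geometric : ∀ q I → 2 ℕ.≤ q → ∑ I (λ i → inv (q ℕ.^ suc i)) ≤ inv q + ι 2 * (inv q * inv q)
    geometric q zero 2≤q = linear (0≤inv q ⊕ 2 ⊛ sq≥0 (inv q)) (solve 2 (λ a s → a :+ # 2 :* s :- # 0 := a :+ # 2 :* s :- (# 0 :+ # 2 :* # 0)) refl (inv q) (inv q * inv q))
    geometric q (suc I) 2≤q = linear (≤-reflexive (∑-head I (λ i → inv (q ℕ.^ suc i))) ⊕ ≤-reflexive (cong inv (ℕ.*-identityʳ q)) ⊕ ≤-reflexive (trans (∑-ext I (λ i → inv-* q (q ℕ.^ suc i))) (∑-*ˡ I (inv q) _)) ⊕ *-monoˡ (inv q) (0≤inv q) (≤2r I)) (solve 5 (λ r s s' t u → r :+ # 2 :* (r :* r) :- s' := u :+ t :+ r :+ r :* s :+ r :* (# 2 :* r) :- (s' :+ u :+ t :+ r :* s)) refl (inv q) (∑ I (λ i → inv (q ℕ.^ suc i))) (∑ (suc I) (λ i → inv (q ℕ.^ suc i))) (∑ I (λ i → inv (q ℕ.^ suc (suc i)))) (inv (q ℕ.^ 1)))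
      where
      half : ι 2 * inv q ≤ 1ℚ
      half = *-monoˡ (ι 2) (0≤ι 2) (inv-anti (s≤s z≤n) 2≤q)
      ≤2r : ∀ I → ∑ I (λ i → inv (q ℕ.^ suc i)) ≤ ι 2 * inv q
      ≤2r I = linear (geometric q I 2≤q ⊕ *-monoˡ (inv q) (0≤inv q) half) (solve 2 (λ s r → # 2 :* r :- s := r :+ # 2 :* (r :* r) :+ r :* # 1 :- (s :+ r :* (# 2 :* r))) refl (∑ I (λ i → inv (q ℕ.^ suc i))) (inv q))

    -- Summed over n ≤ x, the exponent of q is at most x (1/q + 2/q²) by the geometric series.
    -- Multiplied by lg q + 1, this is at most x (lg q / q + 3/q), because (lg q + 1)/q ≤ 1.
    ∑-lg : ∀ x → ∑ (suc x) (λ n → pos n * ι (lg n)) ≤ ι x * (∑ (suc x) (λ q → Λ′ q * inv q) + ι 3 * ∑ (suc x) (λ q → π q * inv q))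
    ∑-lg x = ≤-trans (∑-mono X (λ n n<X → pos-≤ n (λ 1≤n → lg≤G X n 1≤n n<X))) (≤-trans (≤-reflexive swap) (≤-trans (∑-mono X (λ q _ → term q))
      (≤-reflexive (trans (∑-*ˡ X (ι x) _) (cong (ι x *_) (trans (∑-+ X (λ q → Λ′ q * inv q) (λ q → ι 3 * (π q * inv q))) (cong (_+_ (∑ X (λ q → Λ′ q * inv q))) (∑-*ˡ X (ι 3) _))))))))
      where
      X = suc x
      swap : ∑ X (λ n → pos n * G X n) ≡ ∑ X (λ q → c q * ∑ X (λ i → ∑ X (λ n → 𝟙 (q ℕ.^ suc i ∣? n) * pos n)))
      swap = trans (∑-ext X (λ n → sym (∑-*ˡ X (pos n) _))) (trans (∑-swap X X _) (∑-ext X (λ q →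
        trans (∑-ext X (λ n → (solve 3 (λ p c v → p :* (c :* v) := c :* (v :* p)) refl (pos n) (c q) (V X q n)))) (trans (∑-*ˡ X (c q) _)
          (cong (c q *_) (trans (∑-ext X (λ n → sym (∑-*ʳ X (pos n) _))) (∑-swap X X _)))))))
      term : ∀ q → c q * ∑ X (λ i → ∑ X (λ n → 𝟙 (q ℕ.^ suc i ∣? n) * pos n)) ≤ ι x * (Λ′ q * inv q + ι 3 * (π q * inv q))
      term q with prime? q
      ... | no _ = ≤-reflexive (solve 4 (λ l s x r → # 0 :* (l :+ # 1) :* s := x :* (# 0 :* l :* r :+ # 3 :* (# 0 :* r))) refl (ι (lg q)) (∑ X (λ i → ∑ X (λ n → 𝟙 (q ℕ.^ suc i ∣? n) * pos n))) (ι x) (inv q))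
      ... | yes pr = linear (*-monoˡ (ι (lg q) + 1ℚ) (0≤ι (lg q) ⊕ 0≤ι 1) sum ⊕ 2 ⊛ *-monoˡ (ι x * inv q) (*-nonneg (0≤ι x) (0≤inv q)) lr) (solve 4 (λ l s x r → x :* (# 1 :* l :* r :+ # 3 :* (# 1 :* r)) :- # 1 :* (l :+ # 1) :* s := (l :+ # 1) :* (x :* (r :+ # 2 :* (r :* r))) :+ # 2 :* (x :* r :* # 1) :- ((l :+ # 1) :* s :+ # 2 :* (x :* r :* ((l :+ # 1) :* r)))) refl (ι (lg q)) (∑ X (λ i → ∑ X (λ n → 𝟙 (q ℕ.^ suc i ∣? n) * pos n))) (ι x) (inv q))
        where
        1≤q = ℕ.≤-trans (s≤s z≤n) (prime≥2 pr)
        lr : (ι (lg q) + 1ℚ) * inv q ≤ 1ℚ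
        lr = ≤-trans (*-monoʳ (inv q) (0≤inv q) (≤-trans (≤-reflexive (trans (+-comm (ι (lg q)) 1ℚ) (sym (ι-suc (lg q))))) (ι-mono (lg<n 1≤q)))) (ι*inv≤1 q)
        sum : ∑ X (λ i → ∑ X (λ n → 𝟙 (q ℕ.^ suc i ∣? n) * pos n)) ≤ ι x * (inv q + ι 2 * (inv q * inv q))
        sum = ≤-trans (∑-mono X (λ i _ → ≤-trans (≤-reflexive (count-multiples x (ℕ.m^n>0 q {{ℕ.>-nonZero 1≤q}} (suc i)))) (ι-div-≤ x (q ℕ.^ suc i))))
          (≤-trans (≤-reflexive (∑-*ˡ X (ι x) _)) (*-monoˡ (ι x) (0≤ι x) (geometric q X (prime≥2 pr))))

    ∑-𝟙-≤ : ∀ X m → ∑ X (λ q → 𝟙 (q ℕ.≤? m)) ≤ ι (suc m)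
    ∑-𝟙-≤ X m = ≤-trans (∑-extend (ℕ.m≤n+m X (suc m)) (λ q _ _ → 0≤𝟙 (q ℕ.≤? m))) (≤-trans (≤-reflexive (∑-split (suc m) X _))
      (≤-trans (∑-upper (suc m) 1ℚ (λ q _ → 𝟙≤1 (q ℕ.≤? m)) ⊕ ≤-reflexive (∑-zero X (λ q _ → 𝟙-no (suc m ℕ.+ q ℕ.≤? m) (ℕ.<⇒≱ (s≤s (ℕ.m≤m+n m q))))))
        (≤-reflexive (solve 1 (λ m → m :* # 1 :+ # 0 := m) refl (ι (suc m))))))

    -- Passing from u to u + 1 adds 1 to each of the 2^(u+1) old terms, and the terms of the new
    -- dyadic block vanish.
    lg-deficit : ∀ u → ∑ (2 ℕ.^ suc u) (λ n → ι u - ι (lg n)) + 0ℚ ≤ ι 2 * ι (2 ℕ.^ u)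
    lg-deficit zero = 0≤ι 2
    lg-deficit (suc u) = linear (≤-reflexive (trans (cong (λ k → ∑ k (λ n → ι (suc u) - ι (lg n))) (cong (T ℕ.+_) (ℕ.+-identityʳ T))) (∑-split T T (λ n → ι (suc u) - ι (lg n)))) ⊕ ≤-reflexive (∑-zero T (λ r r<T → trans (cong (λ k → ι (suc u) - ι k) (lg-block (suc u) r<T)) (+-inverseʳ (ι (suc u))))) ⊕ ≤-reflexive (trans (∑-ext T (λ n → trans (cong (_- ι (lg n)) (ι-suc u)) (solve 2 (λ u l → # 1 :+ u :- l := u :- l :+ # 1) refl (ι u) (ι (lg n))))) (trans (∑-+ T _ (λ _ → 1ℚ)) (cong (_+_ (∑ T (λ n → ι u - ι (lg n)))) (trans (∑-const T 1ℚ) (*-identityʳ (ι T)))))) ⊕ lg-deficit u ⊕ ≤-reflexive (sym (ι2^ u))) (solve 6 (λ a b s d t t' → # 2 :* t :- (s :+ # 0) := a :+ b :+ # 0 :+ (d :+ t) :+ # 2 :* t' :+ t :- (s :+ b :+ a :+ (d :+ # 0) :+ # 2 :* t')) refl (∑ T (λ n → ι (suc u) - ι (lg n))) (∑ T (λ r → ι (suc u) - ι (lg (T ℕ.+ r)))) (∑ (2 ℕ.^ suc (suc u)) (λ n → ι (suc u) - ι (lg n))) (∑ T (λ n → ι u - ι (lg n))) (ι T) (ι (2 ℕ.^ u)))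
      where T = 2 ℕ.^ suc u

    -- Collects the losses of `deficit-bound`: 2 for lg n in place of lg x, 8 for rounding x/q, 1 +
    -- p for the primes up to p, and 3 · 4 h for the terms 3/q of `∑-lg`.
    e : ℕ → ℚ
    e j = ι (11 ℕ.+ p) + ι 12 * h (suc j)

    -- Every term is nonnegative, as ℓ n ≤ lg n ≤ lg x. A bound for this total therefore bounds all
    -- sums with coefficients of absolute value at most 1, in particular those weighted by `f`.
    deficit : ℕ → ℚ
    deficit x = ∑ (suc x) (λ n → pos n * (ι (lg x) - ℓ (suc x) n))

    deficit-≡ : ∀ x → deficit x ≡ ι x * ι (lg x) - ∑ (suc x) (λ q → Λ q * ι (x div q))
    deficit-≡ x = trans (∑-ext X (λ n → (solve 3 (λ p l m → p :* (l :- m) := p :* l :- p :* m) refl (pos n) (ι (lg x)) (ℓ X n)))) (trans (∑-- X (λ n → pos n * ι (lg x)) (λ n → pos n * ℓ X n))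
      (cong₂ _-_ (trans (∑-*ʳ X (ι (lg x)) pos) (cong (_* ι (lg x)) (∑-pos x))) (∑-pos-ℓ x X)))
      where X = suc x

    -- The sum of lg n over n ≤ x misses x lg x by at most 2 x, and `∑-lg` bounds it by sums over
    -- primes; so ∑ Λ q ⌊x/q⌋ cannot fall far below x lg x.
    deficit-bound : ∀ x → 1 ℕ.≤ x → deficit x ≤ ι x * e (lg x)
    deficit-bound x 1≤x = linear (≤-reflexive (deficit-≡ x) ⊕ ≤-reflexive (sym split) ⊕ ∑-lg x ⊕ low ⊕ thet ⊕ d≤ ⊕ *-monoˡ (ι x) (0≤ι x) small ⊕ 3 ⊛ *-monoˡ (ι x) (0≤ι x) r≤ ⊕ ≤-reflexive (sym (cong (ι x *_) (ι-+ 11 p)))) (solve 13 (λ D x l y L s r s' t d h p k → x :* (k :+ # 12 :* h) :- D := x :* l :- y :+ d :+ x :* (s :+ # 3 :* r) :+ (t :+ y) :+ # 8 :* x :+ # 2 :* x :+ x :* (s' :+ (# 1 :+ p)) :+ # 3 :* (x :* (# 4 :* h)) :+ x :* k :- (D :+ (x :* l :- L) :+ L :+ x :* s' :+ t :+ d :+ x :* s :+ # 3 :* (x :* r) :+ x :* (# 11 :+ p))) refl (deficit x) (ι x) (ι (lg x)) (∑ X (λ q → Λ q * ι (x div q))) (∑ X (λ n → pos n * ι (lg n))) (∑ X (λ q → Λ′ q * inv q)) (∑ X (λ q → π q * inv q)) (∑ X (λ q → Λ q * inv q)) (∑ X Λ) (∑ X (λ n → pos n * (ι (lg x) - ι (lg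 n)))) (h (suc (lg x))) (ι p) (ι (11 ℕ.+ p)))
      where
      X = suc x
      2^lg : ι (2 ℕ.^ lg x) ≤ ι x
      2^lg = ι-mono (lg-lower 1≤x)
      split : ∑ X (λ n → pos n * (ι (lg x) - ι (lg n))) ≡ ι x * ι (lg x) - ∑ X (λ n → pos n * ι (lg n))
      split = trans (∑-ext X (λ n → (solve 3 (λ p l m → p :* (l :- m) := p :* l :- p :* m) refl (pos n) (ι (lg x)) (ι (lg n))))) (trans (∑-- X (λ n → pos n * ι (lg x)) (λ n → pos n * ι (lg n)))
        (cong (_- ∑ X (λ n → pos n * ι (lg n))) (trans (∑-*ʳ X (ι (lg x)) pos) (cong (_* ι (lg x)) (∑-pos x)))))
      low : ι x * ∑ X (λ q → Λ q * inv q) ≤ ∑ X Λ + ∑ X (λ q → Λ q * ι (x div q))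
      low = ≤-trans (≤-reflexive (sym (∑-*ˡ X (ι x) _))) (≤-trans (∑-mono X (λ q _ → term q)) (≤-reflexive (∑-+ X Λ _)))
        where
        term : ∀ q → ι x * (Λ q * inv q) ≤ Λ q + Λ q * ι (x div q)
        term zero = ≤-trans (≤-reflexive (trans (cong (ι x *_) (*-zeroʳ (Λ 0))) (*-zeroʳ (ι x)))) (0≤Λ 0 ⊕ *-nonneg (0≤Λ 0) (0≤ι (x div 0)))
        term q@(suc _) = linear (*-monoˡ (Λ q) (0≤Λ q) (ι-div-≥ x {q} (s≤s z≤n))) (solve 4 (λ x l v y → l :+ l :* y :- x :* (l :* v) := l :* (# 1 :+ y) :- l :* (x :* v)) refl (ι x) (Λ q) (inv q) (ι (x div q)))
      thet : ∑ X Λ ≤ ι 8 * ι x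
      thet = linear (∑-mono X (λ q _ → Λ≤Λ′ q) ⊕ ∑-extend (lg-upper x) (λ q _ _ → 0≤Λ′ q) ⊕ θ-bound (suc (lg x)) ⊕ 4 ⊛ ≤-reflexive (ι2^ (lg x)) ⊕ 8 ⊛ 2^lg) (solve 6 (λ a b c t t' x → # 8 :* x :- a := b :+ c :+ # 4 :* t :+ # 4 :* (# 2 :* t') :+ # 8 :* x :- (a :+ b :+ c :+ # 4 :* t :+ # 8 :* t')) refl (∑ X Λ) (∑ X Λ′) (∑ (2 ℕ.^ suc (lg x)) Λ′) (ι (2 ℕ.^ suc (lg x))) (ι (2 ℕ.^ lg x)) (ι x))
      lg≥ : ∀ n → n ℕ.< 2 ℕ.^ suc (lg x) → 0ℚ ≤ ι (lg x) - ι (lg n)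
      lg≥ n n< = linear (ι-mono (lg-≤ n<)) (solve 2 (λ a b → b :- a :- # 0 := b :- a) refl (ι (lg n)) (ι (lg x)))
      d≤ : ∑ X (λ n → pos n * (ι (lg x) - ι (lg n))) ≤ ι 2 * ι x
      d≤ = linear (∑-mono X (λ n n<X → subst (pos n * (ι (lg x) - ι (lg n)) ≤_) (*-identityˡ (ι (lg x) - ι (lg n))) (*-monoʳ (ι (lg x) - ι (lg n)) (lg≥ n (ℕ.<-≤-trans n<X (lg-upper x))) (𝟙≤1 (1 ℕ.≤? n)))) ⊕ ∑-extend (lg-upper x) (λ n _ n< → lg≥ n n<) ⊕ lg-deficit (lg x) ⊕ 2 ⊛ 2^lg) (solve 5 (λ a b c t x → # 2 :* x :- a := b :+ c :+ # 2 :* t :+ # 2 :* x :- (a :+ b :+ (c :+ # 0) :+ # 2 :* t)) refl (∑ X (λ n → pos n * (ι (lg x) - ι (lg n)))) (∑ X (λ n → ι (lg x) - ι (lg n))) (∑ (2 ℕ.^ suc (lg x)) (λ n → ι (lg x) - ι (lg n))) (ι (2 ℕ.^ lg x)) (ι x))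
      r≤ : ∑ X (λ q → π q * inv q) ≤ ι 4 * h (suc (lg x))
      r≤ = ≤-trans (∑-extend (lg-upper x) (λ q _ _ → *-nonneg (0≤π q) (0≤inv q))) (R-bound (suc (lg x)))
      -- The primes up to p, absent from `Λ`, contribute at most 1 each, as lg q ≤ q.
      small : ∑ X (λ q → Λ′ q * inv q) ≤ ∑ X (λ q → Λ q * inv q) + (1ℚ + ι p)
      small = ≤-trans (∑-mono X (λ q _ → term q)) (≤-trans (≤-reflexive (∑-+ X (λ q → Λ q * inv q) (λ q → 𝟙 (q ℕ.≤? p)))) (+-monoʳ-≤ (∑ X (λ q → Λ q * inv q)) (≤-trans (∑-𝟙-≤ X p) (≤-reflexive (ι-suc p)))))
        where
        term : ∀ q → Λ′ q * inv q ≤ Λ q * inv q + 𝟙 (q ℕ.≤? p)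
        term q with q ℕ.≤? p
        ... | no q≰p = ≤-trans (≤-reflexive (cong (λ z → z * ι (lg q) * inv q) (𝟙-cong (prime? q) (𝒫? q) (λ pr → pr , ℕ.≰⇒> q≰p) proj₁))) (≤-reflexive (sym (+-identityʳ (Λ q * inv q))))
        ... | yes _ = linear (*-monoʳ (inv q) (0≤inv q) (Λ′≤lg q) ⊕ *-monoʳ (inv q) (0≤inv q) (ι-mono (lg≤ q)) ⊕ ι*inv≤1 q ⊕ *-nonneg (0≤Λ q) (0≤inv q)) (solve 4 (λ a b l m → b :+ # 1 :- a := l :+ m :+ # 1 :+ b :- (a :+ l :+ m :+ # 0)) refl (Λ′ q * inv q) (Λ q * inv q) (ι (lg q) * inv q) (ι q * inv q))
          where
          lg≤ : ∀ q → lg q ℕ.≤ q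
          lg≤ zero = z≤n
          lg≤ (suc q) = ℕ.<⇒≤ (lg<n (s≤s z≤n))

    -- The case x = 2^j of `deficit-bound`. The extra 1 pays for the index q = x, which lies outside
    -- `S j`.
    S-lower : ∀ j → ι j ≤ S j + (e j + 1ℚ)
    S-lower j = cancel-* (ι x) (0<ι′ (0<2^ j)) (linear (≤-reflexive (sym (deficit-≡ x)) ⊕ deficit-bound x (0<2^ j) ⊕ up ⊕ ≤-reflexive (sym (cong (λ i → ι x * ι i) lgx)) ⊕ ≤-reflexive (cong (λ i → ι x * e i) lgx) ⊕ ≤-reflexive refl ⊕ last ⊕ ≤-reflexive (trans (cong (Λ x *_) (ι*inv (0<2^ j))) (*-identityʳ (Λ x)))) (solve 11 (λ x j l s s' L v e e' D y → x :* (s :+ (e' :+ # 1)) :- x :* j := D :+ x :* e :+ x :* s' :+ x :* l :+ x :* e' :+ x :* (s :+ L :* v) :+ x :+ L :- (x :* l :- y :+ D :+ y :+ x :* j :+ x :* e :+ x :* s' :+ L :+ L :* (x :* v))) refl (ι x) (ι j) (ι (lg x)) (S j) (∑ (suc x) (λ q → Λ q * inv q)) (Λ x) (inv x) (e (lg x)) (e j) (deficit x) (∑ (suc x) (λ q → Λ q * ι (x div q)))))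
      where
      x = 2 ℕ.^ j
      lgx : lg x ≡ j
      lgx = lg-unique ℕ.≤-refl (ℕ.^-monoʳ-< 2 (s≤s (s≤s z≤n)) (ℕ.n<1+n j))
      last : Λ x ≤ ι x
      last = ≤-trans (Λ≤Λ′ x) (≤-trans (Λ′≤lg x) (ι-mono (ℕ.<⇒≤ (lg<n (0<2^ j)))))
      up : ∑ (suc x) (λ q → Λ q * ι (x div q)) ≤ ι x * ∑ (suc x) (λ q → Λ q * inv q)
      up = ≤-trans (∑-mono (suc x) (λ q _ → (linear (*-monoˡ (Λ q) (0≤Λ q) (ι-div-≤ x q)) (solve 4 (λ l x v y → x :* (l :* v) :- l :* y := l :* (x :* v) :- l :* y) refl (Λ q) (ι x) (inv q) (ι (x div q)))))) (≤-reflexive (∑-*ˡ (suc x) (ι x) _))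

  -- The Möbius function on integers without prime factors up to p.

  module Mobius where

    open import Defs using (primeDivisors; ω; hasSquarePrimeFactor)
    open Mertens
    open LogSum using (e; deficit; deficit-bound)
    open import Data.Nat.Coprimality as Coprimality using (Coprime; coprime-divisor)
    open import Data.List using (filter; length; upTo; applyUpTo)
    open import Data.List.Membership.Propositional.Properties using (∈-filter⁺; ∈-filter⁻; ∈-upTo⁺)
    open import Data.List.Membership.Propositional using (_∈_; lose; find)
    open import Data.List.Relation.Unary.Any.Properties using (any⁺; any⁻)
    open import Data.Bool using (true; false; T; if_then_else_)
    open import Relation.Nullary.Decidable using (does; ¬?)
    open import Relation.Unary using (Decidable)

    length-filter : {P : ℕ → Set} (P? : Decidable P) (g : ℕ → ℕ) (n : ℕ) → ι (length (filter P? (applyUpTo g n))) ≡ ∑ n (λ i → 𝟙 (P? (g i)))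
    length-filter P? g zero = refl
    length-filter P? g (suc n) with P? (g 0) in eq
    ... | yes _ = trans (ι-suc _) (trans (cong (1ℚ +_) (length-filter P? (g ∘ suc) n)) (sym (trans (∑-head n (λ i → 𝟙 (P? (g i)))) (cong (λ d → 𝟙 d + ∑ n (λ i → 𝟙 (P? (g (suc i))))) eq))))
    ... | no _ = trans (length-filter P? (g ∘ suc) n) (sym (trans (∑-head n (λ i → 𝟙 (P? (g i)))) (trans (cong (λ d → 𝟙 d + ∑ n (λ i → 𝟙 (P? (g (suc i))))) eq) (+-identityˡ _))))

    divisor? : ∀ n q → Dec (Prime q × q ∣ n)
    divisor? n q = prime? q ×-dec (q ∣? n)

    ω-sum : ∀ n X → 1 ℕ.≤ n → n ℕ.< X → ι (ω n) ≡ ∑ X (λ q → 𝟙 (divisor? n q))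
    ω-sum n X 1≤n n<X = trans (length-filter (divisor? n) (λ i → i) (suc n)) (∑-extend-≡ n<X (λ q n<q _ → 𝟙-no (divisor? n q) (λ (_ , q∣n) →
      contradiction (∣⇒≤ {{ℕ.>-nonZero 1≤n}} q∣n) (ℕ.<⇒≱ n<q))))

    ι-injective : ∀ {m n} → ι m ≡ ι n → m ≡ n
    ι-injective eq = ℕ.≤-antisym (ι-cancel (≤-reflexive eq)) (ι-cancel (≤-reflexive (sym eq)))

    ω-* : ∀ {q m} → Prime q → 1 ℕ.≤ m → ¬ q ∣ m → ω (q ℕ.* m) ≡ suc (ω m)
    ω-* {q} {m} pq 1≤m q∤m = ι-injective (trans (ω-sum (q ℕ.* m) X 1≤qm ℕ.≤-refl) (trans (∑-ext X term)
      (trans (∑-+ X (λ r → 𝟙 (divisor? m r)) (λ r → 𝟙 (r ℕ.≟ q))) (trans (cong₂ _+_ (sym (ω-sum m X 1≤m m<X)) one) (trans (+-comm (ι (ω m)) 1ℚ) (sym (ι-suc (ω m))))))))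
      where
      X = suc (q ℕ.* m)
      1≤q = ℕ.≤-trans (s≤s z≤n) (prime≥2 pq)
      1≤qm : 1 ℕ.≤ q ℕ.* m
      1≤qm = ℕ.*-mono-≤ 1≤q 1≤m
      m<X : m ℕ.< X
      m<X = s≤s (ℕ.≤-trans (ℕ.≤-reflexive (sym (ℕ.*-identityˡ m))) (ℕ.*-monoˡ-≤ m 1≤q))
      q<X : q ℕ.< X
      q<X = s≤s (ℕ.≤-trans (ℕ.≤-reflexive (sym (ℕ.*-identityʳ q))) (ℕ.*-monoʳ-≤ q 1≤m))
      one : ∑ X (λ r → 𝟙 (r ℕ.≟ q)) ≡ 1ℚ
      one = trans (∑-single X q q<X (λ r _ r≢q → 𝟙-no (r ℕ.≟ q) r≢q)) (𝟙-yes (q ℕ.≟ q) refl)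
      term : ∀ r → 𝟙 (divisor? (q ℕ.* m) r) ≡ 𝟙 (divisor? m r) + 𝟙 (r ℕ.≟ q)
      term r with r ℕ.≟ q
      ... | yes refl = trans (𝟙-yes (divisor? (q ℕ.* m) q) (pq , m∣m*n m)) (cong (_+ 1ℚ) (sym (𝟙-no (divisor? m q) (q∤m ∘ proj₂))))
      ... | no r≢q = trans (𝟙-cong (divisor? (q ℕ.* m) r) (divisor? m r) f (λ (pr , d) → pr , ∣n⇒∣m*n q d)) (sym (+-identityʳ (𝟙 (divisor? m r))))
        where
        f : Prime r × r ∣ q ℕ.* m → Prime r × r ∣ m
        f (pr , d) with euclidsLemma q m pr d
        ... | inj₁ r∣q = contradiction (prime∣prime pr pq r∣q) r≢q
        ... | inj₂ r∣m = pr , r∣m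

    does⁺ : {P : Set} (d : Dec P) → P → T (does d)
    does⁺ (yes _) _ = _
    does⁺ (no ¬p) p = contradiction p ¬p

    does⁻ : {P : Set} (d : Dec P) → T (does d) → P
    does⁻ (yes p) _ = p

    HasSquare : ℕ → Set
    HasSquare n = ∃ λ r → Prime r × r ℕ.* r ∣ n

    hasSquare⁺ : ∀ {n} → 1 ℕ.≤ n → HasSquare n → hasSquarePrimeFactor n ≡ true
    hasSquare⁺ {n} 1≤n (r , pr , d) = T⇒≡ (any⁺ (λ q → does (q ℕ.* q ∣? n)) (lose (∈-filter⁺ (divisor? n) (∈-upTo⁺ (s≤s (∣⇒≤ {{ℕ.>-nonZero 1≤n}} r∣n))) (pr , r∣n)) (does⁺ (r ℕ.* r ∣? n) d)))
      where
      r∣n : r ∣ n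
      r∣n = ∣-trans (m∣m*n r) d
      T⇒≡ : ∀ {b} → T b → b ≡ true
      T⇒≡ {true} _ = refl

    hasSquare⁻ : ∀ {n} → ¬ HasSquare n → hasSquarePrimeFactor n ≡ false
    hasSquare⁻ {n} ¬sq with hasSquarePrimeFactor n in eq
    ... | false = refl
    ... | true with find (any⁻ (λ q → does (q ℕ.* q ∣? n)) (primeDivisors n) (subst T (sym eq) _))
    ... | r , r∈ , t = contradiction (r , proj₁ (proj₂ (∈-filter⁻ (divisor? n) {xs = upTo (suc n)} r∈)) , does⁻ (r ℕ.* r ∣? n) t) ¬sq

    hasSquare-* : ∀ {q m} → Prime q → 1 ℕ.≤ m → ¬ q ∣ m → hasSquarePrimeFactor (q ℕ.* m) ≡ hasSquarePrimeFactor m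
    hasSquare-* {q} {m} pq 1≤m q∤m with hasSquarePrimeFactor m in eq
    ... | true = hasSquare⁺ (ℕ.*-mono-≤ (ℕ.≤-trans (s≤s z≤n) (prime≥2 pq)) 1≤m) (lift (find (any⁻ (λ q → does (q ℕ.* q ∣? m)) (primeDivisors m) (subst T (sym eq) _))))
      where
      lift : (∃ λ r → r ∈ primeDivisors m × T (does (r ℕ.* r ∣? m))) → HasSquare (q ℕ.* m)
      lift (r , r∈ , t) = r , proj₁ (proj₂ (∈-filter⁻ (divisor? m) {xs = upTo (suc m)} r∈)) , ∣n⇒∣m*n q (does⁻ (r ℕ.* r ∣? m) t)
    ... | false = hasSquare⁻ no-square
      where
      true≢false : ∀ {b} → b ≡ true → b ≡ false → true ≡ false
      true≢false refl e = e
      no-square : ¬ HasSquare (q ℕ.* m)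
      no-square (r , pr , d) with r ℕ.≟ q
      ... | yes refl = q∤m (*-cancelˡ-∣ q {{ℕ.>-nonZero (ℕ.≤-trans (s≤s z≤n) (prime≥2 pq))}} d)
      ... | no r≢q = contradiction (true≢false (hasSquare⁺ 1≤m (r , pr , coprime-divisor cop d)) eq) λ ()
        where
        cop : Coprime (r ℕ.* r) q
        cop {d} (d∣rr , d∣q) with prime⇒irreducible pq d∣q
        ... | inj₁ d≡1 = d≡1
        ... | inj₂ refl with euclidsLemma r r pq d∣rr
        ... | inj₁ e = contradiction (sym (prime∣prime pq pr e)) r≢q
        ... | inj₂ e = contradiction (sym (prime∣prime pq pr e)) r≢q

    -- In contrast to the recursion by two of `negOnePow`, one more prime factor changes the sign by
    -- definition.
    sgn : ℕ → ℚ
    sgn zero = 1ℚ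
    sgn (suc n) = - sgn n

    μ′ : ℕ → ℚ
    μ′ n = if hasSquarePrimeFactor n then 0ℚ else sgn (ω n)

    μ′-* : ∀ {q m} → Prime q → 1 ℕ.≤ m → ¬ q ∣ m → μ′ (q ℕ.* m) ≡ - μ′ m
    μ′-* {q} {m} pq 1≤m q∤m = trans (cong₂ (λ b k → if b then 0ℚ else sgn k) (hasSquare-* pq 1≤m q∤m) (ω-* pq 1≤m q∤m)) (lem (hasSquarePrimeFactor m))
      where
      lem : ∀ b → (if b then 0ℚ else - sgn (ω m)) ≡ - (if b then 0ℚ else sgn (ω m))
      lem true = refl
      lem false = refl

    μ′-0 : ∀ {q m} → Prime q → 1 ℕ.≤ m → q ∣ m → μ′ (q ℕ.* m) ≡ 0ℚ
    μ′-0 {q} {m} pq 1≤m q∣m = cong (λ b → if b then 0ℚ else sgn (ω (q ℕ.* m))) (hasSquare⁺ (ℕ.*-mono-≤ (ℕ.≤-trans (s≤s z≤n) (prime≥2 pq)) 1≤m) (q , pq , *-monoʳ-∣ q q∣m))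

    Rough : ℕ → Set
    Rough n = ∀ {q} → q ℕ.< suc p → ¬ (Prime q × q ∣ n)

    rough? : Decidable Rough
    rough? n = ℕ.allUpTo? (λ q → ¬? (divisor? n q)) (suc p)

    -- The Möbius function on the integers whose prime factors all exceed p.
    f : ℕ → ℚ
    f n = 𝟙 (rough? n) * μ′ n

    f0 : f 0 ≡ 0ℚ
    f0 = trans (cong (_* μ′ 0) (𝟙-no (rough? 0) (λ r → r {p} ℕ.≤-refl (pp , p ∣0)))) (*-zeroˡ (μ′ 0))

    f1 : f 1 ≡ 1ℚ
    f1 = trans (cong (_* μ′ 1) (𝟙-yes (rough? 1) (λ { _ (pr , d) → prime∤1 pr d }))) refl

    f-* : ∀ {q m} → Prime q → p ℕ.< q → 1 ℕ.≤ m → ¬ q ∣ m → f (q ℕ.* m) ≡ - f m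
    f-* {q} {m} pq p<q 1≤m q∤m = trans (cong₂ _*_ (𝟙-cong (rough? (q ℕ.* m)) (rough? m) (λ r r< (pr , d) → r r< (pr , ∣n⇒∣m*n q d)) back) (μ′-* pq 1≤m q∤m))
      (solve 2 (λ a b → a :* (:- b) := (:- (a :* b))) refl (𝟙 (rough? m)) (μ′ m))
      where
      back : Rough m → Rough (q ℕ.* m)
      back r {s} s< (ps , d) with euclidsLemma q m ps d
      ... | inj₁ s∣q = contradiction (subst (ℕ._< suc p) (prime∣prime ps pq s∣q) s<) (ℕ.<⇒≱ (s≤s p<q))
      ... | inj₂ s∣m = r s< (ps , s∣m)

    f-0 : ∀ {q m} → Prime q → 1 ℕ.≤ m → q ∣ m → f (q ℕ.* m) ≡ 0ℚ
    f-0 {q} {m} pq 1≤m q∣m = trans (cong (𝟙 (rough? (q ℕ.* m)) *_) (μ′-0 pq 1≤m q∣m)) (*-zeroʳ (𝟙 (rough? (q ℕ.* m))))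

    ∣f∣≤1 : ∀ n → ∣ f n ∣ ≤ 1ℚ
    ∣f∣≤1 n = ≤-trans (≤-reflexive (∣p*q∣≡∣p∣*∣q∣ (𝟙 (rough? n)) (μ′ n))) (≤-trans (*-mono (0≤∣p∣ (𝟙 (rough? n))) (0≤ι 1) (ab (rough? n)) ∣μ∣) (≤-reflexive (*-identityˡ 1ℚ)))
      where
      ab : {P : Set} (d : Dec P) → ∣ 𝟙 d ∣ ≤ 1ℚ
      ab (yes _) = ≤-refl
      ab (no _) = 0≤ι 1
      ∣sgn∣ : ∀ k → ∣ sgn k ∣ ≡ 1ℚ
      ∣sgn∣ zero = refl
      ∣sgn∣ (suc k) = trans (∣-p∣≡∣p∣ (sgn k)) (∣sgn∣ k)
      ∣μ∣ : ∣ μ′ n ∣ ≤ 1ℚ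
      ∣μ∣ with hasSquarePrimeFactor n
      ... | true = 0≤ι 1
      ... | false = ≤-reflexive (∣sgn∣ (ω n))

    ∣f∣≤pos : ∀ n → ∣ f n ∣ ≤ pos n
    ∣f∣≤pos zero = ≤-reflexive (cong ∣_∣ f0)
    ∣f∣≤pos (suc n) = ∣f∣≤1 (suc n)

    F : ℕ → ℚ
    F x = ∑ (suc x) f

    F0 : F 0 ≡ 0ℚ
    F0 = trans (+-identityˡ (f 0)) f0

    ∑-F-diff : ∀ d y → ∣ F (y ℕ.+ d) - F y ∣ ≤ ι d
    ∑-F-diff d y = ≤-trans (≤-reflexive (cong ∣_∣ (trans (cong (_- F y) (∑-split (suc y) d f)) (solve 2 (λ a b → a :+ b :- a := b) refl (F y) (∑ d (λ i → f (suc y ℕ.+ i)))))))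
      (≤-trans (∣∑∣≤ d _) (≤-trans (∑-upper d 1ℚ (λ i _ → ∣f∣≤1 (suc y ℕ.+ i))) (≤-reflexive (*-identityʳ (ι d)))))

    F-lipschitz : ∀ {x y} → y ℕ.≤ x → ∣ F x - F y ∣ ≤ ι x - ι y
    F-lipschitz {x} {y} y≤x = subst (λ z → ∣ F z - F y ∣ ≤ ι z - ι y) (ℕ.m+[n∸m]≡n y≤x) (≤-trans (∑-F-diff (x ℕ.∸ y) y)
      (≤-reflexive (trans (solve 2 (λ y d → d := y :+ d :- y) refl (ι y) (ι (x ℕ.∸ y))) (cong (_- ι y) (sym (ι-+ y (x ℕ.∸ y)))))))

    ∣F∣≤ : ∀ x → ∣ F x ∣ ≤ ι x
    ∣F∣≤ x = subst₂ _≤_ (cong ∣_∣ (trans (cong (_-_ (F x)) F0) (+-identityʳ (F x)))) (+-identityʳ (ι x)) (F-lipschitz {x} {0} z≤n)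

    Λ-only : ∀ q {a b} → (Prime q → p ℕ.< q → a ≡ b) → Λ q * a ≡ Λ q * b
    Λ-only q {a} {b} h with 𝒫? q
    ... | yes (pq , p<q) = cong (1ℚ * ι (lg q) *_) (h pq p<q)
    ... | no _ = solve 3 (λ a b l → # 0 :* l :* a := # 0 :* l :* b) refl a b (ι (lg q))

    -- Both cases of multiplicativity in one formula, valid at m = 0 as well, so that it can be
    -- summed without case distinction.
    f-*′ : ∀ {q} m → Prime q → p ℕ.< q → f (q ℕ.* m) ≡ 𝟙 (q ∣? m) * f m - f m
    f-*′ {q} zero pq p<q = trans (cong f (ℕ.*-zeroʳ q)) (trans f0 (sym (trans (cong (λ z → 𝟙 (q ∣? 0) * z - z) f0) (solve 1 (λ a → a :* # 0 :- # 0 := # 0) refl (𝟙 (q ∣? 0))))))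
    f-*′ {q} m@(suc _) pq p<q with q ∣? m
    ... | yes d = trans (f-0 pq (s≤s z≤n) d) (solve 1 (λ a → # 0 := # 1 :* a :- a) refl (f m))
    ... | no d = trans (f-* pq p<q (s≤s z≤n) d) (solve 1 (λ a → (:- a) := # 0 :* a :- a) refl (f m))

    Fq : ℕ → ℕ → ℚ
    Fq q v = ∑ (suc v) (λ m → 𝟙 (q ∣? m) * f m)

    ∑-f-* : ∀ q v → Prime q → p ℕ.< q → ∑ (suc v) (λ m → f (q ℕ.* m)) ≡ Fq q v - F v
    ∑-f-* q v pq p<q = trans (∑-ext (suc v) (λ n → f-*′ n pq p<q)) (∑-- (suc v) _ f)

    ∣Fq∣≤ : ∀ q v → 1 ℕ.≤ q → ∣ Fq q v ∣ ≤ ι (v div q)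
    ∣Fq∣≤ q v 1≤q = ≤-trans (∣∑∣≤ (suc v) _) (≤-trans (∑-mono (suc v) (λ m _ → ≤-trans (≤-reflexive (trans (∣p*q∣≡∣p∣*∣q∣ (𝟙 (q ∣? m)) (f m)) (cong (_* ∣ f m ∣) (0≤p⇒∣p∣≡p (0≤𝟙 (q ∣? m))))))
      (*-monoˡ (𝟙 (q ∣? m)) (0≤𝟙 (q ∣? m)) (∣f∣≤pos m)))) (≤-reflexive (count-multiples v 1≤q)))

    -- The error of `main-identity`: `e` and 1, increased by 4 h for the n divisible by q². Its
    -- argument will be lg x, so that it is of order log log x.
    E : ℕ → ℚ
    E j = ι (12 ℕ.+ p) + ι 16 * h (suc j)

    0≤h : ∀ j → 0ℚ ≤ h j
    0≤h j = ∑-nonneg j (λ i _ → 0≤inv i)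

    E-mono : ∀ {i j} → i ℕ.≤ j → E i ≤ E j
    E-mono i≤j = +-monoʳ-≤ (ι (12 ℕ.+ p)) (16 ⊛ h-mono (s≤s i≤j))

    E≡ : ∀ j → E j ≡ (e j + 1ℚ) + ι 4 * h (suc j)
    E≡ j = linear-≡ (ι-suc (11 ℕ.+ p)) (solve 3 (λ a b h → b :+ # 12 :* h :+ # 1 :+ # 4 :* h :- (a :+ # 16 :* h) := # 1 :+ b :- a) refl (ι (12 ℕ.+ p)) (ι (11 ℕ.+ p)) (h (suc j)))

    -- Expand ∑ f n * ℓ n over the primes q ∣ n, where f (q * m) = - f m unless q ∣ m;
    -- replacing lg x by ℓ n costs deficit x.
    main-identity : ∀ x → 1 ℕ.≤ x → ∣ ι (lg x) * F x + ∑ (suc x) (λ q → Λ q * F (x div q)) ∣ ≤ ι x * E (lg x)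
    main-identity x 1≤x = ≤-trans (≤-reflexive (cong ∣_∣ identity)) (≤-trans (∣p+q∣≤∣p∣+∣q∣ P Q) (linear (P≤ ⊕ deficit-bound x 1≤x ⊕ Q≤ ⊕ ≤-reflexive (sym (cong (ι x *_) (E≡ (lg x)))) ⊕ 0≤ι x) (solve 7 (λ a b d x e E h → x :* E :- (a :+ b) := d :+ x :* e :+ x :* (# 4 :* h) :+ x :* E :+ x :- (a :+ d :+ b :+ x :* (e :+ # 1 :+ # 4 :* h) :+ # 0)) refl (∣ P ∣) (∣ Q ∣) (deficit x) (ι x) (e (lg x)) (E (lg x)) (h (suc (lg x))))))
      where
      X = suc x
      P Q : ℚ
      P = ∑ X (λ n → f n * (ι (lg x) - ℓ X n))
      Q = ∑ X (λ q → Λ q * Fq q (x div q))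
      identity : ι (lg x) * F x + ∑ X (λ q → Λ q * F (x div q)) ≡ P + Q
      identity = linear-≡ (cong₂ _+_ (cong₂ _+_ (sym (trans (∑-ext X (λ n → (solve 3 (λ f a b → f :* (a :- b) := f :* a :- f :* b) refl (f n) (ι (lg x)) (ℓ X n)))) (∑-- X _ _))) (sym (∑-*ʳ X (ι (lg x)) f))) (trans (∑-ℓ x X f) (trans (∑-ext X (λ q → trans (Λ-only q (∑-f-* q (x div q))) (solve 3 (λ l a b → l :* (a :- b) := l :* a :- l :* b) refl (Λ q) (Fq q (x div q)) (F (x div q))))) (∑-- X _ _)))) (solve 7 (λ l F s P Q t r → P :+ Q :- (l :* F :+ s) := P :+ r :+ (Q :- s) :- (r :- t :+ F :* l :+ t)) refl (ι (lg x)) (F x) (∑ X (λ q → Λ q * F (x div q))) P Q (∑ X (λ n → f n * ℓ X n)) (∑ X (λ n → f n * ι (lg x))))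
      P≤ : ∣ P ∣ ≤ deficit x
      P≤ = ≤-trans (∣∑∣≤ X _) (∑-mono X term)
        where
        term : ∀ n → n ℕ.< X → ∣ f n * (ι (lg x) - ℓ X n) ∣ ≤ pos n * (ι (lg x) - ℓ X n)
        term zero _ = ≤-reflexive (trans (cong (λ z → ∣ z * (ι (lg x) - ℓ X 0) ∣) f0) (trans (cong ∣_∣ (*-zeroˡ (ι (lg x) - ℓ X 0))) (sym (*-zeroˡ (ι (lg x) - ℓ X 0)))))
        term n@(suc _) n<X = ≤-trans (≤-reflexive (trans (∣p*q∣≡∣p∣*∣q∣ (f n) (ι (lg x) - ℓ X n)) (cong (∣ f n ∣ *_) (0≤p⇒∣p∣≡p 0≤)))) (*-monoʳ (ι (lg x) - ℓ X n) 0≤ (∣f∣≤1 n))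
          where
          0≤ : 0ℚ ≤ ι (lg x) - ℓ X n
          0≤ = linear (ℓ≤lg X {n} (s≤s z≤n) ⊕ ι-mono (lg-mono (ℕ.≤-pred n<X))) (solve 3 (λ a b c → a :- c :- # 0 := b :+ a :- (c :+ b)) refl (ι (lg x)) (ι (lg n)) (ℓ X n))
      -- Here |Fq q (x/q)| ≤ x/q², and the crude lg q ≤ q leaves x ∑ 1/q, which is affordable next
      -- to the harmonic term already in `e`.
      Q≤ : ∣ Q ∣ ≤ ι x * (ι 4 * h (suc (lg x)))
      Q≤ = ≤-trans (∣∑∣≤ X _) (≤-trans (∑-mono X (λ q _ → term q)) (≤-trans (≤-reflexive (∑-*ˡ X (ι x) _)) (*-monoˡ (ι x) (0≤ι x)
        (≤-trans (∑-extend (lg-upper x) (λ q _ _ → *-nonneg (0≤π q) (0≤inv q))) (R-bound (suc (lg x)))))))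
        where
        term : ∀ q → ∣ Λ q * Fq q (x div q) ∣ ≤ ι x * (π q * inv q)
        term zero = ≤-reflexive (trans (cong ∣_∣ (trans (cong (_* Fq 0 0) Λ0) (*-zeroˡ (Fq 0 0)))) (sym (trans (cong (ι x *_) (*-zeroʳ (π 0))) (*-zeroʳ (ι x)))))
        term q@(suc _) = linear (≤-reflexive (trans (∣p*q∣≡∣p∣*∣q∣ (Λ q) (Fq q (x div q))) (cong (_* ∣ Fq q (x div q) ∣) (0≤p⇒∣p∣≡p (0≤Λ q)))) ⊕ *-monoˡ (Λ q) (0≤Λ q) (∣Fq∣≤ q (x div q) (s≤s z≤n)) ⊕ *-monoˡ (Λ q) (0≤Λ q) (ι-div-≤ (x div q) q) ⊕ *-monoˡ (Λ q * inv q) (*-nonneg (0≤Λ q) (0≤inv q)) (ι-div-≤ x q) ⊕ *-monoʳ (ι x * inv q * inv q) (*-nonneg (*-nonneg (0≤ι x) (0≤inv q)) (0≤inv q)) (Λ≤Λ′ q) ⊕ ≤-reflexive (cong (_* (ι x * inv q * inv q)) (refl {x = Λ′ q})) ⊕ *-monoˡ (π q * ι x * inv q * inv q) (*-nonneg (*-nonneg (*-nonneg (0≤π q) (0≤ι x)) (0≤inv q)) (0≤inv q)) (ι-mono (ℕ.<⇒≤ (lg<n {q} (s≤s z≤n)))) ⊕ ≤-reflexive (cong (π q * ι x * inv q *_) (ι*inv {q} (s≤s z≤n)))) (solve 11 (λ A l l' a y z v x p g k → x :* (p :* v) :- A := l :* a :+ l :* z :+ l :* (y :* v) :+ l :* v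 :* (x :* v) :+ l' :* (x :* v :* v) :+ p :* g :* (x :* v :* v) :+ p :* x :* v :* v :* k :+ p :* x :* v :* # 1 :- (A :+ l :* a :+ l :* z :+ l :* v :* y :+ l :* (x :* v :* v) :+ l' :* (x :* v :* v) :+ p :* x :* v :* v :* g :+ p :* x :* v :* (k :* v))) refl (∣ Λ q * Fq q (x div q) ∣) (Λ q) (Λ′ q) (∣ Fq q (x div q) ∣) (ι (x div q)) (ι (x div q div q)) (inv q) (ι x) (π q) (ι (lg q)) (ι q))

  -- Möbius inversion and the hyperbola identity.

  module Hyperbola where

    open Mertens
    open LogSum using (e; deficit-bound)
    open import Data.Nat.Coprimality as Coprimality using (Coprime; coprime-divisor)
    open import Data.Nat.Primality.Factorisation using (factorise)
    open import Data.List using ([]; _∷_)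
    open import Data.List.Relation.Unary.All using ([]; _∷_)
    open Mobius
    open import Data.Nat.ListAction using (product)

    prime-factor : ∀ d → 2 ℕ.≤ d → ∃ λ r → Prime r × r ∣ d
    prime-factor d 2≤d with factorise d {{ℕ.>-nonZero (ℕ.≤-trans (s≤s z≤n) 2≤d)}}
    ... | record { factors = [] ; isFactorisation = refl } = contradiction 2≤d λ { (s≤s ()) }
    ... | record { factors = r ∷ fs ; isFactorisation = eq ; factorsPrime = pr ∷ _ } = r , pr , subst (r ∣_) (sym eq) (m∣m*n (product fs))

    ∑-divisors : ℕ → ℕ → ℚ
    ∑-divisors X k = ∑ X (λ d → f d * 𝟙 (d ∣? k))

    -- The divisors prime to q contribute C, and q times such a divisor carries the opposite sign,
    -- so the multiples of q contribute - C.
    ∑-divisors-0 : ∀ x {q k} → Prime q → p ℕ.< q → q ∣ k → 1 ℕ.≤ k → k ℕ.≤ x → ∑-divisors (suc x) k ≡ 0ℚ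
    ∑-divisors-0 x {q} {k} pq p<q (divides k′ k≡) 1≤k k≤x = trans split (trans (cong₂ _+_ A≡ B≡) (+-inverseˡ C))
      where
      1≤q = ℕ.≤-trans (s≤s z≤n) (prime≥2 pq)
      k≡qk′ : k ≡ q ℕ.* k′
      k≡qk′ = trans k≡ (ℕ.*-comm k′ q)
      1≤k′ : 1 ℕ.≤ k′
      1≤k′ = ℕ.n≢0⇒n>0 λ { refl → contradiction (subst (1 ℕ.≤_) k≡ 1≤k) λ () }
      v = x div q
      k′≤v : k′ ℕ.≤ v
      k′≤v = div-≥ 1≤q (subst (ℕ._≤ x) k≡qk′ k≤x)
      g : ℕ → ℚ
      g m = f m * 𝟙 (m ∣? k′) * (1ℚ - 𝟙 (q ∣? m))
      A B C : ℚ
      A = ∑ (suc x) (λ d → 𝟙 (q ∣? d) * (f d * 𝟙 (d ∣? k)))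
      B = ∑ (suc x) (λ d → f d * 𝟙 (d ∣? k) * (1ℚ - 𝟙 (q ∣? d)))
      C = ∑ (suc v) g
      split : ∑-divisors (suc x) k ≡ A + B
      split = trans (∑-ext (suc x) (λ d → (solve 2 (λ a i → a := i :* a :+ a :* (# 1 :- i)) refl (f d * 𝟙 (d ∣? k)) (𝟙 (q ∣? d))))) (∑-+ (suc x) _ _)
      A≡ : A ≡ - C
      A≡ = trans (∑-multiples x _ 1≤q) (trans (∑-ext (suc v) (λ m → trans (cong₂ _*_ (f-*′ m pq p<q) (𝟙-cong (q ℕ.* m ∣? k) (m ∣? k′) (λ d → *-cancelˡ-∣ q {{ℕ.>-nonZero 1≤q}} (subst (q ℕ.* m ∣_) k≡qk′ d)) (λ d → subst (q ℕ.* m ∣_) (sym k≡qk′) (*-monoʳ-∣ q d))))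
        (solve 3 (λ f i j → (i :* f :- f) :* j := (:- (f :* j :* (# 1 :- i)))) refl (f m) (𝟙 (q ∣? m)) (𝟙 (m ∣? k′))))) (∑-neg (suc v) g))
      B≡ : B ≡ C
      B≡ = trans (∑-ext (suc x) term) (sym (∑-extend-≡ (s≤s (div-≤ x q)) (λ i v<i _ → trans (cong (λ z → f i * z * (1ℚ - 𝟙 (q ∣? i))) (𝟙-no (i ∣? k′) (λ d → contradiction (∣⇒≤ {{ℕ.>-nonZero 1≤k′}} d) (ℕ.<⇒≱ (ℕ.≤-<-trans k′≤v v<i)))))
        (solve 2 (λ f j → f :* # 0 :* (# 1 :- j) := # 0) refl (f i) (𝟙 (q ∣? i))))))
        where
        term : ∀ d → f d * 𝟙 (d ∣? k) * (1ℚ - 𝟙 (q ∣? d)) ≡ g d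
        term d with q ∣? d
        ... | yes _ = solve 3 (λ f i j → f :* i :* (# 1 :- # 1) := f :* j :* (# 1 :- # 1)) refl (f d) (𝟙 (d ∣? k)) (𝟙 (d ∣? k′))
        ... | no q∤d = cong (λ z → f d * z * (1ℚ - 0ℚ)) (𝟙-cong (d ∣? k) (d ∣? k′) (λ d∣k → coprime-divisor cop (subst (d ∣_) k≡qk′ d∣k)) (λ d∣k′ → subst (d ∣_) (sym k≡qk′) (∣n⇒∣m*n q d∣k′)))
          where
          cop : Coprime d q
          cop (c∣d , c∣q) with prime⇒irreducible pq c∣q
          ... | inj₁ c≡1 = c≡1
          ... | inj₂ refl = contradiction c∣d q∤d

    -- The divisor sum is 0 if some prime above p divides k and 1 otherwise. In the first case the
    -- last claim is ℓ ≤ lg; in the second ℓ vanishes and it is an equality.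
    ∑-divisors-bounds : ∀ x k → 1 ℕ.≤ k → k ℕ.≤ x → let T = ∑-divisors (suc x) k in 0ℚ ≤ T × T ≤ 1ℚ × ι (lg x) * T ≤ ι (lg x) - ℓ (suc x) k
    ∑-divisors-bounds x k 1≤k k≤x with ℕ.anyUpTo? (λ q → 𝒫? q ×-dec (q ∣? k)) (suc k)
    ... | yes (q , _ , ((pq , p<q) , q∣k)) = ≤-reflexive (sym T≡0) , ≤-trans (≤-reflexive T≡0) (0≤ι 1) ,
        (linear (≤-reflexive (cong (ι (lg x) *_) T≡0) ⊕ ℓ≤lg (suc x) 1≤k ⊕ ι-mono (lg-mono k≤x)) (solve 4 (λ l m T c → l :- c :- l :* T := l :* # 0 :+ m :+ l :- (l :* T :+ c :+ m)) refl (ι (lg x)) (ι (lg k)) (∑-divisors (suc x) k) (ℓ (suc x) k)))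
      where
      T≡0 = ∑-divisors-0 x pq p<q q∣k 1≤k k≤x
    ... | no none = ≤-trans (0≤ι 1) (≤-reflexive (sym T≡1)) , ≤-reflexive T≡1 ,
        (linear (≤-reflexive (cong (ι (lg x) *_) T≡1) ⊕ ≤-reflexive ℓ≡0) (solve 3 (λ l T c → l :- c :- l :* T := l :* # 1 :+ # 0 :- (l :* T :+ c)) refl (ι (lg x)) (∑-divisors (suc x) k) (ℓ (suc x) k)))
      where
      no-prime : ∀ q → Prime q → p ℕ.< q → ¬ q ∣ k
      no-prime q pq p<q d = none (q , s≤s (∣⇒≤ {{ℕ.>-nonZero 1≤k}} d) , (pq , p<q) , d)
      ℓ≡0 : ℓ (suc x) k ≡ 0ℚ
      ℓ≡0 = ∑-zero (suc x) (λ q _ → trans (Λ-only q (λ pq p<q → 𝟙-no (q ∣? k) (no-prime q pq p<q))) (*-zeroʳ (Λ q)))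
      T≡1 : ∑-divisors (suc x) k ≡ 1ℚ
      T≡1 = trans (∑-single (suc x) 1 (s≤s (ℕ.≤-trans 1≤k k≤x)) (λ d _ → other d)) (trans (cong₂ _*_ f1 (𝟙-yes (1 ∣? k) (1∣ k))) (*-identityʳ 1ℚ))
        where
        other : ∀ d → ¬ d ≡ 1 → f d * 𝟙 (d ∣? k) ≡ 0ℚ
        other zero _ = trans (cong (_* 𝟙 (0 ∣? k)) f0) (*-zeroˡ (𝟙 (0 ∣? k)))
        other (suc zero) 1≢1 = contradiction refl 1≢1
        other d@(suc (suc _)) _ with d ∣? k
        ... | no _ = *-zeroʳ (f d)
        ... | yes d∣k with prime-factor d (s≤s (s≤s z≤n))
        ... | r , pr , r∣d = trans (cong (λ z → z * μ′ d * 1ℚ) (𝟙-no (rough? d) (λ rough → rough (s≤s (ℕ.≮⇒≥ (λ p<r → no-prime r pr p<r (∣-trans r∣d d∣k)))) (pr , r∣d)))) (solve 1 (λ m → # 0 :* m :* # 1 := # 0) refl (μ′ d))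

    W : ℕ → ℕ → ℚ
    W x z = ∑ (suc z) (λ n → f n * ι (x div n))

    -- By Möbius inversion, U x counts the k ≤ x all of whose prime factors are at most p.
    U : ℕ → ℚ
    U x = W x x

    U-≡ : ∀ x → U x ≡ ∑ (suc x) (λ k → pos k * ∑-divisors (suc x) k)
    U-≡ x = sym (trans (∑-ext X (λ k → sym (∑-*ˡ X (pos k) _))) (trans (∑-swap X X _) (∑-ext X term)))
      where
      X = suc x
      term : ∀ d → ∑ X (λ k → pos k * (f d * 𝟙 (d ∣? k))) ≡ f d * ι (x div d)
      term zero = trans (∑-zero X (λ k _ → trans (cong (λ z → pos k * (z * 𝟙 (0 ∣? k))) f0) (solve 2 (λ a b → a :* (# 0 :* b) := # 0) refl (pos k) (𝟙 (0 ∣? k))))) (sym (trans (cong (_* ι (x div 0)) f0) (*-zeroˡ (ι (x div 0)))))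
      term d@(suc _) = trans (∑-ext X (λ k → (solve 3 (λ a f i → a :* (f :* i) := f :* (i :* a)) refl (pos k) (f d) (𝟙 (d ∣? k))))) (trans (∑-*ˡ X (f d) _) (cong (f d *_) (count-multiples x (s≤s z≤n))))

    0≤U : ∀ x → 0ℚ ≤ U x
    0≤U x = ≤-trans (∑-nonneg (suc x) term) (≤-reflexive (sym (U-≡ x)))
      where
      term : ∀ k → k ℕ.< suc x → 0ℚ ≤ pos k * ∑-divisors (suc x) k
      term zero _ = ≤-reflexive (sym (*-zeroˡ (∑-divisors (suc x) 0)))
      term k@(suc _) k< = *-nonneg (0≤pos k) (proj₁ (∑-divisors-bounds x k (s≤s z≤n) (ℕ.≤-pred k<)))

    U≤ : ∀ x → U x ≤ ι x
    U≤ x = ≤-trans (≤-reflexive (U-≡ x)) (≤-trans (∑-mono (suc x) (λ k k< → pos-≤ k (λ 1≤k → proj₁ (proj₂ (∑-divisors-bounds x k 1≤k (ℕ.≤-pred k<))))))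
      (≤-reflexive (trans (∑-*ʳ (suc x) 1ℚ pos) (trans (*-identityʳ _) (∑-pos x)))))

    -- An integer counted by U has ℓ = 0 and so uses up the full lg x of the deficit; hence such
    -- integers are rare.
    lg*U≤ : ∀ x → 1 ℕ.≤ x → ι (lg x) * U x ≤ ι x * e (lg x)
    lg*U≤ x 1≤x = ≤-trans (≤-reflexive (trans (cong (ι (lg x) *_) (U-≡ x)) (trans (sym (∑-*ˡ (suc x) (ι (lg x)) _)) (∑-ext (suc x) (λ k → (solve 3 (λ l a T → l :* (a :* T) := a :* (l :* T)) refl (ι (lg x)) (pos k) (∑-divisors (suc x) k)))))))
      (≤-trans (∑-mono (suc x) (λ k k< → pos-≤ k (λ 1≤k → proj₂ (proj₂ (∑-divisors-bounds x k 1≤k (ℕ.≤-pred k<)))))) (deficit-bound x 1≤x))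

    Φ : ℕ → ℕ → ℚ
    Φ x B = ∑ (suc B) (λ b → F (x div b))

    ∑-𝟙-⊓ : ∀ B v → ∑ (suc B) (λ b → pos b * 𝟙 (b ℕ.≤? v)) ≡ ι (B ℕ.⊓ v)
    ∑-𝟙-⊓ zero v = trans (+-identityˡ (pos 0 * 𝟙 (0 ℕ.≤? v))) (*-zeroˡ (𝟙 (0 ℕ.≤? v)))
    ∑-𝟙-⊓ (suc B) v with suc B ℕ.≤? v
    ... | yes B<v = trans (cong₂ _+_ (trans (∑-𝟙-⊓ B v) (cong ι (ℕ.m≤n⇒m⊓n≡m (ℕ.<⇒≤ B<v)))) (*-identityˡ 1ℚ)) (trans (+-comm (ι B) 1ℚ) (trans (sym (ι-suc B)) (cong ι (sym (ℕ.m≤n⇒m⊓n≡m B<v)))))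
    ... | no B≮v = trans (cong₂ _+_ (trans (∑-𝟙-⊓ B v) (cong ι (ℕ.m≥n⇒m⊓n≡n (ℕ.≮⇒≥ B≮v)))) (*-zeroʳ 1ℚ)) (trans (+-identityʳ (ι v)) (cong ι (sym (ℕ.m≥n⇒m⊓n≡n (ℕ.m≤n⇒m≤1+n (ℕ.≮⇒≥ B≮v))))))

    -- Exchange of summation: n ≤ ⌊x/b⌋ and b ≤ ⌊x/n⌋ say the same, so n is counted for min(B,
    -- ⌊x/n⌋) values of b ≥ 1.
    Φ-⊓ : ∀ x B → Φ x B ≡ ∑ (suc x) (λ n → f n * ι (B ℕ.⊓ (x div n)))
    Φ-⊓ x B = trans (∑-ext (suc B) outer) (trans (∑-swap (suc B) (suc x) _) (∑-ext (suc x) inner))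
      where
      F-𝟙 : ∀ v → v ℕ.≤ x → F v ≡ ∑ (suc x) (λ n → f n * 𝟙 (n ℕ.≤? v))
      F-𝟙 v v≤x = trans (∑-cong (suc v) (λ n n≤v → sym (trans (cong (f n *_) (𝟙-yes (n ℕ.≤? v) (ℕ.≤-pred n≤v))) (*-identityʳ (f n)))))
        (∑-extend-≡ (s≤s v≤x) (λ n v<n _ → trans (cong (f n *_) (𝟙-no (n ℕ.≤? v) (ℕ.<⇒≱ v<n))) (*-zeroʳ (f n))))
      outer : ∀ b → F (x div b) ≡ ∑ (suc x) (λ n → f n * (pos b * 𝟙 (b ℕ.≤? (x div n))))
      outer zero = trans F0 (sym (∑-zero (suc x) (λ n _ → (solve 2 (λ f i → f :* (# 0 :* i) := # 0) refl (f n) (𝟙 (0 ℕ.≤? (x div n)))))))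
      outer b@(suc _) = trans (F-𝟙 (x div b) (div-≤ x b)) (∑-ext (suc x) term)
        where
        term : ∀ n → f n * 𝟙 (n ℕ.≤? (x div b)) ≡ f n * (1ℚ * 𝟙 (b ℕ.≤? (x div n)))
        term zero = trans (cong (_* 𝟙 (0 ℕ.≤? (x div b))) f0) (trans (solve 2 (λ a b → # 0 :* a := # 0 :* (# 1 :* b)) refl (𝟙 (0 ℕ.≤? (x div b))) (𝟙 (b ℕ.≤? (x div 0)))) (cong (_* (1ℚ * 𝟙 (b ℕ.≤? (x div 0)))) (sym f0)))
        term n@(suc _) = cong (f n *_) (trans (𝟙-cong (n ℕ.≤? (x div b)) (b ℕ.≤? (x div n)) (flip-≤ b n) (flip-≤ n b)) (sym (*-identityˡ (𝟙 (b ℕ.≤? (x div n))))))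
          where
          flip-≤ : ∀ b n .{{_ : ℕ.NonZero n}} → n ℕ.≤ x div b → b ℕ.≤ x div n
          flip-≤ b n r = div-≥ (ℕ.>-nonZero⁻¹ n) (ℕ.≤-trans (ℕ.≤-trans (ℕ.≤-reflexive (ℕ.*-comm n b)) (ℕ.*-monoʳ-≤ b r)) (div-lower x b))
      inner : ∀ n → ∑ (suc B) (λ b → f n * (pos b * 𝟙 (b ℕ.≤? (x div n)))) ≡ f n * ι (B ℕ.⊓ (x div n))
      inner n = trans (∑-*ˡ (suc B) (f n) _) (cong (f n *_) (∑-𝟙-⊓ B (x div n)))

    -- With z = ⌊x/(B+1)⌋ the minimum of B and ⌊x/n⌋ is B for n ≤ z and ⌊x/n⌋ beyond.
    Φ-identity : ∀ x B → let z = x div suc B in Φ x B ≡ U x - W x z + ι B * F z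
    Φ-identity x B = trans (Φ-⊓ x B) (trans (∑-ext (suc x) term) (trans (∑-- (suc x) _ _) (linear-≡ (cong₂ _+_ (sym (trans (∑-- (suc z) _ _) (cong (_-_ (W x z)) (∑-*ˡ (suc z) (ι B) f)))) (sym restrict)) (solve 6 (λ u w b F s t → u :- w :+ b :* F :- (u :- s) := t :+ s :- (w :- b :* F :+ t)) refl (U x) (W x z) (ι B) (F z) (∑ (suc x) (λ n → 𝟙 (n ℕ.≤? z) * (f n * ι (x div n) - ι B * f n))) (∑ (suc z) (λ n → f n * ι (x div n) - ι B * f n))))))
      where
      z = x div suc B
      restrict : ∑ (suc x) (λ n → 𝟙 (n ℕ.≤? z) * (f n * ι (x div n) - ι B * f n)) ≡ ∑ (suc z) (λ n → f n * ι (x div n) - ι B * f n)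
      restrict = trans (sym (∑-extend-≡ (s≤s (div-≤ x (suc B))) (λ n z<n _ → trans (cong (_* (f n * ι (x div n) - ι B * f n)) (𝟙-no (n ℕ.≤? z) (ℕ.<⇒≱ z<n))) (*-zeroˡ (f n * ι (x div n) - ι B * f n)))))
        (∑-cong (suc z) (λ n n≤z → trans (cong (_* (f n * ι (x div n) - ι B * f n)) (𝟙-yes (n ℕ.≤? z) (ℕ.≤-pred n≤z))) (*-identityˡ (f n * ι (x div n) - ι B * f n))))
      term : ∀ n → f n * ι (B ℕ.⊓ (x div n)) ≡ f n * ι (x div n) - 𝟙 (n ℕ.≤? z) * (f n * ι (x div n) - ι B * f n)
      term zero = trans (cong (_* ι (B ℕ.⊓ 0)) f0) (sym (trans (cong (λ a → a * ι 0 - 𝟙 (0 ℕ.≤? z) * (a * ι 0 - ι B * a)) f0) (solve 3 (λ a i b → # 0 :* # 0 :- i :* (# 0 :* # 0 :- b :* # 0) := # 0 :* a) refl (ι (B ℕ.⊓ 0)) (𝟙 (0 ℕ.≤? z)) (ι B))))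
      term n@(suc _) with n ℕ.≤? z
      ... | yes n≤z = trans (cong (λ k → f n * ι k) (ℕ.m≤n⇒m⊓n≡m (div-≥ (s≤s z≤n) (ℕ.≤-trans (ℕ.*-mono-≤ n≤z (ℕ.n≤1+n B)) (ℕ.≤-trans (ℕ.≤-reflexive (ℕ.*-comm z (suc B))) (div-lower x (suc B)))))))
        (solve 3 (λ f b y → f :* b := f :* y :- # 1 :* (f :* y :- b :* f)) refl (f n) (ι B) (ι (x div n)))
      ... | no n≰z = trans (cong (λ k → f n * ι k) (ℕ.m≥n⇒m⊓n≡n (ℕ.≤-pred (div-< {x} {n} {suc B} (ℕ.<-≤-trans (div-upper x {suc B} (s≤s z≤n))
          (ℕ.≤-trans (ℕ.≤-reflexive (trans (ℕ.+-comm (suc B ℕ.* z) (suc B)) (trans (sym (ℕ.*-suc (suc B) z)) (ℕ.*-comm (suc B) (suc z))))) (ℕ.*-monoˡ-≤ (suc B) (ℕ.≰⇒> n≰z))))))))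
        (solve 3 (λ f b y → f :* y := f :* y :- # 0 :* (f :* y :- b :* f)) refl (f n) (ι B) (ι (x div n)))

    m : ℕ → ℚ
    m z = ∑ (suc z) (λ n → f n * inv n)

    m-W : ∀ x z → ∣ ι x * m z - W x z ∣ ≤ ι z
    m-W x z = ≤-trans (≤-reflexive (cong ∣_∣ (sym (trans (∑-ext (suc z) (λ n → (solve 4 (λ f x v y → f :* (x :* v :- y) := x :* (f :* v) :- f :* y) refl (f n) (ι x) (inv n) (ι (x div n))))) (trans (∑-- (suc z) _ _) (cong (_- W x z) (∑-*ˡ (suc z) (ι x) _)))))))
      (≤-trans (∣∑∣≤ (suc z) _) (≤-trans (∑-mono (suc z) (λ n _ → term n)) (≤-reflexive (∑-pos z))))
      where
      term : ∀ n → ∣ f n * (ι x * inv n - ι (x div n)) ∣ ≤ pos n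
      term zero = ≤-reflexive (cong ∣_∣ (trans (cong (_* (ι x * inv 0 - ι 0)) f0) (*-zeroˡ (ι x * inv 0 - ι 0))))
      term n@(suc _) = ≤-trans (≤-reflexive (∣p*q∣≡∣p∣*∣q∣ (f n) (ι x * inv n - ι (x div n)))) (≤-trans (*-mono (0≤∣p∣ (f n)) (0≤ι 1) (∣f∣≤1 n)
        (abs-≤ (linear (ι-div-≥ x {n} (s≤s z≤n)) (solve 2 (λ a y → # 1 :- (a :- y) := # 1 :+ y :- a) refl (ι x * inv n) (ι (x div n)))) (linear (ι-div-≤ x n ⊕ 0≤ι 1) (solve 2 (λ a y → # 1 :- (:- (a :- y)) := a :+ # 1 :- (y :+ # 0)) refl (ι x * inv n) (ι (x div n)))))) (≤-reflexive (*-identityʳ 1ℚ)))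

    -- At x = z the sum W is U z, which lies between 0 and z; dropping the integer parts costs
    -- another z.
    ∣m∣≤2 : ∀ z → ∣ m z ∣ ≤ ι 2
    ∣m∣≤2 zero = ≤-trans (≤-reflexive (cong ∣_∣ (trans (+-identityˡ (f 0 * inv 0)) (*-zeroʳ (f 0))))) (0≤ι 2)
    ∣m∣≤2 z@(suc _) = cancel-* (ι z) (0<ι _) (linear (≤-reflexive (sym (trans (∣p*q∣≡∣p∣*∣q∣ (ι z) (m z)) (cong (_* ∣ m z ∣) (0≤p⇒∣p∣≡p (0≤ι z))))) ⊕ m-W z z ⊕ ≤-reflexive (0≤p⇒∣p∣≡p (0≤U z)) ⊕ U≤ z ⊕ subst (_≤ ∣ ι z * m z - U z ∣ + ∣ U z ∣) (cong ∣_∣ (solve 2 (λ a u → a :- u :+ u := a) refl (ι z * m z) (U z))) (∣p+q∣≤∣p∣+∣q∣ (ι z * m z - U z) (U z))) (solve 6 (λ z M M' D u a → z :* # 2 :- z :* M := M' :+ z :+ a :+ z :+ (D :+ u) :- (z :* M :+ D :+ u :+ a :+ M')) refl (ι z) (∣ m z ∣) (∣ ι z * m z ∣) (∣ ι z * m z - U z ∣) (∣ U z ∣) (U z)))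

    -- Of the 5 x, U takes x, W takes 2 x + z through x m(z), and B F(z) takes B z ≤ x. The bound is
    -- uniform in B: averaged with weight 1/b, the functions b F(x/b) are of size x / log B.
    Φ-bound : ∀ x B → ∣ Φ x B ∣ ≤ ι 5 * ι x
    Φ-bound x B = abs-≤ up dn
      where
      z = x div suc B
      Bz : ι B * ι z ≤ ι x
      Bz = subst (_≤ ι x) (ι-* B z) (ι-mono (ℕ.≤-trans (ℕ.*-monoˡ-≤ z (ℕ.n≤1+n B)) (div-lower x (suc B))))
      BF : ∀ {a} → a ≤ ι z → ι B * a ≤ ι x
      BF a≤ = ≤-trans (*-monoˡ (ι B) (0≤ι B) a≤) Bz
      z≤x = ι-mono (div-≤ x (suc B))
      xm : ∀ {a} → a ≤ ι 2 → ι x * a ≤ ι x * ι 2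
      xm = *-monoˡ (ι x) (0≤ι x)
      up : Φ x B ≤ ι 5 * ι x
      up = linear (≤-reflexive (Φ-identity x B) ⊕ U≤ x ⊕ ≤-trans (≤∣∣ (ι x * m z - W x z)) (m-W x z) ⊕ BF (≤-trans (≤∣∣ (F z)) (∣F∣≤ z)) ⊕ xm (≤-trans (-≤∣∣ (m z)) (∣m∣≤2 z)) ⊕ z≤x) (solve 8 (λ P u w b F x z m → # 5 :* x :- P := u :- w :+ b :* F :+ x :+ z :+ x :+ x :* # 2 :+ x :- (P :+ u :+ (x :* m :- w) :+ b :* F :+ x :* (:- m) :+ z)) refl (Φ x B) (U x) (W x z) (ι B) (F z) (ι x) (ι z) (m z))
      dn : - Φ x B ≤ ι 5 * ι x
      dn = linear (≤-reflexive (sym (Φ-identity x B)) ⊕ 0≤U x ⊕ ≤-trans (-≤∣∣ (ι x * m z - W x z)) (m-W x z) ⊕ BF (≤-trans (-≤∣∣ (F z)) (∣F∣≤ z)) ⊕ xm (≤-trans (≤∣∣ (m z)) (∣m∣≤2 z)) ⊕ z≤x ⊕ 0≤ι x) (solve 8 (λ P u w b F x z m → # 5 :* x :- (:- P) := P :+ u :+ z :+ x :+ x :* # 2 :+ x :+ x :- (u :- w :+ b :* F :+ # 0 :+ (:- (x :* m :- w)) :+ b :* (:- F) :+ x :* m :+ z :+ # 0)) refl (Φ x B) (U x) (W x z) (ι B) (F z) (ι x) (ι z) (m z))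

  -- Mean squares with weight x⁻³ and the energy inequality.

  module Energy where

    open Mertens
    open Mobius

    inv³ : ℕ → ℚ
    inv³ x = inv x * inv x * inv x

    0≤inv³ : ∀ x → 0ℚ ≤ inv³ x
    0≤inv³ x = *-nonneg (*-nonneg (0≤inv x) (0≤inv x)) (0≤inv x)

    inv³-anti : ∀ {x y} → 1 ℕ.≤ x → x ℕ.≤ y → inv³ y ≤ inv³ x
    inv³-anti {x} {y} 1≤x x≤y = *-mono (*-nonneg (0≤inv y) (0≤inv y)) (0≤inv x) (*-mono (0≤inv y) (0≤inv x) i i) i
      where i = inv-anti 1≤x x≤y

    inv³-* : ∀ x y → inv³ (x ℕ.* y) ≡ inv³ x * inv³ y
    inv³-* x y = trans (cong (λ z → z * z * z) (inv-* x y)) (solve 2 (λ a b → a :* b :* (a :* b) :* (a :* b) := a :* a :* a :* (b :* b :* b)) refl (inv x) (inv y))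

    ι²inv³ : ∀ x → ι x * ι x * inv³ x ≡ inv x
    ι²inv³ zero = refl
    ι²inv³ x@(suc _) = linear-≡ (cong₂ _+_ (cong (inv x *_) (ι*inv {x} (s≤s z≤n))) (cong (ι x * inv x * inv x *_) (ι*inv {x} (s≤s z≤n)))) (solve 2 (λ x v → v :- x :* x :* (v :* v :* v) := v :* # 1 :+ x :* v :* v :* # 1 :- (v :* (x :* v) :+ x :* v :* v :* (x :* v))) refl (ι x) (inv x))

    -- As |F x| ≤ x, this is at most 1/x, so the trivial bound for the energy up to 2^K is K.
    a : ℕ → ℚ
    a x = F x * F x * inv³ x

    0≤a : ∀ x → 0ℚ ≤ a x
    0≤a x = *-nonneg (sq≥0 (F x)) (0≤inv³ x)

    F²≤ : ∀ x → F x * F x ≤ ι x * ι x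
    F²≤ x = ≤-trans (≤-reflexive (sym (∣∣² (F x)))) (*-mono (0≤∣p∣ (F x)) (0≤ι x) (∣F∣≤ x) (∣F∣≤ x))

    a≤inv : ∀ x → a x ≤ inv x
    a≤inv x = ≤-trans (*-monoʳ (inv³ x) (0≤inv³ x) (F²≤ x)) (≤-reflexive (ι²inv³ x))

    a0 : a 0 ≡ 0ℚ
    a0 = *-zeroʳ (F 0 * F 0)

    -- The q integers x with ⌊x/q⌋ = y weigh at most (q y)⁻³ each, and q · q² · (q y)⁻³ = y⁻³. The
    -- exponent 3 is chosen for this balance.
    dilation : ∀ q N (g : ℕ → ℚ) → 1 ℕ.≤ q → (∀ y → 0ℚ ≤ g y) → g 0 ≡ 0ℚ →
      ∑ N (λ x → ι q * ι q * g (x div q) * inv³ x) ≤ ∑ N (λ y → 𝟙 (q ℕ.* y ℕ.<? N) * (g y * inv³ y))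
    dilation q N g 1≤q 0≤g g0 = ≤-trans (≤-reflexive extend) (≤-trans (≤-reflexive (∑-blocks q N _)) (∑-mono N (λ y _ → block y)))
      where
      t : ℕ → ℚ
      t x = ι q * ι q * g (x div q) * inv³ x
      N≤qN : N ℕ.≤ q ℕ.* N
      N≤qN = ℕ.≤-trans (ℕ.≤-reflexive (sym (ℕ.*-identityˡ N))) (ℕ.*-monoˡ-≤ N 1≤q)
      extend : ∑ N t ≡ ∑ (q ℕ.* N) (λ x → 𝟙 (x ℕ.<? N) * t x)
      extend = trans (∑-cong N (λ x x<N → sym (trans (cong (_* t x) (𝟙-yes (x ℕ.<? N) x<N)) (*-identityˡ (t x)))))
        (∑-extend-≡ N≤qN (λ x N≤x _ → trans (cong (_* t x) (𝟙-no (x ℕ.<? N) (ℕ.≤⇒≯ N≤x))) (*-zeroˡ (t x))))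
      block : ∀ y → ∑ q (λ r → 𝟙 (q ℕ.* y ℕ.+ r ℕ.<? N) * t (q ℕ.* y ℕ.+ r)) ≤ 𝟙 (q ℕ.* y ℕ.<? N) * (g y * inv³ y)
      block y = ≤-trans (∑-mono q (λ r r<q → *-mono (0≤𝟙 (q ℕ.* y ℕ.+ r ℕ.<? N)) (*-nonneg (*-nonneg (*-nonneg (0≤ι q) (0≤ι q)) (0≤g y)) (0≤inv³ (q ℕ.* y)))
          (𝟙-mono (q ℕ.* y ℕ.+ r ℕ.<? N) (q ℕ.* y ℕ.<? N) (ℕ.≤-<-trans (ℕ.m≤m+n (q ℕ.* y) r))) (term r r<q)))
        (≤-trans (≤-reflexive (∑-const q _)) (≤-trans (≤-reflexive (solve 4 (λ q i g v → q :* (i :* (q :* q :* g :* v)) := i :* (g :* (q :* q :* q :* v))) refl (ι q) (𝟙 (q ℕ.* y ℕ.<? N)) (g y) (inv³ (q ℕ.* y))))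
          (*-monoˡ (𝟙 (q ℕ.* y ℕ.<? N)) (0≤𝟙 (q ℕ.* y ℕ.<? N)) (*-monoˡ (g y) (0≤g y) (≤-reflexive cube)))))
        where
        cube : ι q * ι q * ι q * inv³ (q ℕ.* y) ≡ inv³ y
        cube = linear-≡ (cong₂ _+_ (cong₂ _+_ (cong₂ _+_ (cong (ι q * ι q * ι q *_) (inv³-* q y)) (cong (inv³ y *_) (ι*inv 1≤q))) (cong (inv³ y * ι q * inv q *_) (ι*inv 1≤q))) (cong (inv³ y * ι q * inv q * ι q * inv q *_) (ι*inv 1≤q))) (solve 4 (λ q v w y → y :- q :* q :* q :* w := q :* q :* q :* (v :* v :* v :* y) :+ y :* # 1 :+ y :* q :* v :* # 1 :+ y :* q :* v :* q :* v :* # 1 :- (q :* q :* q :* w :+ y :* (q :* v) :+ y :* q :* v :* (q :* v) :+ y :* q :* v :* q :* v :* (q :* v))) refl (ι q) (inv q) (inv³ (q ℕ.* y)) (inv³ y))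
        term : ∀ r → r ℕ.< q → t (q ℕ.* y ℕ.+ r) ≤ ι q * ι q * g y * inv³ (q ℕ.* y)
        term r r<q = ≤-trans (≤-reflexive (cong (λ z → ι q * ι q * g z * inv³ (q ℕ.* y ℕ.+ r)) (div-unique {q = q} {v = y} (ℕ.m≤m+n (q ℕ.* y) r) (ℕ.+-monoʳ-< (q ℕ.* y) r<q)))) (pick y)
          where
          pick : ∀ y → ι q * ι q * g y * inv³ (q ℕ.* y ℕ.+ r) ≤ ι q * ι q * g y * inv³ (q ℕ.* y)
          pick zero = ≤-reflexive (trans (cong (λ z → ι q * ι q * z * inv³ (q ℕ.* 0 ℕ.+ r)) g0) (trans (solve 3 (λ q b c → q :* q :* # 0 :* b := q :* q :* # 0 :* c) refl (ι q) (inv³ (q ℕ.* 0 ℕ.+ r)) (inv³ (q ℕ.* 0))) (cong (λ z → ι q * ι q * z * inv³ (q ℕ.* 0)) (sym g0))))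
          pick y@(suc _) = *-monoˡ (ι q * ι q * g y) (*-nonneg (*-nonneg (0≤ι q) (0≤ι q)) (0≤g y)) (inv³-anti (ℕ.*-mono-≤ 1≤q (s≤s z≤n)) (ℕ.m≤m+n (q ℕ.* y) r))

    sq : ℚ → ℚ
    sq x = x * x

    resonance : ℕ → ℕ → ℚ
    resonance x q = sq (F x + ι q * F (x div q))

    -- Δ measures how far F x is from - q F (x / q), its value on average by main-identity.
    A Δ : ℕ → ℚ
    A K = ∑ (2 ℕ.^ K) a
    Δ K = ∑ (2 ℕ.^ K) (λ x → inv³ x * ∑ (suc x) (λ q → Λ q * inv q * resonance x q))

    0≤A : ∀ K → 0ℚ ≤ A K
    0≤A K = ∑-nonneg (2 ℕ.^ K) (λ x _ → 0≤a x)

    A-mono : ∀ {j k} → j ℕ.≤ k → A j ≤ A k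
    A-mono j≤k = ∑-extend (2^-mono j≤k) (λ x _ _ → 0≤a x)

    0≤Δ : ∀ K → 0ℚ ≤ Δ K
    0≤Δ K = ∑-nonneg (2 ℕ.^ K) (λ x _ → *-nonneg (0≤inv³ x) (∑-nonneg (suc x) (λ q _ → *-nonneg (*-nonneg (0≤Λ q) (0≤inv q)) (sq≥0 (F x + ι q * F (x div q))))))

    12≤E : ∀ j → ι 12 ≤ E j
    12≤E j = ≤-trans (ι-mono (ℕ.m≤m+n 12 p)) (linear (16 ⊛ 0≤h (suc j)) (solve 2 (λ a h → a :+ # 16 :* h :- a := # 16 :* h :- # 16 :* # 0) refl (ι (12 ℕ.+ p)) (h (suc j))))

    A≤ : ∀ K → A K ≤ ι K
    A≤ K = ≤-trans (∑-mono (2 ℕ.^ K) (λ x _ → a≤inv x)) (h-2^ K)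

    -- Expanding the resonance gives F² ∑ Λ q / q + 2 F ∑ Λ q F(x/q) + ∑ Λ q q F(x/q)². By Mertens
    -- and `main-identity` the first two parts make - lg x F² up to errors. In the third, `dilation`
    -- leaves a y times the sum of Λ q / q over q y < 2^K, which is about K - lg y.
    energy-inequality : ∀ K → Δ K ≤ ∑ (2 ℕ.^ K) (λ x → a x * (ι K - ι 2 * ι (lg x))) + ι 4 * E K * ι K
    energy-inequality K = ≤-trans (∑-mono X (λ x x<X → pointwise x x<X)) (≤-trans (≤-reflexive (trans (∑-+ X _ _) (cong (_+ ∑ X cross) (trans (∑-+ X _ _) (cong (_+_ (∑ X (λ x → - (ι (lg x) * a x)))) (∑-*ˡ X (ι 3 * ε) inv))))))
      (≤-trans (+-monoʳ-≤ (∑ X (λ x → - (ι (lg x) * a x)) + ι 3 * ε * ∑ X inv) cross≤) (linear (≤-reflexive (trans (∑-+ X _ _) (cong (_+_ (∑ X (λ y → a y * (ι K - ι (lg y))))) (∑-*ˡ X (ι 5) inv))) ⊕ ≤-reflexive (sym (trans (∑-ext X (λ x → (solve 3 (λ a k l → a :* (k :- # 2 :* l) := (:- (l :* a)) :+ a :* (k :- l)) refl (a x) (ι K) (ι (lg x))))) (∑-+ X (λ x → - (ι (lg x) * a x)) (λ y → a y * (ι K - ι (lg y)))))) ⊕ 5 ⊛ h-2^ K ⊕ 3 ⊛ *-monoˡ ε 0≤ε (h-2^ K) ⊕ *-monoʳ (ι K) (0≤ι K) (12≤E K) ⊕ 7 ⊛ 0≤ι K) (solve 7 (λ s t t' w ε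 k v → w :+ # 4 :* ε :* k :- (s :+ # 3 :* ε :* v :+ t) := t' :+ # 5 :* v :+ w :+ # 5 :* k :+ # 3 :* (ε :* k) :+ ε :* k :+ # 7 :* k :- (t :+ (s :+ t') :+ # 5 :* v :+ # 3 :* (ε :* v) :+ # 12 :* k :+ # 7 :* # 0)) refl (∑ X (λ x → - (ι (lg x) * a x))) (∑ X (λ y → a y * (ι K - ι (lg y)) + ι 5 * inv y)) (∑ X (λ y → a y * (ι K - ι (lg y)))) (∑ X (λ x → a x * (ι K - ι 2 * ι (lg x)))) ε (ι K) (∑ X inv)))))
      where
      X = 2 ℕ.^ K
      ε = E K
      0≤ε : 0ℚ ≤ ε
      0≤ε = ≤-trans (0≤ι 12) (12≤E K)
      cross : ℕ → ℚ
      cross x = inv³ x * ∑ (suc x) (λ q → Λ q * ι q * sq (F (x div q)))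
      pointwise : ∀ x → x ℕ.< X → inv³ x * ∑ (suc x) (λ q → Λ q * inv q * resonance x q) ≤ - (ι (lg x) * a x) + ι 3 * ε * inv x + cross x
      pointwise zero _ = ≤-reflexive (trans (*-zeroˡ (∑ 1 (λ q → Λ q * inv q * resonance 0 q))) (sym (trans (cong (λ z → - (ι 0 * z) + ι 3 * ε * 0ℚ + cross 0) a0) (trans (cong (λ z → - (ι 0 * 0ℚ) + ι 3 * ε * 0ℚ + z) (*-zeroˡ (∑ 1 (λ q → Λ q * ι q * sq (F (0 div q)))))) (solve 1 (λ ε → (:- (# 0 :* # 0)) :+ # 3 :* ε :* # 0 :+ # 0 := # 0) refl ε)))))
      pointwise x@(suc _) x<X = ≤-trans (*-monoˡ (inv³ x) (0≤inv³ x) inner) (≤-reflexive (linear-≡ (cong (ι 3 * ε *_) (ι²inv³ x)) (solve 7 (λ w u f ε x v c → (:- (u :* (f :* f :* w))) :+ # 3 :* ε :* v :+ w :* c :- w :* ((:- (u :* (f :* f))) :+ # 3 :* ε :* (x :* x) :+ c) := # 3 :* ε :* v :- # 3 :* ε :* (x :* x :* w)) refl (inv³ x) (ι (lg x)) (F x) ε (ι x) (inv x) (∑ (suc x) (λ q → Λ q * ι q * sq (F (x div q)))))))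
        where
        u = ι (lg x)
        T = ∑ (suc x) (λ q → Λ q * F (x div q))
        Sx = ∑ (suc x) (λ q → Λ q * inv q)
        C = ∑ (suc x) (λ q → Λ q * ι q * sq (F (x div q)))
        expand : ∑ (suc x) (λ q → Λ q * inv q * resonance x q) ≡ sq (F x) * Sx + ι 2 * F x * T + C
        expand = trans (∑-ext (suc x) term) (trans (∑-+ (suc x) _ _) (cong (_+ C) (trans (∑-+ (suc x) _ _) (cong₂ _+_ (∑-*ˡ (suc x) (sq (F x)) _) (∑-*ˡ (suc x) (ι 2 * F x) _)))))
          where
          term : ∀ q → Λ q * inv q * resonance x q ≡ sq (F x) * (Λ q * inv q) + ι 2 * F x * (Λ q * F (x div q)) + Λ q * ι q * sq (F (x div q))
          term q = linear-≡ (cong₂ _+_ (cong (ι 2 *_) (Λ-support q {ι q * inv q * F (x div q) * F x} {1ℚ * F (x div q) * F x} (λ 1≤q → cong (λ z → z * F (x div q) * F x) (ι*inv 1≤q)))) (Λ-support q {ι q * inv q * ι q * sq (F (x div q))} {1ℚ * ι q * sq (F (x div q))} (λ 1≤q → cong (λ z → z * ι q * sq (F (x div q))) (ι*inv 1≤q)))) (solve 5 (λ l v q f g → f :* f :* (l :* v) :+ # 2 :* f :* (l :* g) :+ l :* q :* (g :* g) :- l :* v :* ((f :+ q :* g) :* (f :+ q :* g)) := # 2 :* (l :* (# 1 :* g :* f)) :+ l :* (# 1 :* q :* (g :* g)) :- (# 2 :* (l :* (q :* v :* g :* f)) :+ l :* (q :* v :* q :* (g :* g)))) refl (Λ q) (inv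 q) (ι q) (F x) (F (x div q)))
        S≤ : Sx ≤ u + ι 6
        S≤ = linear (∑-extend (lg-upper x) (λ q _ _ → *-nonneg (0≤Λ q) (0≤inv q)) ⊕ S-upper (suc (lg x)) ⊕ ≤-reflexive (ι-suc (lg x))) (solve 4 (λ s t u u' → u :+ # 6 :- s := t :+ (u' :+ # 5) :+ (# 1 :+ u) :- (s :+ t :+ u')) refl Sx (S (suc (lg x))) u (ι (suc (lg x))))
        FT : F x * (u * F x + T) ≤ ι x * (ι x * ε)
        FT = ≤-trans (≤∣∣ (F x * (u * F x + T))) (≤-trans (≤-reflexive (∣p*q∣≡∣p∣*∣q∣ (F x) (u * F x + T))) (*-mono (0≤∣p∣ (F x)) (*-nonneg (0≤ι x) 0≤ε) (∣F∣≤ x)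
          (≤-trans (main-identity x (s≤s z≤n)) (*-monoˡ (ι x) (0≤ι x) (E-mono {lg x} {K} (ℕ.<⇒≤ (lg-< {x} {K} (s≤s z≤n) x<X)))))))
        inner : ∑ (suc x) (λ q → Λ q * inv q * resonance x q) ≤ - (u * (F x * F x)) + ι 3 * ε * (ι x * ι x) + C
        inner = ≤-trans (≤-reflexive expand) (linear (*-monoˡ (F x * F x) (sq≥0 (F x)) S≤ ⊕ 2 ⊛ FT ⊕ 6 ⊛ F²≤ x ⊕ *-monoˡ (ι x * ι x) (sq≥0 (ι x)) (12≤E K) ⊕ 6 ⊛ sq≥0 (ι x)) (solve 7 (λ f s t c u ε x → (:- (u :* (f :* f))) :+ # 3 :* ε :* (x :* x) :+ c :- (f :* f :* s :+ # 2 :* f :* t :+ c) := f :* f :* (u :+ # 6) :+ # 2 :* (x :* (x :* ε)) :+ # 6 :* (x :* x) :+ x :* x :* ε :+ # 6 :* (x :* x) :- (f :* f :* s :+ # 2 :* (f :* (u :* f :+ t)) :+ # 6 :* (f :* f) :+ x :* x :* # 12 :+ # 6 :* # 0)) refl (F x) Sx T C u ε (ι x)))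
      cross≤ : ∑ X cross ≤ ∑ X (λ y → a y * (ι K - ι (lg y)) + ι 5 * inv y)
      cross≤ = ≤-trans (≤-reflexive (trans (∑-cong X (λ x x<X → trans (cong (inv³ x *_) (∑-extend-≡ x<X (λ q x<q _ → trans (cong (λ z → Λ q * ι q * sq z) (trans (cong F (div-zero x<q)) F0)) (*-zeroʳ (Λ q * ι q))))) (sym (∑-*ˡ X (inv³ x) _)))) (trans (∑-swap X X _) (∑-ext X column))))
        (≤-trans (∑-mono X (λ q _ → dil q)) (≤-trans (≤-reflexive (trans (∑-ext X (λ q → sym (∑-*ˡ X (Λ q * inv q) _))) (trans (∑-swap X X _) (∑-ext X (λ y → trans (∑-ext X (λ q → (solve 3 (λ l i a → l :* (i :* a) := a :* (i :* l)) refl (Λ q * inv q) (𝟙 (q ℕ.* y ℕ.<? X)) (a y)))) (∑-*ˡ X (a y) _)))))) (∑-mono X row)))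
        where
        column : ∀ q → ∑ X (λ x → inv³ x * (Λ q * ι q * sq (F (x div q)))) ≡ Λ q * inv q * ∑ X (λ x → ι q * ι q * sq (F (x div q)) * inv³ x)
        column q = trans (∑-ext X (λ x → (linear-≡ (sym (Λ-support q {ι q * inv q * ι q * (sq (F (x div q)) * inv³ x)} {1ℚ * ι q * (sq (F (x div q)) * inv³ x)} (λ 1≤q → cong (λ z → z * ι q * (sq (F (x div q)) * inv³ x)) (ι*inv 1≤q)))) (solve 5 (λ w l q v g → l :* v :* (q :* q :* g :* w) :- w :* (l :* q :* g) := l :* (q :* v :* q :* (g :* w)) :- l :* (# 1 :* q :* (g :* w))) refl (inv³ x) (Λ q) (ι q) (inv q) (sq (F (x div q))))))) (∑-*ˡ X (Λ q * inv q) _)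
        dil : ∀ q → Λ q * inv q * ∑ X (λ x → ι q * ι q * sq (F (x div q)) * inv³ x) ≤ Λ q * inv q * ∑ X (λ y → 𝟙 (q ℕ.* y ℕ.<? X) * a y)
        dil zero = ≤-reflexive (solve 3 (λ l s t → l :* # 0 :* s := l :* # 0 :* t) refl (Λ 0) (∑ X (λ x → ι 0 * ι 0 * sq (F (x div 0)) * inv³ x)) (∑ X (λ y → 𝟙 (0 ℕ.* y ℕ.<? X) * a y)))
        dil q@(suc _) = *-monoˡ (Λ q * inv q) (*-nonneg (0≤Λ q) (0≤inv q)) (dilation q X (λ y → sq (F y)) (s≤s z≤n) (λ y → sq≥0 (F y)) (cong sq F0))
        row : ∀ y → y ℕ.< X → a y * ∑ X (λ q → 𝟙 (q ℕ.* y ℕ.<? X) * (Λ q * inv q)) ≤ a y * (ι K - ι (lg y)) + ι 5 * inv y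
        row zero _ = ≤-reflexive (trans (cong (_* ∑ X (λ q → 𝟙 (q ℕ.* 0 ℕ.<? X) * (Λ q * inv q))) a0) (trans (solve 2 (λ s k → # 0 :* s := # 0 :* (k :- # 0) :+ # 5 :* # 0) refl (∑ X (λ q → 𝟙 (q ℕ.* 0 ℕ.<? X) * (Λ q * inv q))) (ι K)) (cong (λ z → z * (ι K - ι 0) + ι 5 * 0ℚ) (sym a0))))
        row y@(suc _) y<X = linear (*-monoˡ (a y) (0≤a y) count ⊕ 5 ⊛ a≤inv y) (solve 5 (λ a s k l v → a :* (k :- l) :+ # 5 :* v :- a :* s := a :* (k :- l :+ # 5) :+ # 5 :* v :- (a :* s :+ # 5 :* a)) refl (a y) (∑ X (λ q → 𝟙 (q ℕ.* y ℕ.<? X) * (Λ q * inv q))) (ι K) (ι (lg y)) (inv y))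
          where
          lg≤K : lg y ℕ.≤ K
          lg≤K = ℕ.<⇒≤ (lg-< (s≤s z≤n) y<X)
          j = K ℕ.∸ lg y
          -- Since y ≥ 2^(lg y), the condition q y < 2^K forces q < 2^(K - lg y), the range of
          -- `S-upper`.
          count : ∑ X (λ q → 𝟙 (q ℕ.* y ℕ.<? X) * (Λ q * inv q)) ≤ ι K - ι (lg y) + ι 5
          count = linear (∑-mono X (λ q _ → *-monoʳ (Λ q * inv q) (*-nonneg (0≤Λ q) (0≤inv q)) (𝟙-mono (q ℕ.* y ℕ.<? X) (q ℕ.<? 2 ℕ.^ j) (small q))) ⊕ ≤-reflexive restrict ⊕ S-upper j ⊕ ≤-reflexive (sym (trans (cong ι (sym (ℕ.m+[n∸m]≡n lg≤K))) (ι-+ (lg y) j)))) (solve 6 (λ s t r j k l → k :- l :+ # 5 :- s := t :+ r :+ (j :+ # 5) :+ k :- (s :+ t :+ r :+ (l :+ j))) refl (∑ X (λ q → 𝟙 (q ℕ.* y ℕ.<? X) * (Λ q * inv q))) (∑ X (λ q → 𝟙 (q ℕ.<? 2 ℕ.^ j) * (Λ q * inv q))) (S j) (ι j) (ι K) (ι (lg y)))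
            where
            small : ∀ q → q ℕ.* y ℕ.< X → q ℕ.< 2 ℕ.^ j
            small q qy<X = ℕ.*-cancelʳ-< (2 ℕ.^ lg y) q (2 ℕ.^ j) (ℕ.≤-<-trans (ℕ.*-monoʳ-≤ q (lg-lower {y} (s≤s z≤n))) (subst (q ℕ.* y ℕ.<_) (trans (cong (2 ℕ.^_) (sym (ℕ.m∸n+n≡m lg≤K))) (ℕ.^-distribˡ-+-* 2 j (lg y))) qy<X))
            restrict : ∑ X (λ q → 𝟙 (q ℕ.<? 2 ℕ.^ j) * (Λ q * inv q)) ≡ S j
            restrict = trans (sym (∑-extend-≡ (2^-mono (ℕ.m∸n≤m K (lg y))) (λ q j≤q _ → trans (cong (_* (Λ q * inv q)) (𝟙-no (q ℕ.<? 2 ℕ.^ j) (ℕ.≤⇒≯ j≤q))) (*-zeroˡ (Λ q * inv q)))))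
              (∑-cong (2 ℕ.^ j) (λ q q<j → trans (cong (_* (Λ q * inv q)) (𝟙-yes (q ℕ.<? 2 ℕ.^ j) q<j)) (*-identityˡ (Λ q * inv q))))

    α : ℕ → ℚ
    α k = ∑ (2 ℕ.^ k) (λ r → a (2 ℕ.^ k ℕ.+ r))

    0≤α : ∀ k → 0ℚ ≤ α k
    0≤α k = ∑-nonneg (2 ℕ.^ k) (λ r _ → 0≤a (2 ℕ.^ k ℕ.+ r))

    A-α : ∀ K → A K ≡ ∑ K α
    A-α K = dyadic₀ K a a0

    ∑-a-lg : ∀ K (φ : ℕ → ℚ) → ∑ (2 ℕ.^ K) (λ x → a x * φ (lg x)) ≡ ∑ K (λ k → α k * φ k)
    ∑-a-lg K φ = trans (dyadic₀ K (λ x → a x * φ (lg x)) (trans (cong (_* φ 0) a0) (*-zeroˡ (φ 0)))) (∑-ext K (λ k →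
      trans (∑-cong (2 ℕ.^ k) (λ r r< → cong (λ l → a (2 ℕ.^ k ℕ.+ r) * φ l) (lg-block k r<))) (∑-*ʳ (2 ℕ.^ k) (φ k) _)))

    abel : ∀ K → ∑ K (λ k → α k * (ι K - ι k)) ≡ ∑ K (λ j → A (suc j))
    abel zero = refl
    abel (suc K) = linear-≡ (cong₂ _+_ (cong₂ _+_ (cong₂ _+_ (trans (∑-ext K (λ k → trans (cong (λ z → α k * (z - ι k)) (ι-suc K)) (solve 3 (λ a K k → a :* (# 1 :+ K :- k) := a :* (K :- k) :+ a) refl (α k) (ι K) (ι k)))) (∑-+ K _ α)) (abel K)) (sym (A-α (suc K)))) (cong (α K *_) (ι-suc K))) (solve 8 (λ s s' t b c K' k r → t :+ r :- (s :+ c :* (K' :- k)) := s' :+ b :+ t :+ r :+ c :* (# 1 :+ k) :- (s :+ s' :+ (b :+ c) :+ c :* K')) refl (∑ K (λ k → α k * (ι (suc K) - ι k))) (∑ K (λ k → α k * (ι K - ι k))) (∑ K (λ j → A (suc j))) (∑ K α) (α K) (ι (suc K)) (ι K) (A (suc K)))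

    -- If A j were β j throughout, both sides without Δ would be β K² to leading order. Linear
    -- growth is thus the extremal case, and a positive Δ must be paid by A K falling short of it.
    Δ-bound : ∀ K → Δ K + ι K * A K ≤ ι 2 * ∑ K (λ j → A (suc j)) + ι 4 * E K * ι K
    Δ-bound K = linear (energy-inequality K ⊕ ≤-reflexive (∑-a-lg K (λ l → ι K - ι 2 * ι l)) ⊕ ≤-reflexive (trans (∑-ext K (λ k → (solve 3 (λ a K k → a :* (K :- # 2 :* k) := # 2 :* (a :* (K :- k)) :- K :* a) refl (α k) (ι K) (ι k)))) (trans (∑-- K _ _) (cong₂ _-_ (∑-*ˡ K (ι 2) _) (∑-*ˡ K (ι K) α)))) ⊕ 2 ⊛ ≤-reflexive (abel K) ⊕ ≤-reflexive (cong (ι K *_) (A-α K))) (solve 9 (λ D k A s t r b c e → # 2 :* c :+ e :- (D :+ k :* A) := s :+ e :+ t :+ (# 2 :* r :- k :* b) :+ # 2 :* c :+ k :* b :- (D :+ s :+ t :+ # 2 :* r :+ k :* A)) refl (Δ K) (ι K) (A K) (∑ (2 ℕ.^ K) (λ x → a x * (ι K - ι 2 * ι (lg x)))) (∑ K (λ k → α k * (ι K - ι 2 * ι k))) (∑ K (λ k → α k * (ι K - ι k))) (∑ K α) (∑ K (λ j → A (suc j))) (ι 4 * E K * ι K))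

    -- Because Δ ≥ 0, the blocks with k > K/2, whose weight K - 2 k is negative, cannot outweigh the
    -- earlier ones. It bridges the gap between `coercivity`, which reaches 16 r, and the defect,
    -- which is measured at 24 r.
    growth : ∀ j → A (3 ℕ.* j) ≤ ι 4 * A (2 ℕ.* j) + ι 12 * E (3 ℕ.* j)
    growth zero = ≤-trans (≤-reflexive (trans (+-identityˡ (a 0)) a0)) (*-nonneg (0≤ι 4) (0≤A 0) ⊕ *-nonneg (0≤ι 12) (≤-trans (0≤ι 12) (12≤E 0)))
    growth j@(suc _) = cancel-* (ι j) (0<ι _) (linear (0≤Δ K ⊕ energy-inequality K ⊕ s≤ ⊕ ≤-reflexive (cong (ι j *_) (trans (A-α K) (trans (cong (λ k → ∑ k α) K≡) (∑-split (2 ℕ.* j) j α)))) ⊕ 4 ⊛ ≤-reflexive (sym (cong (ι j *_) (A-α (2 ℕ.* j)))) ⊕ ≤-reflexive (cong (_* ∑ (2 ℕ.* j) α) (ι-* 3 j)) ⊕ 4 ⊛ ≤-reflexive (cong (E K *_) (ι-* 3 j))) (solve 9 (λ j K A3 A2 e s b c D → j :* (# 4 :* A2 :+ # 12 :* e) :- j :* A3 := D :+ (s :+ # 4 :* e :* K) :+ (K :* b :- j :* c) :+ j :* (b :+ c) :+ # 4 :* (j :* A2) :+ # 3 :* j :* b :+ # 4 :* (e :* (# 3 :* j)) :- (# 0 :+ D :+ s :+ j :* A3 :+ # 4 :* (j :* b) :+ K :* b :+ # 4 :* (e :* K))) refl (ι j) (ι K) (A K) (A (2 ℕ.* j)) (E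 K) (∑ (2 ℕ.^ K) (λ x → a x * (ι K - ι 2 * ι (lg x)))) (∑ (2 ℕ.* j) α) (∑ j (λ i → α (2 ℕ.* j ℕ.+ i))) (Δ K)))
      where
      K = 3 ℕ.* j
      K≡ : K ≡ 2 ℕ.* j ℕ.+ j
      K≡ = ℕ-solve 1 (λ j → conₙ 3 :*ₙ j :=ₙ conₙ 2 :*ₙ j :+ₙ j) refl j
      -- The weight K - 2 k is at most K on the first 2 j blocks and at most - j on the last j
      -- blocks.
      s≤ : ∑ (2 ℕ.^ K) (λ x → a x * (ι K - ι 2 * ι (lg x))) ≤ ι K * ∑ (2 ℕ.* j) α - ι j * ∑ j (λ i → α (2 ℕ.* j ℕ.+ i))
      s≤ = ≤-trans (≤-reflexive (trans (∑-a-lg K (λ l → ι K - ι 2 * ι l)) (trans (cong (λ k → ∑ k (λ k → α k * (ι K - ι 2 * ι k))) K≡) (∑-split (2 ℕ.* j) j (λ k → α k * (ι K - ι 2 * ι k))))))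
        (≤-trans (∑-mono (2 ℕ.* j) (λ k _ → (linear (2 ⊛ *-nonneg (0≤α k) (0≤ι k)) (solve 3 (λ a K k → K :* a :- a :* (K :- # 2 :* k) := # 2 :* (a :* k) :- # 2 :* # 0) refl (α k) (ι K) (ι k))))
          ⊕ ∑-mono j (λ i _ → (linear (2 ⊛ *-nonneg (0≤α (2 ℕ.* j ℕ.+ i)) (0≤ι i) ⊕ 2 ⊛ ≤-reflexive (sym (cong (α (2 ℕ.* j ℕ.+ i) *_) (ι-+ (2 ℕ.* j) i))) ⊕ 2 ⊛ ≤-reflexive (sym (cong (α (2 ℕ.* j ℕ.+ i) *_) (ι-* 2 j))) ⊕ ≤-reflexive (cong (α (2 ℕ.* j ℕ.+ i) *_) (ι-* 3 j))) (solve 6 (λ a K j i t t' → (:- j) :* a :- a :* (K :- # 2 :* t) := # 2 :* (a :* i) :+ # 2 :* (a :* t) :+ # 2 :* (a :* t') :+ a :* (# 3 :* j) :- (# 2 :* # 0 :+ # 2 :* (a :* (t' :+ i)) :+ # 2 :* (a :* (# 2 :* j)) :+ a :* K)) refl (α (2 ℕ.* j ℕ.+ i)) (ι K) (ι j) (ι i) (ι (2 ℕ.* j ℕ.+ i)) (ι (2 ℕ.* j))))))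
        (≤-reflexive (trans (cong₂ _+_ (∑-*ˡ (2 ℕ.* j) (ι K) α) (∑-*ˡ j (- ι j) _)) (solve 3 (λ u j c → u :+ (:- j) :* c := u :- j :* c) refl (ι K * ∑ (2 ℕ.* j) α) (ι j) (∑ j (λ i → α (2 ℕ.* j ℕ.+ i)))))))

  -- Comparing the functions x ↦ b F(x/b) in mean square.

  module Dilation where

    open Mertens using (h; h-2^)
    open Mobius using (F; F0; F-lipschitz; ∣F∣≤)
    open Energy

    g : ℕ → ℕ → ℚ
    g b x = ι b * F (x div b)

    dist : ℕ → ℕ → ℕ → ℚ
    dist X b b′ = ∑ X (λ x → sq (g b x - g b′ x) * inv³ x)

    dist-term≥0 : ∀ b b′ x → 0ℚ ≤ sq (g b x - g b′ x) * inv³ x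
    dist-term≥0 b b′ x = *-nonneg (sq≥0 (g b x - g b′ x)) (0≤inv³ x)

    dist-mono : ∀ {X Y} b b′ → X ℕ.≤ Y → dist X b b′ ≤ dist Y b b′
    dist-mono b b′ X≤Y = ∑-extend X≤Y (λ x _ _ → dist-term≥0 b b′ x)

    dist-refl : ∀ X b → dist X b b ≡ 0ℚ
    dist-refl X b = ∑-zero X (λ x _ → (solve 2 (λ g w → (g :- g) :* (g :- g) :* w := # 0) refl (g b x) (inv³ x)))

    dist-sym : ∀ X b b′ → dist X b b′ ≡ dist X b′ b
    dist-sym X b b′ = ∑-ext X (λ x → (solve 3 (λ g h w → (g :- h) :* (g :- h) :* w := (h :- g) :* (h :- g) :* w) refl (g b x) (g b′ x) (inv³ x)))

    -- Minkowski's inequality without square roots, for squared distances measured as squares of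
    -- integers times a common δ. With I = i + 1 and J = j + 1 it is I J (u + v)² ≤ (I + J)(J u² + I
    -- v²), where the two sides differ by (J u - I v)².
    dist-triangle : ∀ X a b c {δ} i j → dist X a b ≤ sq (ι (suc i)) * δ → dist X b c ≤ sq (ι (suc j)) * δ → dist X a c ≤ sq (ι (suc i) + ι (suc j)) * δ
    dist-triangle X a b c {δ} i j p q = cancel-* (I * J) (positive⁻¹ (I * J) {{ℚ.positive (subst (_< I * J) (*-zeroʳ I) (*-monoʳ-<-pos I {{ℚ.positive (0<ι i)}} (0<ι j)))}}) (≤-trans pointwise
      (linear (*-monoˡ ((I + J) * J) (*-nonneg (0≤I ⊕ 0≤J) 0≤J) p ⊕ *-monoˡ ((I + J) * I) (*-nonneg (0≤I ⊕ 0≤J) 0≤I) q) (solve 5 (λ I J d e δ → I :* J :* ((I :+ J) :* (I :+ J) :* δ) :- ((I :+ J) :* J :* d :+ (I :+ J) :* I :* e) := (I :+ J) :* J :* (I :* I :* δ) :+ (I :+ J) :* I :* (J :* J :* δ) :- ((I :+ J) :* J :* d :+ (I :+ J) :* I :* e)) refl I J (dist X a b) (dist X b c) δ)))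
      where
      I = ι (suc i)
      J = ι (suc j)
      0≤I = 0≤ι (suc i)
      0≤J = 0≤ι (suc j)
      pointwise : I * J * dist X a c ≤ (I + J) * J * dist X a b + (I + J) * I * dist X b c
      pointwise = ≤-trans (≤-reflexive (sym (∑-*ˡ X (I * J) _))) (≤-trans (∑-mono X (λ x _ → (linear (*-monoʳ (inv³ x) (0≤inv³ x) (sq≥0 (J * (g a x - g b x) - I * (g b x - g c x)))) (solve 6 (λ I J a b c w → (I :+ J) :* J :* ((a :- b) :* (a :- b) :* w) :+ (I :+ J) :* I :* ((b :- c) :* (b :- c) :* w) :- I :* J :* ((a :- c) :* (a :- c) :* w) := (J :* (a :- b) :- I :* (b :- c)) :* (J :* (a :- b) :- I :* (b :- c)) :* w :- # 0 :* w) refl I J (g a x) (g b x) (g c x) (inv³ x)))))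
        (≤-reflexive (trans (∑-+ X _ _) (cong₂ _+_ (∑-*ˡ X ((I + J) * J) _) (∑-*ˡ X ((I + J) * I) _)))))

    -- Because 1/x² ≤ 2/(x (x + 1)) = 2 (1/x - 1/(x + 1)).
    inv²-telescope : ∀ t n → 1 ℕ.≤ t → ∑ n (λ i → inv (t ℕ.+ i) * inv (t ℕ.+ i)) ≤ ι 2 * (inv t - inv (t ℕ.+ n))
    inv²-telescope t zero 1≤t = ≤-reflexive (trans (solve 1 (λ a → # 0 := # 2 :* (a :- a)) refl (inv t)) (cong (λ k → ι 2 * (inv t - inv k)) (sym (ℕ.+-identityʳ t))))
    inv²-telescope t (suc n) 1≤t = linear (inv²-telescope t n 1≤t ⊕ 2 ⊛ ≤-reflexive (cong inv (ℕ.+-suc t n)) ⊕ step x 1≤x) (solve 5 (λ s t x y y' → # 2 :* (t :- y) :- (s :+ x :* x) := # 2 :* (t :- x) :+ # 2 :* y' :+ # 2 :* (x :- y') :- (s :+ # 2 :* y :+ x :* x)) refl (∑ n (λ i → inv (t ℕ.+ i) * inv (t ℕ.+ i))) (inv t) (inv x) (inv (t ℕ.+ suc n)) (inv (suc x)))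
      where
      x = t ℕ.+ n
      1≤x : 1 ℕ.≤ x
      1≤x = ℕ.≤-trans 1≤t (ℕ.m≤m+n t n)
      step : ∀ x → 1 ℕ.≤ x → inv x * inv x ≤ ι 2 * (inv x - inv (suc x))
      step x@(suc _) _ = linear (2 ⊛ ≤-reflexive (sym diff) ⊕ *-monoˡ (inv x) (0≤inv x) half) (solve 2 (λ v w → # 2 :* (v :- w) :- v :* v := # 2 :* (v :- w) :+ v :* (# 2 :* w) :- (# 2 :* (v :* w) :+ v :* v)) refl (inv x) (inv (suc x)))
        where
        half : inv x ≤ ι 2 * inv (suc x)
        half = cancel-* (ι x * ι (suc x)) (positive⁻¹ (ι x * ι (suc x)) {{ℚ.positive (subst (_< ι x * ι (suc x)) (*-zeroʳ (ι x)) (*-monoʳ-<-pos (ι x) {{ℚ.positive (0<ι _)}} (0<ι x)))}})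
          (linear (≤-reflexive (cong (ι (suc x) *_) (ι*inv {x} (s≤s z≤n))) ⊕ 2 ⊛ ≤-reflexive (sym (cong (ι x *_) (ι*inv {suc x} (s≤s z≤n)))) ⊕ ≤-reflexive (ι-suc x) ⊕ ι-mono {1} {x} (s≤s z≤n)) (solve 4 (λ x s v w → x :* s :* (# 2 :* w) :- x :* s :* v := s :* # 1 :+ # 2 :* (x :* (s :* w)) :+ (# 1 :+ x) :+ x :- (s :* (x :* v) :+ # 2 :* (x :* # 1) :+ s :+ # 1)) refl (ι x) (ι (suc x)) (inv x) (inv (suc x))))
        diff : inv x - inv (suc x) ≡ inv x * inv (suc x)
        diff = linear-≡ (cong₂ _+_ (cong₂ _+_ (cong (inv (suc x) *_) (ι*inv {x} (s≤s z≤n))) (sym (cong (inv x *_) (ι*inv {suc x} (s≤s z≤n))))) (cong (inv x * inv (suc x) *_) (ι-suc x))) (solve 4 (λ x s v w → v :* w :- (v :- w) := w :* # 1 :+ v :* (s :* w) :+ v :* w :* (# 1 :+ x) :- (w :* (x :* v) :+ v :* # 1 :+ v :* w :* s)) refl (ι x) (ι (suc x)) (inv x) (inv (suc x)))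

    inv³-tail : ∀ t M → 1 ℕ.≤ t → ι t * ι t * ∑ M (λ x → 𝟙 (t ℕ.≤? x) * inv³ x) ≤ ι 2
    inv³-tail t M 1≤t = ≤-trans (*-monoˡ (ι t * ι t) (sq≥0 (ι t)) tail) (linear (2 ⊛ ≤-reflexive (ι*inv 1≤t) ⊕ 2 ⊛ ≤-reflexive (cong (ι t * inv t *_) (ι*inv 1≤t))) (solve 2 (λ t v → # 2 :- t :* t :* (# 2 :* (v :* v)) := # 2 :* # 1 :+ # 2 :* (t :* v :* # 1) :- (# 2 :* (t :* v) :+ # 2 :* (t :* v :* (t :* v)))) refl (ι t) (inv t)))
      where
      tail : ∑ M (λ x → 𝟙 (t ℕ.≤? x) * inv³ x) ≤ ι 2 * (inv t * inv t)
      tail = ≤-trans (∑-extend (ℕ.m≤n+m M t) (λ x _ _ → *-nonneg (0≤𝟙 (t ℕ.≤? x)) (0≤inv³ x))) (≤-trans (≤-reflexive (trans (∑-split t M _) (trans (cong (_+ ∑ M (λ i → 𝟙 (t ℕ.≤? (t ℕ.+ i)) * inv³ (t ℕ.+ i)))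
        (∑-zero t (λ x x<t → trans (cong (_* inv³ x) (𝟙-no (t ℕ.≤? x) (ℕ.<⇒≱ x<t))) (*-zeroˡ (inv³ x))))) (+-identityˡ _))))
        (≤-trans (∑-mono M (λ i _ → (linear (*-monoʳ (inv³ (t ℕ.+ i)) (0≤inv³ (t ℕ.+ i)) (𝟙≤1 (t ℕ.≤? (t ℕ.+ i))) ⊕ *-monoˡ (inv (t ℕ.+ i) * inv (t ℕ.+ i)) (sq≥0 (inv (t ℕ.+ i))) (inv-anti 1≤t (ℕ.m≤m+n t i))) (solve 3 (λ i x v → v :* (x :* x) :- i :* (x :* x :* x) := # 1 :* (x :* x :* x) :+ x :* x :* v :- (i :* (x :* x :* x) :+ x :* x :* x)) refl (𝟙 (t ℕ.≤? (t ℕ.+ i))) (inv (t ℕ.+ i)) (inv t)))))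
          (≤-trans (≤-reflexive (∑-*ˡ M (inv t) _)) (linear (*-monoˡ (inv t) (0≤inv t) (inv²-telescope t M 1≤t) ⊕ 2 ⊛ *-nonneg (0≤inv t) (0≤inv (t ℕ.+ M))) (solve 3 (λ s v w → # 2 :* (v :* v) :- v :* s := v :* (# 2 :* (v :- w)) :+ # 2 :* (v :* w) :- (v :* s :+ # 2 :* # 0)) refl (∑ M (λ i → inv (t ℕ.+ i) * inv (t ℕ.+ i))) (inv t) (inv (t ℕ.+ M)))))))

    ∣g∣≤ : ∀ b x → ∣ g b x ∣ ≤ ι x
    ∣g∣≤ b x = ≤-trans (≤-reflexive (trans (∣p*q∣≡∣p∣*∣q∣ (ι b) (F (x div b))) (cong (_* ∣ F (x div b) ∣) (0≤p⇒∣p∣≡p (0≤ι b))))) (≤-trans (*-monoˡ (ι b) (0≤ι b) (∣F∣≤ (x div b))) (≤-trans (≤-reflexive (sym (ι-* b (x div b)))) (ι-mono (div-lower x b))))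

    g-zero : ∀ {b x} → x ℕ.< b → g b x ≡ 0ℚ
    g-zero {b} {x} x<b = trans (cong (λ z → ι b * F z) (div-zero x<b)) (trans (cong (ι b *_) F0) (*-zeroʳ (ι b)))

    sq-≤ : ∀ {a b} → ∣ a ∣ ≤ b → sq a ≤ sq b
    sq-≤ {a} {b} p = ≤-trans (≤-reflexive (sym (∣∣² a))) (*-mono (0≤∣p∣ a) (≤-trans (0≤∣p∣ a) p) p p)

    -- Write q F(V) - t F(Z) = (q - t) F(V) - t (F(Z) - F(V)) with V = ⌊x/q⌋ and Z = ⌊x/t⌋. Then q -
    -- t ≤ t/N, |F(V)| ≤ V, and F is Lipschitz with constant 1.
    near : ∀ N t q x → 1 ℕ.≤ N → 1 ℕ.≤ t → t ℕ.≤ q → N ℕ.* q ℕ.≤ suc N ℕ.* t → t ℕ.≤ x → ∣ g q x - g t x ∣ ≤ ι 2 * (ι x * inv N + ι t)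
    near N t q x 1≤N 1≤t t≤q Nq≤ t≤x = cancel-* (ι N) (0<ι′ 1≤N) (linear (*-monoˡ (ι N) (0≤ι N) first ⊕ 2 ⊛ *-monoʳ (ι V) (0≤ι V) Nq ⊕ 2 ⊛ *-monoʳ (ι V) (0≤ι V) (ι-mono t≤q) ⊕ 2 ⊛ ι-*≤ q V (div-lower x q) ⊕ *-monoˡ (ι N) (0≤ι N) (ι-*≤ t Z (div-lower x t)) ⊕ *-monoˡ (ι N) (0≤ι N) xq ⊕ Nq ⊕ 2 ⊛ ≤-reflexive (sym (cong (ι x *_) (ι*inv 1≤N))) ⊕ *-monoʳ (ι t) (0≤ι t) (ι-mono 1≤N)) (solve 8 (λ N v q t x V Z D → N :* (# 2 :* (x :* v :+ t)) :- N :* D := N :* ((q :- t) :* V :+ t :* (Z :- V)) :+ # 2 :* ((# 1 :+ N) :* t :* V) :+ # 2 :* (q :* V) :+ # 2 :* x :+ N :* x :+ N :* (q :* V :+ q) :+ (# 1 :+ N) :* t :+ # 2 :* (x :* (N :* v)) :+ N :* t :- (N :* D :+ # 2 :* (N :* q :* V) :+ # 2 :* (t :* V) :+ # 2 :* (q :* V) :+ N :* (t :* Z) :+ N :* x :+ N :* q :+ # 2 :* (x :* # 1) :+ # 1 :* t)) refl (ι N) (inv N) (ι q) (ι t) (ι x) (ι V) (ι Z) (∣ g q x - g t x ∣)))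
      where
      V = x div q
      Z = x div t
      1≤q = ℕ.≤-trans 1≤t t≤q
      Nq : ι N * ι q ≤ (1ℚ + ι N) * ι t
      Nq = subst₂ _≤_ (ι-* N q) (trans (ι-* (suc N) t) (cong (_* ι t) (ι-suc N))) (ι-mono Nq≤)
      xq : ι x ≤ ι q * ι V + ι q
      xq = ≤-trans (ι-mono (ℕ.<⇒≤ (div-upper x 1≤q))) (≤-reflexive (trans (ι-+ (q ℕ.* V) q) (cong (_+ ι q) (ι-* q V))))
      V≤Z : V ℕ.≤ Z
      V≤Z = div-≥ 1≤t (ℕ.≤-trans (ℕ.*-monoˡ-≤ V t≤q) (div-lower x q))
      first : ∣ g q x - g t x ∣ ≤ (ι q - ι t) * ι V + ι t * (ι Z - ι V)
      first = ≤-trans (≤-reflexive (cong ∣_∣ (solve 4 (λ q t a b → q :* a :- t :* b := (q :- t) :* a :- t :* (b :- a)) refl (ι q) (ι t) (F V) (F Z))))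
        (≤-trans (∣p-q∣≤∣p∣+∣q∣ ((ι q - ι t) * F V) (ι t * (F Z - F V)))
          (≤-trans (≤-reflexive (trans (∣p*q∣≡∣p∣*∣q∣ (ι q - ι t) (F V)) (cong (_* ∣ F V ∣) (0≤p⇒∣p∣≡p 0≤q-t)))) (*-monoˡ (ι q - ι t) 0≤q-t (∣F∣≤ V))
          ⊕ ≤-trans (≤-reflexive (trans (∣p*q∣≡∣p∣*∣q∣ (ι t) (F Z - F V)) (cong (_* ∣ F Z - F V ∣) (0≤p⇒∣p∣≡p (0≤ι t))))) (*-monoˡ (ι t) (0≤ι t) (F-lipschitz V≤Z))))
        where
        0≤q-t : 0ℚ ≤ ι q - ι t
        0≤q-t = linear (ι-mono t≤q) (solve 2 (λ q t → q :- t :- # 0 := q :- t) refl (ι q) (ι t))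

    -- The square of `near` summed with weight x⁻³: the part x/N yields K/N². The part t yields a
    -- constant, since both functions vanish for x < t and t² times the tail of x⁻³ is bounded.
    lip : ∀ K N t q → 1 ℕ.≤ N → 1 ℕ.≤ t → t ℕ.≤ q → N ℕ.* q ℕ.≤ suc N ℕ.* t → dist (2 ℕ.^ K) q t ≤ ι 8 * (inv N * inv N * ι K) + ι 16
    lip K N t q 1≤N 1≤t t≤q Nq≤ = ≤-trans (∑-mono X (λ x _ → term x)) (≤-trans (≤-reflexive (trans (∑-+ X _ _) (cong₂ _+_ (∑-*ˡ X (ι 8 * (inv N * inv N)) inv) (∑-*ˡ X (ι 8 * (ι t * ι t)) _))))
      (linear (8 ⊛ *-monoˡ (inv N * inv N) (sq≥0 (inv N)) (h-2^ K) ⊕ 8 ⊛ inv³-tail t X 1≤t) (solve 5 (λ n H K t s → # 8 :* (n :* n :* K) :+ # 16 :- (# 8 :* (n :* n) :* H :+ # 8 :* (t :* t) :* s) := # 8 :* (n :* n :* K) :+ # 8 :* # 2 :- (# 8 :* (n :* n :* H) :+ # 8 :* (t :* t :* s))) refl (inv N) (∑ X inv) (ι K) (ι t) (∑ X (λ x → 𝟙 (t ℕ.≤? x) * inv³ x)))))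
      where
      X = 2 ℕ.^ K
      term : ∀ x → sq (g q x - g t x) * inv³ x ≤ ι 8 * (inv N * inv N) * inv x + ι 8 * (ι t * ι t) * (𝟙 (t ℕ.≤? x) * inv³ x)
      term x with t ℕ.≤? x
      ... | no t≰x = ≤-trans (≤-reflexive (trans (cong₂ (λ a b → sq (a - b) * inv³ x) (g-zero (ℕ.<-≤-trans (ℕ.≰⇒> t≰x) t≤q)) (g-zero (ℕ.≰⇒> t≰x))) (solve 1 (λ w → (# 0 :- # 0) :* (# 0 :- # 0) :* w := # 0) refl (inv³ x))))
         (linear (8 ⊛ *-nonneg (sq≥0 (inv N)) (0≤inv x)) (solve 4 (λ n v t w → # 8 :* (n :* n) :* v :+ # 8 :* (t :* t) :* (# 0 :* w) :- # 0 := # 8 :* (n :* n :* v) :- # 8 :* # 0) refl (inv N) (inv x) (ι t) (inv³ x)))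
      ... | yes t≤x = linear (*-monoʳ (inv³ x) (0≤inv³ x) (sq-≤ {g q x - g t x} (near N t q x 1≤N 1≤t t≤q Nq≤ t≤x)) ⊕ 4 ⊛ *-monoʳ (inv³ x) (0≤inv³ x) (sq≥0 (ι x * inv N - ι t)) ⊕ 8 ⊛ ≤-reflexive (cong (inv N * inv N *_) (ι²inv³ x))) (solve 6 (λ D w x n t v → # 8 :* (n :* n) :* v :+ # 8 :* (t :* t) :* (# 1 :* w) :- D :* D :* w := # 2 :* (x :* n :+ t) :* (# 2 :* (x :* n :+ t)) :* w :+ # 4 :* ((x :* n :- t) :* (x :* n :- t) :* w) :+ # 8 :* (n :* n :* v) :- (D :* D :* w :+ # 4 :* (# 0 :* w) :+ # 8 :* (n :* n :* (x :* x :* w)))) refl (g q x - g t x) (inv³ x) (ι x) (inv N) (ι t) (inv x))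

    -- A converse of `dilation` up to 8 = 2³: the y integers x with ⌊x/y⌋ = v are at most 2 y v, so
    -- each weighs at least (2 y v)⁻³.
    inflation : ∀ y J (G : ℕ → ℚ) → 1 ℕ.≤ y → (∀ v → 0ℚ ≤ G v) → G 0 ≡ 0ℚ → ∑ J (λ v → G v * inv³ v) ≤ ι 8 * ∑ (y ℕ.* J) (λ x → ι y * ι y * G (x div y) * inv³ x)
    inflation y J G 1≤y 0≤G G0 = ≤-trans (∑-mono J (λ v _ → block v)) (≤-reflexive (trans (∑-*ˡ J (ι 8) _) (cong (ι 8 *_) (sym (∑-blocks y J _)))))
      where
      block : ∀ v → G v * inv³ v ≤ ι 8 * ∑ y (λ r → ι y * ι y * G ((y ℕ.* v ℕ.+ r) div y) * inv³ (y ℕ.* v ℕ.+ r))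
      block zero = ≤-trans (≤-reflexive (*-zeroʳ (G 0))) (*-nonneg (0≤ι 8) (∑-nonneg y (λ r _ → *-nonneg (*-nonneg (sq≥0 (ι y)) (0≤G ((y ℕ.* 0 ℕ.+ r) div y))) (0≤inv³ (y ℕ.* 0 ℕ.+ r)))))
      block v@(suc _) = ≤-trans (linear (8 ⊛ ≤-reflexive (sym (cong (G v *_) (inv³-* 2 v))) ⊕ ≤-reflexive (sym (trans (cong (_* (G v * inv³ v)) (refl {x = ι 8 * inv³ 2})) (*-identityˡ (G v * inv³ v)))) ⊕ 8 ⊛ ≤-reflexive (sym (cong (G v * ι y * ι y * ι y *_) (inv³-* y (2 ℕ.* v)))) ⊕ 8 ⊛ ≤-reflexive (sym (cong (G v * inv³ (2 ℕ.* v) *_) (ι*inv 1≤y))) ⊕ 8 ⊛ ≤-reflexive (sym (cong (G v * inv³ (2 ℕ.* v) * (ι y * inv y) *_) (ι*inv 1≤y))) ⊕ 8 ⊛ ≤-reflexive (sym (cong (G v * inv³ (2 ℕ.* v) * (ι y * inv y) * (ι y * inv y) *_) (ι*inv 1≤y)))) (solve 7 (λ G w inv³2 u y z i → # 8 :* (y :* (y :* y :* G :* z)) :- G :* w := # 8 :* (G :* u) :+ # 8 :* inv³2 :* (G :* w) :+ # 8 :* (G :* y :* y :* y :* z) :+ # 8 :* (G :* u :* (y :* i)) :+ # 8 :* (G :* u :* (y :* i) :* (y :* i)) :+ # 8 :* (G :* u :* (y :* i) :* (y :* i) :* (y :* i)) :- (# 8 :* (G :* (inv³2 :* w)) :+ G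 :* w :+ # 8 :* (G :* y :* y :* y :* (i :* i :* i :* u)) :+ # 8 :* (G :* u :* # 1) :+ # 8 :* (G :* u :* (y :* i) :* # 1) :+ # 8 :* (G :* u :* (y :* i) :* (y :* i) :* # 1))) refl (G v) (inv³ v) (inv³ 2) (inv³ (2 ℕ.* v)) (ι y) (inv³ (y ℕ.* (2 ℕ.* v))) (inv y)))
        (8 ⊛ ∑-lower y _ (λ r r<y → ≤-trans (*-monoˡ (ι y * ι y * G v) (*-nonneg (sq≥0 (ι y)) (0≤G v)) (inv³-anti (ℕ.≤-trans (ℕ.*-mono-≤ 1≤y (s≤s z≤n)) (ℕ.m≤m+n (y ℕ.* v) r)) (upper r r<y)))
          (≤-reflexive (cong (λ z → ι y * ι y * G z * inv³ (y ℕ.* v ℕ.+ r)) (sym (div-unique {q = y} {v = v} (ℕ.m≤m+n (y ℕ.* v) r) (ℕ.+-monoʳ-< (y ℕ.* v) r<y)))))))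
        where
        upper : ∀ r → r ℕ.< y → y ℕ.* v ℕ.+ r ℕ.≤ y ℕ.* (2 ℕ.* v)
        upper r r<y = ℕ.≤-trans (ℕ.+-monoʳ-≤ (y ℕ.* v) (ℕ.≤-trans (ℕ.<⇒≤ r<y) (ℕ.≤-trans (ℕ.≤-reflexive (sym (ℕ.*-identityʳ y))) (ℕ.*-monoʳ-≤ y (s≤s z≤n)))))
          (ℕ.≤-reflexive (ℕ-solve 2 (λ y v → y :*ₙ v :+ₙ y :*ₙ v :=ₙ y :*ₙ (conₙ 2 :*ₙ v)) refl y v))

    g-* : ∀ y b x → ι y * g b (x div y) ≡ g (y ℕ.* b) x
    g-* y b x = trans (sym (*-assoc (ι y) (ι b) (F (x div y div b)))) (cong₂ _*_ (sym (ι-* y b)) (cong F (div-div x y b)))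

    dist-inflation : ∀ y J b b′ → 1 ℕ.≤ y → 1 ℕ.≤ b → 1 ℕ.≤ b′ → dist J b b′ ≤ ι 8 * dist (y ℕ.* J) (y ℕ.* b) (y ℕ.* b′)
    dist-inflation y J b b′ 1≤y 1≤b 1≤b′ = ≤-trans (inflation y J (λ v → sq (g b v - g b′ v)) 1≤y (λ v → sq≥0 (g b v - g b′ v)) (cong₂ (λ u v → sq (u - v)) (g-zero {b} {0} 1≤b) (g-zero {b′} {0} 1≤b′)))
      (≤-reflexive (cong (ι 8 *_) (∑-ext (y ℕ.* J) (λ x → trans (solve 4 (λ y a c w → y :* y :* ((a :- c) :* (a :- c)) :* w := (y :* a :- y :* c) :* (y :* a :- y :* c) :* w) refl (ι y) (g b (x div y)) (g b′ (x div y)) (inv³ x))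
        (cong₂ (λ u v → sq (u - v) * inv³ x) (g-* y b x) (g-* y b′ x))))))

    h-double : ∀ n → h (n ℕ.+ n) ≤ h n + 1ℚ
    h-double zero = 0≤ι 1
    h-double n@(suc _) = ≤-trans (≤-reflexive (∑-split n n inv)) (+-monoʳ-≤ (h n) (≤-trans (∑-upper n (inv n) (λ i _ → inv-anti (s≤s z≤n) (ℕ.m≤m+n n i))) (ι*inv≤1 n)))

    h-double-lower : ∀ n → 1 ℕ.≤ n → h n + inv 2 ≤ h (n ℕ.+ n)
    h-double-lower n@(suc _) _ = ≤-trans (+-monoʳ-≤ (h n) (≤-trans (≤-reflexive half) (∑-lower n (inv (n ℕ.+ n)) (λ i i<n → inv-anti (s≤s z≤n) (ℕ.+-monoʳ-≤ n (ℕ.<⇒≤ i<n)))))) (≤-reflexive (sym (∑-split n n inv)))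
      where
      half : inv 2 ≡ ι n * inv (n ℕ.+ n)
      half = trans (trans (sym (*-identityʳ (inv 2))) (cong (inv 2 *_) (sym (ι*inv {n} (s≤s z≤n))))) (trans (solve 3 (λ a n v → a :* (n :* v) := n :* (a :* v)) refl (inv 2) (ι n) (inv n)) (cong (ι n *_) (trans (sym (inv-* 2 n)) (cong (λ z → inv (n ℕ.+ z)) (ℕ.+-identityʳ n)))))

    2^suc-* : ∀ i M → 2 ℕ.^ suc i ℕ.* M ≡ 2 ℕ.^ i ℕ.* M ℕ.+ 2 ℕ.^ i ℕ.* M
    2^suc-* i M = ℕ-solve 2 (λ a M → (a :+ₙ (a :+ₙ conₙ 0)) :*ₙ M :=ₙ a :*ₙ M :+ₙ a :*ₙ M) refl (2 ℕ.^ i) M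

    h-block : ∀ i M → h (2 ℕ.^ i ℕ.* M) ≤ h M + ι i
    h-block zero M = ≤-reflexive (trans (cong h (ℕ.+-identityʳ M)) (sym (+-identityʳ (h M))))
    h-block (suc i) M = linear (≤-reflexive (cong h (2^suc-* i M)) ⊕ h-double (2 ℕ.^ i ℕ.* M) ⊕ h-block i M ⊕ ≤-reflexive (sym (ι-suc i))) (solve 6 (λ a a' b c i i' → c :+ i' :- a := a' :+ (b :+ # 1) :+ (c :+ i) :+ i' :- (a :+ a' :+ b :+ (# 1 :+ i))) refl (h (2 ℕ.^ suc i ℕ.* M)) (h (2 ℕ.^ i ℕ.* M ℕ.+ 2 ℕ.^ i ℕ.* M)) (h (2 ℕ.^ i ℕ.* M)) (h M) (ι i) (ι (suc i)))

    h-block-lower : ∀ i M → 1 ℕ.≤ M → h M + ι i * inv 2 ≤ h (2 ℕ.^ i ℕ.* M)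
    h-block-lower zero M 1≤M = ≤-reflexive (trans (cong (_+_ (h M)) (*-zeroˡ (inv 2))) (trans (+-identityʳ (h M)) (cong h (sym (ℕ.+-identityʳ M)))))
    h-block-lower (suc i) M 1≤M = linear (≤-reflexive (sym (cong h (2^suc-* i M))) ⊕ h-double-lower (2 ℕ.^ i ℕ.* M) (ℕ.*-mono-≤ (0<2^ i) 1≤M) ⊕ h-block-lower i M 1≤M ⊕ ≤-reflexive (cong (_* inv 2) (ι-suc i))) (solve 7 (λ a a' b c i i' t → a :- (c :+ i' :* t) := a :+ a' :+ b :+ (# 1 :+ i) :* t :- (a' :+ (b :+ t) :+ (c :+ i :* t) :+ i' :* t)) refl (h (2 ℕ.^ suc i ℕ.* M)) (h (2 ℕ.^ i ℕ.* M ℕ.+ 2 ℕ.^ i ℕ.* M)) (h (2 ℕ.^ i ℕ.* M)) (h M) (ι i) (ι (suc i)) (inv 2))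

    ∑-range : ∀ M T (φ : ℕ → ℚ) → M ℕ.≤ T → ∑ T (λ x → 𝟙 (M ℕ.≤? x) * φ x) ≡ ∑ T φ - ∑ M φ
    ∑-range M T φ M≤T = linear-≡ (cong₂ _+_ (trans (sym (∑-+ T _ _)) (∑-ext T term)) (sym (sym (trans (∑-cong M (λ x x<M → sym (trans (cong (_* φ x) (𝟙-yes (x ℕ.<? M) x<M)) (*-identityˡ (φ x))))) (∑-extend-≡ M≤T (λ x M≤x _ → trans (cong (_* φ x) (𝟙-no (x ℕ.<? M) (ℕ.≤⇒≯ M≤x))) (*-zeroˡ (φ x)))))))) (solve 4 (λ a b c d → b :- c :- a := b :+ d :- (a :+ d :+ c)) refl (∑ T (λ x → 𝟙 (M ℕ.≤? x) * φ x)) (∑ T φ) (∑ M φ) (∑ T (λ x → 𝟙 (x ℕ.<? M) * φ x)))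
      where
      term : ∀ x → 𝟙 (M ℕ.≤? x) * φ x + 𝟙 (x ℕ.<? M) * φ x ≡ φ x
      term x with M ℕ.≤? x
      ... | yes M≤x = trans (cong (λ z → 1ℚ * φ x + z * φ x) (𝟙-no (x ℕ.<? M) (ℕ.≤⇒≯ M≤x))) (solve 1 (λ a → # 1 :* a :+ # 0 :* a := a) refl (φ x))
      ... | no M≰x = trans (cong (λ z → 0ℚ * φ x + z * φ x) (𝟙-yes (x ℕ.<? M) (ℕ.≰⇒> M≰x))) (solve 1 (λ a → # 0 :* a :+ # 1 :* a := a) refl (φ x))

    last-index : {P : ℕ → Set} → (∀ n → Dec (P n)) → ∀ s d → P s → ∃ λ k → s ℕ.≤ k × k ℕ.≤ s ℕ.+ d × P k × (∀ i → k ℕ.< i → i ℕ.≤ s ℕ.+ d → ¬ P i)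
    last-index P? s zero ps = s , ℕ.≤-refl , ℕ.m≤m+n s 0 , ps , λ i s<i i≤s → contradiction (subst (i ℕ.≤_) (ℕ.+-identityʳ s) i≤s) (ℕ.<⇒≱ s<i)
    last-index {P} P? s (suc d) ps with P? (s ℕ.+ suc d)
    ... | yes p = s ℕ.+ suc d , ℕ.m≤m+n s (suc d) , ℕ.≤-refl , p , λ i k<i i≤k → contradiction i≤k (ℕ.<⇒≱ k<i)
    ... | no ¬p with last-index P? s d ps
    ... | k , s≤k , k≤ , pk , above = k , s≤k , ℕ.≤-trans k≤ (ℕ.+-monoʳ-≤ s (ℕ.n≤1+n d)) , pk , above′
      where
      above′ : ∀ i → k ℕ.< i → i ℕ.≤ s ℕ.+ suc d → ¬ P i
      above′ i k<i i≤ pi with i ℕ.≟ s ℕ.+ suc d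
      ... | yes refl = ¬p pi
      ... | no i≢ = above i k<i (ℕ.≤-pred (subst (i ℕ.<_) (ℕ.+-suc s d) (ℕ.≤∧≢⇒< i≤ i≢))) pi

  -- Coercivity: a small defect forces a small energy.

  module Coercivity where

    open Mertens
    open LogSum using (e; S-lower)
    open Mobius
    open Hyperbola using (Φ-bound)
    open Energy
    open Dilation
    open import Data.List using (List; []; _∷_; length)
    open import Data.List.Relation.Unary.All as All using (All; []; _∷_)
    open import Data.List.Relation.Unary.AllPairs using (AllPairs; []; _∷_)
    open import Relation.Nullary.Decidable using (¬?)

    ∑-below : ∀ M B {φ} → (∀ q → 0ℚ ≤ φ q) → ∑ M (λ q → 𝟙 (q ℕ.<? B) * φ q) ≤ ∑ B φ
    ∑-below M B {φ} 0≤φ = ≤-trans (∑-extend (ℕ.m≤n+m M B) (λ q _ _ → *-nonneg (0≤𝟙 (q ℕ.<? B)) (0≤φ q))) (≤-reflexive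
      (trans (sym (∑-extend-≡ (ℕ.m≤m+n B M) (λ q B≤q _ → trans (cong (_* φ q) (𝟙-no (q ℕ.<? B) (ℕ.≤⇒≯ B≤q))) (*-zeroˡ (φ q)))))
        (∑-cong B (λ q q<B → trans (cong (_* φ q) (𝟙-yes (q ℕ.<? B) q<B)) (*-identityˡ (φ q))))))

    ∑L : List ℕ → (ℕ → ℚ) → ℚ
    ∑L [] φ = 0ℚ
    ∑L (b ∷ bs) φ = φ b + ∑L bs φ

    ∑L-swap : ∀ bs n (w : ℕ → ℚ) (φ : ℕ → ℕ → ℚ) → ∑ n (λ y → w y * ∑L bs (λ b → φ b y)) ≡ ∑L bs (λ b → ∑ n (λ y → w y * φ b y))
    ∑L-swap [] n w φ = ∑-zero n (λ y _ → *-zeroʳ (w y))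
    ∑L-swap (b ∷ bs) n w φ = trans (∑-ext n (λ y → *-distribˡ-+ (w y) (φ b y) (∑L bs (λ b → φ b y)))) (trans (∑-+ n _ _) (cong (_+_ (∑ n (λ y → w y * φ b y))) (∑L-swap bs n w φ)))

    ∑L-lower : ∀ bs {P : ℕ → Set} {φ} v → All P bs → (∀ b → P b → v ≤ φ b) → ι (length bs) * v ≤ ∑L bs φ
    ∑L-lower [] v [] h = ≤-reflexive (*-zeroˡ v)
    ∑L-lower (b ∷ bs) {φ = φ} v (pb ∷ pbs) h = linear (≤-reflexive (cong (_* v) (ι-suc (length bs))) ⊕ ∑L-lower bs v pbs h ⊕ h b pb) (solve 5 (λ l l' v f s → f :+ s :- l' :* v := (# 1 :+ l) :* v :+ s :+ f :- (l' :* v :+ l :* v :+ v)) refl (ι (length bs)) (ι (suc (length bs))) v (φ b) (∑L bs φ))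

    ∑L-zero : ∀ bs {φ} → All (λ b → φ b ≡ 0ℚ) bs → ∑L bs φ ≡ 0ℚ
    ∑L-zero [] [] = refl
    ∑L-zero (b ∷ bs) (eq ∷ eqs) = cong₂ _+_ eq (∑L-zero bs eqs)

    ∑L-one : ∀ bs {P : ℕ → Set} {R : ℕ → ℕ → Set} {φ M} → 0ℚ ≤ M → All P bs → AllPairs R bs → (∀ b → P b → φ b ≤ M) → (∀ b b′ → P b → P b′ → R b b′ → φ b ≡ 0ℚ ⊎ φ b′ ≡ 0ℚ) → ∑L bs φ ≤ M
    ∑L-one [] 0≤M [] [] ub excl = 0≤M
    ∑L-one (b ∷ bs) {P} {R} {φ} {M} 0≤M (pb ∷ pbs) (rb ∷ rbs) ub excl with φ b ℚ.≟ 0ℚ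
    ... | yes z = linear (≤-reflexive z ⊕ ∑L-one bs 0≤M pbs rbs ub excl) (solve 3 (λ f s M → M :- (f :+ s) := # 0 :+ M :- (f :+ s)) refl (φ b) (∑L bs φ) M)
    ... | no nz = linear (ub b pb ⊕ ≤-reflexive (∑L-zero bs (others bs pbs rb))) (solve 3 (λ f s M → M :- (f :+ s) := M :+ # 0 :- (f :+ s)) refl (φ b) (∑L bs φ) M)
      where
      others : ∀ bs → All P bs → All (R b) bs → All (λ b → φ b ≡ 0ℚ) bs
      others [] [] [] = []
      others (c ∷ cs) (pc ∷ pcs) (rc ∷ rcs) with excl b c pb pc rc
      ... | inj₁ z = contradiction z nz
      ... | inj₂ z = z ∷ others cs pcs rcs

    inv-*-cancel : ∀ {n} a b → 1 ℕ.≤ n → a * inv n ≤ b * inv n → a ≤ b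
    inv-*-cancel {n} a b 1≤n q = linear (*-monoˡ (ι n) (0≤ι n) q ⊕ ≤-reflexive (sym (cong (a *_) (ι*inv 1≤n))) ⊕ ≤-reflexive (cong (b *_) (ι*inv 1≤n))) (solve 4 (λ a b n v → b :- a := n :* (b :* v) :+ a :* (n :* v) :+ b :* # 1 :- (n :* (a :* v) :+ a :* # 1 :+ b :* (n :* v))) refl a b (ι n) (inv n))

    module _ (r k c : ℕ) (1≤k : 1 ℕ.≤ k) (1≤c : 1 ℕ.≤ c) (scales : E (24 ℕ.* r) + ι (k ℕ.+ c ℕ.+ 7) ≤ ι r) where

      -- 1/N is the width of the windows and [N, 2^c N) the range of b. The multiplier y runs over
      -- [Y, Y′) and the primes q over [Q₀, Y′). The sizes fit together: Y′ J = X, so dilating by y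
      -- < Y′ stays below X, and q ≥ Q₀ gives q/b ≥ 4 Y for every b in the range.
      N X J Y Y′ Q₀ : ℕ
      N = 2 ℕ.^ k
      X = 2 ℕ.^ (24 ℕ.* r)
      J = 2 ℕ.^ (18 ℕ.* r)
      Y = 2 ℕ.^ (3 ℕ.* r)
      Y′ = 2 ℕ.^ (6 ℕ.* r)
      Q₀ = 2 ℕ.^ (3 ℕ.* r ℕ.+ (k ℕ.+ c ℕ.+ 2))

      k+c+7≤r : k ℕ.+ c ℕ.+ 7 ℕ.≤ r
      k+c+7≤r = ι-cancel (linear (scales ⊕ ≤-trans (0≤ι 12) (12≤E (24 ℕ.* r))) (solve 3 (λ e a r → r :- a := r :+ e :- (e :+ a :+ # 0)) refl (E (24 ℕ.* r)) (ι (k ℕ.+ c ℕ.+ 7)) (ι r)))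

      1≤r : 1 ℕ.≤ r
      1≤r = ℕ-linear k+c+7≤r (ℕ-solve 3 (λ k c r → conₙ 1 :+ₙ (r :+ₙ (conₙ 6 :+ₙ c :+ₙ k)) :=ₙ r :+ₙ (k :+ₙ c :+ₙ conₙ 7)) refl k c r)

      1≤N : 1 ℕ.≤ N
      1≤N = 0<2^ k

      2≤N : 2 ℕ.≤ N
      2≤N = 2^-mono {1} {k} 1≤k

      -- δ′ is the bound on the mean resonance of a good prime, set so that bad primes have total
      -- weight at most r, and its 1 keeps it positive. L is the cost of moving inside a window. δ
      -- is the outcome of `pair`: 8 from `dist-inflation` times 4 from squaring a sum of four
      -- terms, applied to 2 L, 2 δ′ and c + 1.
      δ′ L δ : ℚ
      δ′ = Δ (24 ℕ.* r) * inv r + 1ℚ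
      L = ι 8 * (inv N * inv N * ι (24 ℕ.* r)) + ι 16
      δ = ι 64 * L + ι 64 * δ′ + ι 32 * (ι c + 1ℚ)

      0≤δ′ : 0ℚ ≤ δ′
      0≤δ′ = *-nonneg (0≤Δ (24 ℕ.* r)) (0≤inv r) ⊕ 0≤ι 1

      0≤L : 0ℚ ≤ L
      0≤L = *-nonneg (0≤ι 8) (*-nonneg (sq≥0 (inv N)) (0≤ι (24 ℕ.* r))) ⊕ 0≤ι 16

      L≤δ : L ≤ δ
      L≤δ = linear (63 ⊛ 0≤L ⊕ 64 ⊛ 0≤δ′ ⊕ 32 ⊛ 0≤ι c ⊕ 0≤ι 32) (solve 3 (λ L d c → # 64 :* L :+ # 64 :* d :+ # 32 :* (c :+ # 1) :- L := # 63 :* L :+ # 64 :* d :+ # 32 :* c :+ # 32 :- (# 63 :* # 0 :+ # 64 :* # 0 :+ # 32 :* # 0 :+ # 0)) refl L δ′ (ι c))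

      0≤δ : 0ℚ ≤ δ
      0≤δ = ≤-trans 0≤L L≤δ

      lip′ : ∀ {Z} t q → Z ℕ.≤ X → 1 ℕ.≤ t → t ℕ.≤ q → N ℕ.* q ℕ.≤ suc N ℕ.* t → dist Z q t ≤ L
      lip′ t q Z≤X 1≤t t≤q Nq≤ = ≤-trans (dist-mono q t Z≤X) (lip (24 ℕ.* r) N t q 1≤N 1≤t t≤q Nq≤)

      J≤X : J ℕ.≤ X
      J≤X = 2^-mono (ℕ.*-monoˡ-≤ r (ℕ.m≤m+n 18 6))

      res : ℕ → ℕ → ℚ
      res q x = 𝟙 (q ℕ.≤? x) * (resonance x q * inv³ x)

      0≤res : ∀ q x → 0ℚ ≤ res q x
      0≤res q x = *-nonneg (0≤𝟙 (q ℕ.≤? x)) (*-nonneg (sq≥0 (F x + ι q * F (x div q))) (0≤inv³ x))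

      ε : ℕ → ℚ
      ε q = ∑ X (res q)

      Δ-ε : Δ (24 ℕ.* r) ≡ ∑ X (λ q → Λ q * inv q * ε q)
      Δ-ε = trans (∑-cong X row) (trans (∑-swap X X _) (∑-ext X (λ q → ∑-*ˡ X (Λ q * inv q) (res q))))
        where
        row : ∀ x → x ℕ.< X → inv³ x * ∑ (suc x) (λ q → Λ q * inv q * resonance x q) ≡ ∑ X (λ q → Λ q * inv q * res q x)
        row x x<X = trans (sym (∑-*ˡ (suc x) (inv³ x) _)) (trans (∑-cong (suc x) (λ q q≤x → trans (solve 3 (λ w l s → w :* (l :* s) := l :* (# 1 :* (s :* w))) refl (inv³ x) (Λ q * inv q) (resonance x q)) (cong (λ i → Λ q * inv q * (i * (resonance x q * inv³ x))) (sym (𝟙-yes (q ℕ.≤? x) (ℕ.≤-pred q≤x))))))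
          (∑-extend-≡ x<X (λ q x<q _ → trans (cong (λ i → Λ q * inv q * (i * (resonance x q * inv³ x))) (𝟙-no (q ℕ.≤? x) (ℕ.<⇒≱ x<q))) (solve 2 (λ l a → l :* (# 0 :* a) := # 0) refl (Λ q * inv q) (resonance x q * inv³ x)))))

      Good : ℕ → Set
      Good q = ε q ≤ δ′

      good? : ∀ q → Dec (Good q)
      good? q = ε q ≤? δ′

      Window : ℕ → ℕ → Set
      Window t q = t ℕ.≤ q × N ℕ.* q ℕ.≤ suc N ℕ.* t

      window? : ∀ t q → Dec (Window t q)
      window? t q = (t ℕ.≤? q) ×-dec (N ℕ.* q ℕ.≤? suc N ℕ.* t)

      InRange : ℕ → Set
      InRange b = N ℕ.≤ b × b ℕ.< 2 ℕ.^ c ℕ.* N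

      -- In mean square each function is close to the next in the chain y b₁, q₁, - F, q₂, y b₂: the
      -- outer links by the windows, the inner ones because the primes are good. `dist-inflation`
      -- then divides out y.
      pair : ∀ y b₁ b₂ q₁ q₂ → 1 ℕ.≤ y → y ℕ.< Y′ → InRange b₁ → InRange b₂ → Good q₁ → Good q₂ → Window (y ℕ.* b₁) q₁ → Window (y ℕ.* b₂) q₂ → dist J b₁ b₂ ≤ δ
      pair y b₁ b₂ q₁ q₂ 1≤y y<Y′ (N≤b₁ , b₁<) (N≤b₂ , b₂<) good₁ good₂ win₁ win₂ = ≤-trans (dist-inflation y J b₁ b₂ 1≤y (ℕ.≤-trans 1≤N N≤b₁) (ℕ.≤-trans 1≤N N≤b₂))
          (linear (8 ⊛ total ⊕ 32 ⊛ lip′ B₁ q₁ Z≤X 1≤B₁ (proj₁ win₁) (proj₂ win₁) ⊕ 32 ⊛ lip′ B₂ q₂ Z≤X 1≤B₂ (proj₁ win₂) (proj₂ win₂) ⊕ 32 ⊛ ∑-extend Z≤X (λ x _ _ → 0≤res q₁ x) ⊕ 32 ⊛ good₁ ⊕ 32 ⊛ ∑-extend Z≤X (λ x _ _ → 0≤res q₂ x) ⊕ 32 ⊛ good₂ ⊕ 32 ⊛ near-sum) (solve 11 (λ d a₁ a₂ e₁ e₂ e₁' e₂' s L δ′ c → # 64 :* L :+ # 64 :* δ′ :+ # 32 :* (c :+ # 1) :- # 8 :* d := # 8 :* (# 4 :* (a₁ :+ e₁ :+ (e₂ :+ a₂)) :+ # 4 :* s) :+ # 32 :* L :+ # 32 :*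 L :+ # 32 :* e₁' :+ # 32 :* δ′ :+ # 32 :* e₂' :+ # 32 :* δ′ :+ # 32 :* (c :+ # 1) :- (# 8 :* d :+ # 32 :* a₁ :+ # 32 :* a₂ :+ # 32 :* e₁ :+ # 32 :* e₁' :+ # 32 :* e₂ :+ # 32 :* e₂' :+ # 32 :* s)) refl (dist Z B₁ B₂) (dist Z q₁ B₁) (dist Z q₂ B₂) (∑ Z (res q₁)) (∑ Z (res q₂)) (ε q₁) (ε q₂) (∑ Z near₀) L δ′ (ι c)))
        where
        Z B₁ B₂ M Tp : ℕ
        Z = y ℕ.* J
        B₁ = y ℕ.* b₁
        B₂ = y ℕ.* b₂
        M = y ℕ.* N
        Tp = 2 ℕ.^ suc c ℕ.* M
        M≤B : ∀ {b} → N ℕ.≤ b → M ℕ.≤ y ℕ.* b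
        M≤B = ℕ.*-monoʳ-≤ y
        1≤B₁ : 1 ℕ.≤ B₁
        1≤B₁ = ℕ.*-mono-≤ 1≤y (ℕ.≤-trans 1≤N N≤b₁)
        1≤B₂ : 1 ℕ.≤ B₂
        1≤B₂ = ℕ.*-mono-≤ 1≤y (ℕ.≤-trans 1≤N N≤b₂)
        Z≤X : Z ℕ.≤ X
        Z≤X = ℕ.≤-trans (ℕ.*-monoˡ-≤ J (ℕ.<⇒≤ y<Y′)) (ℕ.≤-reflexive (trans (sym (ℕ.^-distribˡ-+-* 2 (6 ℕ.* r) (18 ℕ.* r))) (cong (2 ℕ.^_) (ℕ-solve 1 (λ r → conₙ 6 :*ₙ r :+ₙ conₙ 18 :*ₙ r :=ₙ conₙ 24 :*ₙ r) refl r))))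
        q<T : ∀ {b q} → b ℕ.< 2 ℕ.^ c ℕ.* N → Window (y ℕ.* b) q → q ℕ.< Tp
        q<T {b} {q} b< (_ , Nq≤) = ℕ.≤-<-trans {q} {2 ℕ.* (y ℕ.* b)} (ℕ.*-cancelˡ-≤ N {{ℕ.>-nonZero 1≤N}} (ℕ.≤-trans Nq≤ (ℕ-linear (ℕ.*-monoˡ-≤ (y ℕ.* b) 1≤N) (ℕ-solve 2 (λ N B → (conₙ 1 :+ₙ N) :*ₙ B :+ₙ (N :*ₙ B :+ₙ conₙ 0) :=ₙ N :*ₙ (conₙ 2 :*ₙ B) :+ₙ conₙ 1 :*ₙ B) refl N (y ℕ.* b)))))
          (subst (2 ℕ.* (y ℕ.* b) ℕ.<_) (ℕ-solve 3 (λ y C N → conₙ 2 :*ₙ (y :*ₙ (C :*ₙ N)) :=ₙ (C :+ₙ (C :+ₙ conₙ 0)) :*ₙ (y :*ₙ N)) refl y (2 ℕ.^ c) N) (ℕ.*-monoʳ-< 2 (ℕ.*-monoʳ-< y {{ℕ.>-nonZero 1≤y}} b<)))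
        T≤Z : Tp ℕ.≤ Z
        T≤Z = ℕ.≤-trans (ℕ.≤-reflexive (trans (ℕ-solve 3 (λ C y N → C :*ₙ (y :*ₙ N) :=ₙ y :*ₙ (C :*ₙ N)) refl (2 ℕ.^ suc c) y N) (cong (y ℕ.*_) (sym (ℕ.^-distribˡ-+-* 2 (suc c) k))))) (ℕ.*-monoʳ-≤ y (2^-mono {suc c ℕ.+ k} {18 ℕ.* r} (ℕ-linear (18 ⊛ₙ k+c+7≤r) (ℕ-solve 3 (λ c k r → conₙ 1 :+ₙ c :+ₙ k :+ₙ (conₙ 18 :*ₙ r :+ₙ (conₙ 125 :+ₙ conₙ 17 :*ₙ c :+ₙ conₙ 17 :*ₙ k)) :=ₙ conₙ 18 :*ₙ r :+ₙ conₙ 18 :*ₙ (k :+ₙ c :+ₙ conₙ 7)) refl c k r))))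
        M≤T : M ℕ.≤ Tp
        M≤T = ℕ.≤-trans (ℕ.≤-reflexive (sym (ℕ.*-identityˡ M))) (ℕ.*-monoˡ-≤ M (0<2^ (suc c)))
        -- For x below one of the primes goodness says nothing, and the trivial bound |g| ≤ x is
        -- used. There x < Tp, and both functions vanish for x < M, so c + 1 octaves remain, of
        -- harmonic weight at most c + 1.
        near₀ : ℕ → ℚ
        near₀ x = 𝟙 (M ℕ.≤? x) * (𝟙 (x ℕ.<? Tp) * inv x)
        0≤near₀ : ∀ x → 0ℚ ≤ near₀ x
        0≤near₀ x = *-nonneg (0≤𝟙 (M ℕ.≤? x)) (*-nonneg (0≤𝟙 (x ℕ.<? Tp)) (0≤inv x))
        near-sum : ∑ Z near₀ ≤ ι c + 1ℚ
        near-sum = ≤-trans (≤-reflexive (trans (sym (∑-extend-≡ T≤Z (λ x T≤x _ → trans (cong (λ i → 𝟙 (M ℕ.≤? x) * (i * inv x)) (𝟙-no (x ℕ.<? Tp) (ℕ.≤⇒≯ T≤x))) (solve 2 (λ i v → i :* (# 0 :* v) := # 0) refl (𝟙 (M ℕ.≤? x)) (inv x)))))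
          (trans (∑-cong Tp (λ x x<T → cong (𝟙 (M ℕ.≤? x) *_) (trans (cong (_* inv x) (𝟙-yes (x ℕ.<? Tp) x<T)) (*-identityˡ (inv x))))) (∑-range M Tp inv M≤T))))
          (linear (h-block (suc c) M ⊕ ≤-reflexive (ι-suc c)) (solve 4 (λ a b c' c → c :+ # 1 :- (a :- b) := b :+ c' :+ (# 1 :+ c) :- (a :+ c')) refl (h Tp) (h M) (ι (suc c)) (ι c)))
        total : dist Z B₁ B₂ ≤ ι 4 * (dist Z q₁ B₁ + ∑ Z (res q₁) + (∑ Z (res q₂) + dist Z q₂ B₂)) + ι 4 * ∑ Z near₀
        total = ≤-trans (∑-mono Z (λ x _ → term x)) (≤-reflexive (trans (∑-+ Z _ _) (cong₂ _+_ (trans (∑-*ˡ Z (ι 4) _) (cong (ι 4 *_) (trans (∑-+ Z _ _) (cong₂ _+_ (∑-+ Z _ _) (∑-+ Z _ _))))) (∑-*ˡ Z (ι 4) near₀))))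
          where
          term : ∀ x → sq (g B₁ x - g B₂ x) * inv³ x ≤ ι 4 * (sq (g q₁ x - g B₁ x) * inv³ x + res q₁ x + (res q₂ x + sq (g q₂ x - g B₂ x) * inv³ x)) + ι 4 * near₀ x
          term x = dec-elim ((q₁ ℕ.≤? x) ×-dec (q₂ ℕ.≤? x)) both ¬both-case
            where
            both : q₁ ℕ.≤ x × q₂ ℕ.≤ x → sq (g B₁ x - g B₂ x) * inv³ x ≤ ι 4 * (sq (g q₁ x - g B₁ x) * inv³ x + res q₁ x + (res q₂ x + sq (g q₂ x - g B₂ x) * inv³ x)) + ι 4 * near₀ x
            both (q₁≤x , q₂≤x) = linear (4 ⊛ 0≤near₀ x ⊕ 4 ⊛ ≤-reflexive (sym (cong (_* (resonance x q₁ * inv³ x)) (𝟙-yes (q₁ ℕ.≤? x) q₁≤x))) ⊕ 4 ⊛ ≤-reflexive (sym (cong (_* (resonance x q₂ * inv³ x)) (𝟙-yes (q₂ ℕ.≤? x) q₂≤x))) ⊕ 2 ⊛ *-monoʳ (inv³ x) (0≤inv³ x) (sq≥0 ((g q₁ x - g B₁ x) + (F x + g q₁ x))) ⊕ 2 ⊛ *-monoʳ (inv³ x) (0≤inv³ x) (sq≥0 ((g q₂ x - g B₂ x) + (F x + g q₂ x))) ⊕ *-monoʳ (inv³ x) (0≤inv³ x) (sq≥0 ((g q₁ x - g B₁ x) - (F x + g q₁ x) + ((g q₂ x - g B₂ x) - (F x + g q₂ x))))) (solve 9 (λ F a b c d w s r₁ r₂ → # 4 :* ((a :- b) :* (a :-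 b) :* w :+ r₁ :+ (r₂ :+ (c :- d) :* (c :- d) :* w)) :+ # 4 :* s :- (b :- d) :* (b :- d) :* w := # 4 :* s :+ # 4 :* r₁ :+ # 4 :* r₂ :+ # 2 :* ((a :- b :+ (F :+ a)) :* (a :- b :+ (F :+ a)) :* w) :+ # 2 :* ((c :- d :+ (F :+ c)) :* (c :- d :+ (F :+ c)) :* w) :+ (a :- b :- (F :+ a) :+ (c :- d :- (F :+ c))) :* (a :- b :- (F :+ a) :+ (c :- d :- (F :+ c))) :* w :- (# 4 :* # 0 :+ # 4 :* (# 1 :* ((F :+ a) :* (F :+ a) :* w)) :+ # 4 :* (# 1 :* ((F :+ c) :* (F :+ c) :* w)) :+ # 2 :* (# 0 :* w) :+ # 2 :* (# 0 :* w) :+ # 0 :* w)) refl (F x) (g q₁ x) (g B₁ x) (g q₂ x) (g B₂ x) (inv³ x) (near₀ x) (res q₁ x) (res q₂ x))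
            x<T : ¬ (q₁ ℕ.≤ x × q₂ ℕ.≤ x) → x ℕ.< Tp
            x<T ¬both = dec-elim (q₁ ℕ.≤? x) (λ q₁≤x → ℕ.<-trans (ℕ.≰⇒> (λ q₂≤x → ¬both (q₁≤x , q₂≤x))) (q<T b₂< win₂)) (λ q₁≰x → ℕ.<-trans (ℕ.≰⇒> q₁≰x) (q<T b₁< win₁))
            far : x ℕ.< Tp → sq (g B₁ x - g B₂ x) * inv³ x ≤ ι 4 * near₀ x
            far x<T = 𝟙-elim (M ℕ.≤? x) (λ i → sq (g B₁ x - g B₂ x) * inv³ x ≤ ι 4 * (i * (𝟙 (x ℕ.<? Tp) * inv x)))
              (λ _ → (linear (*-monoʳ (inv³ x) (0≤inv³ x) (sq-≤ {g B₁ x - g B₂ x} {ι 2 * ι x} diff) ⊕ 4 ⊛ ≤-reflexive (ι²inv³ x) ⊕ 4 ⊛ ≤-reflexive (sym (cong (_* inv x) (𝟙-yes (x ℕ.<? Tp) x<T)))) (solve 5 (λ D w x v u → # 4 :* (# 1 :* (u :* v)) :- D :* D :* w := # 2 :* x :* (# 2 :* x) :* w :+ # 4 :* v :+ # 4 :* (u :* v) :- (D :* D :* w :+ # 4 :* (x :* x :* w) :+ # 4 :* (# 1 :* v))) refl (g B₁ x - g B₂ x) (inv³ x) (ι x) (inv x) (𝟙 (x ℕ.<? Tp)))))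
              (λ M≰x → ≤-reflexive (trans (cong₂ (λ a b → sq (a - b) * inv³ x) (g-zero (ℕ.<-≤-trans (ℕ.≰⇒> M≰x) (M≤B N≤b₁))) (g-zero (ℕ.<-≤-trans (ℕ.≰⇒> M≰x) (M≤B N≤b₂)))) (solve 2 (λ w u → (# 0 :- # 0) :* (# 0 :- # 0) :* w := # 4 :* (# 0 :* u)) refl (inv³ x) (𝟙 (x ℕ.<? Tp) * inv x))))
              where
              diff : ∣ g B₁ x - g B₂ x ∣ ≤ ι 2 * ι x
              diff = linear (∣p-q∣≤∣p∣+∣q∣ (g B₁ x) (g B₂ x) ⊕ ∣g∣≤ B₁ x ⊕ ∣g∣≤ B₂ x) (solve 4 (λ D a b x → # 2 :* x :- D := a :+ b :+ x :+ x :- (D :+ a :+ b)) refl (∣ g B₁ x - g B₂ x ∣) (∣ g B₁ x ∣) (∣ g B₂ x ∣) (ι x))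
            ¬both-case : ¬ (q₁ ℕ.≤ x × q₂ ℕ.≤ x) → sq (g B₁ x - g B₂ x) * inv³ x ≤ ι 4 * (sq (g q₁ x - g B₁ x) * inv³ x + res q₁ x + (res q₂ x + sq (g q₂ x - g B₂ x) * inv³ x)) + ι 4 * near₀ x
            ¬both-case ¬both = linear (far (x<T ¬both) ⊕ 4 ⊛ dist-term≥0 q₁ B₁ x ⊕ 4 ⊛ 0≤res q₁ x ⊕ 4 ⊛ 0≤res q₂ x ⊕ 4 ⊛ dist-term≥0 q₂ B₂ x) (solve 6 (λ l a b c d s → # 4 :* (a :+ b :+ (c :+ d)) :+ # 4 :* s :- l := # 4 :* s :+ # 4 :* a :+ # 4 :* b :+ # 4 :* c :+ # 4 :* d :- (l :+ # 4 :* # 0 :+ # 4 :* # 0 :+ # 4 :* # 0 :+ # 4 :* # 0)) refl (sq (g B₁ x - g B₂ x) * inv³ x) (sq (g q₁ x - g B₁ x) * inv³ x) (res q₁ x) (res q₂ x) (sq (g q₂ x - g B₂ x) * inv³ x) (near₀ x))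

      gq : ℕ → ℚ
      gq q = Λ q * inv q * (𝟙 (good? q) * 𝟙 (Q₀ ℕ.≤? q))

      0≤Λinv : ∀ q → 0ℚ ≤ Λ q * inv q
      0≤Λinv q = *-nonneg (0≤Λ q) (0≤inv q)

      0≤gq : ∀ q → 0ℚ ≤ gq q
      0≤gq q = *-nonneg (0≤Λinv q) (*-nonneg (0≤𝟙 (good? q)) (0≤𝟙 (Q₀ ℕ.≤? q)))

      gq≤ : ∀ q → gq q ≤ Λ′ q * inv q
      gq≤ q = linear (*-monoˡ (Λ q * inv q * 𝟙 (good? q)) (*-nonneg (0≤Λinv q) (0≤𝟙 (good? q))) (𝟙≤1 (Q₀ ℕ.≤? q)) ⊕ *-monoˡ (Λ q * inv q) (0≤Λinv q) (𝟙≤1 (good? q)) ⊕ *-monoʳ (inv q) (0≤inv q) (Λ≤Λ′ q)) (solve 5 (λ l m v i j → m :* v :- l :* v :* (i :* j) := l :* v :* i :* # 1 :+ l :* v :* # 1 :+ m :* v :- (l :* v :* i :* j :+ l :* v :* i :+ l :* v)) refl (Λ q) (Λ′ q) (inv q) (𝟙 (good? q)) (𝟙 (Q₀ ℕ.≤? q)))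

      -- The total weight of the good primes in the window (y b , y b (1 + 1/N)].
      weight : ℕ → ℕ → ℚ
      weight b y = ∑ Y′ (λ q → gq q * 𝟙 (window? (y ℕ.* b) q))

      -- The window is contained in an interval of length z + 1 with z = ⌊t/N⌋ above t - 1, where
      -- `window-bound` applies. The factor 2 is z + 1 ≤ 2 t/N, as t ≥ N.
      weight-bound : ∀ b y → Y ℕ.≤ y → N ℕ.≤ b → weight b y ≤ ι (2 ℕ.* (k ℕ.+ 3)) * inv N
      weight-bound b y Y≤y N≤b = bound (y ℕ.* b) 4≤t N≤t
        where
        8≤Y : 8 ℕ.≤ Y
        8≤Y = 2^-mono {3} {3 ℕ.* r} (ℕ.*-monoʳ-≤ 3 1≤r)
        4≤t : 4 ℕ.≤ y ℕ.* b
        4≤t = ℕ.*-mono-≤ {4} {y} {1} {b} (ℕ.≤-trans (ℕ.≤-trans (ℕ.m≤m+n 4 4) 8≤Y) Y≤y) (ℕ.≤-trans 1≤N N≤b)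
        N≤t : N ℕ.≤ y ℕ.* b
        N≤t = ℕ.≤-trans (ℕ.≤-reflexive (sym (ℕ.*-identityˡ N))) (ℕ.*-mono-≤ (ℕ.≤-trans (ℕ.≤-trans (ℕ.m≤m+n 1 7) 8≤Y) Y≤y) N≤b)
        bound : ∀ t → 4 ℕ.≤ t → N ℕ.≤ t → ∑ Y′ (λ q → gq q * 𝟙 (window? t q)) ≤ ι (2 ℕ.* (k ℕ.+ 3)) * inv N
        bound t@(suc t₀) 4≤t N≤t = ≤-trans (∑-mono Y′ (λ q _ → term q)) (≤-trans (≤-reflexive (∑-*ˡ Y′ (inv t) _)) (≤-trans (*-monoˡ (inv t) (0≤inv t) (≤-trans (∑-below Y′ B (λ q → 0≤lw q)) (window-bound k t₀ (suc z) z<t₀ t₀≤))) final))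
          where
          z B : ℕ
          z = t div N
          B = suc (t₀ ℕ.+ suc z)
          lw : ℕ → ℚ
          lw q = 𝟙 (prime? q ×-dec t₀ ℕ.<? q) * ι (lg q)
          0≤lw : ∀ q → 0ℚ ≤ lw q
          0≤lw q = *-nonneg (0≤𝟙 (prime? q ×-dec t₀ ℕ.<? q)) (0≤ι (lg q))
          2z≤t : 2 ℕ.* z ℕ.≤ t
          2z≤t = ℕ.≤-trans (ℕ.*-monoˡ-≤ z 2≤N) (div-lower t N)
          z<t₀ : suc z ℕ.≤ t₀
          z<t₀ = ℕ-linear-by 1 (2z≤t ⊕ₙ 4≤t) (ℕ-solve 2 (λ z t₀ → conₙ 2 :*ₙ (conₙ 1 :+ₙ z) :+ₙ (conₙ 1 :+ₙ t₀ :+ₙ (conₙ 1 :+ₙ t₀) :+ₙ conₙ 0) :=ₙ conₙ 2 :*ₙ t₀ :+ₙ (conₙ 2 :*ₙ z :+ₙ conₙ 4)) refl z t₀)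
          t₀≤ : t₀ ℕ.≤ N ℕ.* suc z
          t₀≤ = ℕ-linear (div-upper t {N} 1≤N ⊕ₙ ℕ.≤-reflexive (sym (ℕ.*-suc N z))) (ℕ-solve 4 (λ t₀ a b N → t₀ :+ₙ (b :+ₙ N :+ₙ a :+ₙ conₙ 2) :=ₙ a :+ₙ (conₙ 1 :+ₙ (conₙ 1 :+ₙ t₀) :+ₙ (N :+ₙ b))) refl t₀ (N ℕ.* suc z) (N ℕ.* z) N)
          term : ∀ q → gq q * 𝟙 (window? t q) ≤ inv t * (𝟙 (q ℕ.<? B) * lw q)
          term q = 𝟙-elim (window? t q) (λ i → gq q * i ≤ inv t * (𝟙 (q ℕ.<? B) * lw q)) inside (λ _ → ≤-trans (≤-reflexive (*-zeroʳ (gq q))) (*-nonneg (0≤inv t) (*-nonneg (0≤𝟙 (q ℕ.<? B)) (0≤lw q))))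
            where
            inside : Window t q → gq q * 1ℚ ≤ inv t * (𝟙 (q ℕ.<? B) * lw q)
            inside (t≤q , Nq≤) = linear (gq≤ q ⊕ *-monoˡ (Λ′ q) (0≤Λ′ q) (inv-anti {t} (s≤s z≤n) t≤q) ⊕ *-monoʳ (inv t) (0≤inv t) l≤w ⊕ ≤-reflexive (sym (cong (_* (inv t * lw q)) (𝟙-yes (q ℕ.<? B) q<B)))) (solve 6 (λ a l v u i w → u :* (i :* w) :- a :* # 1 := l :* v :+ l :* u :+ w :* u :+ i :* (u :* w) :- (a :+ l :* v :+ l :* u :+ # 1 :* (u :* w))) refl (gq q) (Λ′ q) (inv q) (inv t) (𝟙 (q ℕ.<? B)) (lw q))
              where
              l≤w : Λ′ q ≤ lw q
              l≤w = *-monoʳ (ι (lg q)) (0≤ι (lg q)) (𝟙-mono (prime? q) (prime? q ×-dec t₀ ℕ.<? q) (λ pr → pr , t≤q))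
              q<B : q ℕ.< B
              q<B = ℕ.*-cancelˡ-< N q B (ℕ.≤-<-trans Nq≤ (ℕ-linear (div-upper t {N} 1≤N ⊕ₙ ℕ.≤-reflexive (sym (ℕ.*-suc N (t₀ ℕ.+ suc z))) ⊕ₙ ℕ.≤-reflexive (trans (cong (N ℕ.* t₀ ℕ.+_) (sym (ℕ.*-suc N z))) (sym (ℕ.*-distribˡ-+ N t₀ (suc z))))) (ℕ-solve 5 (λ t₀ N b c d → conₙ 1 :+ₙ (conₙ 1 :+ₙ N) :*ₙ (conₙ 1 :+ₙ t₀) :+ₙ (b :+ₙ N :+ₙ c :+ₙ d :+ₙ conₙ 0) :=ₙ c :+ₙ (conₙ 1 :+ₙ (conₙ 1 :+ₙ t₀) :+ₙ (N :+ₙ d) :+ₙ (N :*ₙ t₀ :+ₙ (N :+ₙ b)))) refl t₀ N (N ℕ.* z) (N ℕ.* B) (N ℕ.* (t₀ ℕ.+ suc z)))))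
          final : inv t * ι ((k ℕ.+ 3) ℕ.* suc z) ≤ ι (2 ℕ.* (k ℕ.+ 3)) * inv N
          final = linear (≤-reflexive (cong (inv t *_) (ι-* (k ℕ.+ 3) (suc z))) ⊕ ≤-reflexive (sym (cong (_* inv N) (ι-* 2 (k ℕ.+ 3)))) ⊕ *-monoˡ (ι (k ℕ.+ 3)) (0≤ι (k ℕ.+ 3)) zt) (solve 6 (λ u s K z' d v → d :* v :- u :* s := u :* (K :* z') :+ d :* v :+ K :* (# 2 :* v) :- (u :* s :+ # 2 :* K :* v :+ K :* (u :* z'))) refl (inv t) (ι ((k ℕ.+ 3) ℕ.* suc z)) (ι (k ℕ.+ 3)) (ι (suc z)) (ι (2 ℕ.* (k ℕ.+ 3))) (inv N))
            where
            zt : inv t * ι (suc z) ≤ ι 2 * inv N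
            zt = cancel-* (ι t) (0<ι _) (cancel-* (ι N) (0<ι′ 1≤N) (linear (≤-reflexive (cong (ι N * ι (suc z) *_) (ι*inv {t} (s≤s z≤n))) ⊕ ≤-reflexive (cong (ι N *_) (ι-suc z)) ⊕ ι-*≤ N z (div-lower t N) ⊕ ι-mono N≤t ⊕ 2 ⊛ ≤-reflexive (sym (cong (ι t *_) (ι*inv 1≤N)))) (solve 6 (λ n t u z' z v → n :* (t :* (# 2 :* v)) :- n :* (t :* (u :* z')) := n :* z' :* # 1 :+ n :* (# 1 :+ z) :+ t :+ t :+ # 2 :* (t :* (n :* v)) :- (n :* z' :* (t :* u) :+ n :* z' :+ n :* z :+ n :+ # 2 :* (t :* # 1))) refl (ι N) (ι t) (inv t) (ι (suc z)) (ι z) (inv N))))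

      -- Given q and b, the admissible y form an interval ending at y₁ = ⌊q/b⌋ of relative length
      -- about 1/N. Only the last ⌊y₁/4N⌋ of them are counted, which leaves room for all roundings.
      window-count : ∀ b q → InRange b → Q₀ ℕ.≤ q → q ℕ.< Y′ → inv 8 * inv N ≤ ∑ Y′ (λ y → 𝟙 (Y ℕ.≤? y) * (inv y * 𝟙 (window? (y ℕ.* b) q)))
      window-count b q (N≤b , b<) Q₀≤q q<Y′ = ≤-trans low (≤-trans (∑-lower n (inv y₁) term) (≤-trans (≤-trans (≤-reflexive (sym (+-identityˡ (∑ n _)))) (+-monoˡ-≤ (∑ n (λ j → φ (y₀ ℕ.+ j))) (∑-nonneg y₀ (λ y _ → 0≤φ y))))
          (≤-trans (≤-reflexive (sym (∑-split y₀ n φ))) (∑-extend y₀+n≤ (λ y _ _ → 0≤φ y)))))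
        where
        φ : ℕ → ℚ
        φ y = 𝟙 (Y ℕ.≤? y) * (inv y * 𝟙 (window? (y ℕ.* b) q))
        0≤φ : ∀ y → 0ℚ ≤ φ y
        0≤φ y = *-nonneg (0≤𝟙 (Y ℕ.≤? y)) (*-nonneg (0≤inv y) (0≤𝟙 (window? (y ℕ.* b) q)))
        1≤b = ℕ.≤-trans 1≤N N≤b
        y₁ n y₀ : ℕ
        y₁ = q div b
        n = y₁ div (4 ℕ.* N)
        y₀ = suc y₁ ℕ.∸ n
        1≤4N : 1 ℕ.≤ 4 ℕ.* N
        1≤4N = ℕ.*-mono-≤ {1} {4} (s≤s z≤n) 1≤N
        big : 2 ℕ.^ (3 ℕ.* r ℕ.+ 2) ℕ.≤ y₁
        big = div-≥ 1≤b (ℕ.≤-trans (ℕ.*-monoˡ-≤ (2 ℕ.^ (3 ℕ.* r ℕ.+ 2)) (ℕ.<⇒≤ b<)) (ℕ.≤-trans (ℕ.≤-reflexive (trans (cong (ℕ._* 2 ℕ.^ (3 ℕ.* r ℕ.+ 2)) (sym (ℕ.^-distribˡ-+-* 2 c k))) (trans (sym (ℕ.^-distribˡ-+-* 2 (c ℕ.+ k) (3 ℕ.* r ℕ.+ 2))) (cong (2 ℕ.^_) (ℕ-solve 3 (λ c k r → c :+ₙ k :+ₙ (conₙ 3 :*ₙ r :+ₙ conₙ 2) :=ₙ conₙ 3 :*ₙ r :+ₙ (k :+ₙ c :+ₙ conₙ 2)) refl c k r))))) Q₀≤q))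
        8N≤ : 8 ℕ.* N ℕ.≤ y₁
        8N≤ = ℕ.≤-trans (ℕ.≤-trans (ℕ.≤-reflexive (sym (ℕ.^-distribˡ-+-* 2 3 k))) (2^-mono {3 ℕ.+ k} {3 ℕ.* r ℕ.+ 2} (ℕ-linear (3 ⊛ₙ k+c+7≤r) (ℕ-solve 3 (λ k c r → conₙ 3 :+ₙ k :+ₙ (conₙ 3 :*ₙ r :+ₙ (conₙ 20 :+ₙ conₙ 3 :*ₙ c :+ₙ conₙ 2 :*ₙ k)) :=ₙ conₙ 3 :*ₙ r :+ₙ conₙ 2 :+ₙ conₙ 3 :*ₙ (k :+ₙ c :+ₙ conₙ 7)) refl k c r)))) big
        2Y≤ : 2 ℕ.* Y ℕ.≤ y₁
        2Y≤ = ℕ.≤-trans (2^-mono {suc (3 ℕ.* r)} {3 ℕ.* r ℕ.+ 2} (ℕ-linear (ℕ.z≤n {0}) (ℕ-solve 1 (λ r → conₙ 1 :+ₙ conₙ 3 :*ₙ r :+ₙ (conₙ 0 :+ₙ conₙ 1) :=ₙ conₙ 3 :*ₙ r :+ₙ conₙ 2 :+ₙ conₙ 0) refl r))) big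
        4Nn≤ : 4 ℕ.* N ℕ.* n ℕ.≤ y₁
        4Nn≤ = div-lower y₁ (4 ℕ.* N)
        4n≤ : 4 ℕ.* n ℕ.≤ y₁
        4n≤ = ℕ.≤-trans (ℕ.*-monoˡ-≤ n (ℕ.*-monoʳ-≤ 4 1≤N)) 4Nn≤
        y₀+n≡ : y₀ ℕ.+ n ≡ suc y₁
        y₀+n≡ = ℕ.m∸n+n≡m {suc y₁} {n} (ℕ-linear 4n≤ (ℕ-solve 2 (λ n y₁ → n :+ₙ (y₁ :+ₙ (conₙ 1 :+ₙ conₙ 3 :*ₙ n)) :=ₙ conₙ 1 :+ₙ y₁ :+ₙ conₙ 4 :*ₙ n) refl n y₁))
        y₀+n≤ : y₀ ℕ.+ n ℕ.≤ Y′
        y₀+n≤ = ℕ.≤-trans (ℕ.≤-reflexive y₀+n≡) (ℕ.≤-<-trans (div-≤ q b) q<Y′)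
        Y≤y₀ : Y ℕ.≤ y₀
        Y≤y₀ = ℕ-linear-by 3 (4 ⊛ₙ ℕ.≤-reflexive (sym y₀+n≡) ⊕ₙ 4n≤ ⊕ₙ 3 ⊛ₙ 2Y≤) (ℕ-solve 4 (λ Y y₀ n y₁ → conₙ 4 :*ₙ Y :+ₙ (conₙ 4 :*ₙ (y₀ :+ₙ n) :+ₙ y₁ :+ₙ conₙ 3 :*ₙ y₁ :+ₙ (conₙ 4 :+ₙ conₙ 2 :*ₙ Y)) :=ₙ conₙ 4 :*ₙ y₀ :+ₙ (conₙ 4 :*ₙ (conₙ 1 :+ₙ y₁) :+ₙ conₙ 4 :*ₙ n :+ₙ conₙ 3 :*ₙ (conₙ 2 :*ₙ Y))) refl Y y₀ n y₁)
        Nn≤y₀ : N ℕ.* n ℕ.≤ y₀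
        Nn≤y₀ = ℕ-linear-by 3 (4 ⊛ₙ ℕ.≤-reflexive (sym y₀+n≡) ⊕ₙ 4n≤ ⊕ₙ 3 ⊛ₙ 4Nn≤) (ℕ-solve 4 (λ N y₀ n y₁ → conₙ 4 :*ₙ (N :*ₙ n) :+ₙ (conₙ 4 :*ₙ (y₀ :+ₙ n) :+ₙ y₁ :+ₙ conₙ 3 :*ₙ y₁ :+ₙ (conₙ 4 :+ₙ conₙ 8 :*ₙ N :*ₙ n)) :=ₙ conₙ 4 :*ₙ y₀ :+ₙ (conₙ 4 :*ₙ (conₙ 1 :+ₙ y₁) :+ₙ conₙ 4 :*ₙ n :+ₙ conₙ 3 :*ₙ (conₙ 4 :*ₙ N :*ₙ n))) refl N y₀ n y₁)
        win : ∀ j → j ℕ.< n → Window ((y₀ ℕ.+ j) ℕ.* b) q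
        win j j<n = ℕ.≤-trans (ℕ.*-monoˡ-≤ b (ℕ.≤-pred (ℕ.≤-trans (ℕ.+-monoʳ-< y₀ j<n) (ℕ.≤-reflexive y₀+n≡)))) (ℕ.≤-trans (ℕ.≤-reflexive (ℕ.*-comm y₁ b)) (div-lower q b)) ,
          ℕ.≤-trans (ℕ.*-monoʳ-≤ N (ℕ.<⇒≤ (div-upper q 1≤b))) (ℕ.≤-trans (ℕ.≤-reflexive (trans (ℕ-solve 3 (λ N b y₁ → N :*ₙ (b :*ₙ y₁ :+ₙ b) :=ₙ N :*ₙ (conₙ 1 :+ₙ y₁) :*ₙ b) refl N b y₁) (cong (λ z → N ℕ.* z ℕ.* b) (sym y₀+n≡))))
            (ℕ-linear (ℕ.*-monoˡ-≤ b Nn≤y₀) (ℕ-solve 5 (λ N b y₀ n j → N :*ₙ (y₀ :+ₙ n) :*ₙ b :+ₙ (y₀ :*ₙ b :+ₙ (N :*ₙ b :*ₙ j :+ₙ b :*ₙ j)) :=ₙ (conₙ 1 :+ₙ N) :*ₙ ((y₀ :+ₙ j) :*ₙ b) :+ₙ N :*ₙ n :*ₙ b) refl N b y₀ n j)))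
        term : ∀ j → j ℕ.< n → inv y₁ ≤ φ (y₀ ℕ.+ j)
        term j j<n = ≤-trans (inv-anti (ℕ.≤-trans (0<2^ (3 ℕ.* r)) (ℕ.≤-trans Y≤y₀ (ℕ.m≤m+n y₀ j))) (ℕ.≤-pred (ℕ.≤-trans (ℕ.+-monoʳ-< y₀ j<n) (ℕ.≤-reflexive y₀+n≡))))
          (≤-reflexive (sym (trans (cong₂ (λ a b → a * (inv (y₀ ℕ.+ j) * b)) (𝟙-yes (Y ℕ.≤? (y₀ ℕ.+ j)) (ℕ.≤-trans Y≤y₀ (ℕ.m≤m+n y₀ j))) (𝟙-yes (window? ((y₀ ℕ.+ j) ℕ.* b) q) (win j j<n))) (solve 1 (λ v → # 1 :* (v :* # 1) := v) refl (inv (y₀ ℕ.+ j))))))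
        y₁≤8Nn : y₁ ℕ.≤ 8 ℕ.* N ℕ.* n
        y₁≤8Nn = ℕ-linear (div-upper y₁ 1≤4N ⊕ₙ ℕ.*-monoʳ-≤ (4 ℕ.* N) 1≤n) (ℕ-solve 3 (λ N n y₁ → y₁ :+ₙ (conₙ 4 :*ₙ N :*ₙ n :+ₙ conₙ 4 :*ₙ N :+ₙ conₙ 4 :*ₙ N :*ₙ n :+ₙ conₙ 1) :=ₙ conₙ 8 :*ₙ N :*ₙ n :+ₙ (conₙ 1 :+ₙ y₁ :+ₙ conₙ 4 :*ₙ N :*ₙ conₙ 1)) refl N n y₁)
          where
          1≤n : 1 ℕ.≤ n
          1≤n = div-≥ 1≤4N (ℕ-linear 8N≤ (ℕ-solve 2 (λ N y₁ → conₙ 4 :*ₙ N :*ₙ conₙ 1 :+ₙ (y₁ :+ₙ conₙ 4 :*ₙ N) :=ₙ y₁ :+ₙ conₙ 8 :*ₙ N) refl N y₁))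
        1≤y₁ : 1 ℕ.≤ y₁
        1≤y₁ = ℕ.≤-trans (ℕ.*-mono-≤ {1} {8} (s≤s z≤n) 1≤N) 8N≤
        low : inv 8 * inv N ≤ ι n * inv y₁
        low = cancel-* (ι (8 ℕ.* N)) (0<ι′ (ℕ.*-mono-≤ {1} {8} (s≤s z≤n) 1≤N)) (inv-*-cancel′ (linear (≤-reflexive (cong (ι y₁ *_) (trans (cong (ι (8 ℕ.* N) *_) (sym (inv-* 8 N))) (ι*inv (ℕ.*-mono-≤ {1} {8} (s≤s z≤n) 1≤N)))) ⊕ ≤-reflexive (sym (cong (ι (8 ℕ.* N) * ι n *_) (ι*inv 1≤y₁))) ⊕ ι-mono y₁≤8Nn ⊕ ≤-reflexive (ι-* (8 ℕ.* N) n)) (solve 6 (λ c a n v y s → y :* (c :* (n :* v)) :- y :* (c :* a) := y :* # 1 :+ c :* n :* (y :* v) :+ s :+ c :* n :- (y :* (c :* a) :+ c :* n :* # 1 :+ y :+ s)) refl (ι (8 ℕ.* N)) (inv 8 * inv N) (ι n) (inv y₁) (ι y₁) (ι (8 ℕ.* N ℕ.* n)))))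
          where
          inv-*-cancel′ : ∀ {a b} → ι y₁ * a ≤ ι y₁ * b → a ≤ b
          inv-*-cancel′ = cancel-* (ι y₁) (0<ι′ 1≤y₁)

      -- Mertens gives the primes of [Q₀, Y′) the weight 3 r up to losses that `scales` limits to r.
      -- Markov's inequality, with mean resonance above δ′ ≥ Δ/r, gives the bad ones at most r.
      mass : ι r ≤ ∑ Y′ gq
      mass = linear (split ⊕ bad≤ ⊕ S-lower (6 ℕ.* r) ⊕ S-upper lo ⊕ ≤-reflexive (sym (ι-* 6 r)) ⊕ ≤-reflexive (ι-* 3 r) ⊕ ≤-reflexive (ι-+ (3 ℕ.* r) (k ℕ.+ c ℕ.+ 2)) ⊕ ≤-reflexive (sym (E≡ (6 ℕ.* r))) ⊕ 4 ⊛ 0≤h (suc (6 ℕ.* r)) ⊕ E-mono {6 ℕ.* r} {24 ℕ.* r} (ℕ.*-monoˡ-≤ r (ℕ.m≤m+n 6 18)) ⊕ scales ⊕ ≤-reflexive (sym (trans (cong ι (ℕ-solve 2 (λ k c → k :+ₙ c :+ₙ conₙ 7 :=ₙ k :+ₙ c :+ₙ conₙ 2 :+ₙ conₙ 5) refl k c)) (ι-+ (k ℕ.+ c ℕ.+ 2) 5)))) (solve 14 (λ G b s t r e E i6 il ikc ikc7 i3 h E6 → G :- r := G :+ b :+ r :+ (s :+ (e :+ # 1)) :+ (il :+ # 5) :+ i6 :+ # 3 :* r :+ (i3 :+ ikc) :+ E6 :+ # 4 :* h :+ E :+ r :+ ikc7 :- (s :- t :+ b :+ i6 :+ t :+ #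 6 :* r :+ i3 :+ il :+ (e :+ # 1 :+ # 4 :* h) :+ # 4 :* # 0 :+ E6 :+ (E :+ ikc7) :+ (ikc :+ # 5))) refl (∑ Y′ gq) (∑ Y′ bad) (S (6 ℕ.* r)) (S lo) (ι r) (e (6 ℕ.* r)) (E (24 ℕ.* r)) (ι (6 ℕ.* r)) (ι lo) (ι (k ℕ.+ c ℕ.+ 2)) (ι (k ℕ.+ c ℕ.+ 7)) (ι (3 ℕ.* r)) (h (suc (6 ℕ.* r))) (E (6 ℕ.* r)))
        where
        lo : ℕ
        lo = 3 ℕ.* r ℕ.+ (k ℕ.+ c ℕ.+ 2)
        bad : ℕ → ℚ
        bad q = 𝟙 (¬? (good? q)) * (Λ q * inv q)
        0≤bad : ∀ q → 0ℚ ≤ bad q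
        0≤bad q = *-nonneg (0≤𝟙 (¬? (good? q))) (0≤Λinv q)
        lo≤ : lo ℕ.≤ 6 ℕ.* r
        lo≤ = ℕ-linear (3 ⊛ₙ k+c+7≤r) (ℕ-solve 3 (λ k c r → conₙ 3 :*ₙ r :+ₙ (k :+ₙ c :+ₙ conₙ 2) :+ₙ (conₙ 3 :*ₙ r :+ₙ (conₙ 19 :+ₙ conₙ 2 :*ₙ c :+ₙ conₙ 2 :*ₙ k)) :=ₙ conₙ 6 :*ₙ r :+ₙ conₙ 3 :*ₙ (k :+ₙ c :+ₙ conₙ 7)) refl k c r)
        split : S (6 ℕ.* r) - S lo ≤ ∑ Y′ gq + ∑ Y′ bad
        split = ≤-trans (≤-reflexive (sym (∑-range Q₀ Y′ (λ q → Λ q * inv q) (2^-mono lo≤)))) (≤-trans (∑-mono Y′ (λ q _ → term q)) (≤-reflexive (∑-+ Y′ gq bad)))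
          where
          term : ∀ q → 𝟙 (Q₀ ℕ.≤? q) * (Λ q * inv q) ≤ gq q + bad q
          term q = dec-elim (good? q)
            (λ gd → (linear (≤-reflexive (sym (cong (Λ q * inv q * 𝟙 (Q₀ ℕ.≤? q) *_) (𝟙-yes (good? q) gd))) ⊕ 0≤bad q) (solve 4 (λ i l a b → l :* (a :* i) :+ b :- i :* l := l :* i :* a :+ b :- (l :* i :* # 1 :+ # 0)) refl (𝟙 (Q₀ ℕ.≤? q)) (Λ q * inv q) (𝟙 (good? q)) (bad q))))
            (λ ¬gd → (linear (*-monoʳ (Λ q * inv q) (0≤Λinv q) (𝟙≤1 (Q₀ ℕ.≤? q)) ⊕ ≤-reflexive (sym (cong (_* (Λ q * inv q)) (𝟙-yes (¬? (good? q)) ¬gd))) ⊕ 0≤gq q) (solve 4 (λ i l G b → G :+ b :- i :* l := # 1 :* l :+ b :+ G :- (i :* l :+ # 1 :* l :+ # 0)) refl (𝟙 (Q₀ ℕ.≤? q)) (Λ q * inv q) (gq q) (bad q))))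
        markov : δ′ * ∑ Y′ bad ≤ Δ (24 ℕ.* r)
        markov = ≤-trans (≤-reflexive (sym (∑-*ˡ Y′ δ′ bad))) (≤-trans (∑-mono Y′ (λ q _ → term q)) (≤-trans (∑-extend (2^-mono (ℕ.*-monoˡ-≤ r (ℕ.m≤m+n 6 18))) (λ q _ _ → *-nonneg (0≤Λinv q) (0≤ε q))) (≤-reflexive (sym Δ-ε))))
          where
          0≤ε : ∀ q → 0ℚ ≤ ε q
          0≤ε q = ∑-nonneg X (λ x _ → 0≤res q x)
          term : ∀ q → δ′ * bad q ≤ Λ q * inv q * ε q
          term q = 𝟙-elim (¬? (good? q)) (λ i → δ′ * (i * (Λ q * inv q)) ≤ Λ q * inv q * ε q)
            (λ ¬good → (linear (*-monoˡ (Λ q * inv q) (0≤Λinv q) (<⇒≤ (≰⇒> ¬good))) (solve 3 (λ d l e → l :* e :- d :* (# 1 :* l) := l :* e :- l :* d) refl δ′ (Λ q * inv q) (ε q))))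
            (λ _ → ≤-trans (≤-reflexive (solve 2 (λ d l → d :* (# 0 :* l) := # 0) refl δ′ (Λ q * inv q))) (*-nonneg (0≤Λinv q) (0≤ε q)))
        bad≤ : ∑ Y′ bad ≤ ι r
        bad≤ = cancel-* δ′ (<-≤-trans (0<ι 0) (linear (*-nonneg (0≤Δ (24 ℕ.* r)) (0≤inv r)) (solve 1 (λ a → a :+ # 1 :- # 1 := a :- # 0) refl (Δ (24 ℕ.* r) * inv r))))
          (linear (markov ⊕ ≤-reflexive (sym (cong (_* ι r) (refl {x = δ′}))) ⊕ ≤-reflexive (sym (cong (Δ (24 ℕ.* r) *_) (ι*inv 1≤r))) ⊕ 0≤ι r) (solve 5 (λ d b D r v → d :* r :- d :* b := D :+ d :* r :+ D :* (r :* v) :+ r :- (d :* b :+ (D :* v :+ # 1) :* r :+ D :* # 1 :+ # 0)) refl δ′ (∑ Y′ bad) (Δ (24 ℕ.* r)) (ι r) (inv r)))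

      Far : ℕ → ℕ → Set
      Far b b′ = δ < dist J b b′

      -- Averaged over y with weight 1/y, every b has weight at least r/(8 N). At each y, `pair`
      -- lets at most one member of the family have positive weight, and that is at most 2 (k +
      -- 3)/N, while 1/y sums to at most 3 r. Hence 48 = 8 · 2 · 3.
      far-family : ∀ bs → All InRange bs → AllPairs Far bs → length bs ℕ.≤ 48 ℕ.* (k ℕ.+ 3)
      far-family bs ranges far = ι-cancel (cancel-* {ι (length bs)} {ι (48 ℕ.* (k ℕ.+ 3))} (ι r) (0<ι′ 1≤r) (cancel-* {ι r * ι (length bs)} {ι r * ι (48 ℕ.* (k ℕ.+ 3))} (inv 8) (0<inv 8 (s≤s z≤n))
          (inv-*-cancel (inv 8 * (ι r * ι (length bs))) (inv 8 * (ι r * ι (48 ℕ.* (k ℕ.+ 3)))) 1≤N (linear (lower ⊕ upper ⊕ *-monoˡ (ι (2 ℕ.* (k ℕ.+ 3)) * inv N) (*-nonneg (0≤ι (2 ℕ.* (k ℕ.+ 3))) (0≤inv N)) H≤ ⊕ ≤-reflexive (cong (ι (2 ℕ.* (k ℕ.+ 3)) * inv N *_) (ι-* 3 r)) ⊕ 3 ⊛ ≤-reflexive (cong (_* (inv N * ι r)) (ι-* 2 (k ℕ.+ 3))) ⊕ ≤-reflexive (sym (cong (_* (inv 8 * ι r * inv N)) (ι-* 48 (k ℕ.+ 3)))) ⊕ 6 ⊛ ≤-reflexive (sym (cong (_* (ι (k ℕ.+ 3) * ι r * inv N)) (refl {x = ι 8 * inv 8})))) (solve 10 (λ r e v l K K2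 K48 t H i3 → e :* (r :* K48) :* v :- e :* (r :* l) :* v := t :+ K2 :* v :* H :+ K2 :* v :* i3 :+ K2 :* v :* (# 3 :* r) :+ # 3 :* (# 2 :* K :* (v :* r)) :+ K48 :* (e :* r :* v) :+ # 6 :* (# 8 :* e :* (K :* r :* v)) :- (l :* (e :* v :* r) :+ t :+ K2 :* v :* H :+ K2 :* v :* i3 :+ # 3 :* (K2 :* (v :* r)) :+ # 48 :* K :* (e :* r :* v) :+ # 6 :* (# 1 :* (K :* r :* v)))) refl (ι r) (inv 8) (inv N) (ι (length bs)) (ι (k ℕ.+ 3)) (ι (2 ℕ.* (k ℕ.+ 3))) (ι (48 ℕ.* (k ℕ.+ 3))) (∑ Y′ (λ y → 𝟙 (Y ℕ.≤? y) * inv y * ∑L bs (λ b → weight b y))) (h Y′ - h Y) (ι (3 ℕ.* r)))))))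
        where
        0<inv : ∀ n → 1 ℕ.≤ n → 0ℚ < inv n
        0<inv (suc n) _ = positive⁻¹ (inv (suc n))
        H≤ : h Y′ - h Y ≤ ι (3 ℕ.* r)
        H≤ = linear (≤-reflexive (cong h (trans (cong (2 ℕ.^_) (ℕ-solve 1 (λ r → conₙ 6 :*ₙ r :=ₙ conₙ 3 :*ₙ r :+ₙ conₙ 3 :*ₙ r) refl r)) (ℕ.^-distribˡ-+-* 2 (3 ℕ.* r) (3 ℕ.* r)))) ⊕ h-block (3 ℕ.* r) Y) (solve 4 (λ a a' b i → i :- (a :- b) := a' :+ (b :+ i) :- (a :+ a')) refl (h Y′) (h (2 ℕ.^ (3 ℕ.* r) ℕ.* Y)) (h Y) (ι (3 ℕ.* r)))
        Y≤Y′ : Y ℕ.≤ Y′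
        Y≤Y′ = 2^-mono (ℕ.*-monoˡ-≤ r (ℕ.m≤m+n 3 3))
        exclusive : ∀ y → Y ℕ.≤ y → y ℕ.< Y′ → ∀ b b′ → InRange b → InRange b′ → Far b b′ → weight b y ≡ 0ℚ ⊎ weight b′ y ≡ 0ℚ
        exclusive y Y≤y y<Y′ b b′ rb rb′ f = dec-elim (occupied? b)
          (λ (q₁ , _ , good₁ , win₁) → dec-elim (occupied? b′)
            (λ (q₂ , _ , good₂ , win₂) → contradiction (pair y b b′ q₁ q₂ (ℕ.≤-trans (0<2^ (3 ℕ.* r)) Y≤y) y<Y′ rb rb′ good₁ good₂ win₁ win₂) (λ le → <-irrefl refl (<-≤-trans f le)))
            (λ none → inj₂ (vanish b′ none)))
          (λ none → inj₁ (vanish b none))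
          where
          Occupied : ℕ → Set
          Occupied b = ∃ λ q → q ℕ.< Y′ × Good q × Window (y ℕ.* b) q
          occupied? : ∀ b → Dec (Occupied b)
          occupied? b = ℕ.anyUpTo? (λ q → good? q ×-dec window? (y ℕ.* b) q) Y′
          vanish : ∀ b → ¬ Occupied b → weight b y ≡ 0ℚ
          vanish b none = ∑-zero Y′ (λ q q<Y′ → 𝟙-elim (good? q) (λ i → Λ q * inv q * (i * 𝟙 (Q₀ ℕ.≤? q)) * 𝟙 (window? (y ℕ.* b) q) ≡ 0ℚ)
            (λ gd → trans (cong (Λ q * inv q * (1ℚ * 𝟙 (Q₀ ℕ.≤? q)) *_) (𝟙-no (window? (y ℕ.* b) q) (λ w → none (q , q<Y′ , gd , w)))) (*-zeroʳ (Λ q * inv q * (1ℚ * 𝟙 (Q₀ ℕ.≤? q)))))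
            (λ _ → (solve 3 (λ l i w → l :* (# 0 :* i) :* w := # 0) refl (Λ q * inv q) (𝟙 (Q₀ ℕ.≤? q)) (𝟙 (window? (y ℕ.* b) q)))))
        K2 : ℚ
        K2 = ι (2 ℕ.* (k ℕ.+ 3)) * inv N
        0≤K2 : 0ℚ ≤ K2
        0≤K2 = *-nonneg (0≤ι (2 ℕ.* (k ℕ.+ 3))) (0≤inv N)
        upper : ∑ Y′ (λ y → 𝟙 (Y ℕ.≤? y) * inv y * ∑L bs (λ b → weight b y)) ≤ K2 * (h Y′ - h Y)
        upper = ≤-trans (∑-mono Y′ term) (≤-reflexive (trans (∑-*ˡ Y′ K2 _) (cong (K2 *_) (∑-range Y Y′ inv Y≤Y′))))
          where
          term : ∀ y → y ℕ.< Y′ → 𝟙 (Y ℕ.≤? y) * inv y * ∑L bs (λ b → weight b y) ≤ K2 * (𝟙 (Y ℕ.≤? y) * inv y)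
          term y y<Y′ = 𝟙-elim (Y ℕ.≤? y) (λ i → i * inv y * ∑L bs (λ b → weight b y) ≤ K2 * (i * inv y)) inside (λ _ → ≤-reflexive (solve 3 (λ v s K2 → # 0 :* v :* s := K2 :* (# 0 :* v)) refl (inv y) (∑L bs (λ b → weight b y)) K2))
            where
            inside : Y ℕ.≤ y → 1ℚ * inv y * ∑L bs (λ b → weight b y) ≤ K2 * (1ℚ * inv y)
            inside Y≤y = ≤-trans (*-monoˡ (1ℚ * inv y) (*-nonneg (0≤ι 1) (0≤inv y)) (∑L-one bs 0≤K2 ranges far (λ b (N≤b , _) → weight-bound b y Y≤y N≤b) (exclusive y Y≤y y<Y′))) (≤-reflexive (*-comm (1ℚ * inv y) K2))
        lower : ι (length bs) * (inv 8 * inv N * ι r) ≤ ∑ Y′ (λ y → 𝟙 (Y ℕ.≤? y) * inv y * ∑L bs (λ b → weight b y))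
        lower = ≤-trans (∑L-lower bs (inv 8 * inv N * ι r) ranges single) (≤-reflexive (sym (∑L-swap bs Y′ (λ y → 𝟙 (Y ℕ.≤? y) * inv y) weight)))
          where
          single : ∀ b → InRange b → inv 8 * inv N * ι r ≤ ∑ Y′ (λ y → 𝟙 (Y ℕ.≤? y) * inv y * weight b y)
          single b rb = ≤-trans (*-monoˡ (inv 8 * inv N) (*-nonneg (0≤inv 8) (0≤inv N)) mass) (≤-trans (≤-reflexive (sym (∑-*ˡ Y′ (inv 8 * inv N) gq))) (≤-trans (∑-mono Y′ term)
            (≤-reflexive (trans (∑-ext Y′ (λ q → sym (∑-*ˡ Y′ (gq q) _))) (trans (∑-swap Y′ Y′ _) (∑-ext Y′ (λ y → trans (∑-ext Y′ (λ q → (solve 4 (λ a i v w → a :* (i :* (v :* w)) := i :* v :* (a :* w)) refl (gq q) (𝟙 (Y ℕ.≤? y)) (inv y) (𝟙 (window? (y ℕ.* b) q))))) (∑-*ˡ Y′ (𝟙 (Y ℕ.≤? y) * inv y) _))))))))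
            where
            term : ∀ q → q ℕ.< Y′ → inv 8 * inv N * gq q ≤ gq q * ∑ Y′ (λ y → 𝟙 (Y ℕ.≤? y) * (inv y * 𝟙 (window? (y ℕ.* b) q)))
            term q q<Y′ = 𝟙-elim (Q₀ ℕ.≤? q) (λ i → inv 8 * inv N * (Λ q * inv q * (𝟙 (good? q) * i)) ≤ Λ q * inv q * (𝟙 (good? q) * i) * ∑ Y′ (λ y → 𝟙 (Y ℕ.≤? y) * (inv y * 𝟙 (window? (y ℕ.* b) q)))) inside (λ _ → ≤-reflexive (solve 4 (λ u l i s → u :* (l :* (i :* # 0)) := l :* (i :* # 0) :* s) refl (inv 8 * inv N) (Λ q * inv q) (𝟙 (good? q)) (∑ Y′ (λ y → 𝟙 (Y ℕ.≤? y) * (inv y * 𝟙 (window? (y ℕ.* b) q))))))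
              where
              inside : Q₀ ℕ.≤ q → inv 8 * inv N * (Λ q * inv q * (𝟙 (good? q) * 1ℚ)) ≤ Λ q * inv q * (𝟙 (good? q) * 1ℚ) * ∑ Y′ (λ y → 𝟙 (Y ℕ.≤? y) * (inv y * 𝟙 (window? (y ℕ.* b) q)))
              inside Q₀≤q = ≤-trans (≤-reflexive (*-comm (inv 8 * inv N) (Λ q * inv q * (𝟙 (good? q) * 1ℚ)))) (*-monoˡ (Λ q * inv q * (𝟙 (good? q) * 1ℚ)) (*-nonneg (0≤Λinv q) (*-nonneg (0≤𝟙 (good? q)) (0≤ι 1))) (window-count b q rb Q₀≤q q<Y′))

      steps : ℕ
      steps = suc (48 ℕ.* (k ℕ.+ 3))

      -- As b ≥ N, the number b + 1 lies within the factor 1 + 1/N of b, so `lip` applies.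
      close-next : ∀ b → N ℕ.≤ b → dist J b (suc b) ≤ δ
      close-next b N≤b = ≤-trans (≤-trans (≤-reflexive (dist-sym J b (suc b))) (lip′ b (suc b) J≤X (ℕ.≤-trans 1≤N N≤b) (ℕ.n≤1+n b) (ℕ-linear N≤b (ℕ-solve 2 (λ N b → N :*ₙ (conₙ 1 :+ₙ b) :+ₙ (b :+ₙ conₙ 0) :=ₙ (conₙ 1 :+ₙ N) :*ₙ b :+ₙ N) refl N b)))) L≤δ

      -- Centres that are pairwise far apart are collected along the path from s to s + d;
      -- there are fewer than `steps` of them, and each costs a detour of length two.
      path : ∀ t bs s d → length bs ℕ.+ t ≡ steps → All InRange bs → AllPairs Far bs → (∀ i → s ℕ.≤ i → i ℕ.≤ s ℕ.+ d → All (Far i) bs) → N ℕ.≤ s → s ℕ.+ d ℕ.< 2 ℕ.^ c ℕ.* N →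
        dist J s (s ℕ.+ d) ≤ sq (ι (suc (2 ℕ.* t))) * δ
      path zero bs s d len ranges far _ _ _ = contradiction (far-family bs ranges far) (ℕ.<⇒≱ (ℕ.≤-reflexive (trans (sym len) (ℕ.+-identityʳ (length bs)))))
      -- By the choice of the last index close to s, all later ones are far from s, which therefore
      -- joins the centres. One move to that index and one beyond it use two units of the budget 1 +
      -- 2 t.
      path (suc t) bs s d len ranges far apart N≤s s+d< = from-last (last-index (λ i → dist J s i ≤? δ) s d (≤-trans (≤-reflexive (dist-refl J s)) 0≤δ))
        where
        Goal : ℕ → Set
        Goal e = dist J s e ≤ sq (ι (suc (2 ℕ.* suc t))) * δ
        M : ℚ
        M = ι (suc (2 ℕ.* suc t))
        1≤M : ι 1 ≤ M
        1≤M = ι-mono {1} {suc (2 ℕ.* suc t)} (s≤s z≤n)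
        1δ : δ ≤ sq (ι 1) * δ
        1δ = ≤-reflexive (sym (*-identityˡ δ))
        sum≡ : ι 2 + ι (suc (2 ℕ.* t)) ≡ ι (suc (2 ℕ.* suc t))
        sum≡ = trans (sym (ι-+ 2 (suc (2 ℕ.* t)))) (cong ι (ℕ-solve 1 (λ t → conₙ 2 :+ₙ (conₙ 1 :+ₙ conₙ 2 :*ₙ t) :=ₙ conₙ 1 :+ₙ conₙ 2 :*ₙ (conₙ 1 :+ₙ t)) refl t))
        from-last : (∃ λ i → s ℕ.≤ i × i ℕ.≤ s ℕ.+ d × dist J s i ≤ δ × (∀ j → i ℕ.< j → j ℕ.≤ s ℕ.+ d → ¬ dist J s j ≤ δ)) → Goal (s ℕ.+ d)
        from-last (i , s≤i , i≤ , close , above) = dec-elim (i ℕ.≟ s ℕ.+ d)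
          (λ i≡ → subst Goal i≡ (≤-trans close (≤-trans (≤-reflexive (sym (*-identityˡ δ))) (*-monoʳ δ 0≤δ (*-mono {ι 1} {M} {ι 1} {M} (0≤ι 1) (0≤ι (suc (2 ℕ.* suc t))) 1≤M 1≤M)))))
          (λ i≢ → beyond (ℕ.≤∧≢⇒< i≤ i≢))
          where
          beyond : suc i ℕ.≤ s ℕ.+ d → Goal (s ℕ.+ d)
          beyond i<end = subst Goal end≡ (subst (λ z → dist J s (suc i ℕ.+ d′) ≤ sq z * δ) sum≡
              (dist-triangle J s (suc i) (suc i ℕ.+ d′) {δ} 1 (2 ℕ.* t) (dist-triangle J s i (suc i) {δ} 0 0 (≤-trans close 1δ) (≤-trans (close-next i (ℕ.≤-trans N≤s s≤i)) 1δ))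
                (path t (s ∷ bs) (suc i) d′ (trans (sym (ℕ.+-suc (length bs) t)) len) ((N≤s , ℕ.≤-<-trans (ℕ.m≤m+n s d) s+d<) ∷ ranges) (apart s ℕ.≤-refl (ℕ.m≤m+n s d) ∷ far)
                  (λ j i<j j≤ → subst (δ <_) (dist-sym J s j) (≰⇒> (above j i<j (subst (j ℕ.≤_) end≡ j≤))) ∷ apart j (ℕ.≤-trans s≤i (ℕ.<⇒≤ i<j)) (subst (j ℕ.≤_) end≡ j≤)) (ℕ.≤-trans N≤s (ℕ.≤-trans s≤i (ℕ.n≤1+n i))) (subst (ℕ._< 2 ℕ.^ c ℕ.* N) (sym end≡) s+d<))))
            where
            d′ : ℕ
            d′ = s ℕ.+ d ℕ.∸ suc i
            end≡ : suc i ℕ.+ d′ ≡ s ℕ.+ d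
            end≡ = ℕ.m+[n∸m]≡n i<end

      spread : ∀ b → InRange b → dist J N b ≤ sq (ι (suc (2 ℕ.* steps))) * δ
      spread b (N≤b , b<) = subst (λ z → dist J N z ≤ sq (ι (suc (2 ℕ.* steps))) * δ) (ℕ.m+[n∸m]≡n N≤b)
        (path steps [] N (b ℕ.∸ N) refl [] [] (λ _ _ _ → []) ℕ.≤-refl (subst (ℕ._< 2 ℕ.^ c ℕ.* N) (sym (ℕ.m+[n∸m]≡n N≤b)) b<))

      -- With H = ∑ 1/b one has H g_N = ∑ (g_N - g_b)/b + ∑ F(x/b), because g_b / b = F(x/b). The
      -- first sum is controlled by `spread` and Cauchy-Schwarz, the second is at most 10 x whatever
      -- c is, and H ≥ c/2. Finally `inflation` passes from g_N to F. The constant is 115200 = 8 ·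
      -- 200 · 18 · 4.
      coercivity : A (16 ℕ.* r) ≤ ι 16 * (sq (ι (suc (2 ℕ.* steps))) * δ) + ι 115200 * ι r * (inv c * inv c)
      coercivity = cancel-* (H * H) 0<HH (linear (*-monoˡ (H * H) (<⇒≤ 0<HH) A≤norm ⊕ 8 ⊛ norm≤ ⊕ 1600 ⊛ ≤-reflexive (ι-* 18 r) ⊕ 28800 ⊛ *-monoʳ (ι r) (0≤ι r) HH≥) (solve 7 (λ HH A n M r i18 w → HH :* (# 16 :* M :+ # 115200 :* r :* w) :- HH :* A := HH :* (# 8 :* n) :+ # 8 :* (# 2 :* (HH :* M) :+ # 200 :* i18) :+ # 1600 :* (# 18 :* r) :+ # 28800 :* (# 4 :* (HH :* w) :* r) :- (HH :* A :+ # 8 :* (HH :* n) :+ # 1600 :* i18 :+ # 28800 :* (# 1 :* r))) refl (H * H) (A (16 ℕ.* r)) norm (sq (ι (suc (2 ℕ.* steps))) * δ) (ι r) (ι (18 ℕ.* r)) (inv c * inv c)))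
        where
        n : ℕ
        n = 2 ℕ.^ c ℕ.* N ℕ.∸ N
        N≤2^cN : N ℕ.≤ 2 ℕ.^ c ℕ.* N
        N≤2^cN = ℕ.≤-trans (ℕ.≤-reflexive (sym (ℕ.*-identityˡ N))) (ℕ.*-monoˡ-≤ N (0<2^ c))
        N+n≡ : N ℕ.+ n ≡ 2 ℕ.^ c ℕ.* N
        N+n≡ = ℕ.m+[n∸m]≡n N≤2^cN
        w : ℕ → ℚ
        w i = inv (N ℕ.+ i)
        H norm : ℚ
        H = ∑ n w
        norm = ∑ J (λ x → sq (g N x) * inv³ x)
        H≥ : ι c * inv 2 ≤ H
        H≥ = linear (h-block-lower c N 1≤N ⊕ ≤-reflexive (trans (cong h (sym N+n≡)) (∑-split N n inv))) (solve 4 (λ H a b c → H :- c := a :+ (b :+ H) :- (b :+ c :+ a)) refl H (h (2 ℕ.^ c ℕ.* N)) (h N) (ι c * inv 2))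
        0≤H : 0ℚ ≤ H
        0≤H = ∑-nonneg n (λ i _ → 0≤inv (N ℕ.+ i))
        0<H : 0ℚ < H
        0<H = <-≤-trans (positive⁻¹ (inv 2)) (≤-trans (≤-trans (≤-reflexive (sym (*-identityˡ (inv 2)))) (*-monoʳ (inv 2) (0≤inv 2) (ι-mono 1≤c))) H≥)
        0<HH : 0ℚ < H * H
        0<HH = subst (_< H * H) (*-zeroʳ H) (*-monoʳ-<-pos H {{ℚ.positive 0<H}} 0<H)
        HH≥ : 1ℚ ≤ ι 4 * (H * H * (inv c * inv c))
        HH≥ = linear (*-mono (*-nonneg (0≤ι 1) (0≤ι 1)) (*-nonneg (*-nonneg (0≤ι 2) 0≤H) (0≤inv c)) one one) (solve 2 (λ H v → # 4 :* (H :* H :* (v :* v)) :- # 1 := # 2 :* H :* v :* (# 2 :* H :* v) :- # 1 :* # 1 :* (# 1 :* # 1)) refl H (inv c))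
          where
          one : ι 1 * ι 1 ≤ ι 2 * H * inv c
          one = linear (*-monoˡ (ι 2 * inv c) (*-nonneg (0≤ι 2) (0≤inv c)) H≥ ⊕ ≤-reflexive (sym (ι*inv 1≤c)) ⊕ ≤-reflexive (sym (cong (_* (ι c * inv c)) (refl {x = ι 2 * inv 2})))) (solve 4 (λ H c v t → # 2 :* H :* v :- # 1 :* # 1 := # 2 :* v :* H :+ c :* v :+ # 2 :* t :* (c :* v) :- (# 2 :* v :* (c :* t) :+ # 1 :+ # 1 :* (c :* v))) refl H (ι c) (inv c) (inv 2))
        A≤norm : A (16 ℕ.* r) ≤ ι 8 * norm
        A≤norm = ≤-trans (inflation N (2 ℕ.^ (16 ℕ.* r)) (λ v → sq (F v)) 1≤N (λ v → sq≥0 (F v)) (cong sq F0)) (8 ⊛ ≤-trans (≤-reflexive (∑-ext (N ℕ.* 2 ℕ.^ (16 ℕ.* r)) (λ x → (solve 3 (λ n f w → n :* n :* (f :* f) :* w := n :* f :* (n :* f) :* w) refl (ι N) (F (x div N)) (inv³ x)))))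
          (∑-extend N*≤ (λ x _ _ → *-nonneg (sq≥0 (g N x)) (0≤inv³ x))))
          where
          -- Dilating by N uses up k ≤ 2 r of the exponent 18 r, so the energy is recovered up to 16
          -- r.
          N*≤ : N ℕ.* 2 ℕ.^ (16 ℕ.* r) ℕ.≤ J
          N*≤ = ℕ.≤-trans (ℕ.≤-reflexive (sym (ℕ.^-distribˡ-+-* 2 k (16 ℕ.* r)))) (2^-mono {k ℕ.+ 16 ℕ.* r} {18 ℕ.* r} (ℕ-linear (2 ⊛ₙ k+c+7≤r) (ℕ-solve 3 (λ k c r → k :+ₙ conₙ 16 :*ₙ r :+ₙ (conₙ 2 :*ₙ r :+ₙ (conₙ 14 :+ₙ conₙ 2 :*ₙ c :+ₙ k)) :=ₙ conₙ 18 :*ₙ r :+ₙ conₙ 2 :*ₙ (k :+ₙ c :+ₙ conₙ 7)) refl k c r)))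
        norm≤ : H * H * norm ≤ ι 2 * (H * H * (sq (ι (suc (2 ℕ.* steps))) * δ)) + ι 200 * ι (18 ℕ.* r)
        norm≤ = ≤-trans (≤-reflexive (sym (∑-*ˡ J (H * H) _))) (≤-trans (∑-mono J (λ x _ → pointwise x)) (≤-trans (≤-reflexive (trans (∑-+ J _ _) (cong₂ _+_ (trans (∑-*ˡ J (ι 2 * H) _) (cong (ι 2 * H *_) (trans (∑-swap J n _) (∑-ext n (λ i → ∑-*ˡ J (w i) _))))) (∑-*ˡ J (ι 200) inv))))
          (linear (*-monoˡ (ι 2 * H) (*-nonneg (0≤ι 2) 0≤H) dists ⊕ 200 ⊛ h-2^ (18 ℕ.* r)) (solve 5 (λ H s M t i18 → # 2 :* (H :* H :* M) :+ # 200 :* i18 :- (# 2 :* H :* s :+ # 200 :* t) := # 2 :* H :* (H :* M) :+ # 200 :* i18 :- (# 2 :* H :* s :+ # 200 :* t)) refl H (∑ n (λ i → w i * dist J N (N ℕ.+ i))) (sq (ι (suc (2 ℕ.* steps))) * δ) (∑ J inv) (ι (18 ℕ.* r))))))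
          where
          dists : ∑ n (λ i → w i * dist J N (N ℕ.+ i)) ≤ H * (sq (ι (suc (2 ℕ.* steps))) * δ)
          dists = ≤-trans (∑-mono n (λ i i<n → *-monoˡ (w i) (0≤inv (N ℕ.+ i)) (spread (N ℕ.+ i) (ℕ.m≤m+n N i , subst (N ℕ.+ i ℕ.<_) N+n≡ (ℕ.+-monoʳ-< N i<n))))) (≤-reflexive (∑-*ʳ n (sq (ι (suc (2 ℕ.* steps))) * δ) w))
          pointwise : ∀ x → H * H * (sq (g N x) * inv³ x) ≤ ι 2 * H * ∑ n (λ i → w i * (sq (g N x - g (N ℕ.+ i) x) * inv³ x)) + ι 200 * inv x
          pointwise x = linear (2 ⊛ ≤-reflexive (sym (cong (_* inv³ x) (cong₂ _*_ average average))) ⊕ 2 ⊛ *-monoʳ (inv³ x) (0≤inv³ x) (cauchy-schwarz n w c′ H (λ i _ → 0≤inv (N ℕ.+ i)) 0<H ≤-refl) ⊕ 2 ⊛ ≤-reflexive (sym (cong (H *_) (trans (∑-ext n (λ i → sym (*-assoc (w i) (c′ i * c′ i) (inv³ x)))) (∑-*ʳ n (inv³ x) _)))) ⊕ 2 ⊛ *-monoʳ (inv³ x) (0≤inv³ x) (sq-≤ {P} {ι 10 * ι x} P≤) ⊕ 200 ⊛ ≤-reflexive (ι²inv³ x) ⊕ *-monoʳ (inv³ x) (0≤inv³ x) (sq≥0 (H * g N x - P - P))) (solve 9 (λ H G W s t u P x v → # 2 :* H :* u :+ # 200 :* v :- H :* H :* (G :* G :* W) := # 2 :* (s :* s :* W)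 :+ # 2 :* (H :* t :* W) :+ # 2 :* (H :* u) :+ # 2 :* (# 10 :* x :* (# 10 :* x) :* W) :+ # 200 :* v :+ (H :* G :- P :- P) :* (H :* G :- P :- P) :* W :- (# 2 :* ((H :* G :- P) :* (H :* G :- P) :* W) :+ # 2 :* (s :* s :* W) :+ # 2 :* (H :* (t :* W)) :+ # 2 :* (P :* P :* W) :+ # 200 :* (x :* x :* W) :+ # 0 :* W)) refl H (g N x) (inv³ x) (∑ n (λ i → w i * c′ i)) (∑ n (λ i → w i * (c′ i * c′ i))) (∑ n (λ i → w i * (sq (g N x - g (N ℕ.+ i) x) * inv³ x))) P (ι x) (inv x))
            where
            c′ : ℕ → ℚ
            c′ i = g N x - g (N ℕ.+ i) x
            P : ℚ
            P = ∑ n (λ i → F (x div (N ℕ.+ i)))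
            average : ∑ n (λ i → w i * c′ i) ≡ H * g N x - P
            average = trans (∑-ext n (λ i → (linear-≡ (sym (cong (_* F (x div (N ℕ.+ i))) (ι*inv (ℕ.≤-trans 1≤N (ℕ.m≤m+n N i))))) (solve 4 (λ v G b f → v :* G :- f :- v :* (G :- b :* f) := b :* v :* f :- # 1 :* f) refl (w i) (g N x) (ι (N ℕ.+ i)) (F (x div (N ℕ.+ i))))))) (trans (∑-- n _ _) (cong (_- P) (∑-*ʳ n (g N x) w)))
            Φ-at : ∀ M → 1 ℕ.≤ M → ∣ ∑ M (λ b → F (x div b)) ∣ ≤ ι 5 * ι x
            Φ-at (suc M) _ = Φ-bound x M
            P≤ : ∣ P ∣ ≤ ι 10 * ι x
            P≤ = linear (≤-trans (≤-reflexive (cong ∣_∣ (trans (solve 2 (λ a P → P := a :+ P :- a) refl (∑ N (λ b → F (x div b))) P) (cong (_- ∑ N (λ b → F (x div b))) (trans (sym (∑-split N n (λ b → F (x div b)))) (cong (λ z → ∑ z (λ b → F (x div b))) N+n≡)))))) (∣p-q∣≤∣p∣+∣q∣ (∑ (2 ℕ.^ c ℕ.* N) (λ b → F (x div b))) (∑ N (λ b → F (x div b)))) ⊕ Φ-at (2 ℕ.^ c ℕ.* N) (ℕ.≤-trans 1≤N N≤2^cN) ⊕ Φ-at N 1≤N) (solve 4 (λ P a b x → # 10 :* x :- P := a :+ b :+ # 5 :* x :+ # 5 :* x :- (P :+ a :+ b)) refl (∣ P ∣) (∣ ∑ (2 ℕ.^ c ℕ.* N) (λ b → F (x div b)) ∣)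 (∣ ∑ N (λ b → F (x div b)) ∣) (ι x))

  -- Iteration: trading the slope of the energy bound for its constant.

  module Iteration where

    open Mertens using (h; h-mono; h-2^)
    open Mobius using (E)
    open Energy
    open Coercivity using (coercivity; δ; steps; 0≤δ)

    ∑-suc : ∀ K → ι 2 * ∑ K (λ j → ι (suc j)) ≡ ι K * (ι K + 1ℚ)
    ∑-suc zero = refl
    ∑-suc (suc K) = linear-≡ (cong₂ _+_ (cong₂ _+_ (∑-suc K) (sym (cong (ι (suc K) *_) (ι-suc K)))) (sym (cong (ι K *_) (ι-suc K)))) (solve 3 (λ s k k' → k' :* (k' :+ # 1) :- # 2 :* (s :+ k') := k :* (k :+ # 1) :+ k' :* k' :+ k :* k' :- (# 2 :* s :+ k' :* (# 1 :+ k) :+ k :* (# 1 :+ k))) refl (∑ K (λ j → ι (suc j))) (ι K) (ι (suc K)))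

    -- The invariant of the iteration. Each round lowers the slope β and raises the constant B,
    -- which then determines from where on the bound is useful.
    Affine : ℚ → ℕ → Set
    Affine β B = ∀ j → A j ≤ β * ι j + ι B

    -- 15 · 10⁹ k² absorbs the square of the number 2 steps + 1 = 96 k + 291 of moves between centres.
    contraction : ∀ r k c β B Q (1≤k : 1 ℕ.≤ k) (1≤c : 1 ℕ.≤ c) (scales : E (24 ℕ.* r) + ι (k ℕ.+ c ℕ.+ 7) ≤ ι r) → 1 ℕ.≤ r → Affine β B → 0ℚ ≤ β → β ≤ 1ℚ → ι 15000000000 * (ι k * ι k) ≤ ι Q →
      let K = 24 ℕ.* r; N = 2 ℕ.^ k in A K ≤ ι Q * (β * ι K + (1ℚ + ι 2 * ι B + ι 5 * E K + ι c) - A K) + ι Q * ι K * (inv N * inv N + inv c * inv c)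
    contraction r k c β B Q 1≤k 1≤c scales 1≤r affine 0≤β β≤1 k²≤Q = linear (grow ⊕ 4 ⊛ coercivity r k c 1≤k 1≤c scales ⊕ 64 ⊛ *-monoʳ δ₀ (0≤δ r k c 1≤k 1≤c scales) M≤ ⊕ 9600000 ⊛ ≤-reflexive (cong (k2 *_) (refl {x = δ₀})) ⊕ 614400000 ⊛ *-monoˡ k2 (sq≥0 (ι k)) Δ≤ ⊕ *-monoʳ gap 0≤gap k²≤Q ⊕ *-monoʳ (ι c) (0≤ι c) k²≤Q ⊕ 10752000000 ⊛ *-monoˡ k2 (sq≥0 (ι k)) (ι-mono 1≤c) ⊕ *-monoʳ (ι K * n2) (*-nonneg (0≤ι K) (sq≥0 (inv N))) k²≤Q ⊕ 10084800000 ⊛ *-nonneg (sq≥0 (ι k)) (*-nonneg (0≤ι K) (sq≥0 (inv N))) ⊕ 3940800000 ⊛ *-nonneg (sq≥0 (ι k)) (0≤ι c) ⊕ 254400000 ⊛ *-nonneg (sq≥0 (ι k)) 0≤gap ⊕ *-monoʳ (E K) (≤-trans (0≤ι 12) (12≤E K)) 1e9≤Q ⊕ 14999999988 ⊛ ≤-trans (0≤ι 12) (12≤E K) ⊕ *-monoʳ (ι K * w) (*-nonneg (0≤ι K) (sq≥0 (inv c))) 1e9≤Q ⊕ 14999980800 ⊛ *-nonneg (0≤ι K) (sq≥0 (inv c)) ⊕ 19200 ⊛ ≤-reflexive (sym (cong (_* w) (ι-* 24 r))) ⊕ ≤-reflexive (cong (ι Q *_) (refl {x = gap}))) (solve 16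 (λ a E c Q A A16 K r n2 w k2 D Dr MD B β → Q :* (β :* K :+ (# 1 :+ # 2 :* B :+ # 5 :* E :+ c) :- A) :+ Q :* K :* (n2 :+ w) :- A := # 4 :* A16 :+ # 12 :* E :+ # 4 :* (# 16 :* MD :+ # 115200 :* r :* w) :+ # 64 :* (# 150000 :* k2 :* D) :+ # 9600000 :* (k2 :* (# 64 :* (# 8 :* (n2 :* K) :+ # 16) :+ # 64 :* (Dr :+ # 1) :+ # 32 :* (c :+ # 1))) :+ # 614400000 :* (k2 :* (# 24 :* a)) :+ Q :* a :+ Q :* c :+ # 10752000000 :* (k2 :* c) :+ Q :* (K :* n2) :+ # 10084800000 :* (k2 :* (K :* n2)) :+ # 3940800000 :* (k2 :* c) :+ # 254400000 :* (k2 :* a) :+ Q :* E :+ # 14999999988 :* E :+ Q :* (K :* w) :+ # 14999980800 :* (K :* w) :+ # 19200 :* (K :* w) :+ Q :* (β :* K :+ # 1 :+ # 2 :* B :+ # 4 :* E :- A) :- (A :+ # 4 :* A16 :+ # 64 :* MD :+ # 9600000 :* (k2 :* D) :+ # 614400000 :* (k2 :* Dr) :+ # 15000000000 :* k2 :* a :+ # 15000000000 :* k2 :* c :+ # 10752000000 :* (k2 :* # 1) :+ # 15000000000 :* k2 :* (K :* n2) :+ # 10084800000 :* # 0 :+ # 3940800000 :* # 0 :+ # 254400000 :* # 0 :+ # 15000000000 :* E :+ # 14999999988 :* # 0 :+ # 15000000000 :* (K :* w) :+ # 14999980800 :* # 0 :+ # 19200 :* (# 24 :* r :* w) :+ Q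 :* a)) refl gap (E K) (ι c) (ι Q) (A K) (A (16 ℕ.* r)) (ι K) (ι r) n2 w k2 δ₀ (Δ K * inv r) (M * δ₀) (ι B) β)
      where
      K N : ℕ
      K = 24 ℕ.* r
      N = 2 ℕ.^ k
      gap n2 w k2 M δ₀ : ℚ
      gap = β * ι K + 1ℚ + ι 2 * ι B + ι 4 * E K - A K
      n2 = inv N * inv N
      w = inv c * inv c
      k2 = ι k * ι k
      M = sq (ι (suc (2 ℕ.* steps r k c 1≤k 1≤c scales)))
      δ₀ = δ r k c 1≤k 1≤c scales
      0<K : 0ℚ < ι K
      0<K = 0<ι′ (ℕ.*-mono-≤ {1} {24} (s≤s z≤n) 1≤r)
      grow : A K ≤ ι 4 * A (16 ℕ.* r) + ι 12 * E K
      grow = subst₂ (λ x y → A x ≤ ι 4 * A y + ι 12 * E x) (ℕ-solve 1 (λ r → conₙ 3 :*ₙ (conₙ 8 :*ₙ r) :=ₙ conₙ 24 :*ₙ r) refl r) (ℕ-solve 1 (λ r → conₙ 2 :*ₙ (conₙ 8 :*ₙ r) :=ₙ conₙ 16 :*ₙ r) refl r) (growth (8 ℕ.* r))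
      -- From 96 k + 291 ≤ 387 k and 387² ≤ 150000. The decisive product, in front of `gap`, is 4 ·
      -- 16 · 150000 · 64 · 24, just below 15 · 10⁹.
      M≤ : M ≤ ι 150000 * k2
      M≤ = ≤-trans (*-mono (0≤ι _) (*-nonneg (0≤ι 387) (0≤ι k)) S≤ S≤) (linear (231 ⊛ sq≥0 (ι k)) (solve 1 (λ k → # 150000 :* (k :* k) :- # 387 :* k :* (# 387 :* k) := # 231 :* (k :* k) :- # 231 :* # 0) refl (ι k)))
        where
        S≤ : ι (suc (2 ℕ.* steps r k c 1≤k 1≤c scales)) ≤ ι 387 * ι k
        S≤ = linear (≤-reflexive (ι-suc (2 ℕ.* suc (48 ℕ.* (k ℕ.+ 3)))) ⊕ ≤-reflexive (ι-* 2 (suc (48 ℕ.* (k ℕ.+ 3)))) ⊕ 2 ⊛ ≤-reflexive (ι-suc (48 ℕ.* (k ℕ.+ 3))) ⊕ 2 ⊛ ≤-reflexive (ι-* 48 (k ℕ.+ 3)) ⊕ 96 ⊛ ≤-reflexive (ι-+ k 3) ⊕ 291 ⊛ ι-mono 1≤k) (solve 6 (λ s a b c d k → # 387 :* k :- s := # 1 :+ a :+ # 2 :* b :+ # 2 :* (# 1 :+ c) :+ # 2 :* (# 48 :* d) :+ # 96 :* (k :+ # 3) :+ # 291 :* k :- (s :+ a :+ # 2 :* b :+ # 2 :* c :+ # 96 :* d :+ # 291 :* # 1)) refl (ι (suc (2 ℕ.* suc (48 ℕ.* (k ℕ.+ 3))))) (ι (2 ℕ.* suc (48 ℕ.* (k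 ℕ.+ 3)))) (ι (suc (48 ℕ.* (k ℕ.+ 3)))) (ι (48 ℕ.* (k ℕ.+ 3))) (ι (k ℕ.+ 3)) (ι k))
      total : ι 2 * ∑ K (λ j → A (suc j)) ≤ β * (ι K * (ι K + 1ℚ)) + ι 2 * (ι K * ι B)
      total = ≤-trans (2 ⊛ ∑-mono K (λ j _ → affine (suc j))) (≤-reflexive (trans (cong (ι 2 *_) (trans (∑-+ K _ _) (cong₂ _+_ (∑-*ˡ K β _) (∑-const K (ι B))))) (linear-≡ (cong (β *_) (∑-suc K)) (solve 4 (λ β s K B → β :* (K :* (K :+ # 1)) :+ # 2 :* (K :* B) :- # 2 :* (β :* s :+ K :* B) := β :* (K :* (K :+ # 1)) :- β :* (# 2 :* s)) refl β (∑ K (λ j → ι (suc j))) (ι K) (ι B)))))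
      -- The affine bound inserted in `Δ-bound`: the defect is limited by the distance of A K from
      -- the bound it obeys. If A K is near its bound, Δ is small, and coercivity makes A K small
      -- after all.
      ΔK≤ : Δ K ≤ ι K * gap
      ΔK≤ = linear (Δ-bound K ⊕ total ⊕ *-monoˡ (ι K) (0≤ι K) β≤1) (solve 7 (λ D K A s E β B → K :* (β :* K :+ # 1 :+ # 2 :* B :+ # 4 :* E :- A) :- D := # 2 :* s :+ # 4 :* E :* K :+ (β :* (K :* (K :+ # 1)) :+ # 2 :* (K :* B)) :+ K :* # 1 :- (D :+ K :* A :+ # 2 :* s :+ K :* β)) refl (Δ K) (ι K) (A K) (∑ K (λ j → A (suc j))) (E K) β (ι B))
      0≤gap : 0ℚ ≤ gap
      0≤gap = cancel-* {0ℚ} {gap} (ι K) 0<K (≤-trans (≤-reflexive (*-zeroʳ (ι K))) (≤-trans (0≤Δ K) ΔK≤))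
      Δ≤ : Δ K * inv r ≤ ι 24 * gap
      Δ≤ = linear (*-monoʳ (inv r) (0≤inv r) ΔK≤ ⊕ ≤-reflexive (cong (λ z → z * gap * inv r) (ι-* 24 r)) ⊕ 24 ⊛ ≤-reflexive (cong (gap *_) (ι*inv 1≤r))) (solve 5 (λ D v K a r → # 24 :* a :- D :* v := K :* a :* v :+ # 24 :* r :* a :* v :+ # 24 :* (a :* # 1) :- (D :* v :+ K :* a :* v :+ # 24 :* (a :* (r :* v)))) refl (Δ K) (inv r) (ι K) gap (ι r))
      1e9≤Q : ι 15000000000 ≤ ι Q
      1e9≤Q = linear (k²≤Q ⊕ 15000000000 ⊛ *-mono (0≤ι 1) (0≤ι k) (ι-mono 1≤k) (ι-mono 1≤k)) (solve 2 (λ Q k2 → Q :- # 15000000000 := Q :+ # 15000000000 :* k2 :- (# 15000000000 :* k2 :+ # 15000000000 :* (# 1 :* # 1))) refl (ι Q) k2)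

    E-lg : ∀ K → E K ≤ ι 28 + ι p + ι 16 * ι (lg K)
    E-lg K = linear (≤-reflexive (cong (_+ ι 16 * h (suc K)) (ι-+ 12 p)) ⊕ 16 ⊛ h-mono (lg-upper K) ⊕ 16 ⊛ h-2^ (suc (lg K)) ⊕ 16 ⊛ ≤-reflexive (ι-suc (lg K))) (solve 6 (λ E p h H l l' → # 28 :+ p :+ # 16 :* l :- E := # 12 :+ p :+ # 16 :* h :+ # 16 :* H :+ # 16 :* l' :+ # 16 :* (# 1 :+ l) :- (E :+ # 16 :* h :+ # 16 :* H :+ # 16 :* l')) refl (E K) (ι p) (h (suc K)) (h (2 ℕ.^ suc (lg K))) (ι (lg K)) (ι (suc (lg K))))

    2y≤2^y : ∀ y → 2 ℕ.* y ℕ.≤ 2 ℕ.^ y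
    2y≤2^y zero = z≤n
    2y≤2^y (suc zero) = ℕ.≤-refl
    2y≤2^y (suc (suc y)) = ℕ-linear (2y≤2^y (suc y) ⊕ₙ 2 ⊛ₙ 0<2^ y) (ℕ-solve 2 (λ y a → conₙ 2 :*ₙ (conₙ 2 :+ₙ y) :+ₙ (conₙ 2 :*ₙ a :+ₙ conₙ 2 :*ₙ a :+ₙ conₙ 0) :=ₙ conₙ 2 :*ₙ (conₙ 2 :*ₙ a) :+ₙ (conₙ 2 :*ₙ (conₙ 1 :+ₙ y) :+ₙ conₙ 2 :*ₙ conₙ 1)) refl y (2 ℕ.^ y))

    -- With y = lg K - m ≥ lg K / 2 one gets 2^m lg K ≤ 2^m · 2 y ≤ 2^(m+y) ≤ K.
    lg-small : ∀ m K → 1 ℕ.≤ K → 2 ℕ.^ (2 ℕ.* m) ℕ.≤ K → 2 ℕ.^ m ℕ.* lg K ℕ.≤ K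
    lg-small m K 1≤K big = ℕ.≤-trans (ℕ.*-monoʳ-≤ (2 ℕ.^ m) (ℕ.≤-trans x≤2y (2y≤2^y y))) (ℕ.≤-trans (ℕ.≤-reflexive (trans (sym (ℕ.^-distribˡ-+-* 2 m y)) (cong (2 ℕ.^_) m+y≡))) (lg-lower 1≤K))
      where
      2m≤ : 2 ℕ.* m ℕ.≤ lg K
      2m≤ = lg-≥ big
      y : ℕ
      y = lg K ℕ.∸ m
      m+y≡ : m ℕ.+ y ≡ lg K
      m+y≡ = ℕ.m+[n∸m]≡n (ℕ.≤-trans (ℕ.m≤m+n m (m ℕ.+ 0)) 2m≤)
      x≤2y : lg K ℕ.≤ 2 ℕ.* y
      x≤2y = ℕ-linear (2 ⊛ₙ ℕ.≤-reflexive (sym m+y≡) ⊕ₙ 2m≤) (ℕ-solve 3 (λ x y m → x :+ₙ (conₙ 2 :*ₙ (m :+ₙ y) :+ₙ x :+ₙ conₙ 0) :=ₙ conₙ 2 :*ₙ y :+ₙ (conₙ 2 :*ₙ x :+ₙ conₙ 2 :*ₙ m)) refl (lg K) y m)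

    -- Beyond `threshold` the error 1 + 2 B + 5 E + c is at most K/M. As 5 E ≤ 140 + 5 p + 80 lg K,
    -- half of K pays for the constants (141 = 1 + 140) and half for the logarithm. `next` adds 24
    -- because the estimate is made at multiples of 24.
    threshold next : (M c m B : ℕ) → ℕ
    threshold M c m B = 2 ℕ.* M ℕ.* (141 ℕ.+ 5 ℕ.* p ℕ.+ 2 ℕ.* B ℕ.+ c) ℕ.+ 2 ℕ.^ (2 ℕ.* m)
    next M c m B = threshold M c m B ℕ.+ 24

    module _ (n k Q m : ℕ) (1≤k : 1 ℕ.≤ k) (k²≤Q : ι 15000000000 * (ι k * ι k) ≤ ι Q) (N-large : 16 ℕ.* Q ℕ.* 2 ℕ.^ suc n ℕ.≤ 2 ℕ.^ k ℕ.* 2 ℕ.^ k) (m-large : 160 ℕ.* (4 ℕ.* Q ℕ.* 2 ℕ.^ suc n) ℕ.≤ 2 ℕ.^ m) where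

      private
        c t M T : ℕ
        -- Taking c equal to N makes the two error terms 1/N² and 1/c² of `contraction` the same.
        c = 2 ℕ.^ k
        t = 2 ℕ.^ suc n
        M = 4 ℕ.* Q ℕ.* t
        T = 4 ℕ.* suc Q

      -- T decrements amount to 1/t = 2^-(n+1), which halves the slope. The factor 1/T is a quarter
      -- of the fraction 1/(1 + Q) gained by `contraction`.
      decrement : ℚ
      decrement = inv t * inv T

      private
        1≤c : 1 ℕ.≤ c
        1≤c = 0<2^ k
        1≤t : 1 ℕ.≤ t
        1≤t = 0<2^ (suc n)

        15e9≤Q : ι 15000000000 ≤ ι Q
        15e9≤Q = linear (k²≤Q ⊕ 15000000000 ⊛ *-mono {ι 1} {ι k} {ι 1} {ι k} (0≤ι 1) (0≤ι k) (ι-mono 1≤k) (ι-mono 1≤k)) (solve 2 (λ Q k → Q :- # 15000000000 := Q :+ # 15000000000 :* (k :* k) :- (# 15000000000 :* (k :* k) :+ # 15000000000 :* (# 1 :* # 1))) refl (ι Q) (ι k))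

        large : ∀ B K → 1 ℕ.≤ K → threshold M c m B ℕ.≤ K → ι M * (1ℚ + ι 2 * ι B + ι 5 * E K + ι c) ≤ ι K
        large B K 1≤K big = linear-by 1 (10 ⊛ *-monoˡ (ι M) (0≤ι M) (E-lg K) ⊕ ι-mono (ℕ.≤-trans (ℕ.m≤m+n _ _) big) ⊕ ≤-reflexive (sym (ι-* (2 ℕ.* M) (141 ℕ.+ 5 ℕ.* p ℕ.+ 2 ℕ.* B ℕ.+ c))) ⊕ ≤-reflexive (sym (cong (_* ι (141 ℕ.+ 5 ℕ.* p ℕ.+ 2 ℕ.* B ℕ.+ c)) (ι-* 2 M))) ⊕ 2 ⊛ ≤-reflexive (sym (cong (ι M *_) (ι-+ (141 ℕ.+ 5 ℕ.* p ℕ.+ 2 ℕ.* B) c))) ⊕ 2 ⊛ ≤-reflexive (sym (cong (ι M *_) (ι-+ (141 ℕ.+ 5 ℕ.* p) (2 ℕ.* B)))) ⊕ 2 ⊛ ≤-reflexive (sym (cong (ι M *_) (ι-+ 141 (5 ℕ.* p)))) ⊕ 2 ⊛ ≤-reflexive (sym (cong (ι M *_) (ι-* 5 p))) ⊕ 2 ⊛ ≤-reflexive (sym (cong (ι M *_) (ι-* 2 B))) ⊕ ι-mono (ℕ.≤-trans (ℕ.*-monoˡ-≤ (lg K) m-large) (lg-small m K 1≤K (ℕ.≤-trans (ℕ.m≤n+m _ _) big))) ⊕ ≤-reflexive (sym (ι-* (160 ℕ.* M) (lg K))) ⊕ ≤-reflexive (sym (cong (_* ι (lg K)) (ι-* 160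 M)))) (solve 16 (λ M B E c K p l s s2 s3 u u1 a1 a2 a3 a4 → # 2 :* (K :- M :* (# 1 :+ # 2 :* B :+ # 5 :* E :+ c)) := # 10 :* (M :* (# 28 :+ p :+ # 16 :* l)) :+ K :+ s :+ s2 :* s3 :+ # 2 :* (M :* s3) :+ # 2 :* (M :* a1) :+ # 2 :* (M :* a2) :+ # 2 :* (M :* a3) :+ # 2 :* (M :* a4) :+ K :+ u :+ u1 :* l :- (# 10 :* (M :* E) :+ s :+ s2 :* s3 :+ # 2 :* M :* s3 :+ # 2 :* (M :* (a1 :+ c)) :+ # 2 :* (M :* (a2 :+ a4)) :+ # 2 :* (M :* (# 141 :+ a3)) :+ # 2 :* (M :* (# 5 :* p)) :+ # 2 :* (M :* (# 2 :* B)) :+ u :+ u1 :* l :+ # 160 :* M :* l)) refl (ι M) (ι B) (E K) (ι c) (ι K) (ι p) (ι (lg K)) (ι (2 ℕ.* M ℕ.* (141 ℕ.+ 5 ℕ.* p ℕ.+ 2 ℕ.* B ℕ.+ c))) (ι (2 ℕ.* M)) (ι (141 ℕ.+ 5 ℕ.* p ℕ.+ 2 ℕ.* B ℕ.+ c)) (ι (160 ℕ.* M ℕ.* lg K)) (ι (160 ℕ.* M)) (ι (141 ℕ.+ 5 ℕ.* p ℕ.+ 2 ℕ.* B)) (ι (141 ℕ.+ 5 ℕ.* p)) (ι (5 ℕ.* p)) (ι (2 ℕ.* B)))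

        -- Solved for A K, `contraction` reads (1 + Q) A K ≤ Q β K + errors. Of the spare β K ≥ K/t
        -- the errors take at most K/(4t) and K/(8t), and the decrement takes K/(4t).
        good-scale : ∀ β B r → 1 ℕ.≤ r → Affine β B → inv t ≤ β → β ≤ 1ℚ → ι M * (1ℚ + ι 2 * ι B + ι 5 * E (24 ℕ.* r) + ι c) ≤ ι (24 ℕ.* r) → A (24 ℕ.* r) ≤ (β - decrement) * ι (24 ℕ.* r)
        good-scale β B r 1≤r affine t≤β β≤1 big = cancel-* {A K} {(β - decrement) * ι K} (1ℚ + ι Q) (<-≤-trans (0<ι 0) (linear (0≤ι Q) (solve 1 (λ Q → # 1 :+ Q :- # 1 := Q :- # 0) refl (ι Q)))) (linear-by 7 (8 ⊛ contraction r k c β B Q 1≤k 1≤c scales 1≤r affine (≤-trans (0≤inv t) t≤β) β≤1 k²≤Q ⊕ *-monoʳ (ι K) (0≤ι K) Qn2 ⊕ 2 ⊛ Qx ⊕ 2 ⊛ ≤-reflexive (cong (_* ι K) Qd) ⊕ 8 ⊛ *-monoʳ (ι K) (0≤ι K) t≤β ⊕ 3 ⊛ *-nonneg (0≤inv t) (0≤ι K)) (solve 10 (λ Q A β K B E c n2 v d → # 8 :* ((# 1 :+ Q) :* ((β :- d) :* K) :- (# 1 :+ Q) :* A) := # 8 :* (Q :* (β :* K :+ (# 1 :+ # 2 :* B :+ # 5 :* E :+ c) :- A) :+ Q :* K :* (n2 :+ n2)) :+ v :* K :+ # 2 :* (v :* K) :+ # 2 :* (v :* K) :+ # 8 :* (β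 :* K) :+ # 3 :* (v :* K) :- (# 8 :* A :+ # 16 :* (Q :* n2) :* K :+ # 2 :* (# 4 :* (Q :* (# 1 :+ # 2 :* B :+ # 5 :* E :+ c))) :+ # 2 :* (# 4 :* ((# 1 :+ Q) :* d) :* K) :+ # 8 :* (v :* K) :+ # 3 :* # 0)) refl (ι Q) (A K) β (ι K) (ι B) (E K) (ι c) (inv c * inv c) (inv t) decrement))
          where
          K : ℕ
          K = 24 ℕ.* r
          Qn2 : ι 16 * (ι Q * (inv c * inv c)) ≤ inv t
          Qn2 = linear (*-monoʳ (inv t * inv c * inv c) (*-nonneg (*-nonneg (0≤inv t) (0≤inv c)) (0≤inv c)) (ι-mono N-large) ⊕ ≤-reflexive (cong (_* (inv t * inv c * inv c)) (ι-* c c)) ⊕ ≤-reflexive (sym (cong (_* (inv t * inv c * inv c)) (ι-* (16 ℕ.* Q) t))) ⊕ ≤-reflexive (sym (cong (_* (ι t * inv t * inv c * inv c)) (ι-* 16 Q))) ⊕ 16 ⊛ ≤-reflexive (sym (cong (ι Q * inv c * inv c *_) (ι*inv 1≤t))) ⊕ ≤-reflexive (cong (inv t *_) (ι*inv 1≤c)) ⊕ ≤-reflexive (cong (inv t * ι c * inv c *_) (ι*inv 1≤c))) (solve 8 (λ Q t v c u s s1 cc → v :- # 16 :* (Q :* (u :* u)) := cc :* (v :* u :* u) :+ c :* c :* (v :* u :* u) :+ s :* (v :* u :* u) :+ s1 :* (t :* v :* u :* u) :+ # 16 :* (Q :* u :* u :* (t :* v)) :+ v :* # 1 :+ v :* c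 :* u :* # 1 :- (s :* (v :* u :* u) :+ cc :* (v :* u :* u) :+ s1 :* t :* (v :* u :* u) :+ # 16 :* Q :* (t :* v :* u :* u) :+ # 16 :* (Q :* u :* u :* # 1) :+ v :* (c :* u) :+ v :* c :* u :* (c :* u))) refl (ι Q) (ι t) (inv t) (ι c) (inv c) (ι (16 ℕ.* Q ℕ.* t)) (ι (16 ℕ.* Q)) (ι (c ℕ.* c)))
          Qx : ι 4 * (ι Q * (1ℚ + ι 2 * ι B + ι 5 * E K + ι c)) ≤ inv t * ι K
          Qx = linear (*-monoˡ (inv t) (0≤inv t) big ⊕ ≤-reflexive (sym (cong (_* (inv t * (1ℚ + ι 2 * ι B + ι 5 * E K + ι c))) (ι-* (4 ℕ.* Q) t))) ⊕ ≤-reflexive (sym (cong (_* (ι t * inv t * (1ℚ + ι 2 * ι B + ι 5 * E K + ι c))) (ι-* 4 Q))) ⊕ 4 ⊛ ≤-reflexive (sym (cong (ι Q * (1ℚ + ι 2 * ι B + ι 5 * E K + ι c) *_) (ι*inv 1≤t)))) (solve 7 (λ Q t v M M4 x K → v :* K :- # 4 :* (Q :* x) := v :* K :+ M :* (v :* x) :+ M4 :* (t :* v :* x) :+ # 4 :* (Q :* x :* (t :* v)) :- (v :* (M :* x) :+ M4 :* t :* (v :* x) :+ # 4 :* Q :* (t :* v :* x) :+ # 4 :* (Q :* x :* # 1))) refl (ι Q) (ι t) (inv t) (ι M) (ι (4 ℕ.* Q)) (1ℚ + ι 2 * ι B + ι 5 * E K + ι c) (ι K))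
          Qd : ι 4 * ((1ℚ + ι Q) * decrement) ≡ inv t
          Qd = linear-≡ (cong₂ _+_ (cong₂ _+_ (sym (cong (_* (inv t * inv T)) (ι-* 4 (suc Q)))) (cong (ι 4 *_) (sym (cong (inv t * inv T *_) (ι-suc Q))))) (cong (inv t *_) (ι*inv {T} (s≤s z≤n)))) (solve 5 (λ Q Q' T v u → v :- # 4 :* ((# 1 :+ Q) :* (v :* u)) := T :* (v :* u) :+ # 4 :* (v :* u :* Q') :+ v :* # 1 :- (# 4 :* Q' :* (v :* u) :+ # 4 :* (v :* u :* (# 1 :+ Q)) :+ v :* (T :* u))) refl (ι Q) (ι (suc Q)) (ι T) (inv t) (inv T))
          scales : E K + ι (k ℕ.+ c ℕ.+ 7) ≤ ι r
          scales = cancel-* {E K + ι (k ℕ.+ c ℕ.+ 7)} {ι r} (ι 24) (0<ι 23) (linear (24 ⊛ ≤-reflexive (ι-+ (k ℕ.+ c) 7) ⊕ 24 ⊛ ≤-reflexive (ι-+ k c) ⊕ 24 ⊛ ι-mono (ℕ.<⇒≤ (n<2^n k)) ⊕ 952 ⊛ ι-mono 1≤c ⊕ big ⊕ ≤-reflexive (ι-* 24 r) ⊕ *-monoʳ (1ℚ + ι 2 * ι B + ι 5 * E K + ι c) (0≤ι 1 ⊕ *-nonneg (0≤ι 2) (0≤ι B) ⊕ *-nonneg (0≤ι 5) 0≤E ⊕ 0≤ι c) M≥ ⊕ 4976 ⊛ 0≤E ⊕ 2000 ⊛ 0≤ι B ⊕ 0≤ι 1784) (solve 9 (λ E s s1 k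 c r K M B → # 24 :* r :- # 24 :* (E :+ s) := # 24 :* (s1 :+ # 7) :+ # 24 :* (k :+ c) :+ # 24 :* c :+ # 952 :* c :+ K :+ # 24 :* r :+ M :* (# 1 :+ # 2 :* B :+ # 5 :* E :+ c) :+ # 4976 :* E :+ # 2000 :* B :+ # 1784 :- (# 24 :* s :+ # 24 :* s1 :+ # 24 :* k :+ # 952 :* # 1 :+ M :* (# 1 :+ # 2 :* B :+ # 5 :* E :+ c) :+ K :+ # 1000 :* (# 1 :+ # 2 :* B :+ # 5 :* E :+ c) :+ # 4976 :* # 0 :+ # 2000 :* # 0 :+ # 0)) refl (E K) (ι (k ℕ.+ c ℕ.+ 7)) (ι (k ℕ.+ c)) (ι k) (ι c) (ι r) (ι K) (ι M) (ι B)))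
            where
            0≤E : 0ℚ ≤ E K
            0≤E = ≤-trans (0≤ι 12) (12≤E K)
            M≥ : ι 1000 ≤ ι M
            M≥ = linear (≤-reflexive (sym (ι-* (4 ℕ.* Q) t)) ⊕ *-monoˡ (ι (4 ℕ.* Q)) (0≤ι (4 ℕ.* Q)) (ι-mono 1≤t) ⊕ ≤-reflexive (sym (ι-* 4 Q)) ⊕ 4 ⊛ 15e9≤Q ⊕ 0≤ι 59999999000) (solve 4 (λ M M4 Q t → M :- # 1000 := M :+ M4 :* t :+ M4 :+ # 4 :* Q :+ # 59999999000 :- (M4 :* t :+ M4 :* # 1 :+ # 4 :* Q :+ # 4 :* # 15000000000 :+ # 0)) refl (ι M) (ι (4 ℕ.* Q)) (ι Q) (ι t))

      -- Large j are rounded up to a multiple of 24, at the cost of at most 24. Below the threshold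
      -- the trivial A j ≤ j is absorbed by the constant.
      step : ∀ β B → Affine β B → inv t ≤ β → β ≤ 1ℚ → Affine (β - decrement) (next M c m B)
      step β B affine t≤β β≤1 j = dec-elim (K₀ ℕ.≤? j) big small
        where
        K₀ : ℕ
        K₀ = threshold M c m B
        d≤ : decrement ≤ inv t
        d≤ = ≤-trans (*-monoˡ (inv t) (0≤inv t) (inv≤1 T)) (≤-reflexive (*-identityʳ (inv t)))
        0≤d : 0ℚ ≤ decrement
        0≤d = *-nonneg (0≤inv t) (0≤inv T)
        0≤β-d : 0ℚ ≤ β - decrement
        0≤β-d = linear (d≤ ⊕ t≤β) (solve 3 (λ β d v → β :- d :- # 0 := v :+ β :- (d :+ v)) refl β decrement (inv t))
        small : ¬ K₀ ℕ.≤ j → A j ≤ (β - decrement) * ι j + ι (K₀ ℕ.+ 24)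
        small j<K₀ = linear (A≤ j ⊕ ι-mono (ℕ.<⇒≤ (ℕ.≰⇒> j<K₀)) ⊕ ≤-reflexive (sym (ι-+ K₀ 24)) ⊕ *-nonneg 0≤β-d (0≤ι j) ⊕ 0≤ι 24) (solve 5 (λ A j K K' b → b :* j :+ K' :- A := j :+ K :+ K' :+ b :* j :+ # 24 :- (A :+ j :+ (K :+ # 24) :+ # 0 :+ # 0)) refl (A j) (ι j) (ι K₀) (ι (K₀ ℕ.+ 24)) (β - decrement))
        big : K₀ ℕ.≤ j → A j ≤ (β - decrement) * ι j + ι (K₀ ℕ.+ 24)
        big K₀≤j = linear (A-mono (ℕ.<⇒≤ j<) ⊕ good-scale β B r (s≤s z≤n) affine t≤β β≤1 (large B (24 ℕ.* r) (ℕ.≤-trans (s≤s z≤n) j<) (ℕ.≤-trans K₀≤j (ℕ.<⇒≤ j<))) ⊕ *-monoˡ (β - decrement) 0≤β-d (ι-mono r≤) ⊕ ≤-reflexive (cong ((β - decrement) *_) (ι-+ j 24)) ⊕ ≤-reflexive (sym (ι-+ K₀ 24)) ⊕ 0≤ι K₀ ⊕ 24 ⊛ β≤1 ⊕ 24 ⊛ 0≤d ⊕ 24 ⊛ ≤-reflexive (refl {x = β - decrement})) (solve 10 (λ A A' j J J' K K' b d β → b :* j :+ K' :- A := A' :+ b :* J :+ b :* J' :+ b :* (j :+ # 24) :+ K' :+ K :+ # 24 :* # 1 :+ # 24 :* d :+ # 24 :* (β :- d) :- (A :+ A' :+ b :* J :+ b :* J' :+ (K :+ # 24) :+ # 0 :+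 # 24 :* β :+ # 24 :* # 0 :+ # 24 :* b)) refl (A j) (A (24 ℕ.* r)) (ι j) (ι (24 ℕ.* r)) (ι (j ℕ.+ 24)) (ι K₀) (ι (K₀ ℕ.+ 24)) (β - decrement) decrement β)
          where
          r : ℕ
          r = suc (j div 24)
          j< : j ℕ.< 24 ℕ.* r
          j< = ℕ.<-≤-trans (div-upper j {24} (s≤s z≤n)) (ℕ.≤-reflexive (trans (ℕ.+-comm (24 ℕ.* (j div 24)) 24) (sym (ℕ.*-suc 24 (j div 24)))))
          r≤ : 24 ℕ.* r ℕ.≤ j ℕ.+ 24
          r≤ = ℕ.≤-trans (ℕ.≤-reflexive (trans (ℕ.*-suc 24 (j div 24)) (ℕ.+-comm 24 (24 ℕ.* (j div 24))))) (ℕ.+-monoˡ-≤ 24 (div-lower j 24))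

      -- The constant grows by at most 2^g in each of the T steps. The quantity `B + suc p` is
      -- followed instead of B, because it absorbs the additive terms of `next` into that factor.
      halve : ∀ B g → (∀ B → next M c m B ℕ.+ suc p ℕ.≤ 2 ℕ.^ g ℕ.* (B ℕ.+ suc p)) → Affine (inv (2 ℕ.^ n)) B → ∃ λ B′ → Affine (inv t) B′ × B′ ℕ.+ suc p ℕ.≤ 2 ℕ.^ (g ℕ.* T) ℕ.* (B ℕ.+ suc p)
      halve B g grow affine = finish (iterate T ℕ.≤-refl)
        where
        inv-n : inv (2 ℕ.^ n) ≡ ι 2 * inv t
        inv-n = linear-≡ (cong₂ _+_ (cong (ι 2 *_) (sym (inv-* 2 (2 ℕ.^ n)))) (sym (cong (_* inv (2 ℕ.^ n)) (refl {x = ι 2 * inv 2})))) (solve 3 (λ a v u → # 2 :* v :- a := # 2 :* v :+ # 2 :* u :* a :- (# 2 :* (u :* a) :+ # 1 :* a)) refl (inv (2 ℕ.^ n)) (inv t) (inv 2))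
        advance : ∀ i → i ℕ.< T → (∃ λ B′ → Affine (inv (2 ℕ.^ n) - ι i * decrement) B′ × B′ ℕ.+ suc p ℕ.≤ 2 ℕ.^ (g ℕ.* i) ℕ.* (B ℕ.+ suc p)) → (∃ λ B′ → Affine (inv (2 ℕ.^ n) - ι (suc i) * decrement) B′ × B′ ℕ.+ suc p ℕ.≤ 2 ℕ.^ (g ℕ.* suc i) ℕ.* (B ℕ.+ suc p))
        iterate : ∀ i → i ℕ.≤ T → ∃ λ B′ → Affine (inv (2 ℕ.^ n) - ι i * decrement) B′ × B′ ℕ.+ suc p ℕ.≤ 2 ℕ.^ (g ℕ.* i) ℕ.* (B ℕ.+ suc p)
        iterate zero _ = B , (λ j → ≤-trans (affine j) (≤-reflexive (solve 4 (λ a d j B → a :* j :+ B := (a :- # 0 :* d) :* j :+ B) refl (inv (2 ℕ.^ n)) decrement (ι j) (ι B)))) , ℕ.≤-reflexive (trans (sym (ℕ.*-identityˡ (B ℕ.+ suc p))) (cong (λ z → 2 ℕ.^ z ℕ.* (B ℕ.+ suc p)) (sym (ℕ.*-zeroʳ g))))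
        iterate (suc i) i<T = advance i i<T (iterate i (ℕ.<⇒≤ i<T))
        advance i i<T (B₁ , affine₁ , B₁≤) = next M c m B₁ , (λ j → ≤-trans (step (inv (2 ℕ.^ n) - ι i * decrement) B₁ affine₁ lower upper j) (≤-reflexive (cong (λ z → z * ι j + ι (next M c m B₁)) shift))) ,
          ℕ.≤-trans (grow B₁) (ℕ.≤-trans (ℕ.*-monoʳ-≤ (2 ℕ.^ g) B₁≤) (ℕ.≤-reflexive (trans (sym (ℕ.*-assoc (2 ℕ.^ g) (2 ℕ.^ (g ℕ.* i)) (B ℕ.+ suc p))) (cong (ℕ._* (B ℕ.+ suc p)) (trans (sym (ℕ.^-distribˡ-+-* 2 g (g ℕ.* i))) (cong (2 ℕ.^_) (sym (ℕ.*-suc g i))))))))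
          where
          shift : inv (2 ℕ.^ n) - ι i * decrement - decrement ≡ inv (2 ℕ.^ n) - ι (suc i) * decrement
          shift = linear-≡ (cong (_* decrement) (ι-suc i)) (solve 4 (λ a d i i' → a :- i' :* d :- (a :- i :* d :- d) := (# 1 :+ i) :* d :- i' :* d) refl (inv (2 ℕ.^ n)) decrement (ι i) (ι (suc i)))
          lower : inv t ≤ inv (2 ℕ.^ n) - ι i * decrement
          lower = linear (≤-reflexive (sym inv-n) ⊕ *-monoʳ (inv t * inv T) (*-nonneg (0≤inv t) (0≤inv T)) (ι-mono (ℕ.<⇒≤ i<T)) ⊕ ≤-reflexive (cong (inv t *_) (ι*inv {T} (s≤s z≤n)))) (solve 5 (λ a v i T u → a :- i :* (v :* u) :- v := a :+ T :* (v :* u) :+ v :* # 1 :- (# 2 :* v :+ i :* (v :* u) :+ v :* (T :* u))) refl (inv (2 ℕ.^ n)) (inv t) (ι i) (ι T) (inv T))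
          upper : inv (2 ℕ.^ n) - ι i * decrement ≤ 1ℚ
          upper = linear (inv≤1 (2 ℕ.^ n) ⊕ *-nonneg (0≤ι i) (*-nonneg (0≤inv t) (0≤inv T))) (solve 2 (λ a x → # 1 :- (a :- x) := # 1 :+ x :- (a :+ # 0)) refl (inv (2 ℕ.^ n)) (ι i * decrement))
        finish : (∃ λ B′ → Affine (inv (2 ℕ.^ n) - ι T * decrement) B′ × B′ ℕ.+ suc p ℕ.≤ 2 ℕ.^ (g ℕ.* T) ℕ.* (B ℕ.+ suc p)) → ∃ λ B′ → Affine (inv t) B′ × B′ ℕ.+ suc p ℕ.≤ 2 ℕ.^ (g ℕ.* T) ℕ.* (B ℕ.+ suc p)
        finish (B′ , affine′ , B′≤) = B′ , (λ j → ≤-trans (affine′ j) (≤-reflexive (cong (λ z → z * ι j + ι B′) end))) , B′≤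
          where
          end : inv (2 ℕ.^ n) - ι T * decrement ≡ inv t
          end = linear-≡ (cong₂ _+_ inv-n (sym (cong (inv t *_) (ι*inv {T} (s≤s z≤n))))) (solve 4 (λ a v T u → v :- (a :- T :* (v :* u)) := # 2 :* v :+ v :* (T :* u) :- (a :+ v :* # 1)) refl (inv (2 ℕ.^ n)) (inv t) (ι T) (inv T))

  -- Decay of the energy with an explicit constant.

  module Decay where

    open Iteration
    open Energy using (A≤)

    -- Kept opaque so that the large powers are not unfolded. 2^34 is the first power of two above
    -- 15 · 10⁹.
    opaque
      c₁ : ℕ
      c₁ = 34

      C₁ : ℕ
      C₁ = 2 ℕ.^ c₁

      C₁≤ : C₁ ℕ.≤ 2 ℕ.^ c₁
      C₁≤ = ℕ.≤-refl

      15e9≤C₁ : ι 15000000000 ≤ ι C₁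
      15e9≤C₁ = ι-mono (ℕ.≤ᵇ⇒≤ 15000000000 17179869184 _)

    k*k≤2^k : ∀ k → (4 ℕ.+ k) ℕ.* (4 ℕ.+ k) ℕ.≤ 2 ℕ.^ (4 ℕ.+ k)
    k*k≤2^k zero = ℕ.≤-refl
    k*k≤2^k (suc k) = ℕ-linear-by 15 (25 ⊛ₙ k*k≤2^k k) (ℕ-solve 2 (λ k a → conₙ 16 :*ₙ ((conₙ 5 :+ₙ k) :*ₙ (conₙ 5 :+ₙ k)) :+ₙ (conₙ 25 :*ₙ a :+ₙ (conₙ 7 :*ₙ a :+ₙ conₙ 40 :*ₙ k :+ₙ conₙ 9 :*ₙ k :*ₙ k)) :=ₙ conₙ 16 :*ₙ (a :+ₙ (a :+ₙ conₙ 0)) :+ₙ conₙ 25 :*ₙ ((conₙ 4 :+ₙ k) :*ₙ (conₙ 4 :+ₙ k))) refl k (2 ℕ.^ (4 ℕ.+ k)))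

    next-ι : ∀ M c m B → ι (next M c m B) ≡ ι 2 * ι M * (ι 141 + ι 5 * ι p + ι 2 * ι B + ι c) + ι (2 ℕ.^ (2 ℕ.* m)) + ι 24
    next-ι M c m B = trans (ι-+ (threshold M c m B) 24) (cong (_+ ι 24) (trans (ι-+ (2 ℕ.* M ℕ.* (141 ℕ.+ 5 ℕ.* p ℕ.+ 2 ℕ.* B ℕ.+ c)) (2 ℕ.^ (2 ℕ.* m))) (cong (_+ ι (2 ℕ.^ (2 ℕ.* m)))
      (trans (ι-* (2 ℕ.* M) (141 ℕ.+ 5 ℕ.* p ℕ.+ 2 ℕ.* B ℕ.+ c)) (cong₂ _*_ (ι-* 2 M) (trans (ι-+ (141 ℕ.+ 5 ℕ.* p ℕ.+ 2 ℕ.* B) c) (cong (_+ ι c) (trans (ι-+ (141 ℕ.+ 5 ℕ.* p) (2 ℕ.* B)) (cong₂ _+_ (trans (ι-+ 141 (5 ℕ.* p)) (cong (ι 141 +_) (ι-* 5 p))) (ι-* 2 B))))))))))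

    -- Everything is compared with P = 2^m: M ≤ P/160, c ≤ P, and the power in `threshold` is P².
    -- The total stays below 8 P² (B + suc p), hence the exponent 2 m + 3.
    next-bound : ∀ M k m → 160 ℕ.* M ℕ.≤ 2 ℕ.^ m → k ℕ.≤ m → 8 ℕ.≤ m → ∀ B → next M (2 ℕ.^ k) m B ℕ.+ suc p ℕ.≤ 2 ℕ.^ (m ℕ.+ (m ℕ.+ 3)) ℕ.* (B ℕ.+ suc p)
    next-bound M k m m-large k≤m 8≤m B = ι-cancel (≤-trans (≤-reflexive (trans (ι-+ (next M (2 ℕ.^ k) m B) (suc p)) (cong₂ _+_ (trans (next-ι M (2 ℕ.^ k) m B) (cong (λ z → ι 2 * ι M * (ι 141 + ι 5 * ι p + ι 2 * ι B + ι (2 ℕ.^ k)) + z + ι 24) 2m)) (ι-suc p))))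
        (≤-trans (bound (ι M) (ι (2 ℕ.^ k)) P (ι B) (ι p) 160M≤P (ι-mono (2^-mono {k} {m} k≤m)) (ι-mono {2 ℕ.^ 8} {2 ℕ.^ m} (2^-mono {8} {m} 8≤m)) (0≤ι M) (0≤ι (2 ℕ.^ k)) (0≤ι B) (0≤ι p))
          (≤-reflexive (sym (trans (ι-* (2 ℕ.^ (m ℕ.+ (m ℕ.+ 3))) (B ℕ.+ suc p)) (cong₂ _*_ 2mm3 (trans (ι-+ B (suc p)) (cong (ι B +_) (ι-suc p)))))))))
      where
      P : ℚ
      P = ι (2 ℕ.^ m)
      PP : ι (2 ℕ.^ (m ℕ.+ m)) ≡ P * P
      PP = trans (cong ι (ℕ.^-distribˡ-+-* 2 m m)) (ι-* (2 ℕ.^ m) (2 ℕ.^ m))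
      2m : ι (2 ℕ.^ (2 ℕ.* m)) ≡ P * P
      2m = trans (cong (λ z → ι (2 ℕ.^ (m ℕ.+ z))) (ℕ.+-identityʳ m)) PP
      2mm3 : ι (2 ℕ.^ (m ℕ.+ (m ℕ.+ 3))) ≡ P * P * ι 8
      2mm3 = trans (cong (λ z → ι (2 ℕ.^ z)) (sym (ℕ.+-assoc m m 3))) (trans (cong ι (ℕ.^-distribˡ-+-* 2 (m ℕ.+ m) 3)) (trans (ι-* (2 ℕ.^ (m ℕ.+ m)) 8) (cong (_* ι 8) PP)))
      160M≤P : ι 160 * ι M ≤ P
      160M≤P = ≤-trans (≤-reflexive (sym (ι-* 160 M))) (ι-mono m-large)
      bound : ∀ M c P B p → ι 160 * M ≤ P → c ≤ P → ι 256 ≤ P → 0ℚ ≤ M → 0ℚ ≤ c → 0ℚ ≤ B → 0ℚ ≤ p → ι 2 * M * (ι 141 + ι 5 * p + ι 2 * B + c) + P * P + ι 24 + (1ℚ + p) ≤ P * P * ι 8 * (B + (1ℚ + p))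
      bound M c P B p M≤ c≤ P≥ 0≤M 0≤c 0≤B 0≤p = linear-by 327679 (577536 ⊛ M≤ ⊕ 20480 ⊛ *-monoʳ p 0≤p M≤ ⊕ 8192 ⊛ *-monoʳ B 0≤B M≤ ⊕ 2291379 ⊛ *-monoʳ c 0≤c M≤ ⊕ 2291379 ⊛ *-monoˡ P 0≤P c≤ ⊕ 2381 ⊛ *-monoʳ P 0≤P P≥ ⊕ 32000 ⊛ P≥ ⊕ 671068160 ⊛ *-monoʳ p 0≤p P≥ ⊕ 2621440 ⊛ *-monoʳ (P * p) (*-nonneg 0≤P 0≤p) P≥ ⊕ 2621440 ⊛ *-monoʳ (P * B) (*-nonneg 0≤P 0≤B) P≥ ⊕ 171793121280 ⊛ 0≤p ⊕ 671080448 ⊛ *-nonneg 0≤P 0≤B ⊕ 365965280 ⊛ *-nonneg 0≤M 0≤c) (solve 5 (λ M c P B p → # 327680 :* (P :* P :* # 8 :* (B :+ (# 1 :+ p)) :- (# 2 :* M :* (# 141 :+ # 5 :* p :+ # 2 :* B :+ c) :+ P :* P :+ # 24 :+ (# 1 :+ p))) := # 577536 :* P :+ # 20480 :* (P :* p) :+ # 8192 :* (P :* B) :+ # 2291379 :* (P :* c) :+ # 2291379 :* (P :* P) :+ # 2381 :* (P :* P) :+ # 32000 :* P :+ # 671068160 :* (P :* p) :+ # 2621440 :* (P :* (P :* p)) :+ # 2621440 :* (P :* (P :* B)) :+ # 171793121280 :* p :+ # 671080448 :* (P :* B) :+ # 365965280 :* (M :* c) :- (# 577536 :* (# 160 :*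 M) :+ # 20480 :* (# 160 :* M :* p) :+ # 8192 :* (# 160 :* M :* B) :+ # 2291379 :* (# 160 :* M :* c) :+ # 2291379 :* (P :* c) :+ # 2381 :* (# 256 :* P) :+ # 32000 :* # 256 :+ # 671068160 :* (# 256 :* p) :+ # 2621440 :* (# 256 :* (P :* p)) :+ # 2621440 :* (# 256 :* (P :* B)) :+ # 171793121280 :* # 0 :+ # 671080448 :* # 0 :+ # 365965280 :* # 0)) refl M c P B p)
        where
        0≤P : 0ℚ ≤ P
        0≤P = ≤-trans (0≤ι 256) P≥

    module Parameters (n : ℕ) where

      -- Since Q ≤ 2^(c₁+k), the condition 16 Q 2^(n+1) ≤ 4^k holds when k = n + c₁ + 5, with
      -- exponents matching exactly; in the same way 640 ≤ 2^10 leads to the 11 in m. Thus k, m and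
      -- g are linear in n, while Q and T are quadratic.
      k Q m g T M : ℕ
      k = n ℕ.+ (c₁ ℕ.+ 5)
      Q = C₁ ℕ.* (k ℕ.* k)
      m = n ℕ.+ (c₁ ℕ.+ (k ℕ.+ 11))
      g = m ℕ.+ (m ℕ.+ 3)
      T = 4 ℕ.* suc Q
      M = 4 ℕ.* Q ℕ.* 2 ℕ.^ suc n

      1≤k : 1 ℕ.≤ k
      1≤k = ℕ.≤-trans (ℕ.m≤n+m 1 4) (ℕ.≤-trans (ℕ.m≤n+m 5 c₁) (ℕ.m≤n+m (c₁ ℕ.+ 5) n))

      k²≤Q : ι 15000000000 * (ι k * ι k) ≤ ι Q
      k²≤Q = ≤-trans (*-monoʳ (ι k * ι k) (sq≥0 (ι k)) 15e9≤C₁) (≤-reflexive (sym (trans (ι-* C₁ (k ℕ.* k)) (cong (ι C₁ *_) (ι-* k k)))))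

      Q≤ : Q ℕ.≤ 2 ℕ.^ (c₁ ℕ.+ k)
      Q≤ = ℕ.≤-trans (ℕ.*-mono-≤ C₁≤ (subst (λ k → k ℕ.* k ℕ.≤ 2 ℕ.^ k) (4+ n c₁) (k*k≤2^k (n ℕ.+ suc c₁)))) (ℕ.≤-reflexive (sym (ℕ.^-distribˡ-+-* 2 c₁ k)))
        where
        4+ : ∀ n c → 4 ℕ.+ (n ℕ.+ suc c) ≡ n ℕ.+ (c ℕ.+ 5)
        4+ n c = ℕ-solve 2 (λ n c → conₙ 4 :+ₙ (n :+ₙ (conₙ 1 :+ₙ c)) :=ₙ n :+ₙ (c :+ₙ conₙ 5)) refl n c

      Qt≤ : ∀ j x a → (c₁ ℕ.+ k) ℕ.+ suc n ℕ.+ j ≡ x → a ℕ.≤ 2 ℕ.^ j → a ℕ.* Q ℕ.* 2 ℕ.^ suc n ℕ.≤ 2 ℕ.^ x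
      Qt≤ j x a refl a≤ = ℕ.≤-trans (ℕ.*-monoˡ-≤ (2 ℕ.^ suc n) (ℕ.*-mono-≤ a≤ Q≤)) (ℕ.≤-reflexive (trans (trans (ℕ.*-assoc (2 ℕ.^ j) (2 ℕ.^ (c₁ ℕ.+ k)) (2 ℕ.^ suc n)) (trans (ℕ.*-comm (2 ℕ.^ j) (2 ℕ.^ (c₁ ℕ.+ k) ℕ.* 2 ℕ.^ suc n))
        (cong (ℕ._* 2 ℕ.^ j) (sym (ℕ.^-distribˡ-+-* 2 (c₁ ℕ.+ k) (suc n)))))) (sym (ℕ.^-distribˡ-+-* 2 ((c₁ ℕ.+ k) ℕ.+ suc n) j))))

      N-large : 16 ℕ.* Q ℕ.* 2 ℕ.^ suc n ℕ.≤ 2 ℕ.^ k ℕ.* 2 ℕ.^ k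
      N-large = ℕ.≤-trans (Qt≤ 4 (k ℕ.+ k) 16 (lem n c₁ k) ℕ.≤-refl) (ℕ.≤-reflexive (ℕ.^-distribˡ-+-* 2 k k))
        where
        lem : ∀ n c k → (c ℕ.+ k) ℕ.+ suc n ℕ.+ 4 ≡ k ℕ.+ (n ℕ.+ (c ℕ.+ 5))
        lem n c k = ℕ-solve 3 (λ n c k → c :+ₙ k :+ₙ (conₙ 1 :+ₙ n) :+ₙ conₙ 4 :=ₙ k :+ₙ (n :+ₙ (c :+ₙ conₙ 5))) refl n c k

      m-large : 160 ℕ.* M ℕ.≤ 2 ℕ.^ m
      m-large = ℕ.≤-trans (ℕ.≤-reflexive (trans (sym (ℕ.*-assoc 160 (4 ℕ.* Q) (2 ℕ.^ suc n))) (cong (ℕ._* 2 ℕ.^ suc n) (sym (ℕ.*-assoc 160 4 Q))))) (Qt≤ 10 m 640 (lem n c₁ k) (ℕ.≤ᵇ⇒≤ 640 1024 _))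
        where
        lem : ∀ n c k → (c ℕ.+ k) ℕ.+ suc n ℕ.+ 10 ≡ n ℕ.+ (c ℕ.+ (k ℕ.+ 11))
        lem n c k = ℕ-solve 3 (λ n c k → c :+ₙ k :+ₙ (conₙ 1 :+ₙ n) :+ₙ conₙ 10 :=ₙ n :+ₙ (c :+ₙ (k :+ₙ conₙ 11))) refl n c k

      grow : ∀ B → next M (2 ℕ.^ k) m B ℕ.+ suc p ℕ.≤ 2 ℕ.^ g ℕ.* (B ℕ.+ suc p)
      grow = next-bound M k m m-large (ℕ.≤-trans (ℕ.m≤m+n k 11) (ℕ.≤-trans (ℕ.m≤n+m (k ℕ.+ 11) c₁) (ℕ.m≤n+m (c₁ ℕ.+ (k ℕ.+ 11)) n)))
        (ℕ.≤-trans (ℕ.m≤n+m 8 3) (ℕ.≤-trans (ℕ.m≤n+m 11 k) (ℕ.≤-trans (ℕ.m≤n+m (k ℕ.+ 11) c₁) (ℕ.m≤n+m (c₁ ℕ.+ (k ℕ.+ 11)) n))))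

    -- The binary logarithm of the growth of `B + suc p` over n halvings; each halving adds g T, a
    -- cubic in n.
    exponent : ℕ → ℕ
    exponent zero = 0
    exponent (suc n) = Parameters.g n ℕ.* Parameters.T n ℕ.+ exponent n

    decay : ∀ n → ∃ λ B → Affine (inv (2 ℕ.^ n)) B × B ℕ.+ suc p ℕ.≤ 2 ℕ.^ exponent n ℕ.* suc p
    decay zero = 0 , (λ j → ≤-trans (A≤ j) (≤-reflexive (solve 1 (λ j → j := # 1 :* j :+ # 0) refl (ι j)))) , ℕ.≤-reflexive (sym (ℕ.+-identityʳ (suc p)))
    decay (suc n) = continue (decay n)
      where
      open Parameters n
      continue : (∃ λ B → Affine (inv (2 ℕ.^ n)) B × B ℕ.+ suc p ℕ.≤ 2 ℕ.^ exponent n ℕ.* suc p) → ∃ λ B → Affine (inv (2 ℕ.^ suc n)) B × B ℕ.+ suc p ℕ.≤ 2 ℕ.^ (g ℕ.* T ℕ.+ exponent n) ℕ.* suc p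
      continue (B , affine , B≤) = finish (halve n k Q m 1≤k k²≤Q N-large m-large B g grow affine)
        where
        finish : (∃ λ B′ → Affine (inv (2 ℕ.^ suc n)) B′ × B′ ℕ.+ suc p ℕ.≤ 2 ℕ.^ (g ℕ.* T) ℕ.* (B ℕ.+ suc p)) → ∃ λ B → Affine (inv (2 ℕ.^ suc n)) B × B ℕ.+ suc p ℕ.≤ 2 ℕ.^ (g ℕ.* T ℕ.+ exponent n) ℕ.* suc p
        finish (B′ , affine′ , B′≤) = B′ , affine′ , ℕ.≤-trans B′≤ (ℕ.≤-trans (ℕ.*-monoʳ-≤ (2 ℕ.^ (g ℕ.* T)) B≤) (ℕ.≤-reflexive (trans (sym (ℕ.*-assoc (2 ℕ.^ (g ℕ.* T)) (2 ℕ.^ exponent n) (suc p))) (cong (ℕ._* suc p) (sym (ℕ.^-distribˡ-+-* 2 (g ℕ.* T) (exponent n)))))))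

    C₂ : ℕ
    C₂ = (4 ℕ.* c₁ ℕ.+ 39) ℕ.* (4 ℕ.+ 4 ℕ.* C₁ ℕ.* ((c₁ ℕ.+ 5) ℕ.* (c₁ ℕ.+ 5)))

    -- The halving from n to n + 1 adds at most C₂ (n + 1)³, as g is linear and T quadratic, and n⁴
    -- + (n + 1)³ ≤ (n + 1)⁴.
    exponent-bound : ∀ n → exponent n ℕ.≤ C₂ ℕ.* (n ℕ.* n ℕ.* n ℕ.* n)
    exponent-bound zero = z≤n
    exponent-bound (suc n) = ℕ-linear (one-step ⊕ₙ exponent-bound n) (ℕ-solve 4 (λ n e x C → x :+ₙ e :+ₙ (C :*ₙ ((conₙ 1 :+ₙ n) :*ₙ (conₙ 1 :+ₙ n) :*ₙ (conₙ 1 :+ₙ n)) :+ₙ C :*ₙ (n :*ₙ n :*ₙ n :*ₙ n) :+ₙ (C :*ₙ n :+ₙ conₙ 3 :*ₙ C :*ₙ n :*ₙ n :+ₙ conₙ 3 :*ₙ C :*ₙ n :*ₙ n :*ₙ n)) :=ₙ C :*ₙ ((conₙ 1 :+ₙ n) :*ₙ (conₙ 1 :+ₙ n) :*ₙ (conₙ 1 :+ₙ n) :*ₙ (conₙ 1 :+ₙ n)) :+ₙ (x :+ₙ e)) refl n (exponent n) (Parameters.g n ℕ.* Parameters.T n) C₂)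
      where
      lemma : ∀ c C n → let k = n ℕ.+ (c ℕ.+ 5); m = n ℕ.+ (c ℕ.+ (k ℕ.+ 11)) in m ℕ.+ (m ℕ.+ 3) ℕ.≤ (4 ℕ.* c ℕ.+ 39) ℕ.* suc n × 4 ℕ.* suc (C ℕ.* (k ℕ.* k)) ℕ.≤ (4 ℕ.+ 4 ℕ.* C ℕ.* ((c ℕ.+ 5) ℕ.* (c ℕ.+ 5))) ℕ.* (suc n ℕ.* suc n)
      lemma c C n = (ℕ-linear (ℕ.z≤n {0}) (ℕ-solve 2 (λ c n → n :+ₙ (c :+ₙ (n :+ₙ (c :+ₙ conₙ 5) :+ₙ conₙ 11)) :+ₙ (n :+ₙ (c :+ₙ (n :+ₙ (c :+ₙ conₙ 5) :+ₙ conₙ 11)) :+ₙ conₙ 3) :+ₙ (conₙ 0 :+ₙ (conₙ 4 :+ₙ conₙ 4 :*ₙ c :*ₙ n :+ₙ conₙ 35 :*ₙ n)) :=ₙ (conₙ 4 :*ₙ c :+ₙ conₙ 39) :*ₙ (conₙ 1 :+ₙ n) :+ₙ conₙ 0) refl c n)) , (ℕ-linear (ℕ.z≤n {0}) (ℕ-solve 3 (λ c C n → conₙ 4 :*ₙ (conₙ 1 :+ₙ C :*ₙ ((n :+ₙ (c :+ₙ conₙ 5)) :*ₙ (n :+ₙ (c :+ₙ conₙ 5)))) :+ₙ (conₙ 0 :+ₙ (conₙ 8 :*ₙ C :*ₙ c :*ₙ c :*ₙ n :+ₙ conₙ 4 :*ₙ C :*ₙ c :*ₙ c :*ₙ n :*ₙ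 n :+ₙ conₙ 72 :*ₙ C :*ₙ c :*ₙ n :+ₙ conₙ 40 :*ₙ C :*ₙ c :*ₙ n :*ₙ n :+ₙ conₙ 160 :*ₙ C :*ₙ n :+ₙ conₙ 96 :*ₙ C :*ₙ n :*ₙ n :+ₙ conₙ 8 :*ₙ n :+ₙ conₙ 4 :*ₙ n :*ₙ n)) :=ₙ (conₙ 4 :+ₙ conₙ 4 :*ₙ C :*ₙ ((c :+ₙ conₙ 5) :*ₙ (c :+ₙ conₙ 5))) :*ₙ ((conₙ 1 :+ₙ n) :*ₙ (conₙ 1 :+ₙ n)) :+ₙ conₙ 0) refl c C n))
      one-step : Parameters.g n ℕ.* Parameters.T n ℕ.≤ C₂ ℕ.* (suc n ℕ.* suc n ℕ.* suc n)
      one-step = ℕ.≤-trans (ℕ.*-mono-≤ (proj₁ (lemma c₁ C₁ n)) (proj₂ (lemma c₁ C₁ n))) (ℕ.≤-reflexive (rearrange (4 ℕ.* c₁ ℕ.+ 39) (4 ℕ.+ 4 ℕ.* C₁ ℕ.* ((c₁ ℕ.+ 5) ℕ.* (c₁ ℕ.+ 5))) (suc n)))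
        where
        rearrange : ∀ a b u → a ℕ.* u ℕ.* (b ℕ.* (u ℕ.* u)) ≡ a ℕ.* b ℕ.* (u ℕ.* u ℕ.* u)
        rearrange a b u = ℕ-solve 3 (λ a b u → a :*ₙ u :*ₙ (b :*ₙ (u :*ₙ u)) :=ₙ a :*ₙ b :*ₙ (u :*ₙ u :*ₙ u)) refl a b u

  -- From mean square to pointwise bounds for F.

  module Pointwise where

    open Mertens
    open Mobius
    open Energy
    open Dilation using (g; ∣g∣≤; sq-≤; ∑-range)
    open Coercivity using (∑-below)
    open Decay using (exponent; decay)
    open Iteration using (Affine; E-lg; lg-small)
    open LogSum using (e; S-lower)

    module _ (k : ℕ) (3≤k : 3 ℕ.≤ k) where

      private
        N : ℕ
        N = 2 ℕ.^ k
        1≤N : 1 ℕ.≤ N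
        1≤N = 0<2^ k
        8≤N : 8 ℕ.≤ N
        8≤N = 2^-mono {3} {k} 3≤k

      -- The successor of v appears because v will be ⌊x/q⌋, where only x < q (v + 1) is known.
      Near : ℕ → ℕ → Set
      Near y v = y ℕ.≤ v × N ℕ.* suc v ℕ.≤ suc N ℕ.* y

      near? : ∀ y v → Dec (Near y v)
      near? y v = (y ℕ.≤? v) ×-dec (N ℕ.* suc v ℕ.≤? suc N ℕ.* y)

      near-count : ∀ v X → 8 ℕ.* N ℕ.≤ v → v ℕ.< X → inv 8 * inv N ≤ ∑ X (λ y → inv y * 𝟙 (near? y v))
      near-count v X 8N≤ v<X = ≤-trans low (≤-trans (∑-lower n (inv v) term) (≤-trans (≤-trans (≤-reflexive (sym (+-identityˡ (∑ n (λ j → φ (y₀ ℕ.+ j)))))) (+-monoˡ-≤ (∑ n (λ j → φ (y₀ ℕ.+ j))) (∑-nonneg y₀ (λ y _ → 0≤φ y))))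
          (≤-trans (≤-reflexive (sym (∑-split y₀ n φ))) (∑-extend (ℕ.≤-trans (ℕ.≤-reflexive y₀+n≡) v<X) (λ y _ _ → 0≤φ y)))))
        where
        φ : ℕ → ℚ
        φ y = inv y * 𝟙 (near? y v)
        0≤φ : ∀ y → 0ℚ ≤ φ y
        0≤φ y = *-nonneg (0≤inv y) (0≤𝟙 (near? y v))
        1≤4N : 1 ℕ.≤ 4 ℕ.* N
        1≤4N = ℕ.*-mono-≤ {1} {4} (s≤s z≤n) 1≤N
        n y₀ : ℕ
        n = v div (4 ℕ.* N)
        y₀ = suc v ℕ.∸ n
        4Nn≤ : 4 ℕ.* N ℕ.* n ℕ.≤ v
        4Nn≤ = div-lower v (4 ℕ.* N)
        4n≤ : 4 ℕ.* n ℕ.≤ v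
        4n≤ = ℕ.≤-trans (ℕ.*-monoˡ-≤ n (ℕ.*-monoʳ-≤ 4 1≤N)) 4Nn≤
        y₀+n≡ : y₀ ℕ.+ n ≡ suc v
        y₀+n≡ = ℕ.m∸n+n≡m {suc v} {n} (ℕ-linear 4n≤ (ℕ-solve 2 (λ n v → n :+ₙ (v :+ₙ (conₙ 1 :+ₙ conₙ 3 :*ₙ n)) :=ₙ conₙ 1 :+ₙ v :+ₙ conₙ 4 :*ₙ n) refl n v))
        Nn≤y₀ : N ℕ.* n ℕ.≤ y₀
        Nn≤y₀ = ℕ-linear-by 3 (4 ⊛ₙ ℕ.≤-reflexive (sym y₀+n≡) ⊕ₙ 4n≤ ⊕ₙ 3 ⊛ₙ 4Nn≤) (ℕ-solve 4 (λ N y₀ n v → conₙ 4 :*ₙ (N :*ₙ n) :+ₙ (conₙ 4 :*ₙ (y₀ :+ₙ n) :+ₙ v :+ₙ conₙ 3 :*ₙ v :+ₙ (conₙ 4 :+ₙ conₙ 8 :*ₙ N :*ₙ n)) :=ₙ conₙ 4 :*ₙ y₀ :+ₙ (conₙ 4 :*ₙ (conₙ 1 :+ₙ v) :+ₙ conₙ 4 :*ₙ n :+ₙ conₙ 3 :*ₙ (conₙ 4 :*ₙ N :*ₙ n))) refl N y₀ n v)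
        1≤y₀ : 1 ℕ.≤ y₀
        1≤y₀ = ℕ-linear (ℕ.≤-reflexive (sym y₀+n≡) ⊕ₙ 4n≤) (ℕ-solve 3 (λ y₀ n v → conₙ 1 :+ₙ (y₀ :+ₙ n :+ₙ v :+ₙ conₙ 3 :*ₙ n) :=ₙ y₀ :+ₙ (conₙ 1 :+ₙ v :+ₙ conₙ 4 :*ₙ n)) refl y₀ n v)
        is-near : ∀ j → j ℕ.< n → Near (y₀ ℕ.+ j) v
        is-near j j<n = ℕ.≤-pred (ℕ.≤-trans (ℕ.+-monoʳ-< y₀ j<n) (ℕ.≤-reflexive y₀+n≡)) ,
          ℕ.≤-trans (ℕ.≤-reflexive (cong (N ℕ.*_) (sym y₀+n≡))) (ℕ-linear Nn≤y₀ (ℕ-solve 4 (λ N y₀ n j → N :*ₙ (y₀ :+ₙ n) :+ₙ (y₀ :+ₙ (N :*ₙ j :+ₙ j)) :=ₙ (conₙ 1 :+ₙ N) :*ₙ (y₀ :+ₙ j) :+ₙ N :*ₙ n) refl N y₀ n j))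
        term : ∀ j → j ℕ.< n → inv v ≤ φ (y₀ ℕ.+ j)
        term j j<n = ≤-trans (inv-anti (ℕ.≤-trans 1≤y₀ (ℕ.m≤m+n y₀ j)) (proj₁ (is-near j j<n))) (≤-reflexive (sym (trans (cong (inv (y₀ ℕ.+ j) *_) (𝟙-yes (near? (y₀ ℕ.+ j) v) (is-near j j<n))) (*-identityʳ (inv (y₀ ℕ.+ j))))))
        v≤8Nn : v ℕ.≤ 8 ℕ.* N ℕ.* n
        v≤8Nn = ℕ-linear (div-upper v 1≤4N ⊕ₙ ℕ.*-monoʳ-≤ (4 ℕ.* N) 1≤n) (ℕ-solve 3 (λ N n v → v :+ₙ (conₙ 4 :*ₙ N :*ₙ n :+ₙ conₙ 4 :*ₙ N :+ₙ conₙ 4 :*ₙ N :*ₙ n :+ₙ conₙ 1) :=ₙ conₙ 8 :*ₙ N :*ₙ n :+ₙ (conₙ 1 :+ₙ v :+ₙ conₙ 4 :*ₙ N :*ₙ conₙ 1)) refl N n v)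
          where
          1≤n : 1 ℕ.≤ n
          1≤n = div-≥ 1≤4N (ℕ-linear 8N≤ (ℕ-solve 2 (λ N v → conₙ 4 :*ₙ N :*ₙ conₙ 1 :+ₙ (v :+ₙ conₙ 4 :*ₙ N) :=ₙ v :+ₙ conₙ 8 :*ₙ N) refl N v))
        1≤8N : 1 ℕ.≤ 8 ℕ.* N
        1≤8N = ℕ.*-mono-≤ {1} {8} (s≤s z≤n) 1≤N
        1≤v : 1 ℕ.≤ v
        1≤v = ℕ.≤-trans 1≤8N 8N≤
        low : inv 8 * inv N ≤ ι n * inv v
        low = cancel-* {inv 8 * inv N} {ι n * inv v} (ι (8 ℕ.* N)) (0<ι′ 1≤8N) (cancel-* {ι (8 ℕ.* N) * (inv 8 * inv N)} {ι (8 ℕ.* N) * (ι n * inv v)} (ι v) (0<ι′ 1≤v) (linear (≤-reflexive (cong (ι v *_) (trans (cong (ι (8 ℕ.* N) *_) (sym (inv-* 8 N))) (ι*inv 1≤8N))) ⊕ ≤-reflexive (sym (cong (ι (8 ℕ.* N) * ι n *_) (ι*inv 1≤v))) ⊕ ι-mono v≤8Nn ⊕ ≤-reflexive (ι-* (8 ℕ.* N) n)) (solve 6 (λ c a n w v s → v :* (c :* (n :* w)) :- v :* (c :* a) := v :* # 1 :+ c :* n :* (v :* w) :+ s :+ c :* n :- (v :* (c :* a) :+ c :* n :* # 1 :+ v :+ s)) refl (ι (8 ℕ.* N)) (inv 8 * inv N) (ι n) (inv v) (ι v) (ι (8 ℕ.* N ℕ.* n)))))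

      -- For near y, F v and F y differ by at most v/N, so F v² ≤ 2 F y² + 2 v²/N². This is averaged
      -- over the near y with weight 1/y, whose total is at least 1/(8 N).
      F²-near : ∀ v X → 8 ℕ.* N ℕ.≤ v → v ℕ.< X → F v * F v ≤ ι 2 * (ι v * ι v * (inv N * inv N)) + ι 16 * ι N * ∑ X (λ y → inv y * 𝟙 (near? y v) * (F y * F y))
      F²-near v X 8N≤ v<X = linear (*-monoˡ (ι 8 * ι N) (*-nonneg (0≤ι 8) (0≤ι N)) D≤ ⊕ ≤-reflexive (sym (cong (D *_) (trans (cong (_* (ι N * inv N)) (refl {x = ι 8 * inv 8})) (trans (*-identityˡ (ι N * inv N)) (ι*inv 1≤N))))) ⊕ ≤-reflexive (sym (refl {x = D}))) (solve 7 (λ f w n u s D e → # 2 :* w :+ # 16 :* n :* s :- f := # 8 :* n :* (# 2 :* s) :+ D :* (# 8 :* e :* (n :* u)) :+ D :- (# 8 :* n :* (D :* (e :* u)) :+ D :* # 1 :+ (f :- # 2 :* w))) refl (F v * F v) (ι v * ι v * (inv N * inv N)) (ι N) (inv N) Σ′ D (inv 8))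
        where
        Σ′ C D : ℚ
        Σ′ = ∑ X (λ y → inv y * 𝟙 (near? y v) * (F y * F y))
        C = ∑ X (λ y → inv y * 𝟙 (near? y v))
        D = F v * F v - ι 2 * (ι v * ι v * (inv N * inv N))
        0≤wt : ∀ y → 0ℚ ≤ inv y * 𝟙 (near? y v)
        0≤wt y = *-nonneg (0≤inv y) (0≤𝟙 (near? y v))
        0≤Σ : 0ℚ ≤ Σ′
        0≤Σ = ∑-nonneg X (λ y _ → *-nonneg (0≤wt y) (sq≥0 (F y)))
        DC≤ : D * C ≤ ι 2 * Σ′
        DC≤ = ≤-trans (≤-reflexive (sym (∑-*ˡ X D _))) (≤-trans (∑-mono X (λ y _ → term y)) (≤-reflexive (∑-*ˡ X (ι 2) _)))
          where
          term : ∀ y → D * (inv y * 𝟙 (near? y v)) ≤ ι 2 * (inv y * 𝟙 (near? y v) * (F y * F y))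
          term y = 𝟙-elim (near? y v) (λ i → D * (inv y * i) ≤ ι 2 * (inv y * i * (F y * F y))) inside (λ _ → ≤-reflexive (solve 3 (λ D w f → D :* (w :* # 0) := # 2 :* (w :* # 0 :* (f :* f))) refl D (inv y) (F y)))
            where
            inside : Near y v → D * (inv y * 1ℚ) ≤ ι 2 * (inv y * 1ℚ * (F y * F y))
            inside (y≤v , Nv≤) = linear (2 ⊛ *-monoʳ (inv y) (0≤inv y) diff² ⊕ *-monoʳ (inv y) (0≤inv y) (sq≥0 (F v - F y - F y)) ⊕ ≤-reflexive (cong (_* inv y) (refl {x = D}))) (solve 6 (λ D w f g v u → # 2 :* (w :* # 1 :* (f :* f)) :- D :* (w :* # 1) := # 2 :* (v :* u :* (v :* u) :* w) :+ (g :- f :- f) :* (g :- f :- f) :* w :+ (g :* g :- # 2 :* (v :* v :* (u :* u))) :* w :- (# 2 :* ((g :- f) :* (g :- f) :* w) :+ # 0 :* w :+ D :* w)) refl D (inv y) (F y) (F v) (ι v) (inv N))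
              where
              diff : ∣ F v - F y ∣ ≤ ι v * inv N
              diff = ≤-trans (F-lipschitz y≤v) (cancel-* {ι v - ι y} {ι v * inv N} (ι N) (0<ι′ 1≤N) (linear (ι-mono Nv≤ ⊕ ≤-reflexive (sym (ι-* N (suc v))) ⊕ ≤-reflexive (sym (cong (ι N *_) (ι-suc v))) ⊕ ≤-reflexive (ι-* (suc N) y) ⊕ ≤-reflexive (cong (_* ι y) (ι-suc N)) ⊕ ≤-reflexive (sym (cong (ι v *_) (ι*inv 1≤N))) ⊕ ι-mono y≤v ⊕ 0≤ι N) (solve 8 (λ v y n u a b v' n' → n :* (v :* u) :- n :* (v :- y) := b :+ a :+ n :* v' :+ n' :* y :+ (# 1 :+ n) :* y :+ v :* (n :* u) :+ v :+ n :- (a :+ n :* v' :+ n :* (# 1 :+ v) :+ b :+ n' :* y :+ v :* # 1 :+ y :+ # 0)) refl (ι v) (ι y) (ι N) (inv N) (ι (N ℕ.* suc v)) (ι (suc N ℕ.* y)) (ι (suc v)) (ι (suc N)))))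
              diff² : (F v - F y) * (F v - F y) ≤ (ι v * inv N) * (ι v * inv N)
              diff² = sq-≤ {F v - F y} diff
        D≤ : D * (inv 8 * inv N) ≤ ι 2 * Σ′
        D≤ = dec-elim (0ℚ ≤? D) (λ 0≤D → ≤-trans (*-monoˡ D 0≤D (near-count v X 8N≤ v<X)) DC≤)
          (λ D<0 → ≤-trans (≤-trans (*-monoʳ (inv 8 * inv N) (*-nonneg (0≤inv 8) (0≤inv N)) (<⇒≤ (≰⇒> D<0))) (≤-reflexive (*-zeroˡ (inv 8 * inv N)))) (*-nonneg (0≤ι 2) 0≤Σ))

      -- For fixed y the primes q with ⌊x/q⌋ near y lie just below x/y, in an interval of relative
      -- length about 1/N, so `window-bound` applies. No y is then hit by more than its share, up to
      -- the factor k + 3.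
      near-mass : ∀ x y → 1 ℕ.≤ y → ∑ (suc x) (λ q → Λ q * inv q * (𝟙 (N ℕ.≤? q) * 𝟙 (near? y (x div q)))) ≤ ι 4 * ι (k ℕ.+ 3) * inv N
      near-mass x y 1≤y = dec-elim (N ℕ.≤? top) main none
        where
        top z t₀ : ℕ
        top = x div y
        z = suc (top div N)
        t₀ = top ℕ.∸ z
        q≤top : ∀ q → Near y (x div q) → q ℕ.≤ top
        q≤top q (y≤v , _) = div-≥ 1≤y (ℕ.≤-trans (ℕ.≤-reflexive (ℕ.*-comm y q)) (ℕ.≤-trans (ℕ.*-monoʳ-≤ q y≤v) (div-lower x q)))
        0≤bound : 0ℚ ≤ ι 4 * ι (k ℕ.+ 3) * inv N
        0≤bound = *-nonneg (*-nonneg (0≤ι 4) (0≤ι (k ℕ.+ 3))) (0≤inv N)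
        none : ¬ N ℕ.≤ top → ∑ (suc x) (λ q → Λ q * inv q * (𝟙 (N ℕ.≤? q) * 𝟙 (near? y (x div q)))) ≤ ι 4 * ι (k ℕ.+ 3) * inv N
        none top<N = ≤-trans (≤-reflexive (∑-zero (suc x) (λ q _ → 𝟙-elim (near? y (x div q)) (λ i → Λ q * inv q * (𝟙 (N ℕ.≤? q) * i) ≡ 0ℚ)
          (λ nr → trans (cong (λ i → Λ q * inv q * (i * 1ℚ)) (𝟙-no (N ℕ.≤? q) (λ N≤q → top<N (ℕ.≤-trans N≤q (q≤top q nr))))) (solve 1 (λ l → l :* (# 0 :* # 1) := # 0) refl (Λ q * inv q))) (λ _ → (solve 2 (λ l i → l :* (i :* # 0) := # 0) refl (Λ q * inv q) (𝟙 (N ℕ.≤? q))))))) 0≤bound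
        main : N ℕ.≤ top → ∑ (suc x) (λ q → Λ q * inv q * (𝟙 (N ℕ.≤? q) * 𝟙 (near? y (x div q)))) ≤ ι 4 * ι (k ℕ.+ 3) * inv N
        main N≤top = ≤-trans (∑-mono (suc x) (λ q _ → term q)) (≤-trans (≤-reflexive (∑-*ˡ (suc x) (ι 2 * inv top) _)) (≤-trans (*-monoˡ (ι 2 * inv top) (*-nonneg (0≤ι 2) (0≤inv top)) (≤-trans (∑-below (suc x) (suc (t₀ ℕ.+ z)) 0≤lw) (window-bound k t₀ z z≤t₀ t₀≤))) final))
          where
          1≤top : 1 ℕ.≤ top
          1≤top = ℕ.≤-trans 1≤N N≤top
          8w≤ : 8 ℕ.* (top div N) ℕ.≤ top
          8w≤ = ℕ.≤-trans (ℕ.*-monoˡ-≤ (top div N) 8≤N) (div-lower top N)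
          2z≤ : 2 ℕ.* z ℕ.≤ top
          2z≤ = ℕ-linear-by 3 (8w≤ ⊕ₙ 3 ⊛ₙ ℕ.≤-trans 8≤N N≤top) (ℕ-solve 2 (λ w t → conₙ 4 :*ₙ (conₙ 2 :*ₙ (conₙ 1 :+ₙ w)) :+ₙ (t :+ₙ conₙ 3 :*ₙ t :+ₙ conₙ 16) :=ₙ conₙ 4 :*ₙ t :+ₙ (conₙ 8 :*ₙ w :+ₙ conₙ 3 :*ₙ conₙ 8)) refl (top div N) top)
          t₀+z≡ : t₀ ℕ.+ z ≡ top
          t₀+z≡ = ℕ.m∸n+n≡m {top} {z} (ℕ.≤-trans (ℕ.m≤m+n z (z ℕ.+ 0)) 2z≤)
          z≤t₀ : z ℕ.≤ t₀
          z≤t₀ = ℕ-linear (2z≤ ⊕ₙ ℕ.≤-reflexive (sym t₀+z≡)) (ℕ-solve 3 (λ t t₀ z → z :+ₙ (t :+ₙ (t₀ :+ₙ z) :+ₙ conₙ 0) :=ₙ t₀ :+ₙ (conₙ 2 :*ₙ z :+ₙ t)) refl top t₀ z)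
          t₀≤ : t₀ ℕ.≤ N ℕ.* z
          t₀≤ = ℕ.≤-trans (ℕ.m∸n≤m top z) (ℕ.<⇒≤ (ℕ.<-≤-trans (div-upper top 1≤N) (ℕ.≤-reflexive (trans (ℕ.+-comm (N ℕ.* (top div N)) N) (sym (ℕ.*-suc N (top div N)))))))
          lw : ℕ → ℚ
          lw q = 𝟙 (prime? q ×-dec t₀ ℕ.<? q) * ι (lg q)
          0≤lw : ∀ q → 0ℚ ≤ lw q
          0≤lw q = *-nonneg (0≤𝟙 (prime? q ×-dec t₀ ℕ.<? q)) (0≤ι (lg q))
          term : ∀ q → Λ q * inv q * (𝟙 (N ℕ.≤? q) * 𝟙 (near? y (x div q))) ≤ ι 2 * inv top * (𝟙 (q ℕ.<? suc (t₀ ℕ.+ z)) * lw q)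
          term q = 𝟙-elim (near? y (x div q)) (λ i → Λ q * inv q * (𝟙 (N ℕ.≤? q) * i) ≤ ι 2 * inv top * (𝟙 (q ℕ.<? suc (t₀ ℕ.+ z)) * lw q)) inside
            (λ _ → ≤-trans (≤-reflexive (solve 2 (λ l i → l :* (i :* # 0) := # 0) refl (Λ q * inv q) (𝟙 (N ℕ.≤? q)))) (*-nonneg (*-nonneg (0≤ι 2) (0≤inv top)) (*-nonneg (0≤𝟙 (q ℕ.<? suc (t₀ ℕ.+ z))) (0≤lw q))))
            where
            inside : Near y (x div q) → Λ q * inv q * (𝟙 (N ℕ.≤? q) * 1ℚ) ≤ ι 2 * inv top * (𝟙 (q ℕ.<? suc (t₀ ℕ.+ z)) * lw q)
            inside nr@(y≤v , Nv≤) = linear (*-monoˡ (Λ q * inv q) (*-nonneg (0≤Λ q) (0≤inv q)) (𝟙≤1 (N ℕ.≤? q)) ⊕ *-monoʳ (inv q) (0≤inv q) l≤w ⊕ *-monoˡ (lw q) (0≤lw q) v≤ ⊕ ≤-reflexive (sym (cong (λ i → ι 2 * inv top * (i * lw q)) (𝟙-yes (q ℕ.<? suc (t₀ ℕ.+ z)) (s≤s (subst (q ℕ.≤_) (sym t₀+z≡) (q≤top q nr))))))) (solve 6 (λ l v i t j w → # 2 :* t :* (j :* w) :- l :* v :* (i :* # 1) := l :* v :* # 1 :+ w :* v :+ w :* (# 2 :* t) :+ # 2 :* t :* (j :* w) :- (l :* v :* i :+ l :* v :+ w :* v :+ # 2 :* t :* (# 1 :* w))) refl (Λ q) (inv q)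 (𝟙 (N ℕ.≤? q)) (inv top) (𝟙 (q ℕ.<? suc (t₀ ℕ.+ z))) (lw q))
              where
              1≤q : 1 ℕ.≤ q
              1≤q = pos-q q nr
                where
                pos-q : ∀ q → Near y (x div q) → 1 ℕ.≤ q
                pos-q zero (y≤0 , _) = contradiction 1≤y (ℕ.≤⇒≯ y≤0)
                pos-q (suc q) _ = s≤s z≤n
              Ntop< : N ℕ.* top ℕ.< suc N ℕ.* q
              Ntop< = ℕ.*-cancelʳ-< y (N ℕ.* top) (suc N ℕ.* q) (ℕ-linear (ℕ.*-monoʳ-≤ N (div-lower x y) ⊕ₙ ℕ.*-monoʳ-≤ N (div-upper x 1≤q) ⊕ₙ ℕ.*-monoʳ-≤ q Nv≤ ⊕ₙ 1≤N) (ℕ-solve 6 (λ N t y q v x → conₙ 1 :+ₙ N :*ₙ t :*ₙ y :+ₙ (N :*ₙ x :+ₙ N :*ₙ (q :*ₙ v :+ₙ q) :+ₙ q :*ₙ ((conₙ 1 :+ₙ N) :*ₙ y) :+ₙ N :+ₙ conₙ 0) :=ₙ (conₙ 1 :+ₙ N) :*ₙ q :*ₙ y :+ₙ (N :*ₙ (y :*ₙ t) :+ₙ N :*ₙ (conₙ 1 :+ₙ x) :+ₙ q :*ₙ (N :*ₙ (conₙ 1 :+ₙ v)) :+ₙ conₙ 1)) refl N top y q (x div q) x))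
              top<q+z : top ℕ.< q ℕ.+ z
              top<q+z = ℕ.*-cancelˡ-< N top (q ℕ.+ z) (ℕ-linear (Ntop< ⊕ₙ q≤top q nr ⊕ₙ div-upper top 1≤N) (ℕ-solve 4 (λ N t q w → conₙ 1 :+ₙ N :*ₙ t :+ₙ ((conₙ 1 :+ₙ N) :*ₙ q :+ₙ t :+ₙ (N :*ₙ w :+ₙ N) :+ₙ conₙ 1) :=ₙ N :*ₙ (q :+ₙ (conₙ 1 :+ₙ w)) :+ₙ (conₙ 1 :+ₙ N :*ₙ t :+ₙ q :+ₙ (conₙ 1 :+ₙ t))) refl N top q (top div N)))
              t₀<q : t₀ ℕ.< q
              t₀<q = ℕ-linear (top<q+z ⊕ₙ ℕ.≤-reflexive t₀+z≡) (ℕ-solve 4 (λ t₀ q z t → conₙ 1 :+ₙ t₀ :+ₙ (q :+ₙ z :+ₙ t :+ₙ conₙ 0) :=ₙ q :+ₙ (conₙ 1 :+ₙ t :+ₙ (t₀ :+ₙ z))) refl t₀ q z top)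
              l≤w : Λ q ≤ lw q
              l≤w = ≤-trans (Λ≤Λ′ q) (*-monoʳ (ι (lg q)) (0≤ι (lg q)) (𝟙-mono (prime? q) (prime? q ×-dec t₀ ℕ.<? q) (λ pr → pr , t₀<q)))
              v≤ : inv q ≤ ι 2 * inv top
              v≤ = cancel-* {inv q} {ι 2 * inv top} (ι q) (0<ι′ 1≤q) (cancel-* {ι q * inv q} {ι q * (ι 2 * inv top)} (ι top) (0<ι′ 1≤top) (linear (≤-reflexive (cong (ι top *_) (ι*inv 1≤q)) ⊕ 2 ⊛ ≤-reflexive (sym (cong (ι q *_) (ι*inv 1≤top))) ⊕ ι-mono (ℕ-linear (2 ⊛ₙ top<q+z ⊕ₙ 2z≤) (ℕ-solve 3 (λ t q z → t :+ₙ (conₙ 2 :*ₙ (q :+ₙ z) :+ₙ t :+ₙ conₙ 2) :=ₙ conₙ 2 :*ₙ q :+ₙ (conₙ 2 :*ₙ (conₙ 1 :+ₙ t) :+ₙ conₙ 2 :*ₙ z)) refl top q z)) ⊕ ≤-reflexive (ι-* 2 q)) (solve 5 (λ q v t w q2 → t :* (q :* (# 2 :* w)) :- t :* (q :* v) := t :* # 1 :+ # 2 :* (q :* (t :* w)) :+ q2 :+ # 2 :* q :- (t :* (q :* v) :+ # 2 :* (q :* # 1) :+ t :+ q2)) refl (ι q) (inv q) (ι top) (inv top) (ι (2 ℕ.* q)))))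
          final : ι 2 * inv top * ι ((k ℕ.+ 3) ℕ.* z) ≤ ι 4 * ι (k ℕ.+ 3) * inv N
          final = linear (2 ⊛ ≤-reflexive (cong (inv top *_) (ι-* (k ℕ.+ 3) z)) ⊕ 2 ⊛ *-monoˡ (ι (k ℕ.+ 3)) (0≤ι (k ℕ.+ 3)) zt) (solve 5 (λ w s K z v → # 4 :* K :* v :- # 2 :* w :* s := # 2 :* (w :* (K :* z)) :+ # 2 :* (K :* (# 2 :* v)) :- (# 2 :* (w :* s) :+ # 2 :* (K :* (w :* z)))) refl (inv top) (ι ((k ℕ.+ 3) ℕ.* z)) (ι (k ℕ.+ 3)) (ι z) (inv N))
            where
            zt : inv top * ι z ≤ ι 2 * inv N
            zt = cancel-* {inv top * ι z} {ι 2 * inv N} (ι top) (0<ι′ 1≤top) (cancel-* {ι top * (inv top * ι z)} {ι top * (ι 2 * inv N)} (ι N) (0<ι′ 1≤N) (linear (≤-reflexive (cong (ι N * ι z *_) (ι*inv 1≤top)) ⊕ ≤-reflexive (cong (ι N *_) (ι-suc (top div N))) ⊕ ι-*≤ N (top div N) (div-lower top N) ⊕ ι-mono N≤top ⊕ 2 ⊛ ≤-reflexive (sym (cong (ι top *_) (ι*inv 1≤N)))) (solve 6 (λ n t w z d v → n :* (t :* (# 2 :* v)) :- n :* (t :* (w :* z)) := n :* z :* # 1 :+ n :* (# 1 :+ d) :+ t :+ t :+ # 2 :* (t :* (n :* v)) :- (n :* z :* (t :* w) :+ n :* z :+ n :* d :+ n :+ # 2 :* (t :* # 1))) refl (ι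 N) (ι top) (inv top) (ι z) (ι (top div N)) (inv N))))

      -- In main-identity F (x / q) is traded for the values F y at nearby y; by the window bound on
      -- the primes q every y is hit about equally often, so Cauchy-Schwarz leaves the energy A.
      pointwise : ∀ x → 1 ℕ.≤ x → k ℕ.+ 3 ℕ.≤ lg x → let u = ι (lg x); W = u + ι 6 in
        u * u * (F x * F x) ≤ ι x * ι x * (ι 2 * W * (ι 2 * ι k + ι 15 + E (lg x) + ι 2 * (inv N * inv N) * W + ι 64 * ι (k ℕ.+ 3) * A (suc (lg x))) + ι 2 * (E (lg x) * E (lg x)))
      pointwise x 1≤x k+3≤u = linear (2 ⊛ sq-≤ {u * F x + T} (main-identity x 1≤x) ⊕ sq≥0 (u * F x + T + T) ⊕ 2 ⊛ T² ⊕ 2 ⊛ *-monoˡ W (<⇒≤ 0<W) Z≤) (solve 8 (λ u f T x ε W Z V → x :* x :* (# 2 :* W :* V :+ # 2 :* (ε :* ε)) :- u :* u :* (f :* f) := # 2 :* (x :* ε :* (x :* ε)) :+ (u :* f :+ T :+ T) :* (u :* f :+ T :+ T) :+ # 2 :* (W :* Z) :+ # 2 :* (W :* (x :* x :* V)) :- (# 2 :* ((u :* f :+ T) :* (u :* f :+ T)) :+ # 0 :+ # 2 :* (T :* T) :+ # 2 :* (W :* Z))) refl u (F x) T (ι x) ε W Z V)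
        where
        X j : ℕ
        X = suc x
        j = lg x ℕ.∸ (k ℕ.+ 3)
        j≡ : j ℕ.+ (k ℕ.+ 3) ≡ lg x
        j≡ = ℕ.m∸n+n≡m k+3≤u
        u ε W T Z n2 V : ℚ
        u = ι (lg x)
        ε = E (lg x)
        W = u + ι 6
        T = ∑ X (λ q → Λ q * F (x div q))
        Z = ∑ X (λ q → Λ q * inv q * (g q x * g q x))
        n2 = inv N * inv N
        V = ι 2 * ι k + ι 15 + ε + ι 2 * n2 * W + ι 64 * ι (k ℕ.+ 3) * A (suc (lg x))
        0<W : 0ℚ < W
        0<W = <-≤-trans (0<ι 5) (linear (0≤ι (lg x)) (solve 1 (λ u → u :+ # 6 :- # 6 := u :- # 0) refl u))
        0≤Λinv : ∀ q → 0ℚ ≤ Λ q * inv q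
        0≤Λinv q = *-nonneg (0≤Λ q) (0≤inv q)
        S≤W : ∑ X (λ q → Λ q * inv q) ≤ W
        S≤W = linear (∑-extend (lg-upper x) (λ q _ _ → 0≤Λinv q) ⊕ S-upper (suc (lg x)) ⊕ ≤-reflexive (ι-suc (lg x))) (solve 4 (λ s t u u' → u :+ # 6 :- s := t :+ (u' :+ # 5) :+ (# 1 :+ u) :- (s :+ t :+ u')) refl (∑ X (λ q → Λ q * inv q)) (S (suc (lg x))) u (ι (suc (lg x))))
        T² : T * T ≤ W * Z
        T² = subst (λ t → t * t ≤ W * Z) (∑-ext X (λ q → trans (solve 4 (λ l v q f → l :* v :* (q :* f) := l :* (q :* v :* f)) refl (Λ q) (inv q) (ι q) (F (x div q))) (Λ-support q (λ 1≤q → trans (cong (_* F (x div q)) (ι*inv 1≤q)) (*-identityˡ (F (x div q)))))))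
          (cauchy-schwarz X (λ q → Λ q * inv q) (λ q → g q x) W (λ q _ → 0≤Λinv q) 0<W S≤W)
        near-sum : ℕ → ℚ
        near-sum q = ∑ X (λ y → a y * (𝟙 (N ℕ.≤? q) * 𝟙 (near? y (x div q))))
        0≤near-sum : ∀ q → 0ℚ ≤ near-sum q
        0≤near-sum q = ∑-nonneg X (λ y _ → *-nonneg (0≤a y) (*-nonneg (0≤𝟙 (N ℕ.≤? q)) (0≤𝟙 (near? y (x div q)))))
        bound : ℕ → ℚ
        bound q = ι x * ι x * (𝟙 (q ℕ.<? N) + 𝟙 (2 ℕ.^ j ℕ.≤? q) + ι 2 * n2) + ι 16 * ι N * (ι x * ι x) * near-sum q
        g²≤x² : ∀ q → g q x * g q x ≤ ι x * ι x
        g²≤x² q = sq-≤ {g q x} (∣g∣≤ q x)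
        0≤tail : ∀ q → 0ℚ ≤ ι 16 * ι N * (ι x * ι x) * near-sum q
        0≤tail q = *-nonneg (*-nonneg (*-nonneg (0≤ι 16) (0≤ι N)) (sq≥0 (ι x))) (0≤near-sum q)
        0≤xn2 : 0ℚ ≤ ι x * ι x * n2
        0≤xn2 = *-nonneg (sq≥0 (ι x)) (sq≥0 (inv N))
        0≤x𝟙 : {P : Set} (d : Dec P) → 0ℚ ≤ ι x * ι x * 𝟙 d
        0≤x𝟙 d = *-nonneg (sq≥0 (ι x)) (0≤𝟙 d)
        middle : ∀ q → N ℕ.≤ q → 8 ℕ.* N ℕ.≤ x div q → g q x * g q x ≤ bound q
        middle q N≤q 8N≤v = linear (*-monoˡ (ι q * ι q) (sq≥0 (ι q)) (F²-near v X 8N≤v (s≤s (div-≤ x q))) ⊕ 2 ⊛ *-monoʳ n2 (sq≥0 (inv N)) qv²≤ ⊕ *-monoˡ (ι 16 * ι N) (*-nonneg (0≤ι 16) (0≤ι N)) sums ⊕ 0≤x𝟙 (q ℕ.<? N) ⊕ 0≤x𝟙 (2 ℕ.^ j ℕ.≤? q)) (solve 10 (λ q f x n2 N s t v i j → x :* x :* (i :+ j :+ # 2 :* n2) :+ # 16 :* N :* (x :* x) :* t :- q :* f :* (q :* f) := q :* q :* (# 2 :* (v :* v :* n2) :+ # 16 :* N :* s) :+ # 2 :* (x :* x :* n2) :+ # 16 :* N :* (x :* x :* t) :+ x :* x :* i :+ x :* x :* j :- (q :* q :* (f :* f) :+ # 2 :* (q :* v :* (q :* v) :* n2) :+ # 16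 :* N :* (q :* q :* s) :+ # 0 :+ # 0)) refl (ι q) (F v) (ι x) n2 (ι N) (∑ X (λ y → inv y * 𝟙 (near? y v) * (F y * F y))) (near-sum q) (ι v) (𝟙 (q ℕ.<? N)) (𝟙 (2 ℕ.^ j ℕ.≤? q)))
          where
          v : ℕ
          v = x div q
          qv²≤ : (ι q * ι v) * (ι q * ι v) ≤ ι x * ι x
          qv²≤ = *-mono (*-nonneg (0≤ι q) (0≤ι v)) (0≤ι x) (ι-*≤ q v (div-lower x q)) (ι-*≤ q v (div-lower x q))
          sums : ι q * ι q * ∑ X (λ y → inv y * 𝟙 (near? y v) * (F y * F y)) ≤ ι x * ι x * near-sum q
          sums = ≤-trans (≤-reflexive (sym (∑-*ˡ X (ι q * ι q) _))) (≤-trans (∑-mono X (λ y _ → term y)) (≤-reflexive (∑-*ˡ X (ι x * ι x) _)))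
            where
            term : ∀ y → ι q * ι q * (inv y * 𝟙 (near? y v) * (F y * F y)) ≤ ι x * ι x * (a y * (𝟙 (N ℕ.≤? q) * 𝟙 (near? y v)))
            term y = 𝟙-elim (near? y v) (λ i → ι q * ι q * (inv y * i * (F y * F y)) ≤ ι x * ι x * (a y * (𝟙 (N ℕ.≤? q) * i))) inside
              (λ _ → ≤-reflexive (solve 6 (λ q w f x a i → q :* q :* (w :* # 0 :* (f :* f)) := x :* x :* (a :* (i :* # 0))) refl (ι q) (inv y) (F y) (ι x) (a y) (𝟙 (N ℕ.≤? q))))
              where
              inside : Near y v → ι q * ι q * (inv y * 1ℚ * (F y * F y)) ≤ ι x * ι x * (a y * (𝟙 (N ℕ.≤? q) * 1ℚ))
              inside (y≤v , _) = linear (≤-reflexive (sym (cong (ι q * ι q * (F y * F y) *_) (ι²inv³ y))) ⊕ *-monoʳ (a y) (0≤a y) (*-mono (*-nonneg (0≤ι q) (0≤ι y)) (0≤ι x) qy≤ qy≤) ⊕ ≤-reflexive (sym (cong (λ i → ι x * ι x * (F y * F y * inv³ y) * i) (𝟙-yes (N ℕ.≤? q) N≤q)))) (solve 7 (λ q y w w3 f x i → x :* x :* (f :* f :* w3 :* (i :* # 1)) :- q :* q :* (w :* # 1 :* (f :* f)) := q :* q :* (f :* f) :* (y :* y :* w3) :+ x :* x :* (f :* f :* w3) :+ x :* x :* (f :* f :* w3) :* i :- (q :* q :* (f :* f) :* w :+ q :* y :* (q :* y) :* (f :* f :* w3) :+ x :* x :* (f :* f :* w3) :* # 1)) refl (ι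 q) (ι y) (inv y) (inv³ y) (F y) (ι x) (𝟙 (N ℕ.≤? q)))
                where
                qy≤ : ι q * ι y ≤ ι x
                qy≤ = ι-*≤ q y (ℕ.≤-trans (ℕ.*-monoʳ-≤ q y≤v) (div-lower x q))
        -- The primes q < N and those with ⌊x/q⌋ < 8 N carry little weight and are treated by |g| ≤
        -- x. Only in between is F(x/q) compared with its neighbours.
        term≤ : ∀ q → Λ q * inv q * (g q x * g q x) ≤ Λ q * inv q * bound q
        term≤ zero = ≤-reflexive (solve 3 (λ l s t → l :* # 0 :* s := l :* # 0 :* t) refl (Λ 0) (g 0 x * g 0 x) (bound 0))
        term≤ q@(suc _) = *-monoˡ (Λ q * inv q) (0≤Λinv q) (dec-elim (q ℕ.<? N) small (λ q≮N → dec-elim (8 ℕ.* N ℕ.≤? x div q) (middle q (ℕ.≮⇒≥ q≮N)) high))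
          where
          small : q ℕ.< N → g q x * g q x ≤ bound q
          small q<N = linear (g²≤x² q ⊕ ≤-reflexive (sym (cong (ι x * ι x *_) (𝟙-yes (q ℕ.<? N) q<N))) ⊕ 0≤x𝟙 (2 ℕ.^ j ℕ.≤? q) ⊕ 2 ⊛ 0≤xn2 ⊕ 0≤tail q) (solve 6 (λ G x i j n2 t → x :* x :* (i :+ j :+ # 2 :* n2) :+ t :- G := x :* x :+ x :* x :* i :+ x :* x :* j :+ # 2 :* (x :* x :* n2) :+ t :- (G :+ x :* x :* # 1 :+ # 0 :+ # 2 :* # 0 :+ # 0)) refl (g q x * g q x) (ι x) (𝟙 (q ℕ.<? N)) (𝟙 (2 ℕ.^ j ℕ.≤? q)) n2 (ι 16 * ι N * (ι x * ι x) * near-sum q))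
          high : ¬ 8 ℕ.* N ℕ.≤ x div q → g q x * g q x ≤ bound q
          high v<8N = linear (g²≤x² q ⊕ ≤-reflexive (sym (cong (ι x * ι x *_) (𝟙-yes (2 ℕ.^ j ℕ.≤? q) j≤q))) ⊕ 0≤x𝟙 (q ℕ.<? N) ⊕ 2 ⊛ 0≤xn2 ⊕ 0≤tail q) (solve 6 (λ G x i j n2 t → x :* x :* (i :+ j :+ # 2 :* n2) :+ t :- G := x :* x :+ x :* x :* j :+ x :* x :* i :+ # 2 :* (x :* x :* n2) :+ t :- (G :+ x :* x :* # 1 :+ # 0 :+ # 2 :* # 0 :+ # 0)) refl (g q x * g q x) (ι x) (𝟙 (q ℕ.<? N)) (𝟙 (2 ℕ.^ j ℕ.≤? q)) n2 (ι 16 * ι N * (ι x * ι x) * near-sum q))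
            where
            x<8Nq : x ℕ.< 8 ℕ.* N ℕ.* q
            x<8Nq = ℕ.<-≤-trans (div-upper x {q} (s≤s z≤n)) (ℕ.≤-trans (ℕ.≤-reflexive (trans (ℕ.+-comm (q ℕ.* (x div q)) q) (trans (sym (ℕ.*-suc q (x div q))) (ℕ.*-comm q (suc (x div q)))))) (ℕ.*-monoˡ-≤ q (ℕ.≰⇒> v<8N)))
            j≤q : 2 ℕ.^ j ℕ.≤ q
            j≤q = ℕ.*-cancelʳ-≤ (2 ℕ.^ j) q (8 ℕ.* N) {{ℕ.>-nonZero (ℕ.*-mono-≤ {1} {8} (s≤s z≤n) 1≤N)}} (ℕ.≤-trans (ℕ.≤-reflexive 2^j*8N) (ℕ.≤-trans (lg-lower 1≤x) (ℕ.≤-trans (ℕ.<⇒≤ x<8Nq) (ℕ.≤-reflexive (ℕ.*-comm (8 ℕ.* N) q)))))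
              where
              2^j*8N : 2 ℕ.^ j ℕ.* (8 ℕ.* N) ≡ 2 ℕ.^ lg x
              2^j*8N = trans (cong (2 ℕ.^ j ℕ.*_) (trans (ℕ.*-comm 8 N) (sym (ℕ.^-distribˡ-+-* 2 k 3)))) (trans (sym (ℕ.^-distribˡ-+-* 2 j (k ℕ.+ 3))) (cong (2 ℕ.^_) j≡))
        Z≤ : Z ≤ ι x * ι x * V
        Z≤ = ≤-trans (∑-mono X (λ q _ → term≤ q)) (≤-trans (≤-reflexive expand) (linear (*-monoˡ (ι x * ι x) (sq≥0 (ι x)) lo≤ ⊕ *-monoˡ (ι x * ι x) (sq≥0 (ι x)) hi≤ ⊕ *-monoˡ (ι 2 * (ι x * ι x) * n2) (*-nonneg (*-nonneg (0≤ι 2) (sq≥0 (ι x))) (sq≥0 (inv N))) S≤W ⊕ *-monoˡ (ι 16 * (ι x * ι x)) (*-nonneg (0≤ι 16) (sq≥0 (ι x))) Nm≤ ⊕ ≤-reflexive (sym (cong (ι x * ι x *_) (refl {x = V})))) (solve 13 (λ x lo hi s n2 W N m V k ε K3 B → x :* x :* V :- (x :* x :* (lo :+ hi :+ # 2 :* n2 :* s) :+ # 16 :* N :* (x :* x) :* m) := x :* x :* (k :+ # 5) :+ x :* x :* (k :+ # 10 :+ ε) :+ # 2 :* (x :* x) :* n2 :* W :+ # 16 :* (x :* x) :* (# 4 :* K3 :* B) :+ x :* x :* V :- (x :* x :* lo :+ x :* x :* hi :+ # 2 :* (x :* x) :* n2 :* s :+ # 16 :* (x :* x) :* (N :* m)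 :+ x :* x :* (# 2 :* k :+ # 15 :+ ε :+ # 2 :* n2 :* W :+ # 64 :* K3 :* B))) refl (ι x) lo hi s n2 W (ι N) m V (ι k) ε (ι (k ℕ.+ 3)) (A (suc (lg x))))))
          where
          lo hi s m : ℚ
          lo = ∑ X (λ q → 𝟙 (q ℕ.<? N) * (Λ q * inv q))
          hi = ∑ X (λ q → 𝟙 (2 ℕ.^ j ℕ.≤? q) * (Λ q * inv q))
          s = ∑ X (λ q → Λ q * inv q)
          m = ∑ X (λ q → Λ q * inv q * near-sum q)
          expand : ∑ X (λ q → Λ q * inv q * bound q) ≡ ι x * ι x * (lo + hi + ι 2 * n2 * s) + ι 16 * ι N * (ι x * ι x) * m
          expand = trans (∑-ext X (λ q → (solve 7 (λ l x i j n2 N t → l :* (x :* x :* (i :+ j :+ # 2 :* n2) :+ # 16 :* N :* (x :* x) :* t) := x :* x :* (i :* l :+ j :* l :+ # 2 :* n2 :* l) :+ # 16 :* N :* (x :* x) :* (l :* t)) refl (Λ q * inv q) (ι x) (𝟙 (q ℕ.<? N)) (𝟙 (2 ℕ.^ j ℕ.≤? q)) n2 (ι N) (near-sum q))))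
            (trans (∑-+ X _ _) (cong₂ _+_ (trans (∑-*ˡ X (ι x * ι x) _) (cong (ι x * ι x *_) (trans (∑-+ X _ _) (cong₂ _+_ (∑-+ X _ _) (∑-*ˡ X (ι 2 * n2) _))))) (∑-*ˡ X (ι 16 * ι N * (ι x * ι x)) _)))
          lo≤ : lo ≤ ι k + ι 5
          lo≤ = ≤-trans (∑-below X N 0≤Λinv) (S-upper k)
          -- The difference of the two Mertens bounds over the exponents from j = lg x - (k + 3) on.
          -- The lower bound brings in ε.
          hi≤ : hi ≤ ι k + ι 10 + ε
          hi≤ = linear (∑-extend (lg-upper x) (λ q _ _ → *-nonneg (0≤𝟙 (2 ℕ.^ j ℕ.≤? q)) (0≤Λinv q)) ⊕ ≤-reflexive (∑-range (2 ℕ.^ j) (2 ℕ.^ suc (lg x)) (λ q → Λ q * inv q) (2^-mono {j} {suc (lg x)} (ℕ.≤-trans (ℕ.m∸n≤m (lg x) (k ℕ.+ 3)) (ℕ.n≤1+n (lg x))))) ⊕ S-upper (suc (lg x)) ⊕ ≤-reflexive (ι-suc (lg x)) ⊕ S-lower j ⊕ ≤-reflexive (sym (E≡ j)) ⊕ 4 ⊛ 0≤h (suc j) ⊕ E-mono {j} {lg x} (ℕ.m∸n≤m (lg x) (k ℕ.+ 3)) ⊕ ≤-reflexive (trans (cong ι (sym j≡)) (ι-+ j (k ℕ.+ 3))) ⊕ ≤-reflexive (ι-+ k 3) ⊕ 0≤ι 1) (solve 13 (λ hi t r r' j u u' e Ej ε h k k3 → k :+ # 10 :+ ε :- hi :=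 t :+ (r :- r') :+ (u' :+ # 5) :+ (# 1 :+ u) :+ (r' :+ (e :+ # 1)) :+ Ej :+ # 4 :* h :+ ε :+ (j :+ k3) :+ (k :+ # 3) :+ # 1 :- (hi :+ t :+ r :+ u' :+ j :+ (e :+ # 1 :+ # 4 :* h) :+ # 4 :* # 0 :+ Ej :+ u :+ k3 :+ # 0)) refl hi (∑ (2 ℕ.^ suc (lg x)) (λ q → 𝟙 (2 ℕ.^ j ℕ.≤? q) * (Λ q * inv q))) (S (suc (lg x))) (S j) (ι j) u (ι (suc (lg x))) (e j) (E j) ε (h (suc j)) (ι k) (ι (k ℕ.+ 3)))
          Nm≤ : ι N * m ≤ ι 4 * ι (k ℕ.+ 3) * A (suc (lg x))
          Nm≤ = linear (*-monoˡ (ι N) (0≤ι N) m≤ ⊕ 4 ⊛ ≤-reflexive (cong (∑ X a * ι (k ℕ.+ 3) *_) (ι*inv 1≤N)) ⊕ 4 ⊛ *-monoˡ (ι (k ℕ.+ 3)) (0≤ι (k ℕ.+ 3)) (∑-extend (lg-upper x) (λ y _ _ → 0≤a y))) (solve 6 (λ N m v K3 B b → # 4 :* K3 :* B :- N :* m := N :* (b :* (# 4 :* K3 :* v)) :+ # 4 :* (b :* K3 :* # 1) :+ # 4 :* (K3 :* B) :- (N :* m :+ # 4 :* (b :* K3 :* (N :* v)) :+ # 4 :* (K3 :* b))) refl (ι N) m (inv N) (ι (k ℕ.+ 3)) (A (suc (lg x))) (∑ X a))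
            where
            m≤ : m ≤ ∑ X a * (ι 4 * ι (k ℕ.+ 3) * inv N)
            m≤ = ≤-trans (≤-reflexive (trans (∑-ext X (λ q → sym (∑-*ˡ X (Λ q * inv q) _))) (trans (∑-swap X X _) (∑-ext X (λ y → trans (∑-ext X (λ q → (solve 3 (λ l a i → l :* (a :* i) := a :* (l :* i)) refl (Λ q * inv q) (a y) (𝟙 (N ℕ.≤? q) * 𝟙 (near? y (x div q)))))) (∑-*ˡ X (a y) _))))))
              (≤-trans (∑-mono X (λ y _ → row y)) (≤-reflexive (∑-*ʳ X (ι 4 * ι (k ℕ.+ 3) * inv N) a)))
              where
              row : ∀ y → a y * ∑ X (λ q → Λ q * inv q * (𝟙 (N ℕ.≤? q) * 𝟙 (near? y (x div q)))) ≤ a y * (ι 4 * ι (k ℕ.+ 3) * inv N)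
              row zero = ≤-reflexive (trans (cong (_* ∑ X (λ q → Λ q * inv q * (𝟙 (N ℕ.≤? q) * 𝟙 (near? 0 (x div q))))) a0) (trans (solve 2 (λ s t → # 0 :* s := # 0 :* t) refl (∑ X (λ q → Λ q * inv q * (𝟙 (N ℕ.≤? q) * 𝟙 (near? 0 (x div q))))) (ι 4 * ι (k ℕ.+ 3) * inv N)) (cong (_* (ι 4 * ι (k ℕ.+ 3) * inv N)) (sym a0))))
              row y@(suc _) = *-monoˡ (a y) (0≤a y) (near-mass x y (s≤s z≤n))

    -- Once lg x reaches 2 to this power, the constant of `decay (4 * n)` and the error `E` are both
    -- at most 2^(-4n) lg x.
    threshold-exponent : ℕ → ℕ
    threshold-exponent n = exponent (4 ℕ.* n) ℕ.+ (12 ℕ.* n ℕ.+ (p ℕ.+ 20))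

    inv-2^-+ : ∀ a b → inv (2 ℕ.^ (a ℕ.+ b)) ≡ inv (2 ℕ.^ a) * inv (2 ℕ.^ b)
    inv-2^-+ a b = trans (cong inv (ℕ.^-distribˡ-+-* 2 a b)) (inv-* (2 ℕ.^ a) (2 ℕ.^ b))

    w⁴ : ∀ n → inv (2 ℕ.^ (4 ℕ.* n)) ≡ inv (2 ℕ.^ n) * inv (2 ℕ.^ n) * (inv (2 ℕ.^ n) * inv (2 ℕ.^ n))
    w⁴ n = trans (cong (λ z → inv (2 ℕ.^ z)) (ℕ-solve 1 (λ n → conₙ 4 :*ₙ n :=ₙ n :+ₙ n :+ₙ (n :+ₙ n)) refl n)) (trans (inv-2^-+ (n ℕ.+ n) (n ℕ.+ n)) (cong₂ _*_ (inv-2^-+ n n) (inv-2^-+ n n)))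

    inv-2^-anti : ∀ {a b} → a ℕ.≤ b → inv (2 ℕ.^ b) ≤ inv (2 ℕ.^ a)
    inv-2^-anti {a} {b} a≤b = inv-anti (0<2^ a) (2^-mono a≤b)

    scaled-≤ : ∀ a b K → 2 ℕ.^ a ℕ.* b ℕ.≤ K → ι b ≤ inv (2 ℕ.^ a) * ι K
    scaled-≤ a b K le = cancel-* {ι b} {inv (2 ℕ.^ a) * ι K} (ι (2 ℕ.^ a)) (0<ι′ (0<2^ a)) (linear (ι-*≤ (2 ℕ.^ a) b le ⊕ ≤-reflexive (sym (cong (ι K *_) (ι*inv (0<2^ a))))) (solve 4 (λ t v b K → t :* (v :* K) :- t :* b := K :+ K :* (t :* v) :- (t :* b :+ K :* # 1)) refl (ι (2 ℕ.^ a)) (inv (2 ℕ.^ a)) (ι b) (ι K)))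

    E-small : ∀ n K → 2 ℕ.^ threshold-exponent n ℕ.≤ K → ι 2 * ι (4 ℕ.* n ℕ.+ 3) + ι 15 + E K ≤ inv (2 ℕ.^ (4 ℕ.* n)) * ι K
    E-small n K big = linear-by 1 (2 ⊛ E-lg K ⊕ 4 ⊛ ≤-reflexive (ι-+ (4 ℕ.* n) 3) ⊕ 4 ⊛ ≤-reflexive (ι-* 4 n) ⊕ scaled-≤ (4 ℕ.* n) (2 ℕ.* (8 ℕ.* n ℕ.+ (49 ℕ.+ p))) K (ℕ.≤-trans first big) ⊕ ≤-reflexive (sym (ι-* 2 (8 ℕ.* n ℕ.+ (49 ℕ.+ p)))) ⊕ 2 ⊛ ≤-reflexive (sym (ι-+ (8 ℕ.* n) (49 ℕ.+ p))) ⊕ 2 ⊛ ≤-reflexive (sym (ι-* 8 n)) ⊕ 2 ⊛ ≤-reflexive (sym (ι-+ 49 p)) ⊕ scaled-≤ (4 ℕ.* n) (32 ℕ.* lg K) K second ⊕ ≤-reflexive (sym (ι-* 32 (lg K)))) (solve 12 (λ k2 n n4 E l p βK c c1 c2 c3 L32 → # 2 :* (βK :- (# 2 :* k2 :+ # 15 :+ E)) := # 2 :* (# 28 :+ p :+ # 16 :* l) :+ # 4 :* (n4 :+ # 3) :+ # 4 :* (# 4 :* n) :+ βK :+ c :+ # 2 :* c1 :+ # 2 :* c2 :+ # 2 :* c3 :+ βK :+ L32 :- (# 2 :* E :+ # 4 :* k2 :+ # 4 :* n4 :+ c :+ # 2 :* c1 :+ # 2 :* (c2 :+ c3) :+ #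 2 :* (# 8 :* n) :+ # 2 :* (# 49 :+ p) :+ L32 :+ # 32 :* l)) refl (ι (4 ℕ.* n ℕ.+ 3)) (ι n) (ι (4 ℕ.* n)) (E K) (ι (lg K)) (ι p) (inv (2 ℕ.^ (4 ℕ.* n)) * ι K) (ι (2 ℕ.* (8 ℕ.* n ℕ.+ (49 ℕ.+ p)))) (ι (8 ℕ.* n ℕ.+ (49 ℕ.+ p))) (ι (8 ℕ.* n)) (ι (49 ℕ.+ p)) (ι (32 ℕ.* lg K)))
      where
      first : 2 ℕ.^ (4 ℕ.* n) ℕ.* (2 ℕ.* (8 ℕ.* n ℕ.+ (49 ℕ.+ p))) ℕ.≤ 2 ℕ.^ threshold-exponent n
      first = ℕ.≤-trans (ℕ.*-monoʳ-≤ (2 ℕ.^ (4 ℕ.* n)) {2 ℕ.* (8 ℕ.* n ℕ.+ (49 ℕ.+ p))} {2 ℕ.^ ((n ℕ.+ p) ℕ.+ 7)} (ℕ.≤-trans (sizes n p (2 ℕ.^ n) (2 ℕ.^ p) (n<2^n n) (n<2^n p)) (ℕ.≤-reflexive (trans (cong (ℕ._* 2 ℕ.^ 7) (sym (ℕ.^-distribˡ-+-* 2 n p))) (sym (ℕ.^-distribˡ-+-* 2 (n ℕ.+ p) 7))))))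
        (ℕ.≤-trans (ℕ.≤-reflexive (sym (ℕ.^-distribˡ-+-* 2 (4 ℕ.* n) ((n ℕ.+ p) ℕ.+ 7)))) (2^-mono {4 ℕ.* n ℕ.+ ((n ℕ.+ p) ℕ.+ 7)} {threshold-exponent n} (ℕ-linear (ℕ.z≤n {0}) (ℕ-solve 3 (λ n p e → conₙ 4 :*ₙ n :+ₙ (n :+ₙ p :+ₙ conₙ 7) :+ₙ (conₙ 0 :+ₙ (conₙ 13 :+ₙ e :+ₙ conₙ 7 :*ₙ n)) :=ₙ e :+ₙ (conₙ 12 :*ₙ n :+ₙ (p :+ₙ conₙ 20)) :+ₙ conₙ 0) refl n p (exponent (4 ℕ.* n))))))
        where
        sizes : ∀ n p a b → n ℕ.< a → p ℕ.< b → 2 ℕ.* (8 ℕ.* n ℕ.+ (49 ℕ.+ p)) ℕ.≤ a ℕ.* b ℕ.* 128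
        sizes n p a b n<a p<b = ℕ.≤-trans (ℕ.*-monoʳ-≤ 2 (ℕ.+-mono-≤ (ℕ.*-monoʳ-≤ 8 (ℕ.<⇒≤ n<a)) (ℕ.+-monoʳ-≤ 49 (ℕ.<⇒≤ p<b)))) (ι-cancel (linear (≤-reflexive (ι-* 2 (8 ℕ.* a ℕ.+ (49 ℕ.+ b))) ⊕ 2 ⊛ ≤-reflexive (ι-+ (8 ℕ.* a) (49 ℕ.+ b)) ⊕ 2 ⊛ ≤-reflexive (ι-* 8 a) ⊕ 2 ⊛ ≤-reflexive (ι-+ 49 b) ⊕ ≤-reflexive (sym (ι-* (a ℕ.* b) 128)) ⊕ 128 ⊛ ≤-reflexive (sym (ι-* a b)) ⊕ 126 ⊛ *-monoˡ (ι a) (0≤ι a) (ι-mono (ℕ.≤-trans (s≤s z≤n) p<b)) ⊕ 2 ⊛ *-monoʳ (ι b) (0≤ι b) (ι-mono (ℕ.≤-trans (s≤s z≤n) n<a)) ⊕ 110 ⊛ ι-mono (ℕ.≤-trans (s≤s z≤n) n<a) ⊕ 0≤ι 12) (solve 8 (λ a b ab s s1 s2 s3 r → r :- s := # 2 :* s1 :+ # 2 :* (s2 :+ s3) :+ # 2 :* (# 8 :* a) :+ # 2 :* (# 49 :+ b) :+ r :+ # 128 :* ab :+ # 126 :* (a :* b) :+ # 2 :* (a :* b) :+ # 110 :* a :+ # 12 :- (s :+ # 2 :* s1 :+ # 2 :* s2 :+ # 2 :* s3 :+ ab :* # 128 :+ # 128 :* (a :* b) :+ # 126 :* (a :* # 1)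 :+ # 2 :* (# 1 :* b) :+ # 110 :* # 1 :+ # 0)) refl (ι a) (ι b) (ι (a ℕ.* b)) (ι (2 ℕ.* (8 ℕ.* a ℕ.+ (49 ℕ.+ b)))) (ι (8 ℕ.* a ℕ.+ (49 ℕ.+ b))) (ι (8 ℕ.* a)) (ι (49 ℕ.+ b)) (ι (a ℕ.* b ℕ.* 128)))))
      second : 2 ℕ.^ (4 ℕ.* n) ℕ.* (32 ℕ.* lg K) ℕ.≤ K
      second = ℕ.≤-trans (ℕ.≤-reflexive (trans (sym (ℕ.*-assoc (2 ℕ.^ (4 ℕ.* n)) 32 (lg K))) (cong (ℕ._* lg K) (sym (ℕ.^-distribˡ-+-* 2 (4 ℕ.* n) 5)))))
        (lg-small (4 ℕ.* n ℕ.+ 5) K (ℕ.≤-trans (0<2^ (threshold-exponent n)) big) (ℕ.≤-trans (2^-mono {2 ℕ.* (4 ℕ.* n ℕ.+ 5)} {threshold-exponent n} (ℕ-linear (ℕ.z≤n {0}) (ℕ-solve 3 (λ n p e → conₙ 2 :*ₙ (conₙ 4 :*ₙ n :+ₙ conₙ 5) :+ₙ (conₙ 0 :+ₙ (conₙ 10 :+ₙ e :+ₙ conₙ 4 :*ₙ n :+ₙ p)) :=ₙ e :+ₙ (conₙ 12 :*ₙ n :+ₙ (p :+ₙ conₙ 20)) :+ₙ conₙ 0) refl n p (exponent (4 ℕ.* n))))) big))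

    -- The slope 2^(-4n) enters F² multiplied by 16384 (n + 1), where n + 1 stems from the loss k +
    -- 3 in the window bound. One factor 2^-n absorbs n + 1, and 16384 = 128², so after taking the
    -- root 2^-n remains with room to spare.
    F-decay : ∀ n x → 2 ℕ.^ threshold-exponent n ℕ.≤ lg x → ∣ F x ∣ ≤ ι 128 * inv (2 ℕ.^ n) * ι x
    F-decay n x big = sq-cancel (*-nonneg (*-nonneg (0≤ι 128) (0≤inv (2 ℕ.^ n))) (0≤ι x)) (≤-trans (≤-reflexive (∣∣² (F x))) (conclude (decay (4 ℕ.* n))))
      where
      K k : ℕ
      K = lg x
      k = 4 ℕ.* n ℕ.+ 3
      1≤K : 1 ℕ.≤ K
      1≤K = ℕ.≤-trans (0<2^ (threshold-exponent n)) big
      1≤x : 1 ℕ.≤ x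
      1≤x = lg-positive 1≤K
      k+3≤ : k ℕ.+ 3 ℕ.≤ K
      k+3≤ = ℕ.≤-trans (ℕ.≤-trans (ℕ-linear (ℕ.z≤n {0}) (ℕ-solve 3 (λ n p e → conₙ 4 :*ₙ n :+ₙ conₙ 3 :+ₙ conₙ 3 :+ₙ (conₙ 0 :+ₙ (conₙ 14 :+ₙ e :+ₙ conₙ 8 :*ₙ n :+ₙ p)) :=ₙ e :+ₙ (conₙ 12 :*ₙ n :+ₙ (p :+ₙ conₙ 20)) :+ₙ conₙ 0) refl n p (exponent (4 ℕ.* n)))) (ℕ.<⇒≤ (n<2^n (threshold-exponent n)))) big
      β w u n2 : ℚ
      β = inv (2 ℕ.^ (4 ℕ.* n))
      w = inv (2 ℕ.^ n)
      u = ι K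
      n2 = inv (2 ℕ.^ k) * inv (2 ℕ.^ k)
      0≤β : 0ℚ ≤ β
      0≤β = 0≤inv (2 ℕ.^ (4 ℕ.* n))
      n2≤β : n2 ≤ β
      n2≤β = ≤-trans (*-mono (0≤inv (2 ℕ.^ k)) (0≤ι 1) (inv-2^-anti {4 ℕ.* n} {k} (ℕ.m≤m+n (4 ℕ.* n) 3)) (inv≤1 (2 ℕ.^ k))) (≤-reflexive (*-identityʳ β))
      conclude : (∃ λ B → Affine (inv (2 ℕ.^ (4 ℕ.* n))) B × B ℕ.+ suc p ℕ.≤ 2 ℕ.^ exponent (4 ℕ.* n) ℕ.* suc p) → F x * F x ≤ (ι 128 * w * ι x) * (ι 128 * w * ι x)
      conclude (B , affine , B≤) = cancel-* {F x * F x} {(ι 128 * w * ι x) * (ι 128 * w * ι x)} u (0<ι′ 1≤K) (cancel-* {u * (F x * F x)} {u * ((ι 128 * w * ι x) * (ι 128 * w * ι x))} u (0<ι′ 1≤K)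
          (linear (pointwise k (ℕ.m≤n+m 3 (4 ℕ.* n)) x 1≤x k+3≤ ⊕ *-monoˡ (ι x * ι x) (sq≥0 (ι x)) V≤ ⊕ *-monoˡ (ι x * ι x * (u * u)) (*-nonneg (sq≥0 (ι x)) (sq≥0 u)) final) (solve 7 (λ u f x V w β n → u :* (u :* (# 128 :* w :* x :* (# 128 :* w :* x))) :- u :* (u :* (f :* f)) := x :* x :* V :+ x :* x :* (u :* u :* (β :* (# 16384 :* (n :+ # 1)))) :+ x :* x :* (u :* u) :* (# 16384 :* (w :* w)) :- (u :* u :* (f :* f) :+ x :* x :* V :+ x :* x :* (u :* u) :* (β :* (# 16384 :* (n :+ # 1))))) refl u (F x) (ι x) V w β (ι n))))
        where
        A′ ε W V : ℚ
        A′ = A (suc K)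
        ε = E K
        W = u + ι 6
        V = ι 2 * W * (ι 2 * ι k + ι 15 + ε + ι 2 * n2 * W + ι 64 * ι (k ℕ.+ 3) * A′) + ι 2 * (ε * ε)
        1≤u : ι 1 ≤ u
        1≤u = ι-mono 1≤K
        0≤u : 0ℚ ≤ u
        0≤u = 0≤ι K
        0≤ε : 0ℚ ≤ ε
        0≤ε = ≤-trans (0≤ι 12) (12≤E K)
        B≤βu : ι B ≤ β * u
        B≤βu = scaled-≤ (4 ℕ.* n) B K (ℕ.≤-trans (ℕ.*-monoʳ-≤ (2 ℕ.^ (4 ℕ.* n)) (ℕ.≤-trans (ℕ.m≤m+n B (suc p)) (ℕ.≤-trans B≤ (ℕ.*-monoʳ-≤ (2 ℕ.^ exponent (4 ℕ.* n)) (n<2^n p)))))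
          (ℕ.≤-trans (ℕ.≤-reflexive (trans (cong (2 ℕ.^ (4 ℕ.* n) ℕ.*_) (sym (ℕ.^-distribˡ-+-* 2 (exponent (4 ℕ.* n)) p))) (sym (ℕ.^-distribˡ-+-* 2 (4 ℕ.* n) (exponent (4 ℕ.* n) ℕ.+ p))))) (ℕ.≤-trans (2^-mono {4 ℕ.* n ℕ.+ (exponent (4 ℕ.* n) ℕ.+ p)} {threshold-exponent n} (ℕ-linear (ℕ.z≤n {0}) (ℕ-solve 3 (λ n p e → conₙ 4 :*ₙ n :+ₙ (e :+ₙ p) :+ₙ (conₙ 0 :+ₙ (conₙ 20 :+ₙ conₙ 8 :*ₙ n)) :=ₙ e :+ₙ (conₙ 12 :*ₙ n :+ₙ (p :+ₙ conₙ 20)) :+ₙ conₙ 0) refl n p (exponent (4 ℕ.* n))))) big)))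
        A≤3 : A′ ≤ ι 3 * (β * u)
        A≤3 = linear (affine (suc K) ⊕ ≤-reflexive (cong (β *_) (ι-suc K)) ⊕ B≤βu ⊕ *-monoˡ β 0≤β 1≤u) (solve 5 (λ A β u u' B → # 3 :* (β :* u) :- A := β :* u' :+ B :+ β :* (# 1 :+ u) :+ β :* u :+ β :* u :- (A :+ β :* u' :+ B :+ β :* # 1)) refl A′ β u (ι (suc K)) (ι B))
        0≤k3 : 0ℚ ≤ ι (k ℕ.+ 3)
        0≤k3 = 0≤ι (k ℕ.+ 3)
        k3≡ : ι (k ℕ.+ 3) ≡ ι 4 * ι n + ι 6
        k3≡ = linear-≡ (cong₂ _+_ (cong₂ _+_ (ι-+ k 3) (ι-+ (4 ℕ.* n) 3)) (ι-* 4 n)) (solve 4 (λ a b c n → # 4 :* n :+ # 6 :- a := b :+ # 3 :+ (c :+ # 3) :+ # 4 :* n :- (a :+ b :+ c)) refl (ι (k ℕ.+ 3)) (ι k) (ι (4 ℕ.* n)) (ι n))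
        small : ι 2 * ι k + ι 15 + ε ≤ β * u
        small = E-small n K big
        ε≤ : ε ≤ β * u
        ε≤ = linear (small ⊕ 2 ⊛ 0≤ι k ⊕ 0≤ι 15) (solve 3 (λ k ε b → b :- ε := b :+ # 2 :* k :+ # 15 :- (# 2 :* k :+ # 15 :+ ε :+ # 2 :* # 0 :+ # 0)) refl (ι k) ε (β * u))
        β≤1 : β ≤ 1ℚ
        β≤1 = inv≤1 (2 ℕ.^ (4 ℕ.* n))
        0≤βu : 0ℚ ≤ β * u
        0≤βu = *-nonneg 0≤β 0≤u
        bracket : ι 2 * ι k + ι 15 + ε + ι 2 * n2 * W + ι 64 * ι (k ℕ.+ 3) * A′ ≤ β * u * (ι 1167 + ι 768 * ι n)
        bracket = linear (small ⊕ 2 ⊛ *-monoʳ u 0≤u n2≤β ⊕ 12 ⊛ n2≤β ⊕ 12 ⊛ *-monoˡ β 0≤β 1≤u ⊕ 64 ⊛ *-monoˡ (ι (k ℕ.+ 3)) 0≤k3 A≤3 ⊕ 192 ⊛ ≤-reflexive (cong (_* (β * u)) k3≡)) (solve 8 (λ k ε n2 u β K3 A n → β :* u :* (# 1167 :+ # 768 :* n) :- (# 2 :* k :+ # 15 :+ ε :+ # 2 :* n2 :* (u :+ # 6) :+ # 64 :* K3 :* A) := β :* u :+ # 2 :* (β :* u) :+ # 12 :* β :+ # 12 :* (β :* u) :+ # 64 :* (K3 :* (# 3 :* (β :* u))) :+ # 192 :* ((# 4 :* n :+ # 6) :* (β :* u)) :- (# 2 :* k :+ # 15 :+ ε :+ #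 2 :* (n2 :* u) :+ # 12 :* n2 :+ # 12 :* (β :* # 1) :+ # 64 :* (K3 :* A) :+ # 192 :* (K3 :* (β :* u)))) refl (ι k) ε n2 u β (ι (k ℕ.+ 3)) A′ (ι n))
        V≤ : V ≤ u * u * (β * (ι 16384 * (ι n + 1ℚ)))
        V≤ = linear (2 ⊛ *-mono {W} {ι 7 * u} {ι 2 * ι k + ι 15 + ε + ι 2 * n2 * W + ι 64 * ι (k ℕ.+ 3) * A′} {β * u * (ι 1167 + ι 768 * ι n)} (0≤u ⊕ 0≤ι 6) (*-nonneg 0≤βu (0≤ι 1167 ⊕ *-nonneg (0≤ι 768) (0≤ι n))) W≤ bracket ⊕ 2 ⊛ *-mono 0≤ε 0≤βu ε≤ ε≤ ⊕ 2 ⊛ *-monoʳ (β * u * u) (*-nonneg 0≤βu 0≤u) β≤1 ⊕ 44 ⊛ *-nonneg 0≤βu 0≤u ⊕ 5632 ⊛ *-nonneg (*-nonneg 0≤βu 0≤u) (0≤ι n)) (solve 6 (λ W u ε β n b → u :* u :* (β :* (# 16384 :* (n :+ # 1))) :- (# 2 :* W :* b :+ # 2 :* (ε :* ε)) := # 2 :* (# 7 :* u :* (β :* u :* (# 1167 :+ # 768 :* n))) :+ # 2 :* (β :* u :* (β :* u)) :+ # 2 :* (# 1 :* (β :* u :* u)) :+ # 44 :* (β :* u :* u) :+ # 5632 :* (β :* u :* u :* n) :- (# 2 :* (W :* b) :+ # 2 :* (ε :* ε) :+ # 2 :* (β :* (β :* u :* u)) :+ # 44 :* # 0 :+ # 5632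 :* # 0)) refl W u ε β (ι n) (ι 2 * ι k + ι 15 + ε + ι 2 * n2 * W + ι 64 * ι (k ℕ.+ 3) * A′))
          where
          W≤ : W ≤ ι 7 * u
          W≤ = linear (6 ⊛ 1≤u) (solve 1 (λ u → # 7 :* u :- (u :+ # 6) := # 6 :* u :- # 6 :* # 1) refl u)
        final : β * (ι 16384 * (ι n + 1ℚ)) ≤ ι 16384 * (w * w)
        final = linear (16384 ⊛ ≤-reflexive (cong (_* (ι n + 1ℚ)) (w⁴ n)) ⊕ 16384 ⊛ *-monoˡ (w * w * w) (*-nonneg (sq≥0 w) 0≤w) nw≤1 ⊕ 16384 ⊛ *-monoˡ (w * w) (sq≥0 w) (inv≤1 (2 ℕ.^ n))) (solve 3 (λ β w n → # 16384 :* (w :* w) :- β :* (# 16384 :* (n :+ # 1)) := # 16384 :* (w :* w :* (w :* w) :* (n :+ # 1)) :+ # 16384 :* (w :* w :* w :* # 1) :+ # 16384 :* (w :* w :* # 1) :- (# 16384 :* (β :* (n :+ # 1)) :+ # 16384 :* (w :* w :* w :* (w :* (n :+ # 1))) :+ # 16384 :* (w :* w :* w))) refl β w (ι n))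
          where
          0≤w : 0ℚ ≤ w
          0≤w = 0≤inv (2 ℕ.^ n)
          nw≤1 : w * (ι n + 1ℚ) ≤ 1ℚ
          nw≤1 = ≤-trans (*-monoˡ w 0≤w (≤-trans (≤-reflexive (trans (+-comm (ι n) 1ℚ) (sym (ι-suc n)))) (ι-mono (n<2^n n)))) (≤-trans (≤-reflexive (*-comm w (ι (2 ℕ.^ n)))) (ι*inv≤1 (2 ℕ.^ n)))

  -- Axer's argument: from F to m.

  module Axer where

    open Mertens using (h; h-2^)
    open LogSum using (e)
    open Mobius
    open Hyperbola
    open Pointwise

    -- Axer's argument: x m(z) differs from ∑ f n ⌊x / n⌋ by at most z, and that sum is evaluated
    -- by the hyperbola identity with x / z = B + 1.
    m-bound : ∀ B z δ η → let x = suc B ℕ.* z in 1 ℕ.≤ z → 0ℚ ≤ δ → (∀ v → z ℕ.≤ v → ∣ F v ∣ ≤ δ * ι v) → U x ≤ η * ι x → ∣ m z ∣ ≤ inv (suc B) + η + δ * (h (suc B) + 1ℚ)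
    m-bound B z δ η 1≤z 0≤δ F≤ U≤ηx = cancel-* {∣ m z ∣} {inv (suc B) + η + δ * (h (suc B) + 1ℚ)} (ι x) (0<ι′ 1≤x) (≤-trans (≤-reflexive (trans (cong (_* ∣ m z ∣) (sym (0≤p⇒∣p∣≡p (0≤ι x)))) (sym (∣p*q∣≡∣p∣*∣q∣ (ι x) (m z)))))
        (abs-≤ (linear (≤-trans (≤∣∣ (ι x * m z - W x z)) m-W′ ⊕ ≤-reflexive identity ⊕ U≤ηx ⊕ ≤-trans (-≤∣∣ (Φ x B)) Φ≤ ⊕ BF (≤∣∣ (F z))) (solve 11 (λ x m w u P b F η δ h v → x :* (v :+ η :+ δ :* (h :+ # 1)) :- x :* m := v :* x :+ (u :- w :+ b :* F) :+ η :* x :+ δ :* x :* h :+ δ :* x :- (x :* m :- w :+ P :+ u :+ (:- P) :+ b :* F)) refl (ι x) (m z) (W x z) (U x) (Φ x B) (ι B) (F z) η δ (h (suc B)) (inv (suc B))))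
          (linear (≤-trans (-≤∣∣ (ι x * m z - W x z)) m-W′ ⊕ ≤-reflexive (sym identity) ⊕ ≤-trans (0≤U x) U≤ηx ⊕ 0≤U x ⊕ ≤-trans (≤∣∣ (Φ x B)) Φ≤ ⊕ BF (-≤∣∣ (F z))) (solve 11 (λ x m w u P b F η δ h v → x :* (v :+ η :+ δ :* (h :+ # 1)) :- (:- (x :* m)) := v :* x :+ P :+ η :* x :+ u :+ δ :* x :* h :+ δ :* x :- ((:- (x :* m :- w)) :+ (u :- w :+ b :* F) :+ # 0 :+ # 0 :+ P :+ b :* (:- F))) refl (ι x) (m z) (W x z) (U x) (Φ x B) (ι B) (F z) η δ (h (suc B)) (inv (suc B))))))
      where
      x : ℕ
      x = suc B ℕ.* z
      1≤x : 1 ℕ.≤ x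
      1≤x = ℕ.*-mono-≤ {1} {suc B} (s≤s z≤n) 1≤z
      x/B≡z : x div suc B ≡ z
      x/B≡z = div-unique {x} {suc B} {z} ℕ.≤-refl (ℕ.m<m+n x (s≤s z≤n))
      identity : Φ x B ≡ U x - W x z + ι B * F z
      identity = subst (λ t → Φ x B ≡ U x - W x t + ι B * F t) x/B≡z (Φ-identity x B)
      m-W′ : ∣ ι x * m z - W x z ∣ ≤ inv (suc B) * ι x
      m-W′ = ≤-trans (m-W x z) (≤-reflexive (linear-≡ (cong₂ _+_ (sym (cong (inv (suc B) *_) (ι-* (suc B) z))) (sym (cong (ι z *_) (ι-inv B)))) (solve 4 (λ z v b x → v :* x :- z := v :* x :+ z :* (b :* v) :- (v :* (b :* z) :+ z :* # 1)) refl (ι z) (inv (suc B)) (ι (suc B)) (ι x))))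
      BF : ∀ {a} → a ≤ ∣ F z ∣ → ι B * a ≤ δ * ι x
      BF {a} a≤ = linear (*-monoˡ (ι B) (0≤ι B) (≤-trans a≤ (F≤ z ℕ.≤-refl)) ⊕ *-monoˡ δ 0≤δ (ι-*≤ B z (ℕ.*-monoˡ-≤ z (ℕ.n≤1+n B)))) (solve 5 (λ b a δ z x → δ :* x :- b :* a := b :* (δ :* z) :+ δ :* x :- (b :* a :+ δ :* (b :* z))) refl (ι B) a δ (ι z) (ι x))
      Φ≤ : ∣ Φ x B ∣ ≤ δ * ι x * h (suc B)
      Φ≤ = ≤-trans (∣∑∣≤ (suc B) _) (≤-trans (∑-mono (suc B) term) (≤-reflexive (∑-*ˡ (suc B) (δ * ι x) inv)))
        where
        term : ∀ b → b ℕ.< suc B → ∣ F (x div b) ∣ ≤ δ * ι x * inv b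
        term zero _ = ≤-reflexive (trans (cong ∣_∣ F0) (sym (*-zeroʳ (δ * ι x))))
        term b@(suc _) b≤B = ≤-trans (F≤ (x div b) (div-≥ {x} {b} {z} (s≤s z≤n) (ℕ.*-monoˡ-≤ z (ℕ.<⇒≤ b≤B)))) (≤-trans (*-monoˡ δ 0≤δ (ι-div-≤ x b)) (≤-reflexive (sym (*-assoc δ (ι x) (inv b)))))

    suc*inv-2^≤1 : ∀ n → (ι n + 1ℚ) * inv (2 ℕ.^ n) ≤ 1ℚ
    suc*inv-2^≤1 n = ≤-trans (*-monoʳ (inv (2 ℕ.^ n)) (0≤inv (2 ℕ.^ n)) (≤-trans (≤-reflexive (trans (+-comm (ι n) 1ℚ) (sym (ι-suc n)))) (ι-mono (n<2^n n)))) (ι*inv≤1 (2 ℕ.^ n))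

    e≤E : ∀ j → e j ≤ E j
    e≤E j = linear (≤-reflexive (sym (E≡ j)) ⊕ 4 ⊛ 0≤h (suc j) ⊕ 0≤ι 1) (solve 3 (λ e E h → E :- e := E :+ # 4 :* h :+ # 1 :- (e :+ # 1 :+ # 4 :* h :+ # 4 :* # 0 :+ # 0)) refl (e j) (E j) (h (suc j)))

    U-decay : ∀ n x → 2 ℕ.^ threshold-exponent n ℕ.≤ lg x → U x ≤ inv (2 ℕ.^ (4 ℕ.* n)) * ι x
    U-decay n x big = cancel-* {U x} {inv (2 ℕ.^ (4 ℕ.* n)) * ι x} (ι (lg x)) (0<ι′ 1≤K) (linear (lg*U≤ x (lg-positive 1≤K) ⊕ *-monoˡ (ι x) (0≤ι x) e≤) (solve 5 (λ l u x e β → l :* (β :* x) :- l :* u := x :* e :+ x :* (β :* l) :- (l :* u :+ x :* e)) refl (ι (lg x)) (U x) (ι x) (e (lg x)) (inv (2 ℕ.^ (4 ℕ.* n)))))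
      where
      e≤ : e (lg x) ≤ inv (2 ℕ.^ (4 ℕ.* n)) * ι (lg x)
      e≤ = linear (e≤E (lg x) ⊕ E-small n (lg x) big ⊕ 2 ⊛ 0≤ι (4 ℕ.* n ℕ.+ 3) ⊕ 0≤ι 15) (solve 4 (λ k e E b → b :- e := E :+ b :+ # 2 :* k :+ # 15 :- (e :+ (# 2 :* k :+ # 15 :+ E) :+ # 2 :* # 0 :+ # 0)) refl (ι (4 ℕ.* n ℕ.+ 3)) (e (lg x)) (E (lg x)) (inv (2 ℕ.^ (4 ℕ.* n)) * ι (lg x)))
      1≤K : 1 ℕ.≤ lg x
      1≤K = ℕ.≤-trans (0<2^ (threshold-exponent n)) big

    -- B + 1 = 2^n makes the harmonic factor at most n + 1. It multiplies 128 · 2^(-2n), which is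
    -- why `F-decay` is used at 2 n, and leaves 128 · 2^-n. The terms 1/(B + 1) and η add 2^-n each,
    -- hence 130.
    m-decay : ∀ n z → 2 ℕ.^ threshold-exponent (2 ℕ.* n) ℕ.≤ lg z → ∣ m z ∣ ≤ ι 130 * inv (2 ℕ.^ n)
    m-decay n z big = ≤-trans (m-bound B z (ι 128 * inv (2 ℕ.^ (2 ℕ.* n))) w 1≤z (*-nonneg (0≤ι 128) (0≤inv (2 ℕ.^ (2 ℕ.* n)))) (λ v z≤v → F-decay (2 ℕ.* n) v (ℕ.≤-trans big (lg-mono z≤v)))
        (≤-trans (U-decay (2 ℕ.* n) x (ℕ.≤-trans big (lg-mono z≤x))) (*-monoʳ (ι x) (0≤ι x) (inv-2^-anti {n} {4 ℕ.* (2 ℕ.* n)} (ℕ-linear (ℕ.z≤n {0}) (ℕ-solve 1 (λ n → n :+ₙ (conₙ 0 :+ₙ conₙ 7 :*ₙ n) :=ₙ conₙ 4 :*ₙ (conₙ 2 :*ₙ n) :+ₙ conₙ 0) refl n))))))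
      (linear (≤-reflexive (cong inv B≡) ⊕ 128 ⊛ *-monoˡ (inv (2 ℕ.^ (2 ℕ.* n))) (0≤inv (2 ℕ.^ (2 ℕ.* n))) h≤ ⊕ 128 ⊛ ≤-reflexive (trans (cong (λ k → inv (2 ℕ.^ k)) (ℕ-solve 1 (λ n → conₙ 2 :*ₙ n :=ₙ n :+ₙ n) refl n)) (inv-2^-+ n n)) ⊕ 128 ⊛ ≤-reflexive (cong (_* ι n) (trans (cong (λ k → inv (2 ℕ.^ k)) (ℕ-solve 1 (λ n → conₙ 2 :*ₙ n :=ₙ n :+ₙ n) refl n)) (inv-2^-+ n n))) ⊕ 128 ⊛ *-monoˡ w (0≤inv (2 ℕ.^ n)) (suc*inv-2^≤1 n)) (solve 5 (λ w v h n w2 → # 130 :* w :- (v :+ w :+ # 128 :* w2 :* (h :+ # 1)) := w :+ # 128 :* (w2 :* n) :+ # 128 :* (w :* w) :+ # 128 :* (w :* w :* n) :+ # 128 :* (w :* # 1) :- (v :+ # 128 :* (w2 :* h) :+ # 128 :* w2 :+ # 128 :* (w2 :* n) :+ # 128 :* (w :* ((n :+ # 1) :* w)))) refl w (inv (suc B)) (h (suc B)) (ι n) (inv (2 ℕ.^ (2 ℕ.* n)))))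
      where
      w : ℚ
      w = inv (2 ℕ.^ n)
      B x : ℕ
      B = ℕ.pred (2 ℕ.^ n)
      x = suc B ℕ.* z
      B≡ : suc B ≡ 2 ℕ.^ n
      B≡ = ℕ.suc-pred (2 ℕ.^ n) {{ℕ.>-nonZero (0<2^ n)}}
      h≤ : h (suc B) ≤ ι n
      h≤ = ≤-trans (≤-reflexive (cong h B≡)) (h-2^ n)
      z≤x : z ℕ.≤ x
      z≤x = ℕ.m≤m+n z (B ℕ.* z)
      1≤z : 1 ℕ.≤ z
      1≤z = lg-positive (ℕ.≤-trans (0<2^ (threshold-exponent (2 ℕ.* n))) big)

  -- The sum twisted by ω.

  module Twisted where

    open Mertens
    open Mobius
    open Hyperbola using (m; ∣m∣≤2)
    open import Defs using (ω)
    open import Data.Nat.Induction using (<-rec)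

    coprime-m : ℕ → ℕ → ℚ
    coprime-m q y = ∑ (suc y) (λ n → f n * inv n - 𝟙 (q ∣? n) * (f n * inv n))

    ∑-multiples-f : ∀ q y → Prime q → p ℕ.< q → ∑ (suc y) (λ n → 𝟙 (q ∣? n) * (f n * inv n)) ≡ - (inv q * coprime-m q (y div q))
    ∑-multiples-f q y pq p<q = trans (∑-multiples y (λ n → f n * inv n) (ℕ.≤-trans (s≤s z≤n) (prime≥2 pq))) (trans (∑-ext (suc (y div q)) term) (trans (∑-neg (suc (y div q)) _) (cong -_ (∑-*ˡ (suc (y div q)) (inv q) _))))
      where
      term : ∀ n → f (q ℕ.* n) * inv (q ℕ.* n) ≡ - (inv q * (f n * inv n - 𝟙 (q ∣? n) * (f n * inv n)))
      term n = trans (cong₂ _*_ (f-*′ n pq p<q) (inv-* q n)) (solve 4 (λ i f u v → (i :* f :- f) :* (u :* v) := (:- (u :* (f :* v :- i :* (f :* v))))) refl (𝟙 (q ∣? n)) (f n) (inv q) (inv n))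

    -- Take out the multiples of q from m: f (q n) is - f n for n prime to q and 0 otherwise, so
    -- they contribute minus 1/q times the same kind of sum up to y/q.
    coprime-m-step : ∀ q y → Prime q → p ℕ.< q → coprime-m q y ≡ m y + inv q * coprime-m q (y div q)
    coprime-m-step q y pq p<q = linear-≡ (cong₂ _+_ (∑-- (suc y) (λ n → f n * inv n) (λ n → 𝟙 (q ∣? n) * (f n * inv n))) (sym (∑-multiples-f q y pq p<q))) (solve 4 (λ a m b s → m :+ b :- a := m :- s :+ s :- (a :+ (:- b))) refl (coprime-m q y) (m y) (inv q * coprime-m q (y div q)) (∑ (suc y) (λ n → 𝟙 (q ∣? n) * (f n * inv n))))

    ∣coprime-m∣-step : ∀ q y a b → Prime q → p ℕ.< q → ∣ m y ∣ ≤ a → ∣ coprime-m q (y div q) ∣ ≤ b → ∣ coprime-m q y ∣ ≤ a + inv q * b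
    ∣coprime-m∣-step q y a b pq p<q m≤ c≤ = ≤-trans (≤-reflexive (cong ∣_∣ (coprime-m-step q y pq p<q))) (≤-trans (∣p+q∣≤∣p∣+∣q∣ (m y) (inv q * coprime-m q (y div q))) (m≤ ⊕ ≤-trans (≤-reflexive (trans (∣p*q∣≡∣p∣*∣q∣ (inv q) (coprime-m q (y div q))) (cong (_* ∣ coprime-m q (y div q) ∣) (0≤p⇒∣p∣≡p (0≤inv q))))) (*-monoˡ (inv q) (0≤inv q) c≤)))

    coprime-m-0 : ∀ q → coprime-m q 0 ≡ 0ℚ
    coprime-m-0 q = solve 2 (λ f i → # 0 :+ (f :* # 0 :- i :* (f :* # 0)) := # 0) refl (f 0) (𝟙 (q ∣? 0))

    inv-prime≤½ : ∀ {q} → Prime q → inv q ≤ inv 2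
    inv-prime≤½ pq = inv-anti (s≤s z≤n) (prime≥2 pq)

    div-prime< : ∀ {q} y → Prime q → suc y div q ℕ.< suc y
    div-prime< {q} y pq = div-< {suc y} {q} {suc y} (ℕ.<-≤-trans (ℕ.m<m+n (suc y) {suc y ℕ.+ 0} (s≤s z≤n)) (ℕ.*-monoˡ-≤ (suc y) (prime≥2 pq)))

    -- Induction on y through y/q < y, using 2 + 4/q ≤ 4.
    ∣coprime-m∣≤4 : ∀ q → Prime q → p ℕ.< q → ∀ y → ∣ coprime-m q y ∣ ≤ ι 4
    ∣coprime-m∣≤4 q pq p<q = <-rec _ bound
      where
      bound : ∀ y → (∀ {v} → v ℕ.< y → ∣ coprime-m q v ∣ ≤ ι 4) → ∣ coprime-m q y ∣ ≤ ι 4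
      bound zero _ = ≤-trans (≤-reflexive (cong ∣_∣ (coprime-m-0 q))) (0≤ι 4)
      bound (suc y) rec = linear (∣coprime-m∣-step q (suc y) (ι 2) (ι 4) pq p<q (∣m∣≤2 (suc y)) (rec (div-prime< y pq)) ⊕ 4 ⊛ inv-prime≤½ pq ⊕ 2 ⊛ ≤-reflexive (ι-inv 1)) (solve 3 (λ c v t → # 4 :- c := # 2 :+ v :* # 4 :+ # 4 :* t :+ # 2 :* # 1 :- (c :+ # 4 :* v :+ # 2 :* (# 2 :* t))) refl (∣ coprime-m q (suc y) ∣) (inv q) (inv 2))

    -- The last term has a shape that the recursion preserves: (1/q)/(⌊y/q⌋ + 1) ≤ 1/(y + 1). For y
    -- < Z it is at least 4, the trivial bound, so the decay ρ of m is called upon only from Z on.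
    ∣coprime-m∣≤ : ∀ q → Prime q → p ℕ.< q → ∀ Z ρ → 0ℚ ≤ ρ → (∀ v → Z ℕ.≤ v → ∣ m v ∣ ≤ ρ) → ∀ y → ∣ coprime-m q y ∣ ≤ ι 2 * ρ + ι 4 * ι Z * inv (suc y)
    ∣coprime-m∣≤ q pq p<q Z ρ 0≤ρ m≤ = <-rec _ bound
      where
      below : ∀ y → y ℕ.< Z → ∣ coprime-m q y ∣ ≤ ι 2 * ρ + ι 4 * ι Z * inv (suc y)
      below y y<Z = linear (∣coprime-m∣≤4 q pq p<q y ⊕ 4 ⊛ *-monoʳ (inv (suc y)) (0≤inv (suc y)) (ι-mono y<Z) ⊕ 4 ⊛ ≤-reflexive (sym (ι-inv y)) ⊕ 2 ⊛ 0≤ρ) (solve 5 (λ c ρ Z v s → # 2 :* ρ :+ # 4 :* Z :* v :- c := # 4 :+ # 4 :* (Z :* v) :+ # 4 :* (s :* v) :+ # 2 :* ρ :- (c :+ # 4 :* (s :* v) :+ # 4 :* # 1 :+ # 2 :* # 0)) refl (∣ coprime-m q y ∣) ρ (ι Z) (inv (suc y)) (ι (suc y)))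
      bound : ∀ y → (∀ {v} → v ℕ.< y → ∣ coprime-m q v ∣ ≤ ι 2 * ρ + ι 4 * ι Z * inv (suc v)) → ∣ coprime-m q y ∣ ≤ ι 2 * ρ + ι 4 * ι Z * inv (suc y)
      bound zero _ = ≤-trans (≤-reflexive (cong ∣_∣ (coprime-m-0 q))) (*-nonneg (0≤ι 2) 0≤ρ ⊕ *-nonneg (*-nonneg (0≤ι 4) (0≤ι Z)) (0≤inv 1))
      bound y@(suc y′) rec = dec-elim (y ℕ.<? Z) (below y) λ y≮Z → (linear (∣coprime-m∣-step q y ρ (ι 2 * ρ + ι 4 * ι Z * inv (suc (y div q))) pq p<q (m≤ y (ℕ.≮⇒≥ y≮Z)) (rec (div-prime< y′ pq)) ⊕ 2 ⊛ *-monoʳ ρ 0≤ρ (inv-prime≤½ pq) ⊕ ≤-reflexive (cong (_* ρ) (refl {x = ι 2 * inv 2})) ⊕ 4 ⊛ *-monoˡ (ι Z) (0≤ι Z) smaller) (solve 7 (λ c ρ Z u v w t → # 2 :* ρ :+ # 4 :* Z :* w :- c := ρ :+ u :* (# 2 :* ρ :+ # 4 :* Z :* v) :+ # 2 :* (t :* ρ) :+ # 1 :* ρ :+ # 4 :* (Z :* w) :- (c :+ # 2 :* (u :* ρ) :+ # 2 :* t :* ρ :+ # 4 :* (Z :* (u :* v)))) refl (∣ coprime-m q y ∣) ρ (ι Z) (inv q) (inv (suc (y div q))) (inv (suc y)) (inv 2)))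
        where
        1≤q = ℕ.≤-trans (s≤s z≤n) (prime≥2 pq)
        smaller : inv q * inv (suc (y div q)) ≤ inv (suc y)
        smaller = ≤-trans (≤-reflexive (sym (inv-* q (suc (y div q))))) (inv-anti (s≤s z≤n) (ℕ.≤-trans (div-upper y 1≤q) (ℕ.≤-reflexive (trans (ℕ.+-comm (q ℕ.* (y div q)) q) (sym (ℕ.*-suc q (y div q)))))))

    twisted : ℕ → ℚ
    twisted y = ∑ (suc y) (λ n → f n * inv n * ι (ω n))

    -- On the support of `f` all prime factors exceed p, so `χ` sees every one of them.
    f-ω : ∀ y n → n ℕ.< suc y → f n * ι (ω n) ≡ f n * ∑ (suc y) (λ q → χ q * 𝟙 (q ∣? n))
    f-ω y zero _ = trans (cong (_* ι (ω 0)) f0) (trans (solve 2 (λ a b → # 0 :* a := # 0 :* b) refl (ι (ω 0)) (∑ (suc y) (λ q → χ q * 𝟙 (q ∣? 0)))) (cong (_* ∑ (suc y) (λ q → χ q * 𝟙 (q ∣? 0))) (sym f0)))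
    f-ω y n@(suc _) n≤y = 𝟙-elim (rough? n) (λ i → i * μ′ n * ι (ω n) ≡ i * μ′ n * ∑ (suc y) (λ q → χ q * 𝟙 (q ∣? n)))
        (λ rough → cong (1ℚ * μ′ n *_) (trans (ω-sum n (suc y) (s≤s z≤n) n≤y) (∑-ext (suc y) (λ q → trans (𝟙-cong (divisor? n q) (𝒫? q ×-dec (q ∣? n)) (λ (pq , d) → (pq , ℕ.≰⇒> (λ q≤p → rough (s≤s q≤p) (pq , d))) , d) (λ ((pq , _) , d) → pq , d)) (𝟙-× (𝒫? q) (q ∣? n))))))
        (λ _ → (solve 3 (λ μ a b → # 0 :* μ :* a := # 0 :* μ :* b) refl (μ′ n) (ι (ω n)) (∑ (suc y) (λ q → χ q * 𝟙 (q ∣? n)))))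

    χ-only : ∀ q {a b} → (Prime q → p ℕ.< q → a ≡ b) → χ q * a ≡ χ q * b
    χ-only q {a} {b} h′ = 𝟙-elim (𝒫? q) (λ i → i * a ≡ i * b) (λ (pq , p<q) → cong (1ℚ *_) (h′ pq p<q)) (λ _ → (solve 2 (λ a b → # 0 :* a := # 0 :* b) refl a b))

    χ-only-≤ : ∀ q {a b} → (Prime q → p ℕ.< q → a ≤ b) → χ q * a ≤ χ q * b
    χ-only-≤ q {a} {b} h′ = 𝟙-elim (𝒫? q) (λ i → i * a ≤ i * b) (λ (pq , p<q) → *-monoˡ 1ℚ (0≤ι 1) (h′ pq p<q)) (λ _ → ≤-reflexive (solve 2 (λ a b → # 0 :* a := # 0 :* b) refl a b))

    twisted-≡ : ∀ y → twisted y ≡ - ∑ (suc y) (λ q → χ q * (inv q * coprime-m q (y div q)))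
    twisted-≡ y = trans (∑-cong (suc y) (λ n n≤y → trans (solve 3 (λ f v w → f :* v :* w := v :* (f :* w)) refl (f n) (inv n) (ι (ω n))) (trans (cong (inv n *_) (f-ω y n n≤y))
        (trans (solve 3 (λ f v s → v :* (f :* s) := f :* v :* s) refl (f n) (inv n) (∑ (suc y) (λ q → χ q * 𝟙 (q ∣? n)))) (sym (∑-*ˡ (suc y) (f n * inv n) _))))))
      (trans (∑-swap (suc y) (suc y) (λ n q → f n * inv n * (χ q * 𝟙 (q ∣? n)))) (trans (∑-ext (suc y) inner) (∑-neg (suc y) _)))
      where
      inner : ∀ q → ∑ (suc y) (λ n → f n * inv n * (χ q * 𝟙 (q ∣? n))) ≡ - (χ q * (inv q * coprime-m q (y div q)))
      inner q = trans (∑-ext (suc y) (λ n → (solve 3 (λ a c i → a :* (c :* i) := c :* (i :* a)) refl (f n * inv n) (χ q) (𝟙 (q ∣? n))))) (trans (∑-*ˡ (suc y) (χ q) _) (trans (χ-only q (∑-multiples-f q y)) (solve 2 (λ c b → c :* (:- b) := (:- (c :* b))) refl (χ q) (inv q * coprime-m q (y div q)))))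

    -- The primes q < 2 ^ j meet the decay of the sums over n prime to q; the remaining ones lie in 2 z + 1 dyadic blocks.
    ∣twisted∣≤ : ∀ z j y ρ → 1 ℕ.≤ j → 1 ℕ.≤ y → lg y ≡ j ℕ.+ (z ℕ.+ z) → 0ℚ ≤ ρ → (∀ v → 2 ℕ.^ z ℕ.≤ v → ∣ m v ∣ ≤ ρ) →
      ∣ twisted y ∣ ≤ (ι 2 * ρ + ι 4 * inv (2 ℕ.^ z)) * (ι 4 * h (suc (lg y))) + ι (suc (z ℕ.+ z)) * (ι 16 * inv j)
    ∣twisted∣≤ z j y ρ 1≤j 1≤y lg≡ 0≤ρ m≤ = ≤-trans (≤-reflexive (trans (cong ∣_∣ (twisted-≡ y)) (∣-p∣≡∣p∣ (∑ (suc y) (λ q → χ q * (inv q * coprime-m q (y div q)))))))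
      (≤-trans (∣∑∣≤ (suc y) _) (≤-trans (∑-mono (suc y) (λ q _ → abs q)) (≤-trans (∑-extend (lg-upper y) (λ q _ _ → 0≤t q)) (≤-trans (≤-reflexive split) (head ⊕ tail)))))
      where
      Z : ℕ
      Z = 2 ℕ.^ z
      t : ℕ → ℚ
      t q = χ q * (inv q * ∣ coprime-m q (y div q) ∣)
      0≤t : ∀ q → 0ℚ ≤ t q
      0≤t q = *-nonneg (0≤χ q) (*-nonneg (0≤inv q) (0≤∣p∣ (coprime-m q (y div q))))
      abs : ∀ q → ∣ χ q * (inv q * coprime-m q (y div q)) ∣ ≤ t q
      abs q = ≤-reflexive (trans (∣p*q∣≡∣p∣*∣q∣ (χ q) (inv q * coprime-m q (y div q))) (cong₂ _*_ (0≤p⇒∣p∣≡p (0≤χ q)) (trans (∣p*q∣≡∣p∣*∣q∣ (inv q) (coprime-m q (y div q))) (cong (_* ∣ coprime-m q (y div q) ∣) (0≤p⇒∣p∣≡p (0≤inv q))))))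
      t0 : t 0 ≡ 0ℚ
      t0 = solve 2 (λ c a → c :* (# 0 :* a) := # 0) refl (χ 0) (∣ coprime-m 0 0 ∣)
      block : ℕ → ℚ
      block i = ∑ (2 ℕ.^ i) (λ r → t (2 ℕ.^ i ℕ.+ r))
      split : ∑ (2 ℕ.^ suc (lg y)) t ≡ ∑ (2 ℕ.^ j) t + ∑ (suc (z ℕ.+ z)) (λ i → block (j ℕ.+ i))
      split = trans (dyadic₀ (suc (lg y)) t t0) (trans (cong (λ k → ∑ k block) (trans (cong suc lg≡) (sym (ℕ.+-suc j (z ℕ.+ z))))) (trans (∑-split j (suc (z ℕ.+ z)) block) (cong (_+ ∑ (suc (z ℕ.+ z)) (λ i → block (j ℕ.+ i))) (sym (dyadic₀ j t t0)))))
      D : ℚ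
      D = ι 2 * ρ + ι 4 * inv Z
      0≤D : 0ℚ ≤ D
      0≤D = *-nonneg (0≤ι 2) 0≤ρ ⊕ *-nonneg (0≤ι 4) (0≤inv Z)
      t≤ : ∀ q c → (Prime q → p ℕ.< q → ∣ coprime-m q (y div q) ∣ ≤ c) → 0ℚ ≤ c → t q ≤ c * (π q * inv q)
      t≤ q c c≤ 0≤c = linear (χ-only-≤ q (λ pq p<q → *-monoˡ (inv q) (0≤inv q) (c≤ pq p<q)) ⊕ *-monoʳ (inv q * c) (*-nonneg (0≤inv q) 0≤c) (χ≤π q)) (solve 5 (λ t x i v c → c :* (i :* v) :- t := x :* (v :* c) :+ i :* (v :* c) :- (t :+ x :* (v :* c))) refl (t q) (χ q) (π q) (inv q) c)
      head : ∑ (2 ℕ.^ j) t ≤ D * (ι 4 * h (suc (lg y)))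
      head = ≤-trans (∑-mono (2 ℕ.^ j) (λ q q< → t≤ q D (small q q<) 0≤D)) (≤-trans (≤-reflexive (∑-*ˡ (2 ℕ.^ j) D _)) (*-monoˡ D 0≤D (≤-trans (R-bound j) (4 ⊛ h-mono (ℕ.≤-trans (ℕ.m≤m+n j (z ℕ.+ z)) (ℕ.≤-trans (ℕ.≤-reflexive (sym lg≡)) (ℕ.n≤1+n (lg y))))))))
        where
        -- Here q < 2^j leaves y/q ≥ 2^(2z) = Z², and the term 4 Z/(⌊y/q⌋ + 1) drops to 4/Z.
        small : ∀ q → q ℕ.< 2 ℕ.^ j → Prime q → p ℕ.< q → ∣ coprime-m q (y div q) ∣ ≤ D
        small q q< pq p<q = ≤-trans (∣coprime-m∣≤ q pq p<q Z ρ 0≤ρ m≤ (y div q)) (linear (4 ⊛ *-monoˡ (ι Z) (0≤ι Z) (≤-trans (inv-anti (ℕ.*-mono-≤ {1} {Z} {1} {Z} (0<2^ z) (0<2^ z)) (ℕ.≤-trans ZZ≤ (ℕ.n≤1+n (y div q)))) (≤-reflexive (inv-* Z Z))) ⊕ 4 ⊛ ≤-reflexive (cong (_* inv Z) (ι*inv (0<2^ z)))) (solve 4 (λ ρ Z v u → # 2 :* ρ :+ # 4 :* u :- (# 2 :* ρ :+ # 4 :* Z :* v) := # 4 :* (Z :* (u :* u)) :+ # 4 :* (# 1 :* u) :- (# 4 :* (Z :* v) :+ # 4 :* (Z :* u :* u))) refl ρ (ι Z) (inv (suc (y div q))) (inv Z)))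
          where
          ZZ≤ : Z ℕ.* Z ℕ.≤ y div q
          ZZ≤ = div-≥ {y} {q} (ℕ.≤-trans (s≤s z≤n) (prime≥2 pq)) (ℕ.≤-trans (ℕ.*-monoˡ-≤ (Z ℕ.* Z) (ℕ.<⇒≤ q<)) (ℕ.≤-trans (ℕ.≤-reflexive (trans (cong (2 ℕ.^ j ℕ.*_) (sym (ℕ.^-distribˡ-+-* 2 z z))) (trans (sym (ℕ.^-distribˡ-+-* 2 j (z ℕ.+ z))) (cong (2 ℕ.^_) (sym lg≡))))) (lg-lower 1≤y)))
      -- Without decay: each block has reciprocal sum at most 4/j, taken against the trivial bound
      -- 4.
      tail : ∑ (suc (z ℕ.+ z)) (λ i → block (j ℕ.+ i)) ≤ ι (suc (z ℕ.+ z)) * (ι 16 * inv j)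
      tail = ∑-upper (suc (z ℕ.+ z)) (ι 16 * inv j) (λ i _ → ≤-trans (∑-mono (2 ℕ.^ (j ℕ.+ i)) (λ r _ → t≤ (2 ℕ.^ (j ℕ.+ i) ℕ.+ r) (ι 4) (λ pq p<q → ∣coprime-m∣≤4 (2 ℕ.^ (j ℕ.+ i) ℕ.+ r) pq p<q (y div (2 ℕ.^ (j ℕ.+ i) ℕ.+ r))) (0≤ι 4)))
        (≤-trans (≤-reflexive (∑-*ˡ (2 ℕ.^ (j ℕ.+ i)) (ι 4) _)) (linear (4 ⊛ R-block (j ℕ.+ i) ⊕ 16 ⊛ inv-anti 1≤j (ℕ.m≤m+n j i)) (solve 3 (λ s v w → # 16 :* w :- # 4 :* s := # 4 :* (# 4 :* v) :+ # 16 :* w :- (# 4 :* s :+ # 16 :* v)) refl (∑ (2 ℕ.^ (j ℕ.+ i)) (λ r → π (2 ℕ.^ (j ℕ.+ i) ℕ.+ r) * inv (2 ℕ.^ (j ℕ.+ i) ℕ.+ r))) (inv (j ℕ.+ i)) (inv j)))))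

  -- Choice of scales and decay of both sums.

  module Scales where

    open Mertens using (h; h-mono; h-2^)
    open Hyperbola using (m)
    open Pointwise
    open Axer using (m-decay)
    open Decay using (exponent; exponent-bound; C₂)
    open Dilation using (last-index)
    open Twisted

    -- With 5 n in `m-decay` the bound is 2^(-5n): four of the five factors pay for the (n + 1)⁴
    -- coming from log log y. The doubling is the one in the hypothesis of `m-decay`.
    scale : ℕ → ℕ
    scale n = threshold-exponent (2 ℕ.* (5 ℕ.* n))

    -- From lg y ≥ level n on, the errors are of order 2 ^ - n, while up to the next level h (lg y),
    -- of the size of log log y, is only of order n ⁴.
    level : ℕ → ℕ
    level n = 2 ℕ.^ (scale n ℕ.+ (n ℕ.+ 7))

    level-≡ : ∀ n → level n ≡ 2 ℕ.^ scale n ℕ.* (2 ℕ.^ n ℕ.* 128)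
    level-≡ n = trans (ℕ.^-distribˡ-+-* 2 (scale n) (n ℕ.+ 7)) (cong (2 ℕ.^ scale n ℕ.*_) (ℕ.^-distribˡ-+-* 2 n 7))

    -- 2560000 = 40⁴, as `scale n` contains `exponent (40 * n)`; 148 = 121 + 27 takes in its linear
    -- and constant parts. In C₄, 1056 = 4 (2 · 130 + 4) belongs to the small primes and 131 = 130 +
    -- 1 to m and the tail.
    C₃ C₄ : ℚ
    C₃ = ι 2560000 * ι C₂ + ι 148 + ι p
    C₄ = ι 1056 * C₃ + ι 131

    0≤C₃ : 0ℚ ≤ C₃
    0≤C₃ = (*-nonneg (0≤ι 2560000) (0≤ι C₂) ⊕ 0≤ι 148) ⊕ 0≤ι p

    quartic-≥1 : ∀ s → ι 1 ≤ s → ∀ e c p → e ≤ c * (ι 40 * s * (ι 40 * s) * (ι 40 * s) * (ι 40 * s)) → 0ℚ ≤ p → e + (ι 120 * s + (p + ι 20)) + (s + ι 7) ≤ (ι 2560000 * c + ι 148 + p) * (s * s * s * s)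
    quartic-≥1 s 1≤s e c p e≤ 0≤p = linear (e≤ ⊕ 121 ⊛ s≤q ⊕ 27 ⊛ ≤-trans 1≤s s≤q ⊕ *-monoˡ p 0≤p (≤-trans 1≤s s≤q)) (solve 4 (λ s e c p → (# 2560000 :* c :+ # 148 :+ p) :* (s :* s :* s :* s) :- (e :+ (# 120 :* s :+ (p :+ # 20)) :+ (s :+ # 7)) := c :* (# 40 :* s :* (# 40 :* s) :* (# 40 :* s) :* (# 40 :* s)) :+ # 121 :* (s :* s :* s :* s) :+ # 27 :* (s :* s :* s :* s) :+ p :* (s :* s :* s :* s) :- (e :+ # 121 :* s :+ # 27 :* # 1 :+ p :* # 1)) refl s e c p)
      where
      0≤s : 0ℚ ≤ s
      0≤s = ≤-trans (0≤ι 1) 1≤s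
      s≤q : s ≤ s * s * s * s
      s≤q = linear (*-monoˡ s 0≤s 1≤s ⊕ *-monoˡ (s * s) (sq≥0 s) 1≤s ⊕ *-monoˡ (s * s * s) (*-nonneg (sq≥0 s) 0≤s) 1≤s) (solve 1 (λ s → s :* s :* s :* s :- s := s :* s :+ s :* s :* s :+ s :* s :* s :* s :- (s :* # 1 :+ s :* s :* # 1 :+ s :* s :* s :* # 1)) refl s)

    scale-bound : ∀ n → let s = ι n in 1 ℕ.≤ n → ι (scale n ℕ.+ (n ℕ.+ 7)) ≤ C₃ * (s * s * s * s)
    scale-bound n 1≤n = ≤-trans (≤-reflexive expand) (quartic-≥1 (ι n) (ι-mono 1≤n) (ι (exponent N)) (ι C₂) (ι p) exponent≤ (0≤ι p))
      where
      N : ℕ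
      N = 4 ℕ.* (2 ℕ.* (5 ℕ.* n))
      N≡ : ι N ≡ ι 40 * ι n
      N≡ = linear-≡ (cong₂ _+_ (cong₂ _+_ (ι-* 4 (2 ℕ.* (5 ℕ.* n))) (cong (ι 4 *_) (ι-* 2 (5 ℕ.* n)))) (cong (ι 8 *_) (ι-* 5 n))) (solve 4 (λ N a b n → # 40 :* n :- N := # 4 :* a :+ # 4 :* (# 2 :* b) :+ # 8 :* (# 5 :* n) :- (N :+ # 4 :* a :+ # 8 :* b)) refl (ι N) (ι (2 ℕ.* (5 ℕ.* n))) (ι (5 ℕ.* n)) (ι n))
      N⁴ : ι (N ℕ.* N ℕ.* N ℕ.* N) ≡ ι N * ι N * ι N * ι N
      N⁴ = trans (ι-* (N ℕ.* N ℕ.* N) N) (cong (_* ι N) (trans (ι-* (N ℕ.* N) N) (cong (_* ι N) (ι-* N N))))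
      exponent≤ : ι (exponent N) ≤ ι C₂ * (ι 40 * ι n * (ι 40 * ι n) * (ι 40 * ι n) * (ι 40 * ι n))
      exponent≤ = ≤-trans (ι-mono (exponent-bound N)) (≤-reflexive (trans (ι-* C₂ (N ℕ.* N ℕ.* N ℕ.* N)) (cong (ι C₂ *_) (trans N⁴ (cong (λ a → a * a * a * a) N≡)))))
      expand : ι (scale n ℕ.+ (n ℕ.+ 7)) ≡ ι (exponent N) + (ι 120 * ι n + (ι p + ι 20)) + (ι n + ι 7)
      expand = trans (ι-+ (scale n) (n ℕ.+ 7)) (cong₂ _+_ (trans (ι-+ (exponent N) (12 ℕ.* (2 ℕ.* (5 ℕ.* n)) ℕ.+ (p ℕ.+ 20))) (cong (ι (exponent N) +_)
        (trans (ι-+ (12 ℕ.* (2 ℕ.* (5 ℕ.* n))) (p ℕ.+ 20)) (cong₂ _+_ 120n (ι-+ p 20))))) (ι-+ n 7))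
        where
        120n : ι (12 ℕ.* (2 ℕ.* (5 ℕ.* n))) ≡ ι 120 * ι n
        120n = linear-≡ (cong₂ _+_ (cong₂ _+_ (ι-* 12 (2 ℕ.* (5 ℕ.* n))) (cong (ι 12 *_) (ι-* 2 (5 ℕ.* n)))) (cong (ι 24 *_) (ι-* 5 n))) (solve 4 (λ N a b n → # 120 :* n :- N := # 12 :* a :+ # 12 :* (# 2 :* b) :+ # 24 :* (# 5 :* n) :- (N :+ # 12 :* a :+ # 24 :* b)) refl (ι (12 ℕ.* (2 ℕ.* (5 ℕ.* n)))) (ι (2 ℕ.* (5 ℕ.* n))) (ι (5 ℕ.* n)) (ι n))

    -- The upper limit for lg y keeps the reciprocal sum of the primes within order (n + 1)⁴. The
    -- lower limit provides the decay of m at 2^z and makes the 2 z + 1 blocks of large primes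
    -- negligible next to j.
    sum-bound : ∀ n y → level n ℕ.≤ lg y → lg y ℕ.< level (suc n) → ∣ m y ∣ + ∣ twisted y ∣ ≤ C₄ * inv (2 ℕ.^ n)
    sum-bound n y low high = linear (m≤ y z≤u ⊕ ∣twisted∣≤ z j y ρ 1≤j 1≤y (sym j≡) 0≤ρ (λ v Z≤v → m≤ v (lg-≥ Z≤v)) ⊕ *-mono {ι 2 * ρ + ι 4 * inv (2 ℕ.^ z)} {ι 264 * w5} {ι 4 * h (suc u)} {ι 4 * (C₃ * (s * s * s * s))} (*-nonneg (0≤ι 2) 0≤ρ ⊕ *-nonneg (0≤ι 4) (0≤inv (2 ℕ.^ z))) 0≤Cs D≤ (4 ⊛ h≤) ⊕ 1056 ⊛ *-monoˡ C₃ 0≤C₃ w5s⁴ ⊕ tail≤ ⊕ 130 ⊛ inv-2^-anti {n} {5 ℕ.* n} (ℕ.m≤m+n n (4 ℕ.* n))) (solve 9 (λ a b v w c H T w5 s → (# 1056 :* c :+ # 131) :* w :- (a :+ b) := # 130 :* w5 :+ ((# 2 :* (# 130 :* w5) :+ # 4 :* v) :* (# 4 :* H) :+ T) :+ # 264 :* w5 :* (# 4 :* (c :* (s :* s :* s :* s))) :+ # 1056 :* (c :* w) :+ w :+ # 130 :* w :- (a :+ b :+ (# 2 :* (# 130 :* w5) :+ # 4 :* v) :* (# 4 :* H) :+ # 1056 :* (c :* (w5 :* (s :* s :* s :* s))) :+ T :+ # 130 :* w5)) refl (∣ m y ∣) (∣ twisted y ∣) (inv (2 ℕ.^ z)) w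 C₃ (h (suc u)) (ι (suc (z ℕ.+ z)) * (ι 16 * inv j)) w5 s)
      where
      z u t j : ℕ
      z = 2 ℕ.^ scale n
      u = lg y
      t = 2 ℕ.^ n
      j = u ℕ.∸ (z ℕ.+ z)
      w w5 ρ s : ℚ
      w = inv (2 ℕ.^ n)
      w5 = inv (2 ℕ.^ (5 ℕ.* n))
      ρ = ι 130 * w5
      s = ι (suc n)
      0≤ρ : 0ℚ ≤ ρ
      0≤ρ = *-nonneg (0≤ι 130) (0≤inv (2 ℕ.^ (5 ℕ.* n)))
      0≤s : 0ℚ ≤ s
      0≤s = 0≤ι (suc n)
      0≤Cs : 0ℚ ≤ ι 4 * (C₃ * (s * s * s * s))
      0≤Cs = *-nonneg (0≤ι 4) (*-nonneg 0≤C₃ (*-nonneg (*-nonneg (sq≥0 s) 0≤s) 0≤s))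
      1≤z : 1 ℕ.≤ z
      1≤z = 0<2^ (scale n)
      z≤zt : z ℕ.≤ z ℕ.* t
      z≤zt = ℕ.≤-trans (ℕ.≤-reflexive (sym (ℕ.*-identityʳ z))) (ℕ.*-monoʳ-≤ z (0<2^ n))
      128zt≤u : z ℕ.* (t ℕ.* 128) ℕ.≤ u
      128zt≤u = ℕ.≤-trans (ℕ.≤-reflexive (sym (level-≡ n))) low
      zz≤u : z ℕ.+ z ℕ.≤ u
      zz≤u = ℕ-linear (2 ⊛ₙ z≤zt ⊕ₙ 128zt≤u) (ℕ-solve 3 (λ z t u → z :+ₙ z :+ₙ (conₙ 2 :*ₙ (z :*ₙ t) :+ₙ u :+ₙ conₙ 126 :*ₙ t :*ₙ z) :=ₙ u :+ₙ (conₙ 2 :*ₙ z :+ₙ z :*ₙ (t :*ₙ conₙ 128))) refl z t u)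
      z≤u : z ℕ.≤ u
      z≤u = ℕ.≤-trans (ℕ.m≤m+n z z) zz≤u
      j≡ : j ℕ.+ (z ℕ.+ z) ≡ u
      j≡ = ℕ.m∸n+n≡m zz≤u
      -- From j ≥ 128 z t - 2 z, while 16 (2 z + 1) t ≤ 48 z t: the reason for the 7 in `level`.
      j-large : 16 ℕ.* suc (z ℕ.+ z) ℕ.* t ℕ.≤ j
      j-large = ℕ-linear-by 20 (16 ⊛ₙ z≤zt ⊕ₙ 8 ⊛ₙ 128zt≤u ⊕ₙ 8 ⊛ₙ ℕ.≤-reflexive (sym j≡) ⊕ₙ 336 ⊛ₙ ℕ.*-monoˡ-≤ t 1≤z) (ℕ-solve 4 (λ z t u j → conₙ 21 :*ₙ (conₙ 16 :*ₙ (conₙ 1 :+ₙ (z :+ₙ z)) :*ₙ t) :+ₙ (conₙ 16 :*ₙ (z :*ₙ t) :+ₙ conₙ 8 :*ₙ u :+ₙ conₙ 8 :*ₙ (j :+ₙ (z :+ₙ z)) :+ₙ conₙ 336 :*ₙ (z :*ₙ t) :+ₙ conₙ 13 :*ₙ j) :=ₙ conₙ 21 :*ₙ j :+ₙ (conₙ 16 :*ₙ z :+ₙ conₙ 8 :*ₙ (z :*ₙ (t :*ₙ conₙ 128)) :+ₙ conₙ 8 :*ₙ u :+ₙ conₙ 336 :*ₙ (conₙ 1 :*ₙ t))) refl z t u j)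
      1≤j : 1 ℕ.≤ j
      1≤j = ℕ.≤-trans (ℕ-linear (48 ⊛ₙ 0<2^ n ⊕ₙ 32 ⊛ₙ ℕ.*-monoˡ-≤ t 1≤z) (ℕ-solve 2 (λ z t → conₙ 1 :+ₙ (conₙ 48 :*ₙ t :+ₙ conₙ 32 :*ₙ (z :*ₙ t) :+ₙ conₙ 47) :=ₙ conₙ 16 :*ₙ (conₙ 1 :+ₙ (z :+ₙ z)) :*ₙ t :+ₙ (conₙ 48 :*ₙ conₙ 1 :+ₙ conₙ 32 :*ₙ (conₙ 1 :*ₙ t))) refl z t)) j-large
      1≤y : 1 ℕ.≤ y
      1≤y = lg-positive (ℕ.≤-trans 1≤z z≤u)
      m≤ : ∀ v → z ℕ.≤ lg v → ∣ m v ∣ ≤ ρ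
      m≤ v z≤ = m-decay (5 ℕ.* n) v z≤
      D≤ : ι 2 * ρ + ι 4 * inv (2 ℕ.^ z) ≤ ι 264 * w5
      D≤ = linear (4 ⊛ inv-2^-anti {5 ℕ.* n} {z} 5n≤z) (solve 2 (λ w5 v → # 264 :* w5 :- (# 2 :* (# 130 :* w5) :+ # 4 :* v) := # 4 :* w5 :- # 4 :* v) refl w5 (inv (2 ℕ.^ z)))
        where
        5n≤z : 5 ℕ.* n ℕ.≤ z
        5n≤z = ℕ.≤-trans (ℕ-linear (ℕ.z≤n {0}) (ℕ-solve 3 (λ n p e → conₙ 5 :*ₙ n :+ₙ (conₙ 0 :+ₙ (conₙ 20 :+ₙ e :+ₙ conₙ 115 :*ₙ n :+ₙ p)) :=ₙ e :+ₙ (conₙ 12 :*ₙ (conₙ 2 :*ₙ (conₙ 5 :*ₙ n)) :+ₙ (p :+ₙ conₙ 20)) :+ₙ conₙ 0) refl n p (exponent (4 ℕ.* (2 ℕ.* (5 ℕ.* n)))))) (ℕ.<⇒≤ (n<2^n (scale n)))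
      h≤ : h (suc u) ≤ C₃ * (s * s * s * s)
      h≤ = ≤-trans (h-mono high) (≤-trans (h-2^ (scale (suc n) ℕ.+ (suc n ℕ.+ 7))) (scale-bound (suc n) (s≤s z≤n)))
      w5s⁴ : w5 * (s * s * s * s) ≤ w
      w5s⁴ = ≤-trans (≤-reflexive (trans (cong (_* (s * s * s * s)) w5≡) (solve 2 (λ w s → w :* w :* (w :* w) :* w :* (s :* s :* s :* s) := w :* (s :* w :* (s :* w) :* (s :* w :* (s :* w)))) refl w s))) (≤-trans (*-monoˡ w 0≤w (sq≤1 (*-nonneg 0≤sw 0≤sw) (sq≤1 0≤sw sw≤1))) (≤-reflexive (*-identityʳ w)))
        where
        0≤w : 0ℚ ≤ w
        0≤w = 0≤inv (2 ℕ.^ n)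
        0≤sw : 0ℚ ≤ s * w
        0≤sw = *-nonneg 0≤s 0≤w
        sw≤1 : s * w ≤ 1ℚ
        sw≤1 = ≤-trans (*-monoʳ w 0≤w (ι-mono (n<2^n n))) (ι*inv≤1 (2 ℕ.^ n))
        sq≤1 : ∀ {a} → 0ℚ ≤ a → a ≤ 1ℚ → a * a ≤ 1ℚ
        sq≤1 {a} 0≤a a≤1 = ≤-trans (*-monoˡ a 0≤a a≤1) (≤-trans (≤-reflexive (*-identityʳ a)) a≤1)
        w5≡ : w5 ≡ w * w * (w * w) * w
        w5≡ = trans (cong (λ k → inv (2 ℕ.^ k)) (ℕ-solve 1 (λ n → conₙ 5 :*ₙ n :=ₙ conₙ 4 :*ₙ n :+ₙ n) refl n)) (trans (inv-2^-+ (4 ℕ.* n) n) (cong (_* w) (w⁴ n)))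
      tail≤ : ι (suc (z ℕ.+ z)) * (ι 16 * inv j) ≤ w
      tail≤ = linear (*-monoʳ (w * inv j) (*-nonneg (0≤inv t) (0≤inv j)) (ι-mono j-large) ⊕ ≤-reflexive (cong (w *_) (ι*inv 1≤j)) ⊕ ≤-reflexive (sym (cong (_* (w * inv j)) (ι-* (16 ℕ.* suc (z ℕ.+ z)) t))) ⊕ ≤-reflexive (sym (cong (ι (16 ℕ.* suc (z ℕ.+ z)) * inv j *_) (ι*inv (0<2^ n)))) ⊕ ≤-reflexive (sym (cong (_* inv j) (ι-* 16 (suc (z ℕ.+ z)))))) (solve 7 (λ a b c v w t J → w :- a :* (# 16 :* v) := J :* (w :* v) :+ w :* # 1 :+ c :* (w :* v) :+ b :* v :* (t :* w) :+ b :* v :- (c :* (w :* v) :+ w :* (J :* v) :+ b :* t :* (w :* v) :+ b :* v :* # 1 :+ # 16 :* a :* v)) refl (ι (suc (z ℕ.+ z))) (ι (16 ℕ.* suc (z ℕ.+ z))) (ι (16 ℕ.* suc (z ℕ.+ z) ℕ.* t)) (inv j) w (ι t) (ι j))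

    level-> : ∀ n → n ℕ.< level n
    level-> n = ℕ.≤-trans (n<2^n n) (2^-mono {n} {scale n ℕ.+ (n ℕ.+ 7)} (ℕ-linear (ℕ.z≤n {0}) (ℕ-solve 2 (λ n s → n :+ₙ (conₙ 0 :+ₙ (conₙ 7 :+ₙ s)) :=ₙ s :+ₙ (n :+ₙ conₙ 7) :+ₙ conₙ 0) refl n (scale n))))

    0≤C₄ : 0ℚ ≤ C₄
    0≤C₄ = *-nonneg (0≤ι 1056) 0≤C₃ ⊕ 0≤ι 131

    -- The value lg y lies between two consecutive levels, the lower of index k ≥ n. The search for
    -- k ends because `level i` exceeds i.
    sum-decay : ∀ n y → level n ℕ.≤ lg y → ∣ m y ∣ + ∣ twisted y ∣ ≤ C₄ * inv (2 ℕ.^ n)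
    sum-decay n y n≤ = bracket (last-index (λ i → level i ℕ.≤? lg y) n (lg y) n≤)
      where
      bracket : (∃ λ k → n ℕ.≤ k × k ℕ.≤ n ℕ.+ lg y × level k ℕ.≤ lg y × (∀ i → k ℕ.< i → i ℕ.≤ n ℕ.+ lg y → ¬ level i ℕ.≤ lg y)) → ∣ m y ∣ + ∣ twisted y ∣ ≤ C₄ * inv (2 ℕ.^ n)
      bracket (k , n≤k , _ , low , above) = ≤-trans (sum-bound k y low (ℕ.≰⇒> (above (suc k) ℕ.≤-refl (ℕ.≤-trans (ℕ.<-≤-trans (level-> k) low) (ℕ.m≤n+m (lg y) n))))) (*-monoˡ C₄ 0≤C₄ (inv-2^-anti n≤k))

  -- The partial sums of the statement in terms of m and `twisted`.

  module PartialSums where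

    open import Data.List.Relation.Unary.All using (All; []; _∷_)
    open import Data.Bool using (true; false; if_then_else_)
    open import Relation.Nullary.Decidable using (does; dec-true; dec-false)
    open import Data.Integer as ℤ using (ℤ; +_)
    import Data.Integer.Properties as ℤ
    open import Data.Rational.Unnormalised using (mkℚᵘ; *≡*)
    import Data.Rational.Unnormalised.Properties as ℚᵘ
    open import Data.List using ([]; _∷_; upTo)
    open import Data.List.Membership.Propositional using (_∈_)
    open import Data.List.Membership.Propositional.Properties using (∈-filter⁺; ∈-filter⁻; ∈-upTo⁺)
    open import Data.List.Relation.Unary.Any using (here; there)
    import Data.List.Relation.Unary.All as All
    open import Data.List.Relation.Unary.AllPairs using (AllPairs; []; _∷_)
    import Data.List.Relation.Unary.AllPairs.Properties as AllPairs
    open import Defs using (primeDivisors; ω; hasSquarePrimeFactor; spfIs; μ; negOnePow; term; partialSum)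
    open Mobius
    open Hyperbola using (m)
    open Twisted using (twisted)

    primeDivisors-increasing : ∀ n → AllPairs ℕ._<_ (primeDivisors n)
    primeDivisors-increasing n = AllPairs.filter⁺ (divisor? n) (AllPairs.applyUpTo⁺₁ (λ i → i) (suc n) (λ i<j _ → i<j))

    ∈-primeDivisors⁺ : ∀ {n q} → 1 ℕ.≤ n → Prime q → q ∣ n → q ∈ primeDivisors n
    ∈-primeDivisors⁺ {n} 1≤n pq q∣n = ∈-filter⁺ (divisor? n) (∈-upTo⁺ (s≤s (∣⇒≤ {{ℕ.>-nonZero 1≤n}} q∣n))) (pq , q∣n)

    ∈-primeDivisors⁻ : ∀ {n q} → q ∈ primeDivisors n → Prime q × q ∣ n
    ∈-primeDivisors⁻ {n} q∈ = proj₂ (∈-filter⁻ (divisor? n) {xs = upTo (suc n)} q∈)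

    Least : ℕ → ℕ → Set
    Least n q = Prime q × q ∣ n × (∀ {r} → r ℕ.< q → ¬ (Prime r × r ∣ n))

    data SpfIs (n : ℕ) : Set where
      is-p : Least n p → spfIs p n ≡ true → SpfIs n
      is-not-p : ¬ Least n p → spfIs p n ≡ false → SpfIs n

    -- `primeDivisors` filters an increasing list, so its head is the least prime factor. The result
    -- is phrased as a view, to decide `term` without computing lists again.
    spf-is : ∀ n → 1 ℕ.≤ n → SpfIs n
    spf-is n 1≤n = go (primeDivisors n) refl
      where
      spf-[] : primeDivisors n ≡ [] → spfIs p n ≡ false
      spf-[] eq with primeDivisors n
      spf-[] refl | [] = refl
      spf-∷ : ∀ {q qs} → primeDivisors n ≡ q ∷ qs → spfIs p n ≡ does (q ℕ.≟ p)
      spf-∷ eq with primeDivisors n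
      spf-∷ refl | _ ∷ _ = refl
      go : ∀ ps → primeDivisors n ≡ ps → SpfIs n
      go [] eq = is-not-p (λ (_ , p∣n , _) → contradiction (subst (p ∈_) eq (∈-primeDivisors⁺ 1≤n pp p∣n)) λ ()) (spf-[] eq)
      go (q ∷ qs) eq = dec-elim (q ℕ.≟ p)
          (λ q≡p → is-p (subst (Least n) q≡p least) (trans (spf-∷ eq) (dec-true (q ℕ.≟ p) q≡p)))
          (λ q≢p → is-not-p (λ (_ , p∣n , below) → q≢p (unique p∣n below)) (trans (spf-∷ eq) (dec-false (q ℕ.≟ p) q≢p)))
        where
        q-div : Prime q × q ∣ n
        q-div = ∈-primeDivisors⁻ (subst (q ∈_) (sym eq) (here refl))
        smallest : ∀ {r} → r ∈ q ∷ qs → q ℕ.≤ r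
        smallest (here refl) = ℕ.≤-refl
        smallest (there r∈) with subst (AllPairs ℕ._<_) eq (primeDivisors-increasing n)
        ... | q< ∷ _ = ℕ.<⇒≤ (All.lookup q< r∈)
        least : Least n q
        least = proj₁ q-div , proj₂ q-div , λ r<q (pr , r∣n) → contradiction (smallest (subst (_ ∈_) eq (∈-primeDivisors⁺ 1≤n pr r∣n))) (ℕ.<⇒≱ r<q)
        unique : p ∣ n → (∀ {r} → r ℕ.< p → ¬ (Prime r × r ∣ n)) → q ≡ p
        unique p∣n below = ℕ.≤-antisym (smallest (subst (p ∈_) eq (∈-primeDivisors⁺ 1≤n pp p∣n))) (ℕ.≮⇒≥ (λ q<p → below q<p q-div))

    /-ι : ∀ w k → (+ w) ℚ./ suc k ≡ ι w * inv (suc k)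
    /-ι w k = toℚᵘ-injective (ℚᵘ.≃-trans (toℚᵘ-fromℚᵘ (mkℚᵘ (+ w) k)) (ℚᵘ.≃-sym (ℚᵘ.≃-trans (toℚᵘ-homo-* (ι w) (inv (suc k))) (*≡* (trans (cong (ℤ._* + suc k) (ℤ.*-identityʳ (+ w))) (cong (λ d → + w ℤ.* + d) (sym (ℕ.*-identityˡ (suc k)))))))))

    sgn-/ : ∀ j w k → (negOnePow j ℤ.* + w) ℚ./ suc k ≡ sgn j * ι w * inv (suc k)
    sgn-/ zero w k = trans (cong (ℚ._/ suc k) (ℤ.*-identityˡ (+ w))) (trans (/-ι w k) (cong (_* inv (suc k)) (sym (*-identityˡ (ι w)))))
    sgn-/ (suc zero) w k = trans (cong (ℚ._/ suc k) (ℤ.-1*i≡-i (+ w))) (neg w)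
      where
      neg : ∀ w → (ℤ.- (+ w)) ℚ./ suc k ≡ (- 1ℚ) * ι w * inv (suc k)
      neg zero = trans (/-ι 0 k) (solve 1 (λ v → # 0 :* v := (:- # 1) :* # 0 :* v) refl (inv (suc k)))
      neg (suc w) = trans (cong -_ (/-ι (suc w) k)) (solve 2 (λ a v → (:- (a :* v)) := (:- # 1) :* a :* v) refl (ι (suc w)) (inv (suc k)))
    sgn-/ (suc (suc j)) w k = trans (sgn-/ j w k) (solve 3 (λ s a v → s :* a :* v := (:- (:- s)) :* a :* v) refl (sgn j) (ι w) (inv (suc k)))

    μω/n : ∀ k → (μ (suc k) ℤ.* + ω (suc k)) ℚ./ suc k ≡ μ′ (suc k) * ι (ω (suc k)) * inv (suc k)
    μω/n k = lem (hasSquarePrimeFactor (suc k))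
      where
      w = ω (suc k)
      lem : ∀ b → ((if b then + 0 else negOnePow w) ℤ.* + w) ℚ./ suc k ≡ (if b then 0ℚ else sgn w) * ι w * inv (suc k)
      lem true = trans (/-ι 0 k) (solve 2 (λ a v → # 0 :* v := # 0 :* a :* v) refl (ι w) (inv (suc k)))
      lem false = sgn-/ w w k

    -- Undoes the shift of `term`, whose argument k belongs to the integer k + 1, so that multiples
    -- of p can be selected by index.
    summand : ℕ → ℚ
    summand zero = 0ℚ
    summand (suc k) = term p k

    partialSum-∑ : ∀ N → partialSum p N ≡ ∑ (suc N) summand
    partialSum-∑ zero = refl
    partialSum-∑ (suc N) = cong (_+ term p N) (partialSum-∑ N)

    summand-least : ∀ n → 1 ℕ.≤ n → Least n p → summand n ≡ μ′ n * ι (ω n) * inv n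
    summand-least (suc k) 1≤n least with spf-is (suc k) 1≤n
    ... | is-p _ eq = trans (cong (λ b → if b then (μ (suc k) ℤ.* + ω (suc k)) ℚ./ suc k else 0ℚ) eq) (μω/n k)
    ... | is-not-p ¬least _ = contradiction least ¬least

    summand-0 : ∀ n → ¬ Least n p → summand n ≡ 0ℚ
    summand-0 zero _ = refl
    summand-0 (suc k) ¬least with spf-is (suc k) (s≤s z≤n)
    ... | is-p least _ = contradiction least ¬least
    ... | is-not-p _ eq = cong (λ b → if b then (μ (suc k) ℤ.* + ω (suc k)) ℚ./ suc k else 0ℚ) eq

    f-not-rough : ∀ n {q} → q ℕ.≤ p → Prime q → q ∣ n → f n ≡ 0ℚ
    f-not-rough n q≤p pq q∣n = trans (cong (_* μ′ n) (𝟙-no (rough? n) (λ rough → rough (s≤s q≤p) (pq , q∣n)))) (*-zeroˡ (μ′ n))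

    -- If n has a prime factor below p, then p is not least in p n; if p divides n, then p² divides
    -- p n. Both times `f n` vanishes as well. Otherwise μ changes sign and ω(p n) = 1 + ω(n), which
    -- produces the two sums.
    summand-p* : ∀ n → summand (p ℕ.* n) ≡ - (inv p * (f n * inv n + f n * inv n * ι (ω n)))
    summand-p* zero = trans (cong summand (ℕ.*-zeroʳ p)) (solve 3 (λ v a w → # 0 := (:- (v :* (a :* # 0 :+ a :* # 0 :* w)))) refl (inv p) (f 0) (ι (ω 0)))
    summand-p* n@(suc _) = dec-elim (ℕ.anyUpTo? (divisor? n) p) below above
      where
      1≤pn : 1 ℕ.≤ p ℕ.* n
      1≤pn = ℕ.*-mono-≤ {1} {p} {1} {n} (ℕ.≤-trans (s≤s z≤n) (prime≥2 pp)) (s≤s z≤n)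
      vanish : f n ≡ 0ℚ → summand (p ℕ.* n) ≡ 0ℚ → summand (p ℕ.* n) ≡ - (inv p * (f n * inv n + f n * inv n * ι (ω n)))
      vanish f≡0 s≡0 = trans s≡0 (trans (solve 3 (λ v u w → # 0 := (:- (v :* (# 0 :* u :+ # 0 :* u :* w)))) refl (inv p) (inv n) (ι (ω n))) (cong (λ a → - (inv p * (a * inv n + a * inv n * ι (ω n)))) (sym f≡0)))
      below : (∃ λ q → q ℕ.< p × Prime q × q ∣ n) → summand (p ℕ.* n) ≡ - (inv p * (f n * inv n + f n * inv n * ι (ω n)))
      below (q , q<p , pq , q∣n) = vanish (f-not-rough n (ℕ.<⇒≤ q<p) pq q∣n) (summand-0 (p ℕ.* n) (λ (_ , _ , lt) → lt q<p (pq , ∣n⇒∣m*n p q∣n)))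
      above : ¬ (∃ λ q → q ℕ.< p × Prime q × q ∣ n) → summand (p ℕ.* n) ≡ - (inv p * (f n * inv n + f n * inv n * ι (ω n)))
      above none = dec-elim (p ∣? n) p∣n p∤n
        where
        least : Least (p ℕ.* n) p
        least = pp , m∣m*n n , λ {r} r<p (pr , r∣pn) → r∣⇒ r<p pr (euclidsLemma p n pr r∣pn)
          where
          r∣⇒ : ∀ {r} → r ℕ.< p → Prime r → ¬ ((r ∣ p) ⊎ (r ∣ n))
          r∣⇒ r<p pr (inj₁ r∣p) = ℕ.<⇒≢ r<p (prime∣prime pr pp r∣p)
          r∣⇒ {r} r<p pr (inj₂ r∣n) = none (r , r<p , pr , r∣n)
        p∣n : p ∣ n → summand (p ℕ.* n) ≡ - (inv p * (f n * inv n + f n * inv n * ι (ω n)))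
        p∣n d = vanish (f-not-rough n ℕ.≤-refl pp d) (trans (summand-least (p ℕ.* n) 1≤pn least) (trans (cong (λ a → a * ι (ω (p ℕ.* n)) * inv (p ℕ.* n)) (μ′-0 pp (s≤s z≤n) d)) (solve 2 (λ a b → # 0 :* a :* b := # 0) refl (ι (ω (p ℕ.* n))) (inv (p ℕ.* n)))))
        p∤n : ¬ p ∣ n → summand (p ℕ.* n) ≡ - (inv p * (f n * inv n + f n * inv n * ι (ω n)))
        p∤n ¬d = trans (summand-least (p ℕ.* n) 1≤pn least) (trans (cong₂ _*_ (cong₂ _*_ (μ′-* pp (s≤s z≤n) ¬d) (trans (cong ι (ω-* pp (s≤s z≤n) ¬d)) (ι-suc (ω n)))) (inv-* p n))
            (trans (solve 4 (λ μ w v u → (:- μ) :* (# 1 :+ w) :* (v :* u) := (:- (v :* (# 1 :* μ :* u :+ # 1 :* μ :* u :* w)))) refl (μ′ n) (ι (ω n)) (inv p) (inv n)) (cong (λ i → - (inv p * (i * μ′ n * inv n + i * μ′ n * inv n * ι (ω n)))) (sym (𝟙-yes (rough? n) rough)))))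
          where
          rough : Rough n
          rough {q} q≤p (pq , q∣n) = dec-elim (q ℕ.≟ p) (λ q≡p → ¬d (subst (_∣ n) q≡p q∣n)) (λ q≢p → none (q , ℕ.≤∧≢⇒< (ℕ.≤-pred q≤p) q≢p , pq , q∣n))

    -- Only multiples of p have least prime factor p, so `∑-multiples` and `summand-p*` apply.
    partialSum-≡ : ∀ M → partialSum p M ≡ - (inv p * (m (M div p) + twisted (M div p)))
    partialSum-≡ M = trans (partialSum-∑ M) (trans (∑-ext (suc M) only-multiples) (trans (∑-multiples M summand (ℕ.≤-trans (s≤s z≤n) (prime≥2 pp)))
      (trans (∑-ext Y summand-p*) (trans (∑-neg Y _) (cong -_ (trans (∑-*ˡ Y (inv p) _) (cong (inv p *_) (∑-+ Y (λ n → f n * inv n) (λ n → f n * inv n * ι (ω n))))))))))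
      where
      Y = suc (M div p)
      only-multiples : ∀ n → summand n ≡ 𝟙 (p ∣? n) * summand n
      only-multiples n = 𝟙-elim (p ∣? n) (λ i → summand n ≡ i * summand n) (λ _ → sym (*-identityˡ (summand n)))
        (λ p∤n → trans (summand-0 n (λ (_ , d , _) → p∤n d)) (sym (*-zeroˡ (summand n))))

  -- Convergence to 0.

  module Limit where

    open import Data.Integer as ℤ using (+_; -[1+_])
    import Data.Integer.Properties as ℤ
    open import Data.Rational as ℚ using (mkℚ; 0ℚ; _+_; _*_; _-_; -_; _≤_; _<_; ∣_∣; *≤*; *<*)
    open import Data.Product using (_,_; ∃)
    open import Defs using (partialSum)
    open Hyperbola using (m)
    open Twisted using (twisted)
    open Scales using (C₄; level; sum-decay)
    open PartialSums using (partialSum-≡)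

    archimedean : ∀ a → ∃ λ n → a ≤ ι n
    archimedean (mkℚ (+ n) d c) = n , *≤* (ℤ.≤-trans (ℤ.≤-reflexive (ℤ.*-identityʳ (+ n))) (ℤ.≤-trans (ℤ.+≤+ (ℕ.m≤m*n n (suc d))) (ℤ.≤-reflexive (ℤ.pos-* n (suc d)))))
    archimedean (mkℚ -[1+ n ] d c) = 0 , *≤* ℤ.-≤+

    inv-below : ∀ ε → 0ℚ < ε → ∃ λ d → inv (suc d) ≤ ε
    inv-below (mkℚ (+ suc n) d c) _ = d , *≤* (ℤ.*-monoʳ-≤-nonNeg (+ suc d) (ℤ.+≤+ {1} {suc n} (s≤s z≤n)))
    inv-below (mkℚ (+ zero) d c) (*<* (ℤ.+<+ ()))
    inv-below (mkℚ -[1+ n ] d c) (*<* ())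

    -- With C ≤ g and 1/(d + 1) ≤ ε the exponent n = g (d + 1) is large enough, because n < 2^n.
    vanishing : ∀ C ε → 0ℚ < ε → ∃ λ n → C * inv (2 ℕ.^ n) < ε
    vanishing C ε 0<ε = choose (archimedean C) (inv-below ε 0<ε)
      where
      choose : (∃ λ g → C ≤ ι g) → (∃ λ d → inv (suc d) ≤ ε) → ∃ λ n → C * inv (2 ℕ.^ n) < ε
      choose (g , C≤g) (d , d≤ε) = n , ≤-<-trans (*-monoʳ (inv N) (0≤inv N) C≤g) (<-≤-trans (≰⇒> λ le → ℕ.<⇒≱ (n<2^n n) (ι-cancel (linear (*-monoˡ (ι N * ι (suc d)) (*-nonneg (0≤ι N) (0≤ι (suc d))) le ⊕ ≤-reflexive (sym (cong (ι N *_) (ι-inv d))) ⊕ ≤-reflexive (cong (ι g * ι (suc d) *_) (ι*inv (0<2^ n))) ⊕ ≤-reflexive (sym (ι-* g (suc d)))) (solve 6 (λ N v g D u n → n :- N := N :* D :* (g :* v) :+ N :* (D :* u) :+ g :* D :* # 1 :+ n :- (N :* D :* u :+ N :* # 1 :+ g :* D :* (N :* v) :+ g :* D)) refl (ι N) (inv N) (ι g) (ι (suc d)) (inv (suc d)) (ι n))))) d≤ε)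
        where
        n N : ℕ
        n = g ℕ.* suc d
        N = 2 ℕ.^ n

    ∣partialSum∣≤ : ∀ n M → p ℕ.* 2 ℕ.^ level n ℕ.≤ M → ∣ partialSum p M - 0ℚ ∣ ≤ C₄ * inv (2 ℕ.^ n)
    ∣partialSum∣≤ n M large = ≤-trans (≤-reflexive (trans (cong ∣_∣ (trans (+-identityʳ (partialSum p M)) (partialSum-≡ M))) (trans (∣-p∣≡∣p∣ (inv p * (m y + twisted y))) (trans (∣p*q∣≡∣p∣*∣q∣ (inv p) (m y + twisted y)) (cong (_* ∣ m y + twisted y ∣) (0≤p⇒∣p∣≡p (0≤inv p)))))))
      (≤-trans (*-monoʳ ∣ m y + twisted y ∣ (0≤∣p∣ (m y + twisted y)) (inv≤1 p)) (≤-trans (≤-reflexive (*-identityˡ ∣ m y + twisted y ∣)) (≤-trans (∣p+q∣≤∣p∣+∣q∣ (m y) (twisted y)) (sum-decay n y (lg-≥ (div-≥ {M} {p} {2 ℕ.^ level n} (ℕ.≤-trans (s≤s z≤n) (prime≥2 pp)) large))))))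
      where
      y : ℕ
      y = M div p

    partialSum-converges : ∀ ε → 0ℚ < ε → ∃ λ N → ∀ M → N ℕ.≤ M → ∣ partialSum p M - 0ℚ ∣ < ε
    partialSum-converges ε 0<ε = threshold-of (vanishing C₄ ε 0<ε)
      where
      threshold-of : (∃ λ n → C₄ * inv (2 ℕ.^ n) < ε) → ∃ λ N → ∀ M → N ℕ.≤ M → ∣ partialSum p M - 0ℚ ∣ < ε
      threshold-of (n , small) = p ℕ.* 2 ℕ.^ level n , λ M large → ≤-<-trans (∣partialSum∣≤ n M large) small


open import Defs
open import Data.Nat using (_≥_)

theorem11 : (p : ℕ) → Prime p →
    (ε : ℚ) → 0ℚ < ε →
      ∃ λ N → (M : ℕ) → M ≥ N → ∣ partialSum p M - 0ℚ ∣ < ε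
theorem11 = Limit.partialSum-converges
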